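{- Let $k$ be an odd positive integer, let $n=2k$, let $\xi$ be a primitive element of $\mathbb{F}_{3^n}$ (a generator of the multiplicative group $\mathbb{F}_{3^n}^*$), and let $a=\xi^{\frac{3^k+1}{4}}$. Then the function $f:\mathbb{F}_{3^n}\to\mathbb{F}_3$ defined by $$f(x)=\operatorname{Tr}_n\Big(a x^{\frac{3^n-1}{4}+3^k+1}\Big),\quad x\in\mathbb{F}_{3^n},$$ is a weakly regular bent function.
   Context: $\mathbb{F}_{3^n}$ denotes the finite field with $3^n$ elements and $\operatorname{Tr}_n:\mathbb{F}_{3^n}\to\mathbb{F}_3$ the absolute trace. Let $\omega=e^{2\pi i/3}$; elements of $\mathbb{F}_3$ are regarded as integers modulo $3$ when used as exponents of $\omega$. For $f:\mathbb{F}_{3^n}\to\mathbb{F}_3$ and $b\in\mathbb{F}_{3^n}$, the Walsh coefficient of $f$ at $b$ is $S_f(b)=\sum_{x\in\mathbb{F}_{3^n}}\omega^{f(x)-\operatorname{Tr}_n(bx)}$. The function $f$ is (ternary) bent if $|S_f(b)|^2=3^n$ for all $b\in\mathbb{F}_{3^n}$. A bent function $f$ is weakly regular if there exist a complex number $u$ with $|u|=1$ and a function $f^*:\mathbb{F}_{3^n}\to\mathbb{F}_3$ such that $u\,3^{ -n/2}S_f(b)=\omega^{f^*(b)}$ for all $b\in\mathbb{F}_{3^n}$. -}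

module Defs where

open import Level using (Level; 0ℓ; _⊔_) renaming (suc to lsuc)
open import Algebra.Bundles using (RawRing; Semiring; CommutativeRing)
import Algebra.Definitions.RawSemiring as RawSemiringDefs
import Algebra.Properties.CommutativeMonoid.Sum as Sum
import Algebra.Properties.Monoid.Mult as MonoidMult
import Algebra.Properties.Semiring.Exp as Exp
import Algebra.Properties.Semiring.Mult as Mult
import Algebra.Properties.Ring as RingProperties
import Algebra.Properties.Group as GroupProperties
import Algebra.Solver.Ring.NaturalCoefficients.Default as NatCoeffSolver
open import Data.Empty using (⊥-elim)
open import Data.Fin.Base as Fin using (Fin; toℕ)
open import Data.Fin.Patterns using (0F; 1F; 2F)
import Data.Fin.Properties as Finₚ
open import Data.Fin.Permutation as Perm using (Permutation′)
open import Data.Integer.Base as ℤ using (+_)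
import Data.Integer.Properties as ℤₚ
open import Data.Nat.Base as ℕ using (ℕ; zero; suc)
open import Data.Nat.DivMod using (_mod_)
import Data.Nat.Properties as ℕₚ
open import Data.Product using (∃; ∃-syntax; _×_; _,_; proj₁; proj₂)
open import Data.Rational.Base as ℚ using (ℚ; ½; -½)
open import Data.Sum using (_⊎_; inj₁; inj₂)
open import Data.Vec.Functional using (removeAt)
open import Function.Base using (_∘_)
open import Function.Bundles using (Inverse; Func)
open import Relation.Binary.PropositionalEquality as ≡ using (_≡_)
import Relation.Binary.Reasoning.Setoid as SetoidReasoning
open import Relation.Nullary using (¬_; Dec; yes; no)
open import Relation.Nullary.Decidable using (map′)

module Reals where

  open import Data.Rational.Base
  open import Data.Rational.Properties
  open import Data.Rational.Solver using (module +-*-Solver)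
  import Data.Rational.Unnormalised.Base as ℚᵘ
  import Data.Rational.Unnormalised.Properties as ℚᵘₚ
  open import Relation.Binary.PropositionalEquality

  IsCauchy : (ℕ → ℚ) → Set
  IsCauchy x = ∀ ε → 0ℚ < ε → ∃ λ N → ∀ m n → N ℕ.≤ m → N ℕ.≤ n → ∣ x m - x n ∣ ≤ ε

  -- A real number is a Cauchy sequence of rationals with a modulus of convergence;
  -- equality is convergence of the difference to 0, and operations are termwise.
  record ℝ : Set where
    field
      approx : ℕ → ℚ
      cauchy : IsCauchy approx

  open ℝ public

  infix 4 _≈ℝ_

  _≈ℝ_ : ℝ → ℝ → Set
  x ≈ℝ y = ∀ ε → 0ℚ < ε → ∃ λ N → ∀ n → N ℕ.≤ n → ∣ approx x n - approx y n ∣ ≤ ε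

  fromℚ : ℚ → ℝ
  fromℚ p = record
    { approx = λ _ → p
    ; cauchy = λ ε 0<ε → 0 , λ _ _ _ _ →
        subst (_≤ ε) (sym (cong ∣_∣ (+-inverseʳ p))) (<⇒≤ 0<ε)
    }

  2ℚ 3ℚ : ℚ
  2ℚ = + 2 / 1
  3ℚ = + 3 / 1

  open +-*-Solver using (solve; _:=_; _:+_; _:*_; _:-_; con)

  split-x : ∀ x y → x ≡ (x - y) + y
  split-x = solve 2 (λ x y → x := (x :- y) :+ y) refl

  sub-+ : ∀ x y x′ y′ → (x + y) - (x′ + y′) ≡ (x - x′) + (y - y′)
  sub-+ = solve 4 (λ x y x′ y′ → (x :+ y) :- (x′ :+ y′) := (x :- x′) :+ (y :- y′)) refl

  sub-* : ∀ x y x′ y′ → x * y - x′ * y′ ≡ (x - x′) * y + x′ * (y - y′)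
  sub-* = solve 4 (λ x y x′ y′ → x :* y :- x′ :* y′ := (x :- x′) :* y :+ x′ :* (y :- y′)) refl

  factor : ∀ ε a b s → (ε * s) * b + a * (ε * s) ≡ ε * ((a + b) * s)
  factor = solve 4 (λ ε a b s → (ε :* s) :* b :+ a :* (ε :* s) := ε :* ((a :+ b) :* s)) refl

  sub-sq : ∀ x y → (x - y) * (x + y) ≡ x * x - y * y
  sub-sq = solve 2 (λ x y → (x :- y) :* (x :+ y) := x :* x :- y :* y) refl

  sub-left : ∀ c x y → (c + x) - (c + y) ≡ x - y
  sub-left = solve 3 (λ c x y → (c :+ x) :- (c :+ y) := x :- y) refl

  sub-cancel : ∀ c x → (c + x) - c ≡ x
  sub-cancel = solve 2 (λ c x → (c :+ x) :- c := x) refl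

  pell-sq : ∀ p q → (2ℚ * p + 3ℚ * q) * (2ℚ * p + 3ℚ * q)
                  ≡ (3ℚ * ((p + 2ℚ * q) * (p + 2ℚ * q))) + (p * p - 3ℚ * (q * q))
  pell-sq = solve 2 (λ p q →
    (con 2ℚ :* p :+ con 3ℚ :* q) :* (con 2ℚ :* p :+ con 3ℚ :* q)
    := (con 3ℚ :* ((p :+ con 2ℚ :* q) :* (p :+ con 2ℚ :* q))) :+ (p :* p :- con 3ℚ :* (q :* q))) refl

  pell-quotient : ∀ q s → (3ℚ * (q * q) + 1ℚ) * (s * s) ≡ 3ℚ * ((q * s) * (q * s)) + s * s
  pell-quotient = solve 2 (λ q s →
    (con 3ℚ :* (q :* q) :+ con 1ℚ) :* (s :* s) := con 3ℚ :* ((q :* s) :* (q :* s)) :+ s :* s) refl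

  interchange : ∀ p s → (p * s) * (p * s) ≡ (p * p) * (s * s)
  interchange = solve 2 (λ p s → (p :* s) :* (p :* s) := (p :* p) :* (s :* s)) refl

  P+3Q : ∀ p q → (p + 2ℚ * q) + (p + q) ≡ 2ℚ * p + 3ℚ * q
  P+3Q = solve 2 (λ p q → (p :+ con 2ℚ :* q) :+ (p :+ q) := con 2ℚ :* p :+ con 3ℚ :* q) refl

  P+Q+Q : ∀ p q → (p + q) + q ≡ p + 2ℚ * q
  P+Q+Q = solve 2 (λ p q → (p :+ q) :+ q := p :+ con 2ℚ :* q) refl

  0<1 : 0ℚ < 1ℚ
  0<1 = positive⁻¹ 1ℚ

  half : ∀ {ε} → 0ℚ < ε → 0ℚ < ½ * ε
  half {ε} 0<ε = positive⁻¹ (½ * ε) {{pos*pos⇒pos ½ ε {{positive 0<ε}}}}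

  halves : ∀ ε → ½ * ε + ½ * ε ≡ ε
  halves ε = trans (sym (*-distribʳ-+ ε ½ ½)) (*-identityˡ ε)

  ≤-+ʳ : ∀ p {q} → 0ℚ ≤ q → p ≤ p + q
  ≤-+ʳ p {q} 0≤q = subst (_≤ p + q) (+-identityʳ p) (+-monoʳ-≤ p 0≤q)

  *-mono-≤ : ∀ {p q s t} → 0ℚ ≤ p → 0ℚ ≤ t → p ≤ q → s ≤ t → p * s ≤ q * t
  *-mono-≤ {p} {q} {s} {t} 0≤p 0≤t p≤q s≤t = ≤-trans
    (*-monoˡ-≤-nonNeg p {{nonNegative 0≤p}} s≤t)
    (*-monoʳ-≤-nonNeg t {{nonNegative 0≤t}} p≤q)

  eventually-bounded : ∀ {x} → IsCauchy x →
    ∃ λ N → ∃ λ B → 0ℚ < B × (∀ n → N ℕ.≤ n → ∣ x n ∣ ≤ B)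
  eventually-bounded {x} cx with cx 1ℚ 0<1
  ... | N , close = N , 1ℚ + ∣ x N ∣
      , <-≤-trans 0<1 (≤-+ʳ 1ℚ (0≤∣p∣ (x N)))
      , λ n N≤n → subst (λ t → ∣ t ∣ ≤ 1ℚ + ∣ x N ∣) (sym (split-x (x n) (x N)))
          (≤-trans (∣p+q∣≤∣p∣+∣q∣ (x n - x N) (x N))
                   (+-monoˡ-≤ ∣ x N ∣ (close n N N≤n ℕₚ.≤-refl)))

  +-cauchy : ∀ {x y} → IsCauchy x → IsCauchy y → IsCauchy (λ n → x n + y n)
  +-cauchy {x} {y} cx cy ε 0<ε =
    let M , px = cx (½ * ε) (half 0<ε)
        N , py = cy (½ * ε) (half 0<ε)
    in M ℕ.⊔ N , λ m n m≥ n≥ →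
    subst (λ t → ∣ t ∣ ≤ ε) (sym (sub-+ (x m) (y m) (x n) (y n)))
      (≤-trans (∣p+q∣≤∣p∣+∣q∣ (x m - x n) (y m - y n))
      (≤-trans (+-mono-≤ (px m n (ℕₚ.m⊔n≤o⇒m≤o M N m≥) (ℕₚ.m⊔n≤o⇒m≤o M N n≥))
                         (py m n (ℕₚ.m⊔n≤o⇒n≤o M N m≥) (ℕₚ.m⊔n≤o⇒n≤o M N n≥)))
               (≤-reflexive (halves ε))))

  neg-cauchy : ∀ {x} → IsCauchy x → IsCauchy (λ n → - x n)
  neg-cauchy {x} cx ε 0<ε =
    let N , px = cx ε 0<ε in N , λ m n m≥ n≥ →
    subst (λ t → ∣ t ∣ ≤ ε) (neg-distrib-+ (x m) (- x n))
      (subst (_≤ ε) (sym (∣-p∣≡∣p∣ (x m - x n))) (px m n m≥ n≥))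

  recip : ∀ {S} → 0ℚ < S → ∃ λ s → 0ℚ < s × S * s ≡ 1ℚ
  recip {S} 0<S = (1/ S) {{>-nonZero 0<S}} , positive⁻¹ _ {{1/pos⇒pos S {{positive 0<S}}}}
                , *-inverseʳ S {{>-nonZero 0<S}}

  *-bound : ∀ {δ A B} a b c d → 0ℚ < δ → 0ℚ < B →
            ∣ a - c ∣ ≤ δ → ∣ b - d ∣ ≤ δ → ∣ c ∣ ≤ A → ∣ b ∣ ≤ B →
            ∣ a * b - c * d ∣ ≤ δ * B + A * δ
  *-bound {δ} {A} {B} a b c d 0<δ 0<B ac bd c≤A b≤B =
    subst (λ t → ∣ t ∣ ≤ δ * B + A * δ) (sym (sub-* a b c d))
      (≤-trans (∣p+q∣≤∣p∣+∣q∣ ((a - c) * b) (c * (b - d)))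
      (≤-trans (≤-reflexive (cong₂ _+_ (∣p*q∣≡∣p∣*∣q∣ (a - c) b) (∣p*q∣≡∣p∣*∣q∣ c (b - d))))
               (+-mono-≤ (*-mono-≤ (0≤∣p∣ (a - c)) (<⇒≤ 0<B) ac b≤B)
                         (*-mono-≤ (0≤∣p∣ c) (<⇒≤ 0<δ) c≤A bd))))

  *-modulus : ∀ {ε A B} → 0ℚ < ε → 0ℚ < A → 0ℚ < B →
              ∃ λ δ → 0ℚ < δ × δ * B + A * δ ≡ ε
  *-modulus {ε} {A} {B} 0<ε 0<A 0<B with recip (<-≤-trans 0<A (≤-+ʳ A (<⇒≤ 0<B)))
  ... | s , 0<s , S*s≡1 = ε * s
    , positive⁻¹ (ε * s) {{pos*pos⇒pos ε {{positive 0<ε}} s {{positive 0<s}}}}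
    , trans (factor ε A B s) (trans (cong (ε *_) S*s≡1) (*-identityʳ ε))

  *-cauchy : ∀ {x y} → IsCauchy x → IsCauchy y → IsCauchy (λ n → x n * y n)
  *-cauchy {x} {y} cx cy ε 0<ε =
    let K , A , 0<A , bx = eventually-bounded {x} cx
        L , B , 0<B , by = eventually-bounded {y} cy
        δ , 0<δ , eq     = *-modulus {ε} {A} {B} 0<ε 0<A 0<B
        M , px           = cx δ 0<δ
        N , py           = cy δ 0<δ
    in M ℕ.⊔ N ℕ.⊔ (K ℕ.⊔ L) , λ m n m≥ n≥ →
    let m≥MN = ℕₚ.m⊔n≤o⇒m≤o (M ℕ.⊔ N) (K ℕ.⊔ L) m≥
        n≥MN = ℕₚ.m⊔n≤o⇒m≤o (M ℕ.⊔ N) (K ℕ.⊔ L) n≥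
        m≥L  = ℕₚ.m⊔n≤o⇒n≤o K L (ℕₚ.m⊔n≤o⇒n≤o (M ℕ.⊔ N) (K ℕ.⊔ L) m≥)
        n≥K  = ℕₚ.m⊔n≤o⇒m≤o K L (ℕₚ.m⊔n≤o⇒n≤o (M ℕ.⊔ N) (K ℕ.⊔ L) n≥)
    in subst (∣ x m * y m - x n * y n ∣ ≤_) eq
      (*-bound {δ} {A} {B} (x m) (y m) (x n) (y n) 0<δ 0<B
         (px m n (ℕₚ.m⊔n≤o⇒m≤o M N m≥MN) (ℕₚ.m⊔n≤o⇒m≤o M N n≥MN))
         (py m n (ℕₚ.m⊔n≤o⇒n≤o M N m≥MN) (ℕₚ.m⊔n≤o⇒n≤o M N n≥MN))
         (bx n n≥K) (by m m≥L))

  ℝ-rawRing : RawRing 0ℓ 0ℓ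
  ℝ-rawRing = record
    { Carrier = ℝ
    ; _≈_     = _≈ℝ_
    ; _+_     = λ x y → record
        { approx = λ n → approx x n + approx y n ; cauchy = +-cauchy {approx x} {approx y} (cauchy x) (cauchy y) }
    ; _*_     = λ x y → record
        { approx = λ n → approx x n * approx y n ; cauchy = *-cauchy {approx x} {approx y} (cauchy x) (cauchy y) }
    ; -_      = λ x → record
        { approx = λ n → - approx x n ; cauchy = neg-cauchy {approx x} (cauchy x) }
    ; 0#      = fromℚ 0ℚ
    ; 1#      = fromℚ 1ℚ
    }

  -- P n + Q n √3 = (2 + √3)ⁿ⁺¹ has norm 1, so (P n / Q n)² = 3 + 1 / (Q n)².
  P Q : ℕ → ℚ
  P zero    = 2ℚ
  P (suc n) = 2ℚ * P n + 3ℚ * Q n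
  Q zero    = 1ℚ
  Q (suc n) = P n + 2ℚ * Q n

  0<2* : ∀ {q} → 0ℚ < q → 0ℚ < 2ℚ * q
  0<2* {q} 0<q = positive⁻¹ (2ℚ * q) {{pos*pos⇒pos 2ℚ q {{positive 0<q}}}}

  0<3* : ∀ {q} → 0ℚ < q → 0ℚ < 3ℚ * q
  0<3* {q} 0<q = positive⁻¹ (3ℚ * q) {{pos*pos⇒pos 3ℚ q {{positive 0<q}}}}

  0<P : ∀ n → 0ℚ < P n
  0<Q : ∀ n → 0ℚ < Q n
  0<P zero    = positive⁻¹ 2ℚ
  0<P (suc n) = <-≤-trans (0<2* (0<P n)) (≤-+ʳ (2ℚ * P n) (<⇒≤ (0<3* (0<Q n))))
  0<Q zero    = 0<1
  0<Q (suc n) = <-≤-trans (0<P n) (≤-+ʳ (P n) (<⇒≤ (0<2* (0<Q n))))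

  Q-nonZero : ∀ n → NonZero (Q n)
  Q-nonZero n = >-nonZero (0<Q n)

  1/Q P/Q : ℕ → ℚ
  1/Q n = (1/ Q n) {{Q-nonZero n}}
  P/Q n = P n * 1/Q n

  pell : ∀ n → P n * P n ≡ 3ℚ * (Q n * Q n) + 1ℚ
  pell zero    = refl
  pell (suc n) = trans (pell-sq (P n) (Q n))
    (cong (λ t → 3ℚ * (Q (suc n) * Q (suc n)) + t)
      (trans (cong (λ t → t - 3ℚ * (Q n * Q n)) (pell n)) (sub-cancel (3ℚ * (Q n * Q n)) 1ℚ)))

  Q*1/Q : ∀ n → Q n * 1/Q n ≡ 1ℚ
  Q*1/Q n = *-inverseʳ (Q n) {{Q-nonZero n}}

  0≤1/Q : ∀ n → 0ℚ ≤ 1/Q n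
  0≤1/Q n = <⇒≤ (positive⁻¹ (1/Q n) {{1/pos⇒pos (Q n) {{positive (0<Q n)}}}})

  P/Q² : ∀ n → P/Q n * P/Q n ≡ 3ℚ + 1/Q n * 1/Q n
  P/Q² n = trans (interchange (P n) (1/Q n))
    (trans (cong (_* (1/Q n * 1/Q n)) (pell n))
    (trans (pell-quotient (Q n) (1/Q n))
           (cong (λ t → 3ℚ * (t * t) + 1/Q n * 1/Q n) (Q*1/Q n))))

  Q≤P : ∀ n → Q n ≤ P n
  Q≤P zero    = *≤* (ℤ.+≤+ (ℕ.s≤s ℕ.z≤n))
  Q≤P (suc n) = subst (Q (suc n) ≤_) (P+3Q (P n) (Q n))
    (≤-+ʳ (Q (suc n)) (≤-trans (<⇒≤ (0<P n)) (≤-+ʳ (P n) (<⇒≤ (0<Q n)))))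

  1≤Q : ∀ n → 1ℚ ≤ Q n
  1≤Q zero    = ≤-refl
  1≤Q (suc n) = ≤-trans (1≤Q n) (≤-trans (Q≤P n) (≤-+ʳ (P n) (<⇒≤ (0<2* (0<Q n)))))

  fromℕ : ℕ → ℚ
  fromℕ zero    = 0ℚ
  fromℕ (suc n) = 1ℚ + fromℕ n

  n≤Q : ∀ n → fromℕ n ≤ Q n
  n≤Q zero    = <⇒≤ (0<Q 0)
  n≤Q (suc n) = ≤-trans (+-mono-≤ (≤-trans (1≤Q n) (Q≤P n)) (n≤Q n))
    (subst (P n + Q n ≤_) (P+Q+Q (P n) (Q n)) (≤-+ʳ (P n + Q n) (<⇒≤ (0<Q n))))

  0≤fromℕ : ∀ n → 0ℚ ≤ fromℕ n
  0≤fromℕ zero    = ≤-refl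
  0≤fromℕ (suc n) = ≤-trans (<⇒≤ 0<1) (≤-+ʳ 1ℚ (0≤fromℕ n))

  fromℕ-mono : ∀ {m n} → m ℕ.≤ n → fromℕ m ≤ fromℕ n
  fromℕ-mono {n = n} ℕ.z≤n = 0≤fromℕ n
  fromℕ-mono (ℕ.s≤s m≤n)   = +-monoʳ-≤ 1ℚ (fromℕ-mono m≤n)

  toℚᵘ-fromℕ : ∀ n → toℚᵘ (fromℕ n) ℚᵘ.≃ ℚᵘ.mkℚᵘ (+ n) 0
  toℚᵘ-fromℕ zero    = ℚᵘ.*≡* refl
  toℚᵘ-fromℕ (suc n) = ℚᵘₚ.≃-trans (toℚᵘ-homo-+ 1ℚ (fromℕ n))
    (ℚᵘₚ.≃-trans (ℚᵘₚ.+-congʳ ℚᵘ.1ℚᵘ (toℚᵘ-fromℕ n))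
      (ℚᵘ.*≡* (cong (λ z → (+ 1 ℤ.+ z) ℤ.* + 1) (ℤₚ.*-identityʳ (+ n)))))

  archimedean : ∀ {δ} → 0ℚ < δ → ∃ λ N → 1ℚ ≤ δ * fromℕ N
  archimedean {δ@(mkℚ (+ suc a) d _)} 0<δ = suc d , toℚᵘ-cancel-≤
    (ℚᵘₚ.≤-respʳ-≃
      (ℚᵘₚ.≃-trans (ℚᵘₚ.*-congˡ {toℚᵘ δ} (ℚᵘₚ.≃-sym (toℚᵘ-fromℕ (suc d))))
                   (ℚᵘₚ.≃-sym (toℚᵘ-homo-* δ (fromℕ (suc d)))))
      (ℚᵘ.*≤* (ℤ.+≤+ (ℕₚ.≤-trans (ℕₚ.≤-reflexive (ℕₚ.+-identityʳ _))
        (ℕₚ.≤-trans (ℕₚ.≤-reflexive (ℕₚ.*-identityʳ _))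
          (ℕₚ.≤-trans (ℕₚ.m≤n*m (suc d) (suc a)) (ℕₚ.≤-reflexive (sym (ℕₚ.*-identityʳ _)))))))))
  archimedean {mkℚ (+ zero) _ _} 0<δ with positive 0<δ
  ... | ()
  archimedean {mkℚ ℤ.-[1+ _ ] _ _} 0<δ with positive 0<δ
  ... | ()

  1/Q≤ : ∀ {δ N} → 0ℚ < δ → 1ℚ ≤ δ * fromℕ N → ∀ n → N ℕ.≤ n → 1/Q n ≤ δ
  1/Q≤ {δ} {N} 0<δ 1≤δN n N≤n =
    subst₂ _≤_ (*-identityˡ (1/Q n))
      (trans (*-assoc δ (Q n) (1/Q n)) (trans (cong (δ *_) (Q*1/Q n)) (*-identityʳ δ)))
      (*-monoʳ-≤-nonNeg (1/Q n) {{nonNegative (0≤1/Q n)}}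
        (≤-trans 1≤δN (*-monoˡ-≤-nonNeg δ {{nonNegative (<⇒≤ 0<δ)}}
          (≤-trans (fromℕ-mono N≤n) (n≤Q n)))))

  1/Q≤1 : ∀ n → 1/Q n ≤ 1ℚ
  1/Q≤1 n = subst₂ _≤_ (*-identityˡ (1/Q n)) (Q*1/Q n)
    (*-monoʳ-≤-nonNeg (1/Q n) {{nonNegative (0≤1/Q n)}} (1≤Q n))

  1/Q²≤ : ∀ {δ N} → 0ℚ < δ → 1ℚ ≤ δ * fromℕ N → ∀ n → N ℕ.≤ n → 1/Q n * 1/Q n ≤ δ
  1/Q²≤ {δ} 0<δ big n N≤n = ≤-trans
    (*-mono-≤ (0≤1/Q n) (<⇒≤ 0<1) (1/Q≤ 0<δ big n N≤n) (1/Q≤1 n))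
    (≤-reflexive (*-identityʳ δ))

  0≤1/Q² : ∀ n → 0ℚ ≤ 1/Q n * 1/Q n
  0≤1/Q² n = subst (_≤ 1/Q n * 1/Q n) (*-zeroʳ (1/Q n))
    (*-monoˡ-≤-nonNeg (1/Q n) {{nonNegative (0≤1/Q n)}} (0≤1/Q n))

  1≤P/Q : ∀ n → 1ℚ ≤ P/Q n
  1≤P/Q n = subst (_≤ P/Q n) (Q*1/Q n)
    (*-monoʳ-≤-nonNeg (1/Q n) {{nonNegative (0≤1/Q n)}} (Q≤P n))

  -- If x, y ≥ 1 have squares 3 + s and 3 + t, then ∣ x - y ∣ ≤ ∣ x² - y² ∣ ≤ s + t.
  close : ∀ x y s t → 1ℚ ≤ x → 1ℚ ≤ y → 0ℚ ≤ s → 0ℚ ≤ t →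
          x * x ≡ 3ℚ + s → y * y ≡ 3ℚ + t → ∣ x - y ∣ ≤ s + t
  close x y s t 1≤x 1≤y 0≤s 0≤t x² y² =
    ≤-trans (≤-reflexive (sym (*-identityʳ ∣ x - y ∣)))
    (≤-trans (*-monoˡ-≤-nonNeg ∣ x - y ∣ {{∣-∣-nonNeg (x - y)}} 1≤sum)
    (≤-trans (≤-reflexive
      (trans (sym (∣p*q∣≡∣p∣*∣q∣ (x - y) (x + y)))
        (cong ∣_∣ (trans (sub-sq x y) (trans (cong₂ _-_ x² y²) (sub-left 3ℚ s t))))))
    (≤-trans (∣p-q∣≤∣p∣+∣q∣ s t)
      (≤-reflexive (cong₂ _+_ (0≤p⇒∣p∣≡p 0≤s) (0≤p⇒∣p∣≡p 0≤t))))))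
    where
    le : 1ℚ ≤ x + y
    le = ≤-trans 1≤x (≤-+ʳ x (≤-trans (<⇒≤ 0<1) 1≤y))
    1≤sum : 1ℚ ≤ ∣ x + y ∣
    1≤sum = subst (1ℚ ≤_) (sym (0≤p⇒∣p∣≡p (≤-trans (<⇒≤ 0<1) le))) le

  P/Q-cauchy : IsCauchy P/Q
  P/Q-cauchy ε 0<ε =
    let N , big = archimedean (half 0<ε) in N , λ m n m≥ n≥ →
    ≤-trans (close (P/Q m) (P/Q n) (1/Q m * 1/Q m) (1/Q n * 1/Q n) (1≤P/Q m) (1≤P/Q n)
                   (0≤1/Q² m) (0≤1/Q² n) (P/Q² m) (P/Q² n))
    (≤-trans (+-mono-≤ (1/Q²≤ (half 0<ε) big m m≥) (1/Q²≤ (half 0<ε) big n n≥))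
             (≤-reflexive (halves ε)))

  √3 : ℝ
  √3 = record { approx = P/Q ; cauchy = P/Q-cauchy }

  √3*√3≈3 : RawRing._*_ ℝ-rawRing √3 √3 ≈ℝ fromℚ 3ℚ
  √3*√3≈3 ε 0<ε =
    let N , big = archimedean 0<ε in N , λ n n≥ → subst (_≤ ε)
    (sym (trans (cong (λ t → ∣ t - 3ℚ ∣) (P/Q² n))
         (trans (cong ∣_∣ (sub-cancel 3ℚ (1/Q n * 1/Q n))) (0≤p⇒∣p∣≡p (0≤1/Q² n)))))
    (1/Q²≤ 0<ε big n n≥)

open Reals public using (ℝ; _≈ℝ_; ℝ-rawRing; fromℚ; √3)

module ℝR where
  open RawRing ℝ-rawRing public using (_+_; _*_; -_; 0#; 1#)
  open RawSemiringDefs (RawRing.rawSemiring ℝ-rawRing) public using (_^_)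

record ℂ : Set where
  constructor _+i_
  field
    re im : ℝ

open ℂ public

ℂ-rawRing : RawRing 0ℓ 0ℓ
ℂ-rawRing = record
  { Carrier = ℂ
  ; _≈_     = λ z w → re z ≈ℝ re w × im z ≈ℝ im w
  ; _+_     = λ z w → (re z + re w) +i (im z + im w)
  ; _*_     = λ z w → (re z * re w + - (im z * im w)) +i (re z * im w + im z * re w)
  ; -_      = λ z → (- re z) +i (- im z)
  ; 0#      = 0# +i 0#
  ; 1#      = 1# +i 0#
  }
  where open ℝR

module ℂR where
  open RawRing ℂ-rawRing public using (_≈_; _+_; _*_; -_; 0#; 1#)
  open RawSemiringDefs (RawRing.rawSemiring ℂ-rawRing) public using (_^_; sum)

fromℝ : ℝ → ℂ
fromℝ x = x +i ℝR.0#

∣_∣² : ℂ → ℝ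
∣ z ∣² = re z * re z + im z * im z
  where open ℝR

-- e^{2πi/3} = cos (2π/3) + i sin (2π/3)
ω : ℂ
ω = fromℚ -½ +i (fromℚ ½ ℝR.* √3)

-- 3^{-n/2} as (1/√3)ⁿ, with 1/√3 = √3/3
3^-_/2 : ℕ → ℝ
3^- n /2 = (fromℚ (+ 1 ℚ./ 3) ℝR.* √3) ℝR.^ n

record FiniteField (q : ℕ) (c ℓ : Level) : Set (lsuc (c ⊔ ℓ)) where
  field
    commutativeRing : CommutativeRing c ℓ
  open CommutativeRing commutativeRing public
  field
    0≉1         : ¬ (0# ≈ 1#)
    inverse     : ∀ x → ¬ (x ≈ 0#) → ∃[ y ] x * y ≈ 1#
    enumeration : Inverse (≡.setoid (Fin q)) setoid

  open RawSemiringDefs (Semiring.rawSemiring semiring) public using (_^_; sum) renaming (_×_ to _×′_)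

  IsPrimitive : Carrier → Set (c ⊔ ℓ)
  IsPrimitive ξ = ¬ (ξ ≈ 0#) × (∀ y → ¬ (y ≈ 0#) → ∃[ j ] ξ ^ j ≈ y)

-- The prime field, as residues modulo 3.
𝔽₃ : Set
𝔽₃ = Fin 3

infixl 6 _-₃_

_-₃_ : 𝔽₃ → 𝔽₃ → 𝔽₃
i -₃ j = (toℕ i ℕ.+ (3 ℕ.∸ toℕ j)) mod 3

module Trace {c ℓ} (n : ℕ) (F : FiniteField (3 ℕ.^ n) c ℓ) where
  open FiniteField F

  ι : 𝔽₃ → Carrier
  ι i = toℕ i ×′ 1#

  conjugateSum : Carrier → Carrier
  conjugateSum x = sum {n} λ j → x ^ (3 ℕ.^ toℕ j)

  private
    q : ℕ
    q = 3 ℕ.^ n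
    module E = Inverse enumeration
    module Add = Sum +-commutativeMonoid
    module Mul = Sum *-commutativeMonoid
    module ×ₚ = MonoidMult +-monoid
    module ×ₛ = Mult semiring
    module ^ₚ = Exp semiring
    module RP = RingProperties ring
    module +G = GroupProperties +-group
    module S = NatCoeffSolver commutativeSemiring
    open SetoidReasoning setoid

  to-from : ∀ x → E.to (E.from x) ≈ x
  to-from x = E.inverseˡ ≡.refl

  from-to : ∀ i → E.from (E.to i) ≡ i
  from-to i = E.inverseʳ refl

  _≟_ : ∀ x y → Dec (x ≈ y)
  x ≟ y = map′ (λ eq → trans (sym (to-from x)) (trans (E.to-cong eq) (to-from y))) E.from-cong
               (E.from x Finₚ.≟ E.from y)

  *-cancelˡ : ∀ x {y z} → ¬ (x ≈ 0#) → x * y ≈ x * z → y ≈ z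
  *-cancelˡ x {y} {z} x≉0 xy≈xz with inverse x x≉0
  ... | x⁻¹ , xx⁻¹≈1 = trans (sym (lemma y)) (trans (*-congˡ xy≈xz) (lemma z))
    where
    lemma : ∀ y → x⁻¹ * (x * y) ≈ y
    lemma y = begin
      x⁻¹ * (x * y) ≈⟨ *-assoc x⁻¹ x y ⟨
      x⁻¹ * x * y   ≈⟨ *-congʳ (trans (*-comm x⁻¹ x) xx⁻¹≈1) ⟩
      1# * y        ≈⟨ *-identityˡ y ⟩
      y             ∎

  no-zero-divisors : ∀ x y → x * y ≈ 0# → x ≈ 0# ⊎ y ≈ 0#
  no-zero-divisors x y xy≈0 with x ≟ 0#
  ... | yes x≈0 = inj₁ x≈0
  ... | no  x≉0 = inj₂ (*-cancelˡ x x≉0 (trans xy≈0 (sym (zeroʳ x))))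

  *-nonzero : ∀ {x y} → ¬ (x ≈ 0#) → ¬ (y ≈ 0#) → ¬ (x * y ≈ 0#)
  *-nonzero {x} {y} x≉0 y≉0 xy≈0 with no-zero-divisors x y xy≈0
  ... | inj₁ x≈0 = x≉0 x≈0
  ... | inj₂ y≈0 = y≉0 y≈0

  permutation : (g h : Carrier → Carrier) →
                (∀ {x y} → x ≈ y → g x ≈ g y) → (∀ {x y} → x ≈ y → h x ≈ h y) →
                (∀ x → g (h x) ≈ x) → (∀ x → h (g x) ≈ x) → Permutation′ q
  permutation g h g-cong h-cong gh hg = Perm.permutation
    (λ i → E.from (g (E.to i))) (λ i → E.from (h (E.to i)))
    (inv g h g-cong gh) (inv h g h-cong hg)
    where
    inv : ∀ (g h : Carrier → Carrier) → (∀ {x y} → x ≈ y → g x ≈ g y) → (∀ x → g (h x) ≈ x) →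
          ∀ i → E.from (g (E.to (E.from (h (E.to i))))) ≡ i
    inv g h g-cong gh i =
      ≡.trans (E.from-cong (trans (g-cong (to-from (h (E.to i)))) (gh (E.to i)))) (from-to i)

  q×x≈0 : ∀ x → q ×′ x ≈ 0#
  q×x≈0 x = +G.∙-cancelˡ (sum E.to) _ _ (begin
    sum E.to + q ×′ x                   ≈⟨ +-congˡ (Add.sum-replicate q) ⟨
    sum E.to + sum {q} (λ _ → x)        ≈⟨ Add.∑-distrib-+ E.to (λ _ → x) ⟨
    sum (λ i → E.to i + x)              ≈⟨ Add.sum-cong-≋ (λ i → to-from (E.to i + x)) ⟨
    sum (λ i → E.to (E.from (E.to i + x))) ≈⟨ Add.∑-permute E.to π ⟨
    sum E.to                            ≈⟨ +-identityʳ _ ⟨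
    sum E.to + 0#                       ∎)
    where
    π = permutation (_+ x) (_+ - x) +-congʳ +-congʳ
      (λ y → trans (+-assoc y (- x) x) (trans (+-congˡ (-‿inverseˡ x)) (+-identityʳ y)))
      (λ y → trans (+-assoc y x (- x)) (trans (+-congˡ (-‿inverseʳ x)) (+-identityʳ y)))

  characteristic-3 : 3 ×′ 1# ≈ 0#
  characteristic-3 = go n (q×x≈0 1#)
    where
    go : ∀ m → (3 ℕ.^ m) ×′ 1# ≈ 0# → 3 ×′ 1# ≈ 0#
    go zero    eq = ⊥-elim (0≉1 (sym (trans (sym (+-identityʳ 1#)) eq)))
    go (suc m) eq with no-zero-divisors _ _ (trans (sym (×ₛ.×1-homo-* 3 (3 ℕ.^ m))) eq)
    ... | inj₁ 3≈0 = 3≈0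
    ... | inj₂ eq′ = go m eq′

  3×x≈0 : ∀ x → 3 ×′ x ≈ 0#
  3×x≈0 x = begin
    3 ×′ x          ≈⟨ ×ₚ.×-congʳ 3 (*-identityˡ x) ⟨
    3 ×′ (1# * x)   ≈⟨ ×ₛ.×-assoc-* 3 1# x ⟨
    (3 ×′ 1#) * x   ≈⟨ *-congʳ characteristic-3 ⟩
    0# * x          ≈⟨ zeroˡ x ⟩
    0#              ∎

  frobenius-+ : ∀ x y → (x + y) ^ 3 ≈ x ^ 3 + y ^ 3
  frobenius-+ x y = begin
    (x + y) ^ 3
      ≈⟨ S.solve 2 (λ x y → (x S.:+ y) S.:^ 3 S.:=
           (x S.:^ 3 S.:+ y S.:^ 3) S.:+ (t x y S.:+ (t x y S.:+ (t x y S.:+ S.con 0)))) refl x y ⟩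
    x ^ 3 + y ^ 3 + 3 ×′ (x * x * y + x * y * y)
      ≈⟨ +-congˡ (3×x≈0 _) ⟩
    x ^ 3 + y ^ 3 + 0#
      ≈⟨ +-identityʳ _ ⟩
    x ^ 3 + y ^ 3 ∎
    where
    t : ∀ {k} → S.Polynomial k → S.Polynomial k → S.Polynomial k
    t x y = x S.:* x S.:* y S.:+ x S.:* y S.:* y

  frobenius-sum : ∀ {m} (t : Fin m → Carrier) → sum t ^ 3 ≈ sum (λ i → t i ^ 3)
  frobenius-sum {zero}  t = zeroˡ _
  frobenius-sum {suc m} t = trans (frobenius-+ (t 0F) (sum (t ∘ Fin.suc)))
                                  (+-congˡ (frobenius-sum (t ∘ Fin.suc)))

  -- Lagrange: multiplication by x permutes the nonzero elements, whose product is nonzero.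
  x^q≈x : ∀ x → x ^ q ≈ x
  x^q≈x x with x ≟ 0#
  ... | yes x≈0 = trans (^ₚ.^-congˡ q x≈0) (trans (0^ q (ℕₚ.m^n≢0 3 n)) (sym x≈0))
    where
    0^ : ∀ m → ℕ.NonZero m → 0# ^ m ≈ 0#
    0^ (suc m) _ = zeroˡ _
  ... | no x≉0 with inverse x x≉0
  ...   | x⁻¹ , xx⁻¹≈1 = begin
    x ^ q                                      ≈⟨ Mul.sum-replicate q ⟨
    product {q} (λ _ → x)                      ≈⟨ Mul.sum-cong-≋ (λ i → split (E.to i)) ⟨
    product {q} (λ i → h (E.to i) * d (E.to i)) ≈⟨ Mul.∑-distrib-+ (h ∘ E.to) (d ∘ E.to) ⟩
    product (h ∘ E.to) * product (d ∘ E.to)    ≈⟨ *-cong ∏h≈1 ∏d≈x ⟩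
    1# * x                                     ≈⟨ *-identityˡ x ⟩
    x                                          ∎
    where
    product : ∀ {m} → (Fin m → Carrier) → Carrier
    product = Mul.sum
    h d g : Carrier → Carrier
    h y with y ≟ 0#
    ... | yes _ = 1#
    ... | no  _ = x
    d y with y ≟ 0#
    ... | yes _ = x
    ... | no  _ = 1#
    g y with y ≟ 0#
    ... | yes _ = 1#
    ... | no  _ = y

    split : ∀ y → h y * d y ≈ x
    split y with y ≟ 0#
    ... | yes _ = *-identityˡ x
    ... | no  _ = *-identityʳ x

    g≉0 : ∀ y → ¬ (g y ≈ 0#)
    g≉0 y gy≈0 with y ≟ 0#
    ... | yes _  = 0≉1 (sym gy≈0)
    ... | no y≉0 = y≉0 gy≈0

    g-cong : ∀ {y z} → y ≈ z → g y ≈ g z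
    g-cong {y} {z} y≈z with y ≟ 0# | z ≟ 0#
    ... | yes _   | yes _   = refl
    ... | yes y≈0 | no z≉0  = ⊥-elim (z≉0 (trans (sym y≈z) y≈0))
    ... | no y≉0  | yes z≈0 = ⊥-elim (y≉0 (trans y≈z z≈0))
    ... | no _    | no _    = y≈z

    g-* : ∀ y → g (y * x) ≈ h y * g y
    g-* y with y ≟ 0# | (y * x) ≟ 0#
    ... | yes y≈0 | yes _  = sym (*-identityˡ 1#)
    ... | yes y≈0 | no yx≉0 = ⊥-elim (yx≉0 (trans (*-congʳ y≈0) (zeroˡ x)))
    ... | no y≉0  | yes yx≈0 = ⊥-elim (*-nonzero y≉0 x≉0 yx≈0)
    ... | no y≉0  | no _ = *-comm y x

    ∏g≉0 : ∀ {m} (t : Fin m → Carrier) → ¬ (product (g ∘ t) ≈ 0#)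
    ∏g≉0 {zero}  t eq = 0≉1 (sym eq)
    ∏g≉0 {suc m} t = *-nonzero (g≉0 (t 0F)) (∏g≉0 (t ∘ Fin.suc))

    π = permutation (_* x) (_* x⁻¹) *-congʳ *-congʳ
      (λ y → trans (*-assoc y x⁻¹ x) (trans (*-congˡ (trans (*-comm x⁻¹ x) xx⁻¹≈1)) (*-identityʳ y)))
      (λ y → trans (*-assoc y x x⁻¹) (trans (*-congˡ xx⁻¹≈1) (*-identityʳ y)))

    ∏h≈1 : product (h ∘ E.to) ≈ 1#
    ∏h≈1 = *-cancelˡ (product (g ∘ E.to)) (∏g≉0 E.to) (begin
      product (g ∘ E.to) * product (h ∘ E.to)   ≈⟨ *-comm _ _ ⟩
      product (h ∘ E.to) * product (g ∘ E.to)   ≈⟨ Mul.∑-distrib-+ (h ∘ E.to) (g ∘ E.to) ⟨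
      product (λ i → h (E.to i) * g (E.to i))   ≈⟨ Mul.sum-cong-≋ (λ i → g-* (E.to i)) ⟨
      product (λ i → g (E.to i * x))            ≈⟨ Mul.sum-cong-≋ (λ i → g-cong (to-from (E.to i * x))) ⟨
      product (λ i → g (E.to (E.from (E.to i * x)))) ≈⟨ Mul.∑-permute (g ∘ E.to) π ⟨
      product (g ∘ E.to)                        ≈⟨ *-identityʳ _ ⟨
      product (g ∘ E.to) * 1#                   ∎)

    ∏d≈x : product (d ∘ E.to) ≈ x
    ∏d≈x = aux q E.to E.from E.from-cong to-from from-to
      where
      aux : ∀ m (to : Fin m → Carrier) (from : Carrier → Fin m) →
            (∀ {x y} → x ≈ y → from x ≡ from y) →
            (∀ x → to (from x) ≈ x) → (∀ i → from (to i) ≡ i) → product (d ∘ to) ≈ x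
      aux zero    to from fc tf ft with from 0#
      ... | ()
      aux (suc m) to from fc tf ft = begin
        product (d ∘ to)                              ≈⟨ Mul.sum-remove {i = z} (d ∘ to) ⟩
        d (to z) * product (removeAt (d ∘ to) z)      ≈⟨ *-cong (d0 (tf 0#)) (Mul.sum-cong-≋ (λ i → dn (ne i))) ⟩
        x * product {m} (λ _ → 1#)                    ≈⟨ *-congˡ (Mul.sum-replicate-zero m) ⟩
        x * 1#                                        ≈⟨ *-identityʳ x ⟩
        x                                             ∎
        where
        z = from 0#
        d0 : ∀ {y} → y ≈ 0# → d y ≈ x
        d0 {y} y≈0 with y ≟ 0#
        ... | yes _  = refl
        ... | no y≉0 = ⊥-elim (y≉0 y≈0)
        dn : ∀ {y} → ¬ (y ≈ 0#) → d y ≈ 1#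
        dn {y} y≉0 with y ≟ 0#
        ... | yes y≈0 = ⊥-elim (y≉0 y≈0)
        ... | no _    = refl
        ne : ∀ i → ¬ (to (Fin.punchIn z i) ≈ 0#)
        ne i eq = Finₚ.punchInᵢ≢i z i (≡.trans (≡.sym (ft _)) (fc eq))

  conjugateSum³ : ∀ x → conjugateSum x ^ 3 ≈ conjugateSum x
  conjugateSum³ x = +G.∙-cancelʳ (x ^ 1) _ _ (begin
    conjugateSum x ^ 3 + x ^ 1
      ≈⟨ +-congʳ (frobenius-sum {n} (λ j → x ^ (3 ℕ.^ toℕ j))) ⟩
    sum {n} (λ j → (x ^ (3 ℕ.^ toℕ j)) ^ 3) + x ^ 1
      ≈⟨ +-congʳ (Add.sum-cong-≋ {n} (λ j → trans (^ₚ.^-assocʳ x (3 ℕ.^ toℕ j) 3)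
           (^ₚ.^-congʳ x (ℕₚ.*-comm (3 ℕ.^ toℕ j) 3)))) ⟩
    sum {n} (λ j → x ^ (3 ℕ.^ suc (toℕ j))) + x ^ 1
      ≈⟨ +-comm _ _ ⟩
    sum {suc n} (λ j → x ^ (3 ℕ.^ toℕ j))
      ≈⟨ Add.sum-init-last {n} (λ j → x ^ (3 ℕ.^ toℕ j)) ⟩
    sum {n} (λ j → x ^ (3 ℕ.^ toℕ (Fin.inject₁ j))) + x ^ (3 ℕ.^ toℕ (Fin.fromℕ n))
      ≈⟨ +-cong (Add.sum-cong-≋ {n} (λ j → ^ₚ.^-congʳ x (≡.cong (3 ℕ.^_) (Finₚ.toℕ-inject₁ j))))
                (^ₚ.^-congʳ x (≡.cong (3 ℕ.^_) (Finₚ.toℕ-fromℕ n))) ⟩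
    conjugateSum x + x ^ q
      ≈⟨ +-congˡ (trans (x^q≈x x) (sym (*-identityʳ x))) ⟩
    conjugateSum x + x ^ 1 ∎)

  -- t³ - t = t (t - 1) (t + 1)
  cube-fixed : ∀ t → t ^ 3 ≈ t → ∃[ i ] ι i ≈ t
  cube-fixed t t³≈t with t ≟ 0#
  ... | yes t≈0 = 0F , sym t≈0
  ... | no  t≉0 with no-zero-divisors (t + 1#) (t + - 1#) product≈0
    where
    t²≈1 : t * t ≈ 1#
    t²≈1 = *-cancelˡ t t≉0 (begin
      t * (t * t)        ≈⟨ *-congˡ (*-congˡ (*-identityʳ t)) ⟨
      t ^ 3              ≈⟨ t³≈t ⟩
      t                  ≈⟨ *-identityʳ t ⟨
      t * 1#             ∎)
    product≈0 : (t + 1#) * (t + - 1#) ≈ 0#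
    product≈0 = begin
      (t + 1#) * (t + - 1#)            ≈⟨ distribˡ (t + 1#) t (- 1#) ⟩
      (t + 1#) * t + (t + 1#) * - 1#   ≈⟨ +-cong (trans (distribʳ t t 1#) (+-cong t²≈1 (*-identityˡ t)))
                                            (trans (sym (RP.-‿distribʳ-* (t + 1#) 1#)) (-‿cong (*-identityʳ (t + 1#)))) ⟩
      (1# + t) + - (t + 1#)            ≈⟨ +-congʳ (+-comm 1# t) ⟩
      (t + 1#) + - (t + 1#)            ≈⟨ -‿inverseʳ (t + 1#) ⟩
      0#                               ∎
  ...   | inj₁ t+1≈0 = 2F , +G.∙-cancelʳ 1# _ _ (begin
    2 ×′ 1# + 1#    ≈⟨ +-comm (2 ×′ 1#) 1# ⟩
    3 ×′ 1#         ≈⟨ characteristic-3 ⟩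
    0#              ≈⟨ t+1≈0 ⟨
    t + 1#          ∎)
  ...   | inj₂ t-1≈0 = 1F , trans (+-identityʳ 1#) (sym (+G.x∙y⁻¹≈ε⇒x≈y t 1# t-1≈0))

  Tr : Carrier → 𝔽₃
  Tr x = proj₁ (cube-fixed (conjugateSum x) (conjugateSum³ x))

  ι-Tr : ∀ x → ι (Tr x) ≈ conjugateSum x
  ι-Tr x = proj₂ (cube-fixed (conjugateSum x) (conjugateSum³ x))

  2≉0 : ¬ (2 ×′ 1# ≈ 0#)
  2≉0 2≈0 = 0≉1 (begin
    0#              ≈⟨ characteristic-3 ⟨
    3 ×′ 1#         ≈⟨ +-congˡ 2≈0 ⟩
    1# + 0#         ≈⟨ +-identityʳ 1# ⟩
    1#              ∎)

  ι-injective : ∀ {i j} → ι i ≈ ι j → i ≡ j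
  ι-injective {0F} {0F} _  = ≡.refl
  ι-injective {1F} {1F} _  = ≡.refl
  ι-injective {2F} {2F} _  = ≡.refl
  ι-injective {0F} {1F} eq = ⊥-elim (0≉1 (trans eq (+-identityʳ 1#)))
  ι-injective {1F} {0F} eq = ⊥-elim (0≉1 (trans (sym eq) (+-identityʳ 1#)))
  ι-injective {0F} {2F} eq = ⊥-elim (2≉0 (sym eq))
  ι-injective {2F} {0F} eq = ⊥-elim (2≉0 eq)
  ι-injective {1F} {2F} eq = ⊥-elim (0≉1 (trans (+G.∙-cancelˡ 1# _ _ eq) (+-identityʳ 1#)))
  ι-injective {2F} {1F} eq = ⊥-elim (0≉1 (trans (+G.∙-cancelˡ 1# _ _ (sym eq)) (+-identityʳ 1#)))

  conjugateSum-cong : ∀ {x y} → x ≈ y → conjugateSum x ≈ conjugateSum y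
  conjugateSum-cong x≈y = Add.sum-cong-≋ {n} (λ j → ^ₚ.^-congˡ (3 ℕ.^ toℕ j) x≈y)

  Tr-cong : ∀ {x y} → x ≈ y → Tr x ≡ Tr y
  Tr-cong {x} {y} x≈y = ι-injective (trans (ι-Tr x) (trans (conjugateSum-cong x≈y) (sym (ι-Tr y))))

  TernaryFunction : Set (c ⊔ ℓ)
  TernaryFunction = Func setoid (≡.setoid 𝔽₃)

  open Func using (to)

  -- S_f(b), the sum over the field being taken along its enumeration
  walsh : TernaryFunction → Carrier → ℂ
  walsh f b = ℂR.sum λ i → let x = E.to i in ω ℂR.^ toℕ (to f x -₃ Tr (b * x))

  IsBent : TernaryFunction → Set c
  IsBent f = ∀ b → ∣ walsh f b ∣² ≈ℝ fromℚ (+ q ℚ./ 1)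

  -- The modulus condition |u| = 1 is stated on its square.
  IsWeaklyRegularBent : TernaryFunction → Set (c ⊔ ℓ)
  IsWeaklyRegularBent f = IsBent f ×
    ∃ λ (u : ℂ) → ∣ u ∣² ≈ℝ ℝR.1# × ∃ λ (f* : TernaryFunction) → ∀ b →
      u ℂR.* fromℝ (3^- n /2) ℂR.* walsh f b ℂR.≈ ω ℂR.^ toℕ (to f* b)

  traceMonomial : Carrier → ℕ → TernaryFunction
  traceMonomial a d = record
    { to   = λ x → Tr (a * x ^ d)
    ; cong = λ x≈y → Tr-cong (*-congˡ (^ₚ.^-congˡ d x≈y))
    }

open FiniteField public using (Carrier; IsPrimitive) renaming (_^_ to power)
open Trace public using (traceMonomial; IsWeaklyRegularBent)

{-# OPTIONS --safe #-}
module Submission where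

-- Write q = 3ᵏ ≡ 3 mod 8, K = 𝔽_q, i = ξ^((q² - 1) / 4) = √-1, F = K (i), T and N for trace and norm of F / K, and ψ for
-- the additive character of K.  Since a^q = i a, the function is f(x) = Tr_k (ε(x) c N(x)) with c = T(a), where the
-- sign ε(x) depends only on x^((q² - 1) / 4).  Hence 2 S(b) = - q (ψ(M) + ψ(- M)) + P with M = N(b) / c, where P is
-- the sum of ε(x) (ψ(c N(x)) - ψ(- c N(x))) ψ(- T(b x)).  The sign is constant on K*-lines, so summing over
-- each line turns P into quadratic Gauss sums; the symmetries x ↦ x^q and x ↦ i x then leave
-- P = ± Γ (ψ(- M) - ψ(M)) Z with Γ² = - q and Z = ψ(- M) ∑ η(z) ψ(M (z² - z)), η the quadratic character of K.
-- It remains to see that Z = ± Γ when ψ(M) ≠ 1.  In characteristic 3 the sum E = ∑ ψ(M (r⁴ - r²)) = Γ(M) ψ(- M) + ψ(M) Z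
-- belongs to a quadratic form over 𝔽₃, so |E|² = q |Ker|; if ψ(M) ≠ 1 then |Ker| is 1 or 3.  Both Z and Γ
-- are integer multiples z, γ of √-3, and z² - z γ + γ² = |Ker| γ² with z odd leaves z = ± γ.
-- All sums are evaluated in ℤ[ω], whose image in ℂ is taken only at the end.

-- The sign of P is never computed. As P = ± q (ψ(M) - ψ(- M)), either sign collapses 2 S(b) to - 2
-- q ψ(∓ M), so u = - 1 serves for every b and only the dual function depends on the sign. The
-- obstacle is Z: the symmetries show only that it is purely imaginary. The detour through E
-- supplies one quadratic equation in the integers z and γ, with roots 0, γ if |Ker| = 1 and 2 γ, -
-- γ if |Ker| = 3. Parity then decides: r and - r contribute equally to E, so E ≡ 1 mod 2, which
-- forces z to be odd and rules out 0 and 2 γ. This is why the sums stay in ℤ[ω]: parity makes sense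
-- there, and dividing by 2 or by q - 1 is cancellation of an integer. The congruence q ≡ 3 mod 8
-- acts twice. It makes - 1 a nonsquare of K, so that F = K (i) and Γ is purely imaginary; and it
-- makes (q² - 1) / 4 twice an odd number, so that x ↦ i x changes the sign of x^((q² - 1) / 4).

-- The ring ℤ[ω].

module EisensteinIntegers where

  open import Algebra.Bundles using (CommutativeRing)
  open import Algebra.Structures using (IsCommutativeRing)
  open import Algebra.Solver.Ring.AlmostCommutativeRing using (fromCommutativeRing; _-Raw-AlmostCommutative⟶_)
  import Algebra.Solver.Ring as Solver
  open import Data.Integer.Base as ℤ using (ℤ; +_; -[1+_])
  import Data.Integer.Properties as ℤₚ
  open import Data.Integer.Tactic.RingSolver using (solve-∀)
  open import Data.Product.Base using (_,_)
  import Data.Maybe.Base as Maybe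
  open import Level using (0ℓ)
  open import Relation.Binary.PropositionalEquality
  open import Relation.Nullary.Decidable using (dec⇒maybe)

  infix  5 _+ω_
  infixl 6 _⊕_
  infixl 7 _⊗_
  infix  8 ⊖_

  -- a +ω b stands for a + b ω, where ω² = - 1 - ω.
  record 𝔼 : Set where
    constructor _+ω_
    field
      const coω : ℤ

  open 𝔼 public

  opaque
    _⊕_ _⊗_ : 𝔼 → 𝔼 → 𝔼
    (a +ω b) ⊕ (c +ω d) = (a ℤ.+ c) +ω (b ℤ.+ d)
    (a +ω b) ⊗ (c +ω d) = (a ℤ.* c ℤ.- b ℤ.* d) +ω (a ℤ.* d ℤ.+ b ℤ.* c ℤ.- b ℤ.* d)

    ⊖_ conj : 𝔼 → 𝔼
    ⊖ (a +ω b) = (ℤ.- a) +ω (ℤ.- b)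
    conj (a +ω b) = (a ℤ.- b) +ω (ℤ.- b)

  opaque
    unfolding _⊕_

    𝔼-isCommutativeRing : IsCommutativeRing _≡_ _⊕_ _⊗_ ⊖_ (+ 0 +ω + 0) (+ 1 +ω + 0)
    𝔼-isCommutativeRing = record
      { isRing = record
        { +-isAbelianGroup = record
          { isGroup = record
            { isMonoid = record
              { isSemigroup = record
                { isMagma = record { isEquivalence = isEquivalence ; ∙-cong = cong₂ _⊕_ }
                ; assoc = λ { (a +ω b) (c +ω d) (e +ω f) → cong₂ _+ω_ (ℤₚ.+-assoc a c e) (ℤₚ.+-assoc b d f) }
                }
              ; identity = (λ { (a +ω b) → cong₂ _+ω_ (ℤₚ.+-identityˡ a) (ℤₚ.+-identityˡ b) })
                         , (λ { (a +ω b) → cong₂ _+ω_ (ℤₚ.+-identityʳ a) (ℤₚ.+-identityʳ b) })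
              }
            ; inverse = (λ { (a +ω b) → cong₂ _+ω_ (ℤₚ.+-inverseˡ a) (ℤₚ.+-inverseˡ b) })
                      , (λ { (a +ω b) → cong₂ _+ω_ (ℤₚ.+-inverseʳ a) (ℤₚ.+-inverseʳ b) })
            ; ⁻¹-cong = cong ⊖_
            }
          ; comm = λ { (a +ω b) (c +ω d) → cong₂ _+ω_ (ℤₚ.+-comm a c) (ℤₚ.+-comm b d) }
          }
        ; *-cong = cong₂ _⊗_
        ; *-assoc = λ { (a +ω b) (c +ω d) (e +ω f) → cong₂ _+ω_ (assoc₁ a b c d e f) (assoc₂ a b c d e f) }
        ; *-identity = (λ { (a +ω b) → cong₂ _+ω_ (idˡ₁ a b) (idˡ₂ a b) })
                     , (λ { (a +ω b) → cong₂ _+ω_ (idʳ₁ a b) (idʳ₂ a b) })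
        ; distrib = (λ { (a +ω b) (c +ω d) (e +ω f) → cong₂ _+ω_ (distˡ₁ a b c d e f) (distˡ₂ a b c d e f) })
                  , (λ { (a +ω b) (c +ω d) (e +ω f) → cong₂ _+ω_ (distʳ₁ a b c d e f) (distʳ₂ a b c d e f) })
        }
      ; *-comm = λ { (a +ω b) (c +ω d) → cong₂ _+ω_ (comm₁ a b c d) (comm₂ a b c d) }
      }
      where
      open import Data.Integer.Base using (_+_; _*_; _-_)
      assoc₁ : ∀ a b c d e f → (a * c - b * d) * e - (a * d + b * c - b * d) * f
                             ≡ a * (c * e - d * f) - b * (c * f + d * e - d * f)
      assoc₁ = solve-∀
      assoc₂ : ∀ a b c d e f → (a * c - b * d) * f + (a * d + b * c - b * d) * e - (a * d + b * c - b * d) * f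
                             ≡ a * (c * f + d * e - d * f) + b * (c * e - d * f) - b * (c * f + d * e - d * f)
      assoc₂ = solve-∀
      idˡ₁ : ∀ a b → + 1 * a - + 0 * b ≡ a
      idˡ₁ = solve-∀
      idˡ₂ : ∀ a b → + 1 * b + + 0 * a - + 0 * b ≡ b
      idˡ₂ = solve-∀
      idʳ₁ : ∀ a b → a * + 1 - b * + 0 ≡ a
      idʳ₁ = solve-∀
      idʳ₂ : ∀ a b → a * + 0 + b * + 1 - b * + 0 ≡ b
      idʳ₂ = solve-∀
      distˡ₁ : ∀ a b c d e f → a * (c + e) - b * (d + f) ≡ (a * c - b * d) + (a * e - b * f)
      distˡ₁ = solve-∀
      distˡ₂ : ∀ a b c d e f → a * (d + f) + b * (c + e) - b * (d + f)
                             ≡ (a * d + b * c - b * d) + (a * f + b * e - b * f)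
      distˡ₂ = solve-∀
      distʳ₁ : ∀ a b c d e f → (c + e) * a - (d + f) * b ≡ (c * a - d * b) + (e * a - f * b)
      distʳ₁ = solve-∀
      distʳ₂ : ∀ a b c d e f → (c + e) * b + (d + f) * a - (d + f) * b
                             ≡ (c * b + d * a - d * b) + (e * b + f * a - f * b)
      distʳ₂ = solve-∀
      comm₁ : ∀ a b c d → a * c - b * d ≡ c * a - d * b
      comm₁ = solve-∀
      comm₂ : ∀ a b c d → a * d + b * c - b * d ≡ c * b + d * a - d * b
      comm₂ = solve-∀

  𝔼-commutativeRing : CommutativeRing 0ℓ 0ℓ
  𝔼-commutativeRing = record { isCommutativeRing = 𝔼-isCommutativeRing }

  module 𝔼ᵣ = CommutativeRing 𝔼-commutativeRing

  ⟪_⟫ : ℤ → 𝔼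
  ⟪ m ⟫ = m +ω + 0

  0𝔼 1𝔼 ζ ζ² √-3 : 𝔼
  0𝔼 = ⟪ + 0 ⟫
  1𝔼 = ⟪ + 1 ⟫
  ζ  = + 0 +ω + 1
  ζ² = -[1+ 0 ] +ω -[1+ 0 ]
  √-3 = + 1 +ω + 2

  opaque
    unfolding _⊕_

    conj-+ : ∀ x y → conj (x ⊕ y) ≡ conj x ⊕ conj y
    conj-+ (a +ω b) (c +ω d) = cong₂ _+ω_ (l a b c d) (ℤₚ.neg-distrib-+ b d)
      where
      l : ∀ a b c d → (a ℤ.+ c) ℤ.- (b ℤ.+ d) ≡ (a ℤ.- b) ℤ.+ (c ℤ.- d)
      l = solve-∀

    conj-* : ∀ x y → conj (x ⊗ y) ≡ conj x ⊗ conj y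
    conj-* (a +ω b) (c +ω d) = cong₂ _+ω_ (l₁ a b c d) (l₂ a b c d)
      where
      open import Data.Integer.Base using () renaming (_+_ to _⊞_; _*_ to _⊠_; _-_ to _⊟_; -_ to ⊟_)
      l₁ : ∀ a b c d → (a ⊠ c ⊟ b ⊠ d) ⊟ (a ⊠ d ⊞ b ⊠ c ⊟ b ⊠ d)
                     ≡ (a ⊟ b) ⊠ (c ⊟ d) ⊟ (⊟ b) ⊠ (⊟ d)
      l₁ = solve-∀
      l₂ : ∀ a b c d → ⊟ (a ⊠ d ⊞ b ⊠ c ⊟ b ⊠ d)
                     ≡ (a ⊟ b) ⊠ (⊟ d) ⊞ (⊟ b) ⊠ (c ⊟ d) ⊟ (⊟ b) ⊠ (⊟ d)
      l₂ = solve-∀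

    conj-neg : ∀ x → conj (⊖ x) ≡ ⊖ conj x
    conj-neg (a +ω b) = cong₂ _+ω_ (sym (ℤₚ.neg-distrib-+ a (ℤ.- b))) refl

    const-⊕ : ∀ x y → const (x ⊕ y) ≡ const x ℤ.+ const y
    const-⊕ x y = refl

    coω-⊕ : ∀ x y → coω (x ⊕ y) ≡ coω x ℤ.+ coω y
    coω-⊕ x y = refl

    ⊖-components : ∀ x → ⊖ x ≡ (ℤ.- const x) +ω (ℤ.- coω x)
    ⊖-components x = refl

    ⟪⟫-neg : ∀ m → ⟪ ℤ.- m ⟫ ≡ ⊖ ⟪ m ⟫
    ⟪⟫-neg m = refl

    ⟪⟫-* : ∀ m n → ⟪ m ℤ.* n ⟫ ≡ ⟪ m ⟫ ⊗ ⟪ n ⟫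
    ⟪⟫-* m n = cong₂ _+ω_ (l₁ m n) (l₂ m n)
      where
      l₁ : ∀ m n → m ℤ.* n ≡ m ℤ.* n ℤ.- + 0 ℤ.* + 0
      l₁ = solve-∀
      l₂ : ∀ m n → + 0 ≡ m ℤ.* + 0 ℤ.+ + 0 ℤ.* n ℤ.- + 0 ℤ.* + 0
      l₂ = solve-∀

    conj-⟪⟫ : ∀ m → conj ⟪ m ⟫ ≡ ⟪ m ⟫
    conj-⟪⟫ m = cong₂ _+ω_ (ℤₚ.+-identityʳ m) refl

    conj-conj : ∀ x → conj (conj x) ≡ x
    conj-conj (a +ω b) = cong₂ _+ω_ (l a b) (ℤₚ.neg-involutive b)
      where
      l : ∀ a b → (a ℤ.- b) ℤ.- (ℤ.- b) ≡ a
      l = solve-∀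

    conj-ζ : conj ζ ≡ ζ²
    conj-ζ = refl

    conj-ζ² : conj ζ² ≡ ζ
    conj-ζ² = refl

    ζ*ζ : ζ ⊗ ζ ≡ ζ²
    ζ*ζ = refl

    ζ²*ζ² : ζ² ⊗ ζ² ≡ ζ
    ζ²*ζ² = refl

    ζ*ζ² : ζ ⊗ ζ² ≡ 1𝔼
    ζ*ζ² = refl

    ζ²-ζ : ζ² ≡ ⊖ 1𝔼 ⊕ ⊖ ζ
    ζ²-ζ = refl

    ⟪⟫-+ : ∀ m n → ⟪ m ℤ.+ n ⟫ ≡ ⟪ m ⟫ ⊕ ⟪ n ⟫
    ⟪⟫-+ m n = refl

    ⟪⟫-*𝔼 : ∀ m x → ⟪ m ⟫ ⊗ x ≡ (m ℤ.* const x) +ω (m ℤ.* coω x)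
    ⟪⟫-*𝔼 m (a +ω b) = cong₂ _+ω_ (l₁ m a b) (l₂ m a b)
      where
      l₁ : ∀ m a b → m ℤ.* a ℤ.- + 0 ℤ.* b ≡ m ℤ.* a
      l₁ = solve-∀
      l₂ : ∀ m a b → m ℤ.* b ℤ.+ + 0 ℤ.* a ℤ.- + 0 ℤ.* b ≡ m ℤ.* b
      l₂ = solve-∀

    -- All divisions in `𝔼` are of this kind: by 3 in `eigen-1⇒0`, and later by 2 and by `q - 1`.
    ⟪⟫-cancelˡ : ∀ m x y → .{{ℤ.NonZero m}} → ⟪ m ⟫ ⊗ x ≡ ⟪ m ⟫ ⊗ y → x ≡ y
    ⟪⟫-cancelˡ m (a +ω b) (c +ω d) eq = cong₂ _+ω_ (ℤₚ.*-cancelˡ-≡ m a c (cong const eq′)) (ℤₚ.*-cancelˡ-≡ m b d (cong coω eq′))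
      where
      eq′ : (m ℤ.* a) +ω (m ℤ.* b) ≡ (m ℤ.* c) +ω (m ℤ.* d)
      eq′ = trans (sym (⟪⟫-*𝔼 m (a +ω b))) (trans eq (⟪⟫-*𝔼 m (c +ω d)))

    -- For x = a + b ω the hypothesis compares a - b with - a, so b = 2 a, and 1 + 2 ω = √-3.
    conj≡-⇒imaginary : ∀ x → conj x ≡ ⊖ x → x ≡ ⟪ const x ⟫ ⊗ √-3
    conj≡-⇒imaginary (a +ω b) eq = sym (trans (⟪⟫-*𝔼 a √-3) (cong₂ _+ω_ (ℤₚ.*-identityʳ a) (trans (l₁ a b) (trans (cong
        (λ t → t ℤ.+ a ℤ.+ b) (cong const eq)) (l₂ a b)))))
      where
      l₁ : ∀ a b → a ℤ.* + 2 ≡ (a ℤ.- b) ℤ.+ a ℤ.+ b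
      l₁ = solve-∀
      l₂ : ∀ a b → (ℤ.- a) ℤ.+ a ℤ.+ b ≡ b
      l₂ = solve-∀

  data IsCubeRoot : 𝔼 → Set where
    is1  : IsCubeRoot 1𝔼
    isζ  : IsCubeRoot ζ
    isζ² : IsCubeRoot ζ²

  private
    ℤ⟶𝔼 : CommutativeRing.rawRing ℤₚ.+-*-commutativeRing -Raw-AlmostCommutative⟶ fromCommutativeRing 𝔼-commutativeRing
    ℤ⟶𝔼 = record { ⟦_⟧ = ⟪_⟫ ; +-homo = ⟪⟫-+ ; *-homo = ⟪⟫-* ; -‿homo = ⟪⟫-neg ; 0-homo = refl ; 1-homo = refl }

  module 𝔼-Solver = Solver (CommutativeRing.rawRing ℤₚ.+-*-commutativeRing) (fromCommutativeRing 𝔼-commutativeRing)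
    ℤ⟶𝔼 (λ m n → Maybe.map (cong ⟪_⟫) (dec⇒maybe (m ℤₚ.≟ n)))

  module 𝔼-Solverᴱ where
    open 𝔼-Solver public using ()
      renaming (solve to solveᴱ; con to conᴱ; _:=_ to _:=ᴱ_; _:*_ to _:*ᴱ_; _:+_ to _:+ᴱ_; :-_ to :-ᴱ_)

-- Finite sums with values in ℤ[ω].

module FiniteSums where

  open EisensteinIntegers
  open 𝔼ᵣ using (_+_; _*_; 0#; 1#; +-identityʳ; +-identityˡ; *-identityˡ; *-identityʳ; zeroˡ; zeroʳ; distribʳ)
  open import Algebra.Bundles using (CommutativeRing)
  import Algebra.Properties.CommutativeMonoid.Sum as MonoidSum
  import Algebra.Properties.Semiring.Sum as SemiringSum
  open import Data.Fin.Base using (Fin; zero; suc)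
  open import Data.Fin.Properties using (_≟_; suc-injective)
  import Data.Fin.Permutation as Perm
  open import Data.Integer.Base as ℤ using (+_)
  open import Data.Nat.Base as ℕ using (ℕ)
  open import Data.Product.Base using (_×_)
  open import Function.Base using (_∘_)
  open import Relation.Binary.PropositionalEquality
  open import Relation.Nullary using (yes; no; contradiction)

  private
    module M = MonoidSum (CommutativeRing.+-commutativeMonoid 𝔼-commutativeRing)
    module S = SemiringSum (CommutativeRing.semiring 𝔼-commutativeRing)

  opaque
    ∑ : ∀ {m} → (Fin m → 𝔼) → 𝔼
    ∑ = M.sum

    ∑-zero : (f : Fin 0 → 𝔼) → ∑ f ≡ 0#
    ∑-zero f = refl

    ∑-suc : ∀ {m} (f : Fin (ℕ.suc m) → 𝔼) → ∑ f ≡ f zero + ∑ (f ∘ suc)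
    ∑-suc f = refl

    ∑-cong : ∀ {m} {f g : Fin m → 𝔼} → (∀ i → f i ≡ g i) → ∑ f ≡ ∑ g
    ∑-cong = M.sum-cong-≗

    ∑-+ : ∀ {m} (f g : Fin m → 𝔼) → ∑ (λ i → f i + g i) ≡ ∑ f + ∑ g
    ∑-+ = M.∑-distrib-+

    ∑-*ˡ : ∀ {m} x (f : Fin m → 𝔼) → ∑ (λ i → x * f i) ≡ x * ∑ f
    ∑-*ˡ x f = sym (S.*-distribˡ-sum x f)

    ∑-*ʳ : ∀ {m} x (f : Fin m → 𝔼) → ∑ (λ i → f i * x) ≡ ∑ f * x
    ∑-*ʳ x f = sym (S.*-distribʳ-sum x f)

    ∑-swap : ∀ {m n} (f : Fin m → Fin n → 𝔼) → ∑ (λ i → ∑ (f i)) ≡ ∑ (λ j → ∑ (λ i → f i j))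
    ∑-swap = M.∑-comm

    ∑-0 : ∀ {m} {f : Fin m → 𝔼} → (∀ i → f i ≡ 0#) → ∑ f ≡ 0#
    ∑-0 {m} eq = trans (∑-cong eq) (M.sum-replicate-zero m)

    ∑-const : ∀ m x → ∑ {m} (λ _ → x) ≡ ⟪ + m ⟫ * x
    ∑-const ℕ.zero    x = sym (zeroˡ x)
    ∑-const (ℕ.suc m) x = sym (trans (cong (_* x) (⟪⟫-+ (+ 1) (+ m))) (trans (distribʳ x 1# ⟪ + m ⟫) (cong₂ _+_
        (*-identityˡ x) (sym (∑-const m x)))))

    ∑-reindex : ∀ {m} (f : Fin m → 𝔼) (to from : Fin m → Fin m) →
                (∀ i → to (from i) ≡ i) → (∀ i → from (to i) ≡ i) → ∑ (f ∘ to) ≡ ∑ f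
    ∑-reindex f to from to-from from-to = sym (M.∑-permute f (Perm.permutation to from to-from from-to))

    conj-∑ : ∀ {m} (f : Fin m → 𝔼) → conj (∑ f) ≡ ∑ (conj ∘ f)
    conj-∑ {ℕ.zero}  f = conj-⟪⟫ (+ 0)
    conj-∑ {ℕ.suc m} f = trans (conj-+ (f zero) (∑ (f ∘ suc))) (cong₂ _+_ refl (conj-∑ (f ∘ suc)))

  opaque
    δ : ∀ {m} → Fin m → Fin m → 𝔼
    δ i j with i ≟ j
    ... | yes _ = 1#
    ... | no  _ = 0#

    δ-≡ : ∀ {m} {i j : Fin m} → i ≡ j → δ i j ≡ 1#
    δ-≡ {i = i} {j} eq with i ≟ j
    ... | yes _  = refl
    ... | no neq = contradiction eq neq

    δ-≢ : ∀ {m} {i j : Fin m} → i ≢ j → δ i j ≡ 0#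
    δ-≢ {i = i} {j} neq with i ≟ j
    ... | yes eq = contradiction eq neq
    ... | no _   = refl

    δ-⇔ : ∀ {m n} {i j : Fin m} {k l : Fin n} → (i ≡ j → k ≡ l) → (k ≡ l → i ≡ j) → δ i j ≡ δ k l
    δ-⇔ {i = i} {j} f g with i ≟ j
    ... | yes eq = sym (δ-≡ (f eq))
    ... | no neq = sym (δ-≢ (neq ∘ g))

  ∑-δ : ∀ {m} (i : Fin m) (f : Fin m → 𝔼) → ∑ (λ j → δ i j * f j) ≡ f i
  ∑-δ zero f = trans (∑-suc _) (trans (cong₂ _+_ (trans (cong (_* f zero) (δ-≡ refl)) (*-identityˡ (f zero)))
      (∑-0 (λ i → trans (cong (_* f (suc i)) (δ-≢ λ ())) (zeroˡ (f (suc i)))))) (+-identityʳ (f zero)))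
  ∑-δ (suc i) f = trans (∑-suc _) (trans (cong₂ _+_ (trans (cong (_* f zero) (δ-≢ λ ())) (zeroˡ (f zero)))
      (trans (∑-cong (λ j → cong (_* f (suc j)) (δ-⇔ {i = suc i} {j = suc j} suc-injective (cong suc)))) (∑-δ i (f ∘ suc))))
    (+-identityˡ (f (suc i))))

  ∑-δ1 : ∀ {m} (i : Fin m) → ∑ (δ i) ≡ 1#
  ∑-δ1 i = trans (∑-cong (λ j → sym (*-identityʳ (δ i j)))) (∑-δ i (λ _ → 1#))

  δ-* : ∀ {m} {i j : Fin m} {x y : 𝔼} → (i ≡ j → x ≡ y) → δ i j * x ≡ δ i j * y
  δ-* {i = i} {j} {x} {y} eq with i ≟ j
  ... | yes p = cong (δ i j *_) (eq p)
  ... | no ¬p = trans (trans (cong (_* x) (δ-≢ ¬p)) (zeroˡ x)) (sym (trans (cong (_* y) (δ-≢ ¬p)) (zeroˡ y)))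

  -- Change of variables along a map that need not be injective: each value is weighted with the
  -- size of its fibre, written as a sum of deltas. It is applied to squaring, in `K` and in `F`.
  ∑-fibre : ∀ {m n} (φ : Fin m → Fin n) (f : Fin n → 𝔼) →
            ∑ (f ∘ φ) ≡ ∑ (λ j → ∑ (λ i → δ (φ i) j) * f j)
  ∑-fibre φ f = trans (∑-cong (λ i → sym (∑-δ (φ i) f)))
    (trans (∑-swap (λ i j → δ (φ i) j * f j)) (∑-cong (λ j → ∑-*ʳ (f j) (λ i → δ (φ i) j))))

  -- The number of pairs over `j` is the double sum of `δ (fst j) a * δ (snd j) b`, which factors
  -- into 1 times 1. This will split a sum over `F` into sums over two coordinates in `K`.
  ∑-reindex₂ : ∀ {m n} (f : Fin n → 𝔼) (pair : Fin m → Fin m → Fin n) (fst snd : Fin n → Fin m) →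
               (∀ i → pair (fst i) (snd i) ≡ i) →
               (∀ a b → fst (pair a b) ≡ a) → (∀ a b → snd (pair a b) ≡ b) →
               ∑ f ≡ ∑ (λ a → ∑ (λ b → f (pair a b)))
  ∑-reindex₂ {m} {n} f pair fst snd surj fst-pair snd-pair = sym (trans
    (∑-cong (λ a → ∑-fibre (pair a) f))
    (trans (∑-swap (λ a j → ∑ (λ b → δ (pair a b) j) * f j))
    (∑-cong (λ j → trans (∑-*ʳ (f j) (λ a → ∑ (λ b → δ (pair a b) j)))
      (trans (cong (_* f j) (trans (∑-cong (λ a → trans (∑-cong (split j a)) (∑-*ˡ (δ (fst j) a) (δ (snd j)))))
                            (trans (∑-δ (fst j) (λ _ → ∑ (δ (snd j)))) (∑-δ1 (snd j)))))
             (*-identityˡ (f j)))))))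
    where
    split : ∀ j a b → δ (pair a b) j ≡ δ (fst j) a * δ (snd j) b
    split j a b with fst j ≟ a | snd j ≟ b
    ... | yes p | yes r = trans (δ-≡ (trans (cong₂ pair (sym p) (sym r)) (surj j)))
      (sym (trans (cong₂ _*_ (δ-≡ p) (δ-≡ r)) (*-identityˡ 1#)))
    ... | yes p | no ¬r = trans (δ-≢ (λ eq → ¬r (trans (cong snd (sym eq)) (snd-pair a b))))
      (sym (trans (cong (δ (fst j) a *_) (δ-≢ ¬r)) (zeroʳ _)))
    ... | no ¬p | _     = trans (δ-≢ (λ eq → ¬p (trans (cong fst (sym eq)) (fst-pair a b))))
      (sym (trans (cong (_* δ (snd j) b) (δ-≢ ¬p)) (zeroˡ _)))

-- Fields of characteristic 3 on the set Fin q.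

module TernaryFields where

  open import Algebra.Bundles using (CommutativeRing; RawRing)
  open import Algebra.Structures using (IsCommutativeRing)
  import Algebra.Properties.CommutativeSemiring.Exp as Exp
  import Algebra.Properties.Ring as RingProperties
  open import Algebra.Solver.Ring.AlmostCommutativeRing using (fromCommutativeRing; _-Raw-AlmostCommutative⟶_)
  import Algebra.Solver.Ring as Solver
  open import Data.Fin.Base using (Fin)
  open import Data.Fin.Patterns using (0F; 1F; 2F)
  open import Data.Fin.Properties using () renaming (_≟_ to _≟F_)
  open import Data.Maybe.Base using (Maybe; just; nothing)
  open import Data.Nat.Base as ℕ using (ℕ; zero; suc)
  import Data.Nat.Properties as ℕₚ
  open import Data.Product.Base using (∃; _,_; proj₁; proj₂)
  open import Data.Sum.Base using (_⊎_; inj₁; inj₂)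
  open import Level using (0ℓ)
  open import Relation.Binary.PropositionalEquality
  open import Relation.Nullary using (yes; no; contradiction)

  -- Taking Fin q itself as carrier makes equality propositional, so that no congruence proofs are needed.
  record Field₃ (q : ℕ) : Set where
    infixl 6 _+_
    infixl 7 _*_
    infix  8 -_
    field
      _+_ _*_ : Fin q → Fin q → Fin q
      -_      : Fin q → Fin q
      0# 1#   : Fin q
      isCommutativeRing : IsCommutativeRing _≡_ _+_ _*_ -_ 0# 1#
      0≢1     : 0# ≢ 1#
      inverse : ∀ x → x ≢ 0# → ∃ λ y → x * y ≡ 1#
      1+1+1   : 1# + (1# + 1#) ≡ 0#

    commutativeRing : CommutativeRing 0ℓ 0ℓ
    commutativeRing = record { isCommutativeRing = isCommutativeRing }

    open CommutativeRing commutativeRing public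
      using (_-_; +-identityˡ; +-identityʳ; +-assoc; +-comm; *-comm; *-assoc;
           *-identityˡ; *-identityʳ; zeroˡ; zeroʳ; distribˡ; distribʳ; -‿inverseʳ; -‿inverseˡ; semiring; ring)
    open Exp (CommutativeRing.commutativeSemiring commutativeRing) public
      using (_^_; ^-homo-*; ^-assocʳ; ^-distrib-*)
    private module RP = RingProperties ring

    private
      F₃ : RawRing 0ℓ 0ℓ
      F₃ = record { Carrier = Fin 3 ; _≈_ = _≡_ ; _+_ = plus ; _*_ = times ; -_ = neg ; 0# = 0F ; 1# = 1F }
        where
        plus times : Fin 3 → Fin 3 → Fin 3
        plus 0F x = x
        plus x 0F = x
        plus 1F 1F = 2F
        plus 1F 2F = 0F
        plus 2F 1F = 0F
        plus 2F 2F = 1F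
        times 0F x = 0F
        times 1F x = x
        times 2F 0F = 0F
        times 2F 1F = 2F
        times 2F 2F = 1F
        neg : Fin 3 → Fin 3
        neg 0F = 0F
        neg 1F = 2F
        neg 2F = 1F

      image : Fin 3 → Fin q
      image 0F = 0#
      image 1F = 1#
      image 2F = - 1#

      1+1 : 1# + 1# ≡ - 1#
      1+1 = trans (sym (+-identityˡ _)) (trans (cong (_+ (1# + 1#)) (sym (-‿inverseˡ 1#)))
        (trans (+-assoc (- 1#) 1# (1# + 1#)) (trans (cong (- 1# +_) 1+1+1) (+-identityʳ (- 1#)))))

      -1-1 : - 1# + - 1# ≡ 1#
      -1-1 = trans (RP.-‿+-comm 1# 1#) (trans (cong -_ 1+1) (RP.-‿involutive 1#))

      morphism : F₃ -Raw-AlmostCommutative⟶ fromCommutativeRing commutativeRing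
      morphism = record { ⟦_⟧ = image ; +-homo = +-homo ; *-homo = *-homo ; -‿homo = neg-homo ; 0-homo = refl ; 1-homo = refl }
        where
        module F₃ = RawRing F₃
        +-homo : ∀ i j → image (i F₃.+ j) ≡ image i + image j
        +-homo 0F j = sym (+-identityˡ _)
        +-homo 1F 0F = sym (+-identityʳ _)
        +-homo 1F 1F = sym 1+1
        +-homo 1F 2F = sym (-‿inverseʳ 1#)
        +-homo 2F 0F = sym (+-identityʳ _)
        +-homo 2F 1F = sym (-‿inverseˡ 1#)
        +-homo 2F 2F = sym -1-1
        *-homo : ∀ i j → image (i F₃.* j) ≡ image i * image j
        *-homo 0F j = sym (zeroˡ _)
        *-homo 1F j = sym (*-identityˡ _)
        *-homo 2F 0F = sym (zeroʳ _)
        *-homo 2F 1F = sym (*-identityʳ _)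
        *-homo 2F 2F = sym (trans (sym (RP.-‿distribˡ-* 1# (- 1#))) (trans (cong -_ (*-identityˡ (- 1#))) (RP.-‿involutive 1#)))
        neg-homo : ∀ i → image (F₃.- i) ≡ - image i
        neg-homo 0F = sym RP.-0#≈0#
        neg-homo 1F = refl
        neg-homo 2F = sym (RP.-‿involutive 1#)

      F₃-equal : ∀ i j → Maybe (image i ≡ image j)
      F₃-equal i j with i ≟F j
      ... | yes eq = just (cong image eq)
      ... | no _   = nothing

    -- With coefficients in the prime field, identities peculiar to characteristic 3, such as
    -- additivity of the cube or 2 = - 1, become polynomial identities.
    module Solver₃ = Solver F₃ (fromCommutativeRing commutativeRing) morphism F₃-equal
    open Solver₃

    *-cancelˡ : ∀ x {y z} → x ≢ 0# → x * y ≡ x * z → y ≡ z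
    *-cancelˡ x {y} {z} x≢0 eq with inverse x x≢0
    ... | x⁻¹ , xx⁻¹≡1 = trans (sym (lemma y)) (trans (cong (x⁻¹ *_) eq) (lemma z))
      where
      lemma : ∀ y → x⁻¹ * (x * y) ≡ y
      lemma y = trans (sym (*-assoc x⁻¹ x y)) (trans (cong (_* y) (trans (*-comm x⁻¹ x) xx⁻¹≡1)) (*-identityˡ y))

    no-zero-divisors : ∀ x y → x * y ≡ 0# → x ≡ 0# ⊎ y ≡ 0#
    no-zero-divisors x y xy≡0 with x ≟F 0#
    ... | yes x≡0 = inj₁ x≡0
    ... | no  x≢0 = inj₂ (*-cancelˡ x x≢0 (trans xy≡0 (sym (zeroʳ x))))

    *-≢0 : ∀ {x y} → x ≢ 0# → y ≢ 0# → x * y ≢ 0#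
    *-≢0 {x} {y} x≢0 y≢0 xy≡0 with no-zero-divisors x y xy≡0
    ... | inj₁ x≡0 = x≢0 x≡0
    ... | inj₂ y≡0 = y≢0 y≡0

    ^-≢0 : ∀ {x} n → x ≢ 0# → x ^ n ≢ 0#
    ^-≢0 zero    x≢0 eq = 0≢1 (sym eq)
    ^-≢0 (suc n) x≢0 = *-≢0 x≢0 (^-≢0 n x≢0)

    opaque
      -- 0 ⁻¹ = 0
      _⁻¹ : Fin q → Fin q
      x ⁻¹ with x ≟F 0#
      ... | yes _  = 0#
      ... | no x≢0 = proj₁ (inverse x x≢0)

      *-inverse : ∀ {x} → x ≢ 0# → x * x ⁻¹ ≡ 1#
      *-inverse {x} x≢0 with x ≟F 0#
      ... | yes x≡0 = contradiction x≡0 x≢0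
      ... | no x≢0  = proj₂ (inverse x x≢0)

      0⁻¹ : 0# ⁻¹ ≡ 0#
      0⁻¹ with 0# ≟F 0#
      ... | yes _ = refl
      ... | no ¬p = contradiction refl ¬p

    ⁻¹-≢0 : ∀ {x} → x ≢ 0# → x ⁻¹ ≢ 0#
    ⁻¹-≢0 {x} x≢0 eq = 0≢1 (trans (sym (trans (cong (x *_) eq) (zeroʳ x))) (*-inverse x≢0))

    ⁻¹-unique : ∀ {x y} → x * y ≡ 1# → x ⁻¹ ≡ y
    ⁻¹-unique {x} {y} eq = *-cancelˡ x x≢0 (trans (*-inverse x≢0) (sym eq))
      where
      x≢0 : x ≢ 0#
      x≢0 x≡0 = 0≢1 (trans (sym (trans (cong (_* y) x≡0) (zeroˡ y))) eq)

    ⁻¹-involutive : ∀ x → (x ⁻¹) ⁻¹ ≡ x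
    ⁻¹-involutive x with x ≟F 0#
    ... | yes refl = trans (cong _⁻¹ 0⁻¹) 0⁻¹
    ... | no x≢0 = ⁻¹-unique (trans (*-comm _ x) (*-inverse x≢0))

    ⁻¹-* : ∀ x y → (x * y) ⁻¹ ≡ x ⁻¹ * y ⁻¹
    ⁻¹-* x y with x ≟F 0# | y ≟F 0#
    ... | yes refl | _ = trans (cong _⁻¹ (zeroˡ y)) (trans 0⁻¹ (sym (trans (cong (_* y ⁻¹) 0⁻¹) (zeroˡ (y ⁻¹)))))
    ... | no _ | yes refl = trans (cong _⁻¹ (zeroʳ x)) (trans 0⁻¹ (sym (trans (cong (x ⁻¹ *_) 0⁻¹) (zeroʳ (x ⁻¹)))))
    ... | no x≢0 | no y≢0 = ⁻¹-unique (trans (solve 4 (λ x y i j → x :* y :* (i :* j) := (x :* i) :* (y :* j)) refl x y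
        (x ⁻¹) (y ⁻¹))
      (trans (cong₂ _*_ (*-inverse x≢0) (*-inverse y≢0)) (*-identityˡ 1#)))

    ⁻¹-neg : ∀ {x} → x ≢ 0# → (- x) ⁻¹ ≡ - (x ⁻¹)
    ⁻¹-neg {x} x≢0 = ⁻¹-unique (trans (solve 2 (λ x i → (:- x) :* (:- i) := x :* i) refl x (x ⁻¹)) (*-inverse x≢0))

    -1≢1 : - 1# ≢ 1#
    -1≢1 eq = 0≢1 (trans (sym (-‿inverseˡ 1#)) (trans (cong (_+ 1#) eq) (trans 1+1 eq)))

    -≢0 : ∀ {x} → x ≢ 0# → - x ≢ 0#
    -≢0 {x} x≢0 eq = x≢0 (trans (solve 1 (λ x → x := :- (:- x)) refl x) (trans (cong -_ eq) (solve 0 (:- con 0F := con 0F) refl)))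

    x≡-x⇒x≡0 : ∀ {x} → x ≡ - x → x ≡ 0#
    x≡-x⇒x≡0 {x} eq = trans (solve 1 (λ x → x := :- x :- x) refl x) (trans (cong (_- x) (sym eq)) (-‿inverseʳ x))

    ≢0⇒≢- : ∀ {x} → x ≢ 0# → x ≢ - x
    ≢0⇒≢- x≢0 eq = x≢0 (x≡-x⇒x≡0 eq)

    x-y≡0⇒x≡y : ∀ {x y} → x - y ≡ 0# → x ≡ y
    x-y≡0⇒x≡y {x} {y} eq = trans (solve 2 (λ x y → x := (x :- y) :+ y) refl x y) (trans (cong (_+ y) eq) (+-identityˡ y))

    x²≡y²⇒x≡±y : ∀ {x y} → x * x ≡ y * y → x ≡ y ⊎ x ≡ - y
    x²≡y²⇒x≡±y {x} {y} eq with no-zero-divisors (x - y) (x + y)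
      (trans (solve 2 (λ x y → (x :- y) :* (x :+ y) := x :* x :- y :* y) refl x y) (trans (cong (_- y * y) eq) (-‿inverseʳ
          (y * y))))
    ... | inj₁ p = inj₁ (x-y≡0⇒x≡y p)
    ... | inj₂ p = inj₂ (trans (solve 2 (λ x y → x := (x :+ y) :- y) refl x y) (trans (cong (_- y) p) (+-identityˡ (- y))))

    1^ : ∀ n → 1# ^ n ≡ 1#
    1^ zero    = refl
    1^ (suc n) = trans (*-identityˡ _) (1^ n)

    0^suc : ∀ n → 0# ^ suc n ≡ 0#
    0^suc n = zeroˡ _

    ^3-+ : ∀ x y → (x + y) ^ 3 ≡ x ^ 3 + y ^ 3
    ^3-+ = solve 2 (λ x y → (x :+ y) :^ 3 := x :^ 3 :+ y :^ 3) refl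

    frobenius-+ : ∀ m x y → (x + y) ^ (3 ℕ.^ m) ≡ x ^ (3 ℕ.^ m) + y ^ (3 ℕ.^ m)
    frobenius-+ zero    x y = solve 2 (λ x y → (x :+ y) :^ 1 := x :^ 1 :+ y :^ 1) refl x y
    frobenius-+ (suc m) x y = trans (step (x + y)) (trans (cong (_^ 3) (frobenius-+ m x y))
      (trans (^3-+ _ _) (sym (cong₂ _+_ (step x) (step y)))))
      where
      step : ∀ x → x ^ (3 ℕ.^ suc m) ≡ (x ^ (3 ℕ.^ m)) ^ 3
      step x = trans (cong (x ^_) (ℕₚ.*-comm 3 (3 ℕ.^ m))) (sym (^-assocʳ x (3 ℕ.^ m) 3))

-- Additive characters and orthogonality.

module AdditiveCharacters where

  open EisensteinIntegers
  open FiniteSums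
  open TernaryFields
  open import Data.Fin.Base using (Fin)
  open import Data.Fin.Properties using () renaming (_≟_ to _≟F_)
  open import Data.Integer.Base as ℤ using (+_)
  open import Data.Product.Base using (_,_)
  open import Data.Sum.Base as Sum using (_⊎_; inj₁; inj₂)
  open import Function.Base using (_∘_)
  open import Relation.Binary.PropositionalEquality
  open import Relation.Nullary using (yes; no; contradiction)
  open ≡-Reasoning

  cube-root-1? : ∀ {x} → IsCubeRoot x → x ≡ 1𝔼 ⊎ x ≢ 1𝔼
  cube-root-1? is1  = inj₁ refl
  cube-root-1? isζ  = inj₂ λ ()
  cube-root-1? isζ² = inj₂ λ ()

  cube-root-* : ∀ {x} → IsCubeRoot x → x ⊗ x ≡ conj x
  cube-root-* is1  = trans (𝔼ᵣ.*-identityˡ 1𝔼) (sym (conj-⟪⟫ (+ 1)))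
  cube-root-* isζ  = trans ζ*ζ (sym conj-ζ)
  cube-root-* isζ² = trans ζ²*ζ² (sym conj-ζ²)

  cube-root-conj : ∀ {x} → IsCubeRoot x → x ⊗ conj x ≡ 1𝔼
  cube-root-conj is1  = trans (𝔼ᵣ.*-identityˡ _) (conj-⟪⟫ (+ 1))
  cube-root-conj isζ  = trans (cong (ζ ⊗_) conj-ζ) ζ*ζ²
  cube-root-conj isζ² = trans (cong (ζ² ⊗_) conj-ζ²) (trans (𝔼ᵣ.*-comm ζ² ζ) ζ*ζ²)

  -- Instead of dividing by x - 1: if ζ s = s, then also ζ² s = s, and 3 s = (1 + ζ + ζ²) s = 0.
  eigen-1⇒0 : ∀ {x s} → IsCubeRoot x → x ≢ 1𝔼 → x ⊗ s ≡ s → s ≡ 0𝔼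
  eigen-1⇒0 is1 x≢1 _ = contradiction refl x≢1
  eigen-1⇒0 {s = s} isζ _ eq = ⟪⟫-cancelˡ (+ 3) s 0𝔼 (begin
    ⟪ + 3 ⟫ ⊗ s ≡⟨ solve 1 (λ s → con (+ 3) :* s := s :+ (s :+ s)) refl s ⟩
    s ⊕ (s ⊕ s) ≡⟨ cong (s ⊕_) (cong₂ _⊕_ (sym eq) (trans (sym eq) (trans (cong (ζ ⊗_) (sym eq)) (trans (sym
        (𝔼ᵣ.*-assoc ζ ζ s)) (cong (_⊗ s) ζ*ζ))))) ⟩
    s ⊕ (ζ ⊗ s ⊕ ζ² ⊗ s) ≡⟨ cong (λ t → s ⊕ (ζ ⊗ s ⊕ t ⊗ s)) ζ²-ζ ⟩
    s ⊕ (ζ ⊗ s ⊕ (⊖ 1𝔼 ⊕ ⊖ ζ) ⊗ s) ≡⟨ solve 2 (λ z s → s :+ (z :* s :+ (:- con (+ 1) :+ :- z) :* s) := con (+ 3) :* con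
        (+ 0)) refl ζ s ⟩
    ⟪ + 3 ⟫ ⊗ 0𝔼 ∎)
    where open 𝔼-Solver
  eigen-1⇒0 {s = s} isζ² _ eq = eigen-1⇒0 isζ (λ ()) (begin
    ζ ⊗ s ≡⟨ cong (_⊗ s) ζ²*ζ² ⟨
    ζ² ⊗ ζ² ⊗ s ≡⟨ 𝔼ᵣ.*-assoc ζ² ζ² s ⟩
    ζ² ⊗ (ζ² ⊗ s) ≡⟨ cong (ζ² ⊗_) eq ⟩
    ζ² ⊗ s ≡⟨ eq ⟩
    s ∎)

  module FieldSums {q} (K : Field₃ q) where
    open Field₃ K

    ∑-scale : ∀ {c} (f : Fin q → 𝔼) → c ≢ 0# → ∑ (λ x → f (c * x)) ≡ ∑ f
    ∑-scale {c} f c≢0 = ∑-reindex f (c *_) (c ⁻¹ *_)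
      (λ x → trans (sym (*-assoc c (c ⁻¹) x)) (trans (cong (_* x) (*-inverse c≢0)) (*-identityˡ x)))
      (λ x → trans (sym (*-assoc (c ⁻¹) c x)) (trans (cong (_* x) (trans (*-comm (c ⁻¹) c) (*-inverse c≢0))) (*-identityˡ x)))

    ∑-shift : ∀ c (f : Fin q → 𝔼) → ∑ (λ x → f (x + c)) ≡ ∑ f
    ∑-shift c f = ∑-reindex f (_+ c) (_- c)
      (λ x → solve 2 (λ x c → (x :- c) :+ c := x) refl x c) (λ x → solve 2 (λ x c → (x :+ c) :- c := x) refl x c)
      where open Solver₃

    ∑-character : (φ : Fin q → 𝔼) → (∀ x y → φ (x + y) ≡ φ x ⊗ φ y) → ∀ {t} → IsCubeRoot (φ t) → φ t ≢ 1𝔼 → ∑ φ ≡ 0𝔼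
    ∑-character φ φ-+ {t} root φt≢1 = eigen-1⇒0 root φt≢1 (begin
      φ t ⊗ ∑ φ              ≡⟨ ∑-*ˡ (φ t) φ ⟨
      ∑ (λ x → φ t ⊗ φ x)    ≡⟨ ∑-cong (λ x → trans (φ-+ x t) (𝔼ᵣ.*-comm (φ x) (φ t))) ⟨
      ∑ (λ x → φ (x + t))    ≡⟨ ∑-shift t φ ⟩
      ∑ φ                    ∎)

    δ-square : ∀ w {y} → y ≢ 0# → δ (w * w) (y * y) ≡ δ y w ⊕ δ (- y) w
    δ-square w {y} y≢0 with w ≟F y | w ≟F - y
    ... | yes w≡y | yes w≡-y = contradiction (trans (sym w≡y) w≡-y) (≢0⇒≢- y≢0)
    ... | yes w≡y | no w≢-y  = trans (δ-≡ (cong₂ _*_ w≡y w≡y))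
      (sym (trans (cong₂ _⊕_ (δ-≡ (sym w≡y)) (δ-≢ (w≢-y ∘ sym))) (𝔼ᵣ.+-identityʳ 1𝔼)))
    ... | no w≢y  | yes w≡-y = trans (δ-≡ (trans (cong₂ _*_ w≡-y w≡-y) (solve 1 (λ y → (:- y) :* (:- y) := y :* y) refl y)))
      (sym (trans (cong₂ _⊕_ (δ-≢ (w≢y ∘ sym)) (δ-≡ (sym w≡-y))) (𝔼ᵣ.+-identityˡ 1𝔼)))
      where open Solver₃
    ... | no w≢y  | no w≢-y  = trans (δ-≢ λ eq → Sum.[ w≢y , w≢-y ] (x²≡y²⇒x≡±y eq))
      (sym (trans (cong₂ _⊕_ (δ-≢ (w≢y ∘ sym)) (δ-≢ (w≢-y ∘ sym))) (𝔼ᵣ.+-identityˡ 0𝔼)))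

    ∑-square-roots : ∀ {y} → y ≢ 0# → ∑ (λ w → δ (w * w) (y * y)) ≡ 1𝔼 ⊕ 1𝔼
    ∑-square-roots {y} y≢0 = trans (∑-cong (λ w → δ-square w y≢0))
      (trans (∑-+ (δ y) (δ (- y))) (cong₂ _⊕_ (∑-δ1 y) (∑-δ1 (- y))))

  -- Invariance under cubing singles out x ↦ ω^(± Tr x) among the nontrivial additive characters. It
  -- gives ψ(x³ - x) = 1 and allows cubing part of an argument, which is what turns r⁴ into a
  -- quadratic form.
  record Character {q} (K : Field₃ q) : Set where
    open Field₃ K
    field
      ψ       : Fin q → 𝔼
      ψ-+     : ∀ x y → ψ (x + y) ≡ ψ x ⊗ ψ y
      ψ-root  : ∀ x → IsCubeRoot (ψ x)
      ψ-^3    : ∀ x → ψ (x ^ 3) ≡ ψ x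
      t₀      : Fin q
      ψt₀≢1   : ψ t₀ ≢ 1𝔼

    ψ-neg : ∀ x → ψ (- x) ≡ conj (ψ x)
    ψ-neg x = trans (cong ψ (solve 1 (λ x → :- x := x :+ x) refl x)) (trans (ψ-+ x x) (cube-root-* (ψ-root x)))
      where open Solver₃

    ψ-0 : ψ 0# ≡ 1𝔼
    ψ-0 = trans (cong ψ (sym (-‿inverseʳ 0#))) (trans (ψ-+ 0# (- 0#)) (trans (cong (ψ 0# ⊗_) (ψ-neg 0#)) (cube-root-conj
        (ψ-root 0#))))

    open FieldSums K

    ∑ψ : ∀ c → ∑ (λ y → ψ (c * y)) ≡ ⟪ + q ⟫ ⊗ δ 0# c
    ∑ψ c with 0# ≟F c
    ... | yes 0≡c = trans (∑-cong (λ y → trans (cong ψ (trans (cong (_* y) (sym 0≡c)) (zeroˡ y))) ψ-0)) (trans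
        (∑-const q 1𝔼) (cong (⟪ + q ⟫ ⊗_) (sym (δ-≡ 0≡c))))
    ... | no 0≢c = trans (trans (∑-scale ψ (0≢c ∘ sym)) (∑-character ψ ψ-+ (ψ-root t₀) ψt₀≢1)) (sym (trans (cong
        (⟪ + q ⟫ ⊗_) (δ-≢ 0≢c)) (𝔼ᵣ.zeroʳ ⟪ + q ⟫)))

-- The quadratic character and quadratic Gauss sums of K.

module GaussSumsOverK where

  open EisensteinIntegers
  open FiniteSums
  open TernaryFields
  open AdditiveCharacters
  open import Data.Fin.Base using (Fin)
  open import Data.Fin.Patterns using (0F; 1F; 2F)
  open import Data.Fin.Properties using () renaming (_≟_ to _≟F_)
  open import Data.Integer.Base as ℤ using (+_)
  open import Data.Nat.Base as ℕ using (ℕ; zero; suc)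
  open import Data.Nat.Solver using (module +-*-Solver)
  open import Data.Sum.Base as Sum using (inj₁; inj₂)
  open import Function.Base using (_∘_)
  open import Relation.Binary.PropositionalEquality
  open import Relation.Nullary using (yes; no; contradiction)
  open ≡-Reasoning

  module QuadraticCharacter {q} (K : Field₃ q) (h : ℕ)
    (fermat : ∀ x → Field₃._^_ K x (3 ℕ.+ 4 ℕ.* h) ≡ x) where
    open Field₃ K
    open FieldSums K

    private
      r : ℕ
      r = 1 ℕ.+ 2 ℕ.* h

    x^r²≡1 : ∀ {x} → x ≢ 0# → x ^ r * x ^ r ≡ 1#
    x^r²≡1 {x} x≢0 = *-cancelˡ x x≢0 (begin
      x * (x ^ r * x ^ r)     ≡⟨ cong (x *_) (^-homo-* x r r) ⟨
      x ^ (1 ℕ.+ (r ℕ.+ r))   ≡⟨ cong (x ^_) (solve 1 (λ h → con 1 :+ ((con 1 :+ con 2 :* h) :+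
          (con 1 :+ con 2 :* h)) := con 3 :+ con 4 :* h) refl h) ⟩
      x ^ (3 ℕ.+ 4 ℕ.* h)     ≡⟨ fermat x ⟩
      x                       ≡⟨ *-identityʳ x ⟨
      x * 1#                  ∎)
      where open +-*-Solver

    -- As q = 3 + 4 h, the exponent (q + 1) / 4 = h + 1 is an integer, and (x^(h + 1))² = x · x^r
    -- because 2 (h + 1) = r + 1.
    x^r≡1⇒square : ∀ {x} → x ^ r ≡ 1# → x ≡ x ^ suc h * x ^ suc h
    x^r≡1⇒square {x} eq = begin
      x                       ≡⟨ *-identityʳ x ⟨
      x * 1#                  ≡⟨ cong (x *_) eq ⟨
      x ^ suc r               ≡⟨ cong (x ^_) (solve 1 (λ h → con 1 :+ (con 1 :+ con 2 :* h) := (con 1 :+ h) :+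
          (con 1 :+ h)) refl h) ⟩
      x ^ (suc h ℕ.+ suc h)   ≡⟨ ^-homo-* x (suc h) (suc h) ⟩
      x ^ suc h * x ^ suc h   ∎
      where open +-*-Solver

    [-x]^odd : ∀ x m → (- x) ^ (1 ℕ.+ 2 ℕ.* m) ≡ - (x ^ (1 ℕ.+ 2 ℕ.* m))
    [-x]^odd x m = begin
      - x * (- x) ^ (2 ℕ.* m)      ≡⟨ cong (- x *_) (^-assocʳ (- x) 2 m) ⟨
      - x * ((- x) ^ 2) ^ m        ≡⟨ cong (λ t → - x * t ^ m) (solve 1 (λ x → (:- x) :^ 2 := x :^ 2) refl x) ⟩
      - x * (x ^ 2) ^ m            ≡⟨ cong (- x *_) (^-assocʳ x 2 m) ⟩
      - x * x ^ (2 ℕ.* m)          ≡⟨ solve 2 (λ x y → :- x :* y := :- (x :* y)) refl x _ ⟩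
      - (x * x ^ (2 ℕ.* m))        ∎
      where open Solver₃

    data Sign : Fin q → Set where
      zero : Sign 0#
      one  : Sign 1#
      -one : Sign (- 1#)

    sign : ∀ x → Sign (x ^ r)
    sign x with x ≟F 0#
    ... | yes refl = subst Sign (sym (0^suc (2 ℕ.* h))) zero
    ... | no x≢0 with x²≡y²⇒x≡±y (trans (x^r²≡1 x≢0) (sym (*-identityˡ 1#)))
    ...   | inj₁ eq = subst Sign (sym eq) one
    ...   | inj₂ eq = subst Sign (sym eq) -one

    sgn : Fin q → 𝔼
    sgn u = δ u 1# ⊕ ⊖ δ u (- 1#)

    -- the quadratic character, by Euler's criterion with r = (q - 1) / 2
    η : Fin q → 𝔼
    η x = sgn (x ^ r)

    open 𝔼-Solverᴱ

    sgn-0 : sgn 0# ≡ 0𝔼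
    sgn-0 = trans (cong₂ (λ a b → a ⊕ ⊖ b) (δ-≢ 0≢1) (δ-≢ (-≢0 (0≢1 ∘ sym) ∘ sym))) (solveᴱ 0 (conᴱ (+ 0) :+ᴱ (:-ᴱ conᴱ
        (+ 0)) :=ᴱ conᴱ (+ 0)) refl)

    sgn-1 : sgn 1# ≡ 1𝔼
    sgn-1 = trans (cong₂ (λ a b → a ⊕ ⊖ b) (δ-≡ refl) (δ-≢ (-1≢1 ∘ sym))) (solveᴱ 0 (conᴱ (+ 1) :+ᴱ (:-ᴱ conᴱ
        (+ 0)) :=ᴱ conᴱ (+ 1)) refl)

    sgn--1 : sgn (- 1#) ≡ ⊖ 1𝔼
    sgn--1 = trans (cong₂ (λ a b → a ⊕ ⊖ b) (δ-≢ -1≢1) (δ-≡ refl)) (solveᴱ 0 (conᴱ (+ 0) :+ᴱ (:-ᴱ conᴱ (+ 1)) :=ᴱ :-ᴱ conᴱ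
        (+ 1)) refl)

    sgn-* : ∀ {u v} → Sign u → Sign v → sgn (u * v) ≡ sgn u ⊗ sgn v
    sgn-* {v = v} zero _ = trans (cong sgn (zeroˡ v)) (trans sgn-0 (sym (trans (cong (_⊗ sgn v) sgn-0) (𝔼ᵣ.zeroˡ (sgn v)))))
    sgn-* {v = v} one  _ = trans (cong sgn (*-identityˡ v)) (sym (trans (cong (_⊗ sgn v) sgn-1) (𝔼ᵣ.*-identityˡ (sgn v))))
    sgn-* -one zero = trans (cong sgn (zeroʳ (- 1#))) (trans sgn-0 (sym (trans (cong (sgn (- 1#) ⊗_) sgn-0) (𝔼ᵣ.zeroʳ (sgn
        (- 1#))))))
    sgn-* -one one  = trans (cong sgn (*-identityʳ (- 1#))) (sym (trans (cong (sgn (- 1#) ⊗_) sgn-1) (𝔼ᵣ.*-identityʳ (sgn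
        (- 1#)))))
    sgn-* -one -one = trans (cong sgn (solve 0 ((:- con 1F) :* (:- con 1F) := con 1F) refl)) (trans sgn-1
      (sym (trans (cong₂ _⊗_ sgn--1 sgn--1) (solveᴱ 0 ((:-ᴱ conᴱ (+ 1)) :*ᴱ (:-ᴱ conᴱ (+ 1)) :=ᴱ conᴱ (+ 1)) refl))))
      where open Solver₃

    η-* : ∀ x y → η (x * y) ≡ η x ⊗ η y
    η-* x y = trans (cong sgn (^-distrib-* x y r)) (sgn-* (sign x) (sign y))

    η-0 : η 0# ≡ 0𝔼
    η-0 = trans (cong sgn (0^suc (2 ℕ.* h))) sgn-0

    η-1 : η 1# ≡ 1𝔼
    η-1 = trans (cong sgn (1^ r)) sgn-1

    η-square : ∀ {x} → x ≢ 0# → η (x * x) ≡ 1𝔼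
    η-square {x} x≢0 = trans (cong sgn (trans (^-distrib-* x x r) (x^r²≡1 x≢0))) sgn-1

    η-neg : ∀ x → η (- x) ≡ ⊖ η x
    η-neg x = trans (cong η (solve 1 (λ x → :- x := (:- con 1F) :* x) refl x)) (trans (η-* (- 1#) x)
      (trans (cong (_⊗ η x) (trans (cong sgn (trans ([-x]^odd 1# h) (cong (-_) (1^ r)))) sgn--1))
        (solveᴱ 1 (λ e → (:-ᴱ conᴱ (+ 1)) :*ᴱ e :=ᴱ :-ᴱ e) refl (η x))))
      where open Solver₃

    -- Since - 1 is a nonsquare, the nonsquares are the negatives of nonzero squares, so each case
    -- can carry an explicit root.
    data SquareView (x : Fin q) : Set where
      is-zero   : x ≡ 0# → SquareView x
      is-square : ∀ y → y ≢ 0# → x ≡ y * y → η x ≡ 1𝔼 → SquareView x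
      is-neg    : ∀ y → y ≢ 0# → x ≡ - (y * y) → η x ≡ ⊖ 1𝔼 → SquareView x

    squareView : ∀ x → SquareView x
    squareView x with x ≟F 0#
    ... | yes x≡0 = is-zero x≡0
    ... | no x≢0 with x²≡y²⇒x≡±y (trans (x^r²≡1 x≢0) (sym (*-identityˡ 1#)))
    ...   | inj₁ eq = is-square (x ^ suc h) (^-≢0 (suc h) x≢0) (x^r≡1⇒square eq) (trans (cong sgn eq) sgn-1)
    ...   | inj₂ eq = is-neg ((- x) ^ suc h) (^-≢0 (suc h) (-≢0 x≢0))
      (trans (solve 1 (λ x → x := :- (:- x)) refl x) (cong (-_) (x^r≡1⇒square
        (trans ([-x]^odd x h) (trans (cong (-_) eq) (solve 0 (:- (:- con 1F) := con 1F) refl))))))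
      (trans (cong sgn eq) sgn--1)
      where open Solver₃

    -- - 1 is not a square as q ≡ 3 mod 4
    y²≢-z² : ∀ {y z} → z ≢ 0# → y * y ≢ - (z * z)
    y²≢-z² {y} {z} z≢0 eq with y ≟F 0#
    ... | yes refl = *-≢0 z≢0 z≢0 (trans (solve 1 (λ z → z := :- (:- z)) refl (z * z)) (trans (cong (-_) (trans (sym eq)
        (zeroˡ 0#))) (solve 0 (:- con 0F := con 0F) refl)))
      where open Solver₃
    ... | no y≢0 = 1≢-1 (trans (sym (η-square y≢0)) (trans (cong η eq) (trans (η-neg (z * z)) (cong ⊖_ (η-square z≢0)))))
      where
      1≢-1 : 1𝔼 ≢ ⊖ 1𝔼
      1≢-1 eq with trans eq (sym (⟪⟫-neg (+ 1)))
      ... | ()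

    ∑-roots : ∀ z → ∑ (λ y → δ (y * y) z) ≡ 1𝔼 ⊕ η z
    ∑-roots z with squareView z
    ... | is-zero refl = trans (∑-cong (λ y → δ-⇔ (λ eq → sym (Sum.reduce (no-zero-divisors y y eq))) (λ eq → trans (cong
        (_* y) (sym eq)) (zeroˡ y))))
      (trans (∑-δ1 0#) (sym (trans (cong (1𝔼 ⊕_) η-0) (𝔼ᵣ.+-identityʳ 1𝔼))))
    ... | is-square x x≢0 refl η≡1 = trans (∑-square-roots x≢0) (cong (1𝔼 ⊕_) (sym η≡1))
    ... | is-neg x x≢0 refl η≡-1 = trans (∑-0 (λ y → δ-≢ (y²≢-z² x≢0))) (sym (trans (cong (1𝔼 ⊕_) η≡-1) (𝔼ᵣ.-‿inverseʳ 1𝔼)))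

    ∑-squares : (f : Fin q → 𝔼) → ∑ (λ y → f (y * y)) ≡ ∑ (λ z → (1𝔼 ⊕ η z) ⊗ f z)
    ∑-squares f = trans (∑-fibre (λ y → y * y) f) (∑-cong (λ z → cong (_⊗ f z) (∑-roots z)))

    ∑-squares-+ : (f : Fin q → 𝔼) → ∑ (λ y → f (y * y)) ≡ ∑ f ⊕ ∑ (λ z → η z ⊗ f z)
    ∑-squares-+ f = trans (∑-squares f) (trans (∑-cong (λ z → trans (𝔼ᵣ.distribʳ (f z) 1𝔼 (η z)) (cong (_⊕ η z ⊗ f z)
        (𝔼ᵣ.*-identityˡ (f z)))))
      (∑-+ f (λ z → η z ⊗ f z)))

    η-⁻¹ : ∀ x → η (x ⁻¹) ≡ η x
    η-⁻¹ x with x ≟F 0#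
    ... | yes refl = cong η 0⁻¹
    ... | no x≢0 = begin
      η (x ⁻¹)                   ≡⟨ 𝔼ᵣ.*-identityˡ (η (x ⁻¹)) ⟨
      1𝔼 ⊗ η (x ⁻¹)              ≡⟨ cong (_⊗ η (x ⁻¹)) (trans (sym (η-square x≢0)) (η-* x x)) ⟩
      η x ⊗ η x ⊗ η (x ⁻¹)       ≡⟨ 𝔼ᵣ.*-assoc (η x) (η x) (η (x ⁻¹)) ⟩
      η x ⊗ (η x ⊗ η (x ⁻¹))     ≡⟨ cong (η x ⊗_) (trans (sym (η-* x (x ⁻¹))) (trans (cong η (*-inverse x≢0)) η-1)) ⟩
      η x ⊗ 1𝔼                   ≡⟨ 𝔼ᵣ.*-identityʳ (η x) ⟩
      η x                        ∎

    -- With t = 1 + γ² and z = 1 / t the left-hand sum runs over (1 + η (t - 1)) η t, and η (t - 1) η t = η (1 - z).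
    ∑-conic : (f : Fin q → 𝔼) → (∀ z → f (1# - z) ≡ f z) →
              f 0# ⊕ ∑ (λ γ → η (1# + γ * γ) ⊗ f ((1# + γ * γ) ⁻¹)) ≡ ∑ (λ z → η z ⊗ f z) ⊕ ∑ (λ z → η z ⊗ f z)
    ∑-conic f f-sym = begin
      f 0# ⊕ ∑ (λ γ → η (1# + γ * γ) ⊗ f ((1# + γ * γ) ⁻¹))
        ≡⟨ cong (f 0# ⊕_) (∑-squares (λ u → η (1# + u) ⊗ f ((1# + u) ⁻¹))) ⟩
      f 0# ⊕ ∑ (λ u → (1𝔼 ⊕ η u) ⊗ (η (1# + u) ⊗ f ((1# + u) ⁻¹)))
        ≡⟨ cong (f 0# ⊕_) (∑-cong (λ u → cong₂ (λ a b → (1𝔼 ⊕ η a) ⊗ (η b ⊗ f (b ⁻¹)))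
             (solve 1 (λ u → u := (u :+ con 1F) :- con 1F) refl u) (+-comm 1# u))) ⟩
      f 0# ⊕ ∑ (λ u → (1𝔼 ⊕ η ((u + 1#) - 1#)) ⊗ (η (u + 1#) ⊗ f ((u + 1#) ⁻¹)))
        ≡⟨ cong (f 0# ⊕_) (∑-shift 1# (λ t → (1𝔼 ⊕ η (t - 1#)) ⊗ (η t ⊗ f (t ⁻¹)))) ⟩
      f 0# ⊕ ∑ (λ t → (1𝔼 ⊕ η (t - 1#)) ⊗ (η t ⊗ f (t ⁻¹)))
        ≡⟨ cong (f 0# ⊕_) (∑-reindex (λ t → (1𝔼 ⊕ η (t - 1#)) ⊗ (η t ⊗ f (t ⁻¹))) _⁻¹ _⁻¹ ⁻¹-involutive ⁻¹-involutive) ⟨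
      f 0# ⊕ ∑ (λ z → (1𝔼 ⊕ η (z ⁻¹ - 1#)) ⊗ (η (z ⁻¹) ⊗ f (z ⁻¹ ⁻¹)))
        ≡⟨ cong₂ _⊕_ (sym (∑-δ 0# f)) (∑-cong (λ z → cong₂ (λ a b → (1𝔼 ⊕ η (z ⁻¹ - 1#)) ⊗ (a ⊗ f b)) (η-⁻¹ z)
            (⁻¹-involutive z))) ⟩
      ∑ (λ z → δ 0# z ⊗ f z) ⊕ ∑ (λ z → (1𝔼 ⊕ η (z ⁻¹ - 1#)) ⊗ (η z ⊗ f z))
        ≡⟨ ∑-+ _ _ ⟨
      ∑ (λ z → δ 0# z ⊗ f z ⊕ (1𝔼 ⊕ η (z ⁻¹ - 1#)) ⊗ (η z ⊗ f z))
        ≡⟨ ∑-cong pointwise ⟩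
      ∑ (λ z → η z ⊗ f z ⊕ η (1# - z) ⊗ f (1# - z))
        ≡⟨ ∑-+ _ _ ⟩
      ∑ (λ z → η z ⊗ f z) ⊕ ∑ (λ z → η (1# - z) ⊗ f (1# - z))
        ≡⟨ cong (∑ (λ z → η z ⊗ f z) ⊕_) (∑-reindex (λ z → η z ⊗ f z) (λ z → 1# - z) (λ z → 1# - z) invol invol) ⟩
      ∑ (λ z → η z ⊗ f z) ⊕ ∑ (λ z → η z ⊗ f z) ∎
      where
      open Solver₃
      invol : ∀ z → 1# - (1# - z) ≡ z
      invol = solve 1 (λ z → con 1F :- (con 1F :- z) := z) refl
      -- At z = 0 the left side is `f 0#` alone, because η 0 = 0, and the right side is η(1) f(1),
      -- equal to it by `f-sym`. For z ≠ 0 the factors combine to η(z⁻¹ - 1) η(z) = η(1 - z).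
      pointwise : ∀ z → δ 0# z ⊗ f z ⊕ (1𝔼 ⊕ η (z ⁻¹ - 1#)) ⊗ (η z ⊗ f z) ≡ η z ⊗ f z ⊕ η (1# - z) ⊗ f (1# - z)
      pointwise z with z ≟F 0#
      ... | yes refl = begin
        δ 0# 0# ⊗ f 0# ⊕ (1𝔼 ⊕ e) ⊗ (η 0# ⊗ f 0#)
          ≡⟨ cong₂ (λ a b → a ⊗ f 0# ⊕ (1𝔼 ⊕ e) ⊗ (b ⊗ f 0#)) (δ-≡ refl) η-0 ⟩
        1𝔼 ⊗ f 0# ⊕ (1𝔼 ⊕ e) ⊗ (0𝔼 ⊗ f 0#)
          ≡⟨ solveᴱ 2 (λ e v → conᴱ (+ 1) :*ᴱ v :+ᴱ (conᴱ (+ 1) :+ᴱ e) :*ᴱ (conᴱ (+ 0) :*ᴱ v) :=ᴱ conᴱ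
              (+ 0) :*ᴱ v :+ᴱ conᴱ (+ 1) :*ᴱ v) refl e (f 0#) ⟩
        0𝔼 ⊗ f 0# ⊕ 1𝔼 ⊗ f 0#
          ≡⟨ cong₂ _⊕_ (cong (_⊗ f 0#) η-0) (cong₂ _⊗_ (trans (cong η (solve 0 (con 1F :- con 0F := con 1F) refl)) η-1)
              (f-sym 0#)) ⟨
        η 0# ⊗ f 0# ⊕ η (1# - 0#) ⊗ f (1# - 0#) ∎
        where
        e : 𝔼
        e = η (0# ⁻¹ - 1#)
      ... | no z≢0 = begin
        δ 0# z ⊗ f z ⊕ (1𝔼 ⊕ e) ⊗ (η z ⊗ f z)
          ≡⟨ cong (λ a → a ⊗ f z ⊕ (1𝔼 ⊕ e) ⊗ (η z ⊗ f z)) (δ-≢ (z≢0 ∘ sym)) ⟩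
        0𝔼 ⊗ f z ⊕ (1𝔼 ⊕ e) ⊗ (η z ⊗ f z)
          ≡⟨ solveᴱ 3 (λ e d v → conᴱ (+ 0) :*ᴱ v :+ᴱ (conᴱ (+ 1) :+ᴱ e) :*ᴱ (d :*ᴱ v) :=ᴱ d :*ᴱ v :+ᴱ
              (e :*ᴱ d) :*ᴱ v) refl e (η z) (f z) ⟩
        η z ⊗ f z ⊕ e ⊗ η z ⊗ f z
          ≡⟨ cong₂ (λ s t → η z ⊗ f z ⊕ s ⊗ t) (trans (sym (η-* (z ⁻¹ - 1#) z)) (cong η eq)) (sym (f-sym z)) ⟩
        η z ⊗ f z ⊕ η (1# - z) ⊗ f (1# - z) ∎
        where
        e : 𝔼
        e = η (z ⁻¹ - 1#)
        eq : (z ⁻¹ - 1#) * z ≡ 1# - z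
        eq = trans (solve 2 (λ w z → (w :- con 1F) :* z := z :* w :- z) refl (z ⁻¹) z) (cong (_- z) (*-inverse z≢0))

  module GaussSums {q} (K : Field₃ q) (Ψ : Character K) (h : ℕ)
    (fermat : ∀ x → Field₃._^_ K x (3 ℕ.+ 4 ℕ.* h) ≡ x) where
    open Field₃ K
    open FieldSums K
    open Character Ψ
    open QuadraticCharacter K h fermat
    open 𝔼-Solverᴱ

    Γ : Fin q → 𝔼
    Γ A = ∑ (λ y → ψ (A * (y * y)))

    Γ-η : ∀ {A} → A ≢ 0# → Γ A ≡ ∑ (λ z → η z ⊗ ψ (A * z))
    Γ-η {A} A≢0 = trans (∑-squares-+ (λ z → ψ (A * z))) (trans (cong (_⊕ ∑ (λ z → η z ⊗ ψ (A * z)))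
        (trans (∑ψ A) (trans (cong (⟪ + q ⟫ ⊗_) (δ-≢ (A≢0 ∘ sym))) (𝔼ᵣ.zeroʳ ⟪ + q ⟫))))
      (𝔼ᵣ.+-identityˡ _))

    Γ-scale : ∀ {c A} → c ≢ 0# → A ≢ 0# → Γ (c * A) ≡ η c ⊗ Γ A
    Γ-scale {c} {A} c≢0 A≢0 = begin
      Γ (c * A)                                  ≡⟨ Γ-η (*-≢0 c≢0 A≢0) ⟩
      ∑ (λ z → η z ⊗ ψ (c * A * z))              ≡⟨ ∑-scale (λ z → η z ⊗ ψ (c * A * z)) (⁻¹-≢0 c≢0) ⟨
      ∑ (λ z → η (c ⁻¹ * z) ⊗ ψ (c * A * (c ⁻¹ * z)))
        ≡⟨ ∑-cong (λ z → cong₂ _⊗_ (trans (η-* (c ⁻¹) z) (cong (_⊗ η z) (η-⁻¹ c))) (cong ψ (eq z))) ⟩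
      ∑ (λ z → η c ⊗ η z ⊗ ψ (A * z))            ≡⟨ ∑-cong (λ z → 𝔼ᵣ.*-assoc (η c) (η z) (ψ (A * z))) ⟩
      ∑ (λ z → η c ⊗ (η z ⊗ ψ (A * z)))          ≡⟨ ∑-*ˡ (η c) (λ z → η z ⊗ ψ (A * z)) ⟩
      η c ⊗ ∑ (λ z → η z ⊗ ψ (A * z))            ≡⟨ cong (η c ⊗_) (Γ-η A≢0) ⟨
      η c ⊗ Γ A                                  ∎
      where
      eq : ∀ z → c * A * (c ⁻¹ * z) ≡ A * z
      eq z = trans (solve 4 (λ c A d z → c :* A :* (d :* z) := (c :* d) :* (A :* z)) refl c A (c ⁻¹) z)
        (trans (cong (_* (A * z)) (*-inverse c≢0)) (*-identityˡ (A * z)))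
        where open Solver₃

    Γ-neg : ∀ {A} → A ≢ 0# → Γ (- A) ≡ ⊖ Γ A
    Γ-neg {A} A≢0 = trans (cong Γ (solve 1 (λ A → :- A := (:- con 1F) :* A) refl A)) (trans (Γ-scale (-≢0 (0≢1 ∘ sym)) A≢0)
      (trans (cong (_⊗ Γ A) (trans (η-neg 1#) (cong ⊖_ η-1))) (solveᴱ 1 (λ g → (:-ᴱ conᴱ (+ 1)) :*ᴱ g :=ᴱ :-ᴱ g) refl (Γ A))))
      where open Solver₃

    -- Conjugation replaces A by - A, and η(- 1) = - 1. Thus a quadratic Gauss sum of `K` is an
    -- integer multiple of √-3.
    conj-Γ : ∀ {A} → A ≢ 0# → conj (Γ A) ≡ ⊖ Γ A
    conj-Γ {A} A≢0 = trans (conj-∑ (λ y → ψ (A * (y * y)))) (trans (∑-cong (λ y → trans (sym (ψ-neg (A * (y * y))))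
      (cong ψ (solve 2 (λ A y → :- (A :* (y :* y)) := (:- A) :* (y :* y)) refl A y)))) (Γ-neg A≢0))
      where open Solver₃

    -- the shape f = ψ ∘ Q, g = ψ ∘ B of a quadratic form Q with polar form B
    ∑-norm : (f : Fin q → 𝔼) (g : Fin q → Fin q → 𝔼) →
             (∀ r s → f (r + s) ⊗ conj (f s) ≡ f r ⊗ g r s) →
             ∑ f ⊗ conj (∑ f) ≡ ∑ (λ r → f r ⊗ ∑ (g r))
    ∑-norm f g eq = begin
      ∑ f ⊗ conj (∑ f)                           ≡⟨ cong (∑ f ⊗_) (conj-∑ f) ⟩
      ∑ f ⊗ ∑ (λ s → conj (f s))                 ≡⟨ ∑-*ˡ (∑ f) (λ s → conj (f s)) ⟨
      ∑ (λ s → ∑ f ⊗ conj (f s))                 ≡⟨ ∑-cong (λ s → trans (cong (_⊗ conj (f s)) (sym (∑-shift s f))) (sym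
          (∑-*ʳ (conj (f s)) (λ r → f (r + s))))) ⟩
      ∑ (λ s → ∑ (λ r → f (r + s) ⊗ conj (f s))) ≡⟨ ∑-cong (λ s → ∑-cong (λ r → eq r s)) ⟩
      ∑ (λ s → ∑ (λ r → f r ⊗ g r s))            ≡⟨ ∑-swap (λ s r → f r ⊗ g r s) ⟩
      ∑ (λ r → ∑ (λ s → f r ⊗ g r s))            ≡⟨ ∑-cong (λ r → ∑-*ˡ (f r) (g r)) ⟩
      ∑ (λ r → f r ⊗ ∑ (g r))                    ∎

    -- The polar form of A y² is 2 A r s = - A r s; its radical is 0, so only r = 0 survives.
    Γ-norm : ∀ {A} → A ≢ 0# → Γ A ⊗ conj (Γ A) ≡ ⟪ + q ⟫
    Γ-norm {A} A≢0 = trans (∑-norm (λ y → ψ (A * (y * y))) (λ r s → ψ (- (A * r) * s)) (λ r s →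
        trans (cong (ψ (A * ((r + s) * (r + s))) ⊗_) (sym (ψ-neg _))) (trans (sym (ψ-+ _ _)) (trans (cong ψ (eq A r s))
            (ψ-+ _ _)))))
      (trans (∑-cong (λ r → trans (cong (ψ (A * (r * r)) ⊗_) (trans (∑ψ (- (A * r))) (cong (⟪ + q ⟫ ⊗_)
          (δ-⇔ {k = 0#} {l = r} (zero⇒ r) (⇒zero r)))))
                            (solveᴱ 3 (λ a b c → a :*ᴱ (b :*ᴱ c) :=ᴱ c :*ᴱ (a :*ᴱ b)) refl _ _ _)))
      (trans (∑-δ 0# (λ r → ψ (A * (r * r)) ⊗ ⟪ + q ⟫)) (trans (cong (_⊗ ⟪ + q ⟫) (trans (cong ψ (solve 1 (λ A → A :*
          (con 0F :* con 0F) := con 0F) refl A)) ψ-0))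
        (𝔼ᵣ.*-identityˡ ⟪ + q ⟫))))
      where
      open Solver₃
      eq : ∀ A r s → A * ((r + s) * (r + s)) + - (A * (s * s)) ≡ A * (r * r) + - (A * r) * s
      eq = solve 3 (λ A r s → A :* ((r :+ s) :* (r :+ s)) :+ :- (A :* (s :* s)) := A :* (r :* r) :+ (:- (A :* r)) :* s) refl
      zero⇒ : ∀ r → 0# ≡ - (A * r) → 0# ≡ r
      zero⇒ r e with r ≟F 0#
      ... | yes p = sym p
      ... | no p  = contradiction (sym e) (-≢0 (*-≢0 A≢0 p))
      ⇒zero : ∀ r → 0# ≡ r → 0# ≡ - (A * r)
      ⇒zero _ refl = solve 1 (λ A → con 0F := :- (A :* con 0F)) refl A

    Γ² : ∀ {A} → A ≢ 0# → Γ A ⊗ Γ A ≡ ⊖ ⟪ + q ⟫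
    Γ² {A} A≢0 = trans (solveᴱ 1 (λ g → g :*ᴱ g :=ᴱ :-ᴱ (g :*ᴱ (:-ᴱ g))) refl (Γ A)) (cong ⊖_ (trans (cong (Γ A ⊗_) (sym
        (conj-Γ A≢0))) (Γ-norm A≢0)))

    ∑-quadratic : ∀ {A} B → A ≢ 0# → ∑ (λ y → ψ (A * (y * y) + - (B * y))) ≡ ψ (- (B * B * A ⁻¹)) ⊗ Γ A
    ∑-quadratic {A} B A≢0 = trans (∑-cong (λ y → trans (cong ψ (eq y)) (ψ-+ _ _)))
      (trans (∑-*ˡ (ψ (- (B * B * A ⁻¹))) (λ y → ψ (A * ((y + c) * (y + c))))) (cong (ψ (- (B * B * A ⁻¹)) ⊗_) (∑-shift c
          (λ y → ψ (A * (y * y))))))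
      where
      open Solver₃
      c : Fin q
      c = B * A ⁻¹
      -- completing the square, where 2 = - 1
      eq : ∀ y → A * (y * y) + - (B * y) ≡ - (B * B * A ⁻¹) + A * ((y + c) * (y + c))
      eq y = begin
        A * (y * y) + - (B * y)
          ≡⟨ solve 3 (λ A B y → A :* (y :* y) :+ (:- (B :* y)) := A :* (y :* y) :+ (con 2F :* (con 1F :* (B :* y)))) refl A B y ⟩
        A * (y * y) + (- 1# * (1# * (B * y)))
          ≡⟨ cong (λ t → A * (y * y) + (- 1# * (t * (B * y)))) (*-inverse A≢0) ⟨
        A * (y * y) + (- 1# * (A * A ⁻¹ * (B * y)))
          ≡⟨ solve 4 (λ A B a y → A :* (y :* y) :+ con 2F :* (A :* a :* (B :* y)) := :- (B :* B :* (con 1F :* a)) :+ (A :*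
              (y :* y) :+ con 2F :* (A :* a :* (B :* y)) :+ B :* B :* (con 1F :* a))) refl A B (A ⁻¹) y ⟩
        - (B * B * (1# * A ⁻¹)) + (A * (y * y) + (- 1# * (A * A ⁻¹ * (B * y))) + B * B * (1# * A ⁻¹))
          ≡⟨ cong₂ (λ s t → - (B * B * s) + (A * (y * y) + (- 1# * (A * A ⁻¹ * (B * y))) + B * B * (t * A ⁻¹)))
              (*-identityˡ (A ⁻¹)) (sym (*-inverse A≢0)) ⟩
        - (B * B * A ⁻¹) + (A * (y * y) + (- 1# * (A * A ⁻¹ * (B * y))) + B * B * (A * A ⁻¹ * A ⁻¹))
          ≡⟨ solve 4 (λ A B a y → (:- (B :* B :* a)) :+ (A :* (y :* y) :+ con 2F :* (A :* a :* (B :* y)) :+ B :* B :*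
              (A :* a :* a)) := (:- (B :* B :* a)) :+ A :* ((y :+ B :* a) :* (y :+ B :* a))) refl A B (A ⁻¹) y ⟩
        - (B * B * A ⁻¹) + A * ((y + c) * (y + c)) ∎

-- The radical of the quadratic form M (r⁴ - r²).

module PolarFormZeros where

  open EisensteinIntegers
  open TernaryFields
  open AdditiveCharacters
  open import Data.Fin.Base using (Fin)
  open import Data.Fin.Patterns using (0F; 1F)
  open import Data.Sum.Base as Sum using (_⊎_; inj₁; inj₂)
  open import Data.Product.Base using (_,_)
  open import Relation.Binary.PropositionalEquality
  open ≡-Reasoning

  module PolarZeros {q} (K : Field₃ q) (Ψ : Character K) where
    open Field₃ K
    open Character Ψ
    open Solver₃

    private
      1*1 : 1# * 1# ≡ 1#
      1*1 = *-identityˡ 1#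

    -- Here N = (r² + m²)² / (r m³), which expands to a³ - a + b with a = r / m and b = m / r, since
    -- 2 = - 1. Moreover b³ = c³ - c for c = s / r. Both a³ - a and c³ - c have character value 1,
    -- and ψ(b) = ψ(b³).
    ψ≡1 : ∀ {N r m s} → r ≢ 0# → m ≢ 0# → N * (r * m ^ 3) ≡ 1# → m ^ 3 ≡ s ^ 3 - r * r * s → r * r + m * m ≡ - 1# → ψ N ≡ 1𝔼
    ψ≡1 {N} {r} {m} {s} r≢0 m≢0 N≡ m³≡ r²+m² = begin
      ψ N                                    ≡⟨ cong ψ N≡a³-a+b ⟩
      ψ (a ^ 3 + - a + b)                    ≡⟨ trans (ψ-+ _ _) (cong₂ _⊗_ (ψ-³- a) ψb≡1) ⟩
      1𝔼 ⊗ 1𝔼                                ≡⟨ 𝔼ᵣ.*-identityˡ 1𝔼 ⟩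
      1𝔼                                     ∎
      where
      a b c : Fin q
      a = r * m ⁻¹
      b = m * r ⁻¹
      c = s * r ⁻¹
      ψ-³- : ∀ x → ψ (x ^ 3 + - x) ≡ 1𝔼
      ψ-³- x = trans (ψ-+ _ _) (trans (cong₂ _⊗_ (ψ-^3 x) (ψ-neg x)) (cube-root-conj (ψ-root x)))
      ψb≡1 : ψ b ≡ 1𝔼
      ψb≡1 = begin
        ψ b                                  ≡⟨ ψ-^3 b ⟨
        ψ (b ^ 3)                            ≡⟨ cong ψ (solve 2 (λ m i → (m :* i) :^ 3 := m :^ 3 :* (i :*
            (i :* i))) refl m (r ⁻¹)) ⟩
        ψ (m ^ 3 * (r ⁻¹ * (r ⁻¹ * r ⁻¹)))   ≡⟨ cong (λ t → ψ (t * (r ⁻¹ * (r ⁻¹ * r ⁻¹)))) m³≡ ⟩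
        ψ ((s ^ 3 - r * r * s) * (r ⁻¹ * (r ⁻¹ * r ⁻¹)))
          ≡⟨ cong ψ (solve 3 (λ r s i → (s :^ 3 :- r :* r :* s) :* (i :* (i :* i)) := (s :* i) :^ 3 :+ (:- ((r :* i) :*
              (r :* i) :* (s :* i)))) refl r s (r ⁻¹)) ⟩
        ψ (c ^ 3 + - (r * r ⁻¹ * (r * r ⁻¹) * c))
          ≡⟨ cong (λ t → ψ (c ^ 3 + - (t * c))) (trans (cong₂ _*_ (*-inverse r≢0) (*-inverse r≢0)) 1*1) ⟩
        ψ (c ^ 3 + - (1# * c))               ≡⟨ cong (λ t → ψ (c ^ 3 + - t)) (*-identityˡ c) ⟩
        ψ (c ^ 3 + - c)                      ≡⟨ ψ-³- c ⟩
        1𝔼                                   ∎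
      N≡a³-a+b : N ≡ a ^ 3 + - a + b
      N≡a³-a+b = begin
        N
          ≡⟨ solve 1 (λ N → N := N :* ((:- con 1F) :* (:- con 1F))) refl N ⟩
        N * (- 1# * - 1#)
          ≡⟨ cong (λ t → N * (t * t)) r²+m² ⟨
        N * ((r * r + m * m) * (r * r + m * m))
          ≡⟨ solve 3 (λ N r m → N :* ((r :* r :+ m :* m) :* (r :* r :+ m :* m))
               := (N :* r) :* (con 1F :* con 1F :* con 1F) :* (r :* r :* r) :+ (:- ((N :* r) :* (r :*
                   (m :* m) :* con 1F))) :+ N :* con 1F :* (m :^ 3) :* m) refl N r m ⟩
        N * r * (1# * 1# * 1#) * (r * r * r) + - (N * r * (r * (m * m) * 1#)) + N * 1# * m ^ 3 * m
          ≡⟨ cong₂ (λ s t → N * r * (s * s * s) * (r * r * r) + - (N * r * (r * (m * m) * s)) + N * t * m ^ 3 * m)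
              (*-inverse m≢0) (*-inverse r≢0) ⟨
        N * r * (m * m ⁻¹ * (m * m ⁻¹) * (m * m ⁻¹)) * (r * r * r) + - (N * r * (r * (m * m) * (m * m ⁻¹))) + N *
            (r * r ⁻¹) * m ^ 3 * m
          ≡⟨ solve 5 (λ N r m i j → N :* r :* (m :* i :* (m :* i) :* (m :* i)) :* (r :* r :* r) :+ (:- (N :* r :* (r :*
              (m :* m) :* (m :* i)))) :+ N :* (r :* j) :* m :^ 3 :* m
               := (N :* (r :* m :^ 3)) :* ((r :* i) :^ 3 :+ (:- (r :* i)) :+ m :* j)) refl N r m (m ⁻¹) (r ⁻¹) ⟩
        N * (r * m ^ 3) * (a ^ 3 + - a + b)
          ≡⟨ cong (_* (a ^ 3 + - a + b)) N≡ ⟩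
        1# * (a ^ 3 + - a + b)
          ≡⟨ *-identityˡ _ ⟩
        a ^ 3 + - a + b ∎

    module _ (M : Fin q) where
      -- The form Q(r) = M (r⁴ - r²) has the polar form B(r, s) = M (r³ s + r s³ + r s). Cubing the
      -- two terms linear in s does not change ψ and gives ψ(B(r, s)) = ψ(`polar r` · s³).
      polar : Fin q → Fin q
      polar r = M ^ 3 * (r ^ 3) ^ 3 + M ^ 3 * r ^ 3 + M * r

      -- Two independent zeros r, s of the polar form put ± M into the form a³ - a + b with ψ b = 1:
      -- with e = s³ - r² s one gets (M r e)² = 1 and (r² + 1)³ = - e², so that e = m³ and r² + m² = - 1
      -- for m = - e / (r² + 1), whence ± M = 1 / (r m³) = (r² + m²)² / (r m³).
      independent-zeros : ∀ {r s} → M ≢ 0# → r ≢ 0# → s ≢ 0# → r ≢ s → r ≢ - s → polar r ≡ 0# → polar s ≡ 0# → ψ M ≡ 1𝔼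
      independent-zeros {r} {s} M≢0 r≢0 s≢0 r≢s r≢-s λr≡0 λs≡0 = conclude (x²≡y²⇒x≡±y {M * (r * e)} {1#} (trans Mre²≡1 (sym 1*1)))
        where
        e u m : Fin q
        e = s ^ 3 - r * r * s
        u = r * r + 1#
        m = - (e * u ⁻¹)

        e≢0 : e ≢ 0#
        e≢0 e≡0 with no-zero-divisors s ((s - r) * (s + r)) (trans (solve 2 (λ r s → s :* ((s :- r) :*
            (s :+ r)) := s :^ 3 :- r :* r :* s) refl r s) e≡0)
        ... | inj₁ p = s≢0 p
        ... | inj₂ p with no-zero-divisors (s - r) (s + r) p
        ...   | inj₁ p₁ = r≢s (sym (x-y≡0⇒x≡y p₁))
        ...   | inj₂ p₂ = r≢-s (x-y≡0⇒x≡y (trans (solve 2 (λ r s → r :- (:- s) := s :+ r) refl r s) p₂))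

        -- r e = r s³ - r³ s is the Moore determinant of r and s, nonzero by their independence over
        -- 𝔽₃. In s³ `polar r` - r³ `polar s` the middle terms M³ r³ s³ cancel, and what is left
        -- compares M r e with its cube.
        [Mre]³ : (M * (r * e)) ^ 3 ≡ M * (r * e)
        [Mre]³ = begin
          (M * (r * e)) ^ 3
            ≡⟨ cong (λ t → (M * t) ^ 3) (solve 2 (λ r s → r :* (s :^ 3 :- r :* r :* s) := r :* s :^ 3 :- r :^ 3 :* s) refl r s) ⟩
          (M * (r * s ^ 3 - r ^ 3 * s)) ^ 3
            ≡⟨ solve 5 (λ M r s R S → (M :* (r :* S :- R :* s)) :^ 3 := M :^ 3 :*
                (r :^ 3 :* S :^ 3 :- R :^ 3 :* s :^ 3)) refl M r s (r ^ 3) (s ^ 3) ⟩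
          M ^ 3 * (r ^ 3 * (s ^ 3) ^ 3 - (r ^ 3) ^ 3 * s ^ 3)
            ≡⟨ solve 8 (λ M M³ r s R S R³ S³ → M³ :* (R :* S³ :- R³ :* S) := M :* (r :* S :- R :* s) :- (S :*
                (M³ :* R³ :+ M³ :* R :+ M :* r) :- R :* (M³ :* S³ :+ M³ :* S :+ M :* s)))
                 refl M (M ^ 3) r s (r ^ 3) (s ^ 3) ((r ^ 3) ^ 3) ((s ^ 3) ^ 3) ⟩
          M * (r * s ^ 3 - r ^ 3 * s) - (s ^ 3 * polar r - r ^ 3 * polar s)
            ≡⟨ cong₂ (λ x y → M * (r * s ^ 3 - r ^ 3 * s) - (s ^ 3 * x - r ^ 3 * y)) λr≡0 λs≡0 ⟩
          M * (r * s ^ 3 - r ^ 3 * s) - (s ^ 3 * 0# - r ^ 3 * 0#)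
            ≡⟨ solve 3 (λ M r s → M :* (r :* s :^ 3 :- r :^ 3 :* s) :- (s :^ 3 :* con 0F :- r :^ 3 :* con 0F) := M :*
                (r :* (s :^ 3 :- r :* r :* s))) refl M r s ⟩
          M * (r * e) ∎

        Mre²≡1 : M * (r * e) * (M * (r * e)) ≡ 1#
        Mre²≡1 = *-cancelˡ (M * (r * e)) (*-≢0 M≢0 (*-≢0 r≢0 e≢0)) (trans (solve 1 (λ x → x :* (x :* x) := x :^ 3) refl
            (M * (r * e)))
          (trans [Mre]³ (sym (*-identityʳ _))))

        -- As r⁶ + 1 = (r² + 1)³, the first polar equation factors: `polar r` = M r (M² r² u³ + 1).
        M²r²u³ : M * M * (r * r) * u ^ 3 ≡ - 1#
        M²r²u³ = x-y≡0⇒x≡y (*-cancelˡ (M * r) (*-≢0 M≢0 r≢0) (trans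
          (solve 2 (λ M r → M :* r :* (M :* M :* (r :* r) :* (r :* r :+ con 1F) :^ 3 :- (:- con 1F)) := M :^ 3 :*
              (r :^ 3) :^ 3 :+ M :^ 3 :* r :^ 3 :+ M :* r) refl M r)
          (trans λr≡0 (sym (zeroʳ (M * r))))))

        u³≡-e² : u ^ 3 ≡ - (e * e)
        u³≡-e² = *-cancelˡ (M * M * (r * r)) (*-≢0 (*-≢0 M≢0 M≢0) (*-≢0 r≢0 r≢0)) (trans M²r²u³ (trans (cong (-_) (sym Mre²≡1))
          (solve 3 (λ M r e → :- (M :* (r :* e) :* (M :* (r :* e))) := M :* M :* (r :* r) :* (:- (e :* e))) refl M r e)))

        u≢0 : u ≢ 0#
        u≢0 u≡0 = -≢0 (*-≢0 e≢0 e≢0) (trans (sym u³≡-e²) (trans (cong (_^ 3) u≡0) (zeroˡ _)))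

        m²≡-u : m * m ≡ - u
        m²≡-u = begin
          m * m                          ≡⟨ solve 2 (λ e w → (:- (e :* w)) :* (:- (e :* w)) := (:- (:- (e :* e))) :*
              (w :* w)) refl e (u ⁻¹) ⟩
          - - (e * e) * (u ⁻¹ * u ⁻¹)    ≡⟨ cong (λ t → - t * (u ⁻¹ * u ⁻¹)) u³≡-e² ⟨
          - (u ^ 3) * (u ⁻¹ * u ⁻¹)      ≡⟨ solve 2 (λ u w → (:- (u :^ 3)) :* (w :* w) := :- (u :* ((u :* w) :*
              (u :* w)))) refl u (u ⁻¹) ⟩
          - (u * (u * u ⁻¹ * (u * u ⁻¹))) ≡⟨ cong (λ t → - (u * t)) (trans (cong₂ _*_ (*-inverse u≢0) (*-inverse u≢0)) 1*1) ⟩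
          - (u * 1#)                     ≡⟨ cong (-_) (*-identityʳ u) ⟩
          - u                            ∎

        m³≡e : m ^ 3 ≡ e
        m³≡e = begin
          m ^ 3                          ≡⟨ solve 1 (λ m → m :^ 3 := m :* (m :* m)) refl m ⟩
          m * (m * m)                    ≡⟨ cong (m *_) m²≡-u ⟩
          - (e * u ⁻¹) * - u             ≡⟨ solve 3 (λ e w u → (:- (e :* w)) :* (:- u) := e :* (u :* w)) refl e (u ⁻¹) u ⟩
          e * (u * u ⁻¹)                 ≡⟨ cong (e *_) (*-inverse u≢0) ⟩
          e * 1#                         ≡⟨ *-identityʳ e ⟩
          e                              ∎

        m≢0 : m ≢ 0#
        m≢0 = -≢0 (*-≢0 e≢0 (⁻¹-≢0 u≢0))

        r²+m²≡-1 : r * r + m * m ≡ - 1#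
        r²+m²≡-1 = trans (cong (r * r +_) m²≡-u) (solve 1 (λ r → r :* r :+ (:- (r :* r :+ con 1F)) := :- con 1F) refl r)

        conclude : M * (r * e) ≡ 1# ⊎ M * (r * e) ≡ - 1# → ψ M ≡ 1𝔼
        conclude (inj₁ eq) = ψ≡1 r≢0 m≢0 (trans (cong (λ t → M * (r * t)) m³≡e) eq) m³≡e r²+m²≡-1
        conclude (inj₂ eq) = begin
          ψ M            ≡⟨ cong ψ (solve 1 (λ M → M := :- (:- M)) refl M) ⟩
          ψ (- - M)      ≡⟨ ψ-neg (- M) ⟩
          conj (ψ (- M)) ≡⟨ cong conj (ψ≡1 {N = - M} r≢0 m≢0 (trans (cong (λ t → - M * (r * t)) m³≡e) (trans (solve 2
              (λ M x → (:- M) :* x := :- (M :* x)) refl M (r * e))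
                              (trans (cong (-_) eq) (solve 0 (:- (:- con 1F) := con 1F) refl)))) m³≡e r²+m²≡-1) ⟩
          conj 1𝔼        ≡⟨ conj-⟪⟫ _ ⟩
          1𝔼             ∎

-- The quartic sum E and the equation Z = ± Γ.

module QuarticSums where

  open EisensteinIntegers
  open FiniteSums
  open TernaryFields
  open AdditiveCharacters
  open GaussSumsOverK
  open PolarFormZeros
  open import Data.Fin.Base using (Fin)
  open import Data.Fin.Patterns using (0F)
  open import Data.Fin.Properties using (any?) renaming (_≟_ to _≟F_)
  open import Data.Integer.Base as ℤ using (ℤ; +_)
  import Data.Integer.Properties as ℤₚ
  open import Data.Integer.Tactic.RingSolver using (solve-∀)
  open import Data.Nat.Base as ℕ using (ℕ)
  import Data.Nat.Properties as ℕₚ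
  open import Data.Product.Base using (∃; _×_; _,_; proj₁; proj₂)
  open import Data.Sum.Base as Sum using (_⊎_; inj₁; inj₂)
  open import Function.Base using (_∘_; _$_)
  open import Relation.Binary.PropositionalEquality
  open import Relation.Nullary using (yes; no; contradiction; ¬?)
  open import Relation.Nullary.Decidable using (_×-dec_)
  open ≡-Reasoning

  module Imaginary where
    open import Data.Integer.Base using (_+_; _*_; _-_; -_)

    even≢odd : ∀ s t → + 2 * s ≢ + 1 + + 2 * t
    even≢odd s t eq = ℕₚ.even≢odd ℤ.∣ s - t ∣ 0 (trans (sym (ℤₚ.abs-* (+ 2) (s - t))) (cong ℤ.∣_∣ (trans (l s t) (cong
        (_- + 2 * t) eq) ∙ r t)))
      where
      l : ∀ s t → + 2 * (s - t) ≡ + 2 * s - + 2 * t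
      l = solve-∀
      r : ∀ t → + 1 + + 2 * t - + 2 * t ≡ + 1
      r = solve-∀
      _∙_ : ∀ {x y z : ℤ} → x ≡ y → y ≡ z → x ≡ z
      _∙_ = trans

    private
      factors : ∀ z g a b → a * b ≡ + 0 → (a ≡ + 0 → z ≢ + 1 + + 2 * g) → (z ≡ + 1 + + 2 * g) → b ≡ + 0
      factors z g a b ab≡0 a≢ odd with ℤₚ.i*j≡0⇒i≡0∨j≡0 a ab≡0
      ... | inj₁ a≡0 = contradiction odd (a≢ a≡0)
      ... | inj₂ b≡0 = b≡0

    -- z² - z g + g² = κ g² factors as z (z - g) = 0 for κ = 1 and as (z - 2 g) (z + g) = 0 for κ = 3.
    odd-root : ∀ {κ} z g t → κ ≡ + 1 ⊎ κ ≡ + 3 → z ≡ + 1 + + 2 * t → z * z - z * g + g * g ≡ κ * (g * g) → z ≡ g ⊎ z ≡ - g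
    odd-root z g t (inj₁ refl) odd eq = inj₁ $ ℤₚ.i-j≡0⇒i≡j z g (factors z t z (z - g) (trans (l z g) (trans (cong
        (_- g * g) eq) (r g)))
      (λ z≡0 z-odd → even≢odd (+ 0) t (trans (sym z≡0) z-odd)) odd)
      where
      l : ∀ z g → z * (z - g) ≡ z * z - z * g + g * g - g * g
      l = solve-∀
      r : ∀ g → + 1 * (g * g) - g * g ≡ + 0
      r = solve-∀
    odd-root z g t (inj₂ refl) odd eq = inj₂ $ ℤₚ.i-j≡0⇒i≡j z (- g) (trans (e z g) (factors z t (z - + 2 * g) (z + g)
        (trans (l z g) (trans (cong (_- + 3 * (g * g)) eq) (r g)))
      (λ p z-odd → even≢odd g t (trans (sym (ℤₚ.i-j≡0⇒i≡j z (+ 2 * g) p)) z-odd)) odd))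
      where
      l : ∀ z g → (z - + 2 * g) * (z + g) ≡ z * z - z * g + g * g - + 3 * (g * g)
      l = solve-∀
      r : ∀ g → + 3 * (g * g) - + 3 * (g * g) ≡ + 0
      r = solve-∀
      e : ∀ z g → z - (- g) ≡ z + g
      e = solve-∀

    opaque
      unfolding _⊕_

      norm-imaginary : ∀ g → const ((⟪ g ⟫ ⊗ √-3) ⊗ conj (⟪ g ⟫ ⊗ √-3)) ≡ + 3 * (g * g)
      norm-imaginary g = l g
        where
        l : ∀ g → (g * + 1 - + 0 * + 2) * ((g * + 1 - + 0 * + 2) - (g * + 2 + + 0 * + 1 - + 0 * + 2)) -
            (g * + 2 + + 0 * + 1 - + 0 * + 2) * (- (g * + 2 + + 0 * + 1 - + 0 * + 2)) ≡ + 3 * (g * g)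
        l = solve-∀

      conj-imaginary : ∀ z → conj (⟪ z ⟫ ⊗ √-3) ≡ ⟪ - z ⟫ ⊗ √-3
      conj-imaginary z = cong₂ _+ω_ (l z) (r z)
        where
        l : ∀ z → (z * + 1 - + 0 * + 2) - (z * + 2 + + 0 * + 1 - + 0 * + 2) ≡ - z * + 1 - + 0 * + 2
        l = solve-∀
        r : ∀ z → - (z * + 2 + + 0 * + 1 - + 0 * + 2) ≡ - z * + 2 + + 0 * + 1 - + 0 * + 2
        r = solve-∀

      -- In coordinates E = (g - 2 z) - (z + g) ω, whose norm is 3 (z² - z g + g²). The sum of the
      -- coordinates is - 3 z, and E ≡ 1 mod 2 makes it odd, so z is odd and `odd-root` applies.
      twisted-sum-ζ : ∀ {κ E V} z g → κ ≡ + 1 ⊎ κ ≡ + 3 →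
        E ≡ ζ ⊗ (⟪ z ⟫ ⊗ √-3 ⊕ ζ ⊗ (⟪ g ⟫ ⊗ √-3)) →
        E ≡ 1𝔼 ⊕ ⟪ + 2 ⟫ ⊗ V →
        E ⊗ conj E ≡ ⟪ κ ⟫ ⊗ ((⟪ g ⟫ ⊗ √-3) ⊗ conj (⟪ g ⟫ ⊗ √-3)) →
        z ≡ g ⊎ z ≡ - g
      twisted-sum-ζ {κ} {E} {V} z g κ≡ eq odd norm = odd-root z g (- + 1 - const V - z - coω V) κ≡
        (trans (p₁ z g) (trans (cong₂ (λ a b → - b - a + (+ 0 - + 2 * z)) (trans (sym (cong const eq)) (cong const odd))
            (trans (sym (cong coω eq)) (cong coω odd))) (p₂ z (const V) (coω V))))
        (ℤₚ.*-cancelˡ-≡ (+ 3) _ _ (trans (n₁ z g) (trans (sym (cong (λ E → const (E ⊗ conj E)) eq)) (trans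
            (cong const norm) (trans (cong const (⟪⟫-*𝔼 κ ((⟪ g ⟫ ⊗ √-3) ⊗ conj (⟪ g ⟫ ⊗ √-3)))) (trans (cong (κ *_)
            (norm-imaginary g)) (n₂ κ g)))))))
        where
        a b : ℤ → ℤ → ℤ
        a z g = const (ζ ⊗ (⟪ z ⟫ ⊗ √-3 ⊕ ζ ⊗ (⟪ g ⟫ ⊗ √-3)))
        b z g = coω (ζ ⊗ (⟪ z ⟫ ⊗ √-3 ⊕ ζ ⊗ (⟪ g ⟫ ⊗ √-3)))
        a≡ : ∀ z g → a z g ≡ g - + 2 * z
        a≡ z g = l z g
          where
          l : ∀ z g → + 0 * ((z * + 1 - + 0 * + 2) + (+ 0 * (g * + 1 - + 0 * + 2) - + 1 * (g * + 2 + + 0 * + 1 - + 0 * + 2)))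
               - + 1 * ((z * + 2 + + 0 * + 1 - + 0 * + 2) + (+ 0 * (g * + 2 + + 0 * + 1 - + 0 * + 2) + + 1 *
                   (g * + 1 - + 0 * + 2) - + 1 * (g * + 2 + + 0 * + 1 - + 0 * + 2))) ≡ g - + 2 * z
          l = solve-∀
        b≡ : ∀ z g → b z g ≡ - z - g
        b≡ z g = l z g
          where
          l : ∀ z g → + 0 * ((z * + 2 + + 0 * + 1 - + 0 * + 2) + (+ 0 * (g * + 2 + + 0 * + 1 - + 0 * + 2) + + 1 *
              (g * + 1 - + 0 * + 2) - + 1 * (g * + 2 + + 0 * + 1 - + 0 * + 2)))
               + + 1 * ((z * + 1 - + 0 * + 2) + (+ 0 * (g * + 1 - + 0 * + 2) - + 1 * (g * + 2 + + 0 * + 1 - + 0 * + 2)))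
               - + 1 * ((z * + 2 + + 0 * + 1 - + 0 * + 2) + (+ 0 * (g * + 2 + + 0 * + 1 - + 0 * + 2) + + 1 *
                   (g * + 1 - + 0 * + 2) - + 1 * (g * + 2 + + 0 * + 1 - + 0 * + 2))) ≡ - z - g
          l = solve-∀
        p₁ : ∀ z g → z ≡ - b z g - a z g + (+ 0 - + 2 * z)
        p₁ z g = sym (trans (cong₂ (λ s t → - s - t + (+ 0 - + 2 * z)) (b≡ z g) (a≡ z g)) (l z g))
          where
          l : ∀ z g → - (- z - g) - (g - + 2 * z) + (+ 0 - + 2 * z) ≡ z
          l = solve-∀
        p₂ : ∀ z v w → - (+ 0 + (+ 2 * w + + 0 * v - + 0 * w)) - (+ 1 + (+ 2 * v - + 0 * w)) + (+ 0 - + 2 * z)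
            ≡ + 1 + + 2 * (- + 1 - v - z - w)
        p₂ = solve-∀
        n₁ : ∀ z g → + 3 * (z * z - z * g + g * g) ≡ a z g * (a z g - b z g) - b z g * (- b z g)
        n₁ z g = sym (trans (cong₂ (λ a b → a * (a - b) - b * (- b)) (a≡ z g) (b≡ z g)) (l z g))
          where
          l : ∀ z g → (g - + 2 * z) * ((g - + 2 * z) - (- z - g)) - (- z - g) * (- (- z - g)) ≡ + 3 * (z * z - z * g + g * g)
          l = solve-∀
        n₂ : ∀ κ g → κ * (+ 3 * (g * g)) ≡ + 3 * (κ * (g * g))
        n₂ = solve-∀
    -- Conjugation exchanges ζ and ζ² while negating z and g, so the case ζ² reduces to the case ζ.
    twisted-sum : ∀ {p κ E V} z g → IsCubeRoot p → p ≢ 1𝔼 → κ ≡ + 1 ⊎ κ ≡ + 3 →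
      E ≡ p ⊗ (⟪ z ⟫ ⊗ √-3 ⊕ p ⊗ (⟪ g ⟫ ⊗ √-3)) →
      E ≡ 1𝔼 ⊕ ⟪ + 2 ⟫ ⊗ V →
      E ⊗ conj E ≡ ⟪ κ ⟫ ⊗ ((⟪ g ⟫ ⊗ √-3) ⊗ conj (⟪ g ⟫ ⊗ √-3)) →
      z ≡ g ⊎ z ≡ - g
    twisted-sum z g is1 p≢1 = contradiction refl p≢1
    twisted-sum z g isζ _   = twisted-sum-ζ z g
    twisted-sum {κ = κ} {E} {V} z g isζ² _ κ≡ eq odd norm = Sum.map ℤₚ.neg-injective ℤₚ.neg-injective
      (twisted-sum-ζ {V = conj V} (- z) (- g) κ≡
        (trans (cong conj eq) (trans (conj-* ζ² _) (cong₂ _⊗_ conj-ζ² (trans (conj-+ _ _)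
          (cong₂ _⊕_ (conj-imaginary z) (trans (conj-* ζ² _) (cong₂ _⊗_ conj-ζ² (conj-imaginary g))))))))
        (trans (cong conj odd) (trans (conj-+ 1𝔼 _) (cong₂ _⊕_ (conj-⟪⟫ (+ 1)) (trans (conj-* _ V) (cong (_⊗ conj V)
            (conj-⟪⟫ (+ 2)))))))
        (trans (swap E) (trans norm (cong (⟪ κ ⟫ ⊗_) (trans (sym (swap (⟪ g ⟫ ⊗ √-3))) (cong (λ t → t ⊗ conj t)
            (conj-imaginary g)))))))
      where
      swap : ∀ E → conj E ⊗ conj (conj E) ≡ E ⊗ conj E
      swap E = trans (cong (conj E ⊗_) (conj-conj E)) (𝔼ᵣ.*-comm (conj E) E)

  -- E = ∑ ψ (M (r⁴ - r²)) is the exponential sum of a quadratic form over 𝔽₃, since r⁴ = r³ r.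
  module QuarticSum {q} (K : Field₃ q) (Ψ : Character K) (h : ℕ)
    (fermat : ∀ x → Field₃._^_ K x (3 ℕ.+ 4 ℕ.* h) ≡ x)
    (cbrt : Fin q → Fin q) (cbrt³ : ∀ x → Field₃._^_ K (cbrt x) 3 ≡ x) (cbrt-³ : ∀ x → cbrt (Field₃._^_ K x 3) ≡ x) where
    open Field₃ K
    open FieldSums K
    open Character Ψ
    open QuadraticCharacter K h fermat
    open GaussSums K Ψ h fermat
    open 𝔼-Solverᴱ
    open Solver₃

    module _ {M : Fin q} (M≢0 : M ≢ 0#) where
      form : Fin q → Fin q
      form r = M * (r * r * (r * r) - r * r)

      open PolarZeros K Ψ using (independent-zeros)
      polar : Fin q → Fin q
      polar = PolarZeros.polar K Ψ M

      E : 𝔼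
      E = ∑ (λ r → ψ (form r))

      ψ-polar : ∀ r s → ψ (M * (r ^ 3 * s + r * s ^ 3 + r * s)) ≡ ψ (polar r * s ^ 3)
      ψ-polar r s = begin
        ψ (M * (r ^ 3 * s + r * s ^ 3 + r * s))
          ≡⟨ trans (cong ψ (solve 3 (λ M r s → M :* (r :^ 3 :* s :+ r :* s :^ 3 :+ r :* s) :=
              (M :* r :^ 3 :* s :+ M :* r :* s) :+ M :* r :* s :^ 3) refl M r s)) (ψ-+ _ _) ⟩
        ψ (M * r ^ 3 * s + M * r * s) ⊗ ψ (M * r * s ^ 3)
          ≡⟨ cong (_⊗ ψ (M * r * s ^ 3)) (ψ-^3 _) ⟨
        ψ ((M * r ^ 3 * s + M * r * s) ^ 3) ⊗ ψ (M * r * s ^ 3)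
          ≡⟨ trans (cong ψ (solve 3 (λ M r s → (M :^ 3 :* (r :^ 3) :^ 3 :+ M :^ 3 :* r :^ 3 :+ M :* r) :* s :^ 3 :=
              (M :* r :^ 3 :* s :+ M :* r :* s) :^ 3 :+ M :* r :* s :^ 3) refl M r s)) (ψ-+ _ _) ⟨
        ψ (polar r * s ^ 3) ∎

      -- On the radical 2 Q(r) = B(r, r) has character value 1, and 2 = - 1. Hence all elements of
      -- the radical contribute equally to |E|².
      ψ-form≡1 : ∀ {r} → polar r ≡ 0# → ψ (form r) ≡ 1𝔼
      ψ-form≡1 {r} eq = begin
        ψ (form r)
          ≡⟨ cong ψ (solve 2 (λ M r → M :* (r :* r :* (r :* r) :- r :* r) := :- (M :*
              (r :^ 3 :* r :+ r :* r :^ 3 :+ r :* r))) refl M r) ⟩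
        ψ (- (M * (r ^ 3 * r + r * r ^ 3 + r * r)))
          ≡⟨ ψ-neg _ ⟩
        conj (ψ (M * (r ^ 3 * r + r * r ^ 3 + r * r)))
          ≡⟨ cong conj (trans (ψ-polar r r) (trans (cong ψ (trans (cong (_* r ^ 3) eq) (zeroˡ (r ^ 3)))) ψ-0)) ⟩
        conj 1𝔼
          ≡⟨ conj-⟪⟫ (+ 1) ⟩
        1𝔼 ∎

      E-norm : E ⊗ conj E ≡ ⟪ + q ⟫ ⊗ ∑ (λ r → δ 0# (polar r))
      E-norm = begin
        E ⊗ conj E
          ≡⟨ ∑-norm (λ r → ψ (form r)) (λ r s → ψ (polar r * s ^ 3)) (λ r s →
               trans (cong (ψ (form (r + s)) ⊗_) (sym (ψ-neg (form s)))) (trans (sym (ψ-+ _ _)) (trans (cong ψ (expand r s))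
                 (trans (ψ-+ _ _) (cong (ψ (form r) ⊗_) (ψ-polar r s)))))) ⟩
        ∑ (λ r → ψ (form r) ⊗ ∑ (λ s → ψ (polar r * s ^ 3)))
          -- Cubing permutes `K`, so s³ may be replaced by a free variable t, and the inner sum
          -- becomes an orthogonality relation.
          ≡⟨ ∑-cong (λ r → cong (ψ (form r) ⊗_) (trans (∑-reindex (λ t → ψ (polar r * t)) (_^ 3) cbrt cbrt³ cbrt-³) (∑ψ
              (polar r)))) ⟩
        ∑ (λ r → ψ (form r) ⊗ (⟪ + q ⟫ ⊗ δ 0# (polar r)))
          ≡⟨ ∑-cong (λ r → trans (solveᴱ 3 (λ a b c → a :*ᴱ (b :*ᴱ c) :=ᴱ b :*ᴱ (c :*ᴱ a)) refl (ψ (form r)) ⟪ + q ⟫ (δ 0#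
              (polar r)))
               (cong (⟪ + q ⟫ ⊗_) (trans (δ-* (λ eq → ψ-form≡1 (sym eq))) (𝔼ᵣ.*-identityʳ (δ 0# (polar r)))))) ⟩
        ∑ (λ r → ⟪ + q ⟫ ⊗ δ 0# (polar r))
          ≡⟨ ∑-*ˡ ⟪ + q ⟫ (λ r → δ 0# (polar r)) ⟩
        ⟪ + q ⟫ ⊗ ∑ (λ r → δ 0# (polar r)) ∎
        where
        expand : ∀ r s → form (r + s) + - form s ≡ form r + M * (r ^ 3 * s + r * s ^ 3 + r * s)
        expand r s = solve 3 (λ M r s → M :* ((r :+ s) :* (r :+ s) :* ((r :+ s) :* (r :+ s)) :- (r :+ s) :* (r :+ s)) :+
            (:- (M :* (s :* s :* (s :* s) :- s :* s)))
          := M :* (r :* r :* (r :* r) :- r :* r) :+ M :* (r :^ 3 :* s :+ r :* s :^ 3 :+ r :* s)) refl M r s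

      polar-0 : polar 0# ≡ 0#
      polar-0 = solve 1 (λ M → M :^ 3 :* (con 0F :^ 3) :^ 3 :+ M :^ 3 :* con 0F :^ 3 :+ M :* con 0F := con 0F) refl M

      polar-neg : ∀ r → polar (- r) ≡ - polar r
      polar-neg r = solve 2 (λ M r → M :^ 3 :* ((:- r) :^ 3) :^ 3 :+ M :^ 3 :* (:- r) :^ 3 :+ M :* (:- r)
        := :- (M :^ 3 :* (r :^ 3) :^ 3 :+ M :^ 3 :* r :^ 3 :+ M :* r)) refl M r

      -- The zeros of the additive map `polar` form a space over 𝔽₃, and `independent-zeros`
      -- excludes dimension two. One nonzero zero s, found by search, therefore leaves just 0, s and
      -- - s.
      zeros : ψ M ≢ 1𝔼 → ∃ λ κ → (κ ≡ + 1 ⊎ κ ≡ + 3) × ∑ (λ r → δ 0# (polar r)) ≡ ⟪ κ ⟫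
      zeros ψM≢1 with any? (λ r → ¬? (r ≟F 0#) ×-dec (polar r ≟F 0#))
      ... | no none = + 1 , inj₁ refl , trans (∑-cong (λ r → δ-⇔ {k = 0#} {l = r} (only-0 r) (λ eq → trans (sym polar-0)
          (cong polar eq)))) (∑-δ1 0#)
        where
        only-0 : ∀ r → 0# ≡ polar r → 0# ≡ r
        only-0 r eq with r ≟F 0#
        ... | yes r≡0 = sym r≡0
        ... | no r≢0  = contradiction (r , r≢0 , sym eq) none
      ... | yes (s , s≢0 , λs≡0) = + 3 , inj₂ refl , trans (∑-cong pointwise)
          (trans (∑-+ (δ 0#) (λ r → δ s r ⊕ δ (- s) r)) (trans (cong₂ _⊕_ (∑-δ1 0#) (trans (∑-+ (δ s) (δ (- s)))
              (cong₂ _⊕_ (∑-δ1 s) (∑-δ1 (- s)))))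
            (solveᴱ 0 (conᴱ (+ 1) :+ᴱ (conᴱ (+ 1) :+ᴱ conᴱ (+ 1)) :=ᴱ conᴱ (+ 3)) refl)))
        where
        pointwise : ∀ r → δ 0# (polar r) ≡ δ 0# r ⊕ (δ s r ⊕ δ (- s) r)
        pointwise r with r ≟F 0#
        ... | yes refl = trans (δ-≡ (sym polar-0)) (sym (trans (cong₂ _⊕_ (δ-≡ refl) (cong₂ _⊕_ (δ-≢ s≢0) (δ-≢ (-≢0 s≢0))))
          (solveᴱ 0 (conᴱ (+ 1) :+ᴱ (conᴱ (+ 0) :+ᴱ conᴱ (+ 0)) :=ᴱ conᴱ (+ 1)) refl)))
        ... | no r≢0 with r ≟F s
        ...   | yes refl = trans (δ-≡ (sym λs≡0)) (sym (trans (cong₂ _⊕_ (δ-≢ (r≢0 ∘ sym)) (cong₂ _⊕_ (δ-≡ refl) (δ-≢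
            (≢0⇒≢- s≢0 ∘ sym))))
          (solveᴱ 0 (conᴱ (+ 0) :+ᴱ (conᴱ (+ 1) :+ᴱ conᴱ (+ 0)) :=ᴱ conᴱ (+ 1)) refl)))
        ...   | no r≢s with r ≟F - s
        ...     | yes refl = trans (δ-≡ (sym (trans (polar-neg s) (trans (cong (-_) λs≡0) (solve 0 (:- con 0F := con 0F) refl)))))
          (sym (trans (cong₂ _⊕_ (δ-≢ (r≢0 ∘ sym)) (cong₂ _⊕_ (δ-≢ (r≢s ∘ sym)) (δ-≡ refl)))
            (solveᴱ 0 (conᴱ (+ 0) :+ᴱ (conᴱ (+ 0) :+ᴱ conᴱ (+ 1)) :=ᴱ conᴱ (+ 1)) refl)))
        ...     | no r≢-s = trans (δ-≢ (λ eq → ψM≢1 (independent-zeros M M≢0 r≢0 s≢0 r≢s r≢-s (sym eq) λs≡0)))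
          (sym (trans (cong₂ _⊕_ (δ-≢ (r≢0 ∘ sym)) (cong₂ _⊕_ (δ-≢ (r≢s ∘ sym)) (δ-≢ (r≢-s ∘ sym))))
            (solveᴱ 0 (conᴱ (+ 0) :+ᴱ (conᴱ (+ 0) :+ᴱ conᴱ (+ 0)) :=ᴱ conᴱ (+ 0)) refl)))

      kernel : Fin q → 𝔼
      kernel z = ψ (M * (z * z - z))

      -- The factor ψ(- M) is the phase that makes the sum purely imaginary, which `conj-Z`
      -- establishes over `F`.
      W Z : 𝔼
      W = ∑ (λ z → η z ⊗ kernel z)
      Z = ψ (- M) ⊗ W

      E≡ : E ≡ ψ (- M) ⊗ Γ M ⊕ W
      E≡ = trans (∑-squares-+ kernel) (cong (_⊕ W) (begin
        ∑ kernel                                         ≡⟨ ∑-cong (λ z → cong ψ (solve 2 (λ M z → M :*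
            (z :* z :- z) := M :* (z :* z) :+ (:- (M :* z))) refl M z)) ⟩
        ∑ (λ z → ψ (M * (z * z) + - (M * z)))            ≡⟨ ∑-quadratic M M≢0 ⟩
        ψ (- (M * M * M ⁻¹)) ⊗ Γ M
          ≡⟨ cong (λ t → ψ (- t) ⊗ Γ M) (trans (*-assoc M M (M ⁻¹)) (trans (cong (M *_) (*-inverse M≢0)) (*-identityʳ M))) ⟩
        ψ (- M) ⊗ Γ M                                    ∎))

      -- The number 1 + η(z) of square roots of z is 0 or 2 except at z = 0, where the kernel has
      -- the value 1; `half` counts the pairs r, - r over z.
      E-odd : ∃ λ V → E ≡ 1𝔼 ⊕ ⟪ + 2 ⟫ ⊗ V
      E-odd = ∑ (λ z → half z ⊗ kernel z) , (begin
        E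
          ≡⟨ ∑-squares kernel ⟩
        ∑ (λ z → (1𝔼 ⊕ η z) ⊗ kernel z)
          ≡⟨ ∑-cong (λ z → trans (cong (_⊗ kernel z) (1+η z)) (solveᴱ 3 (λ a b c → (a :+ᴱ conᴱ
              (+ 2) :*ᴱ b) :*ᴱ c :=ᴱ a :*ᴱ c :+ᴱ conᴱ (+ 2) :*ᴱ (b :*ᴱ c)) refl (δ 0# z) (half z) (kernel z))) ⟩
        ∑ (λ z → δ 0# z ⊗ kernel z ⊕ ⟪ + 2 ⟫ ⊗ (half z ⊗ kernel z))
          ≡⟨ trans (∑-+ (λ z → δ 0# z ⊗ kernel z) (λ z → ⟪ + 2 ⟫ ⊗ (half z ⊗ kernel z))) (cong₂ _⊕_ (∑-δ 0# kernel)
              (∑-*ˡ ⟪ + 2 ⟫ (λ z → half z ⊗ kernel z))) ⟩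
        kernel 0# ⊕ ⟪ + 2 ⟫ ⊗ ∑ (λ z → half z ⊗ kernel z)
          ≡⟨ cong (_⊕ ⟪ + 2 ⟫ ⊗ ∑ (λ z → half z ⊗ kernel z)) (trans (cong ψ (solve 1 (λ M → M :*
              (con 0F :* con 0F :- con 0F) := con 0F) refl M)) ψ-0) ⟩
        1𝔼 ⊕ ⟪ + 2 ⟫ ⊗ ∑ (λ z → half z ⊗ kernel z) ∎)
        where
        halve : ∀ z → ∃ λ s → 1𝔼 ⊕ η z ≡ δ 0# z ⊕ ⟪ + 2 ⟫ ⊗ s
        halve z with squareView z
        ... | is-zero refl = 0𝔼 , trans (cong (1𝔼 ⊕_) η-0) (trans (solveᴱ 0 (conᴱ (+ 1) :+ᴱ conᴱ (+ 0) :=ᴱ conᴱ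
            (+ 1) :+ᴱ conᴱ (+ 2) :*ᴱ conᴱ (+ 0)) refl)
          (cong (_⊕ ⟪ + 2 ⟫ ⊗ 0𝔼) (sym (δ-≡ refl))))
        ... | is-square y y≢0 refl η≡1 = 1𝔼 , trans (cong (1𝔼 ⊕_) η≡1) (trans (solveᴱ 0 (conᴱ (+ 1) :+ᴱ conᴱ
            (+ 1) :=ᴱ conᴱ (+ 0) :+ᴱ conᴱ (+ 2) :*ᴱ conᴱ (+ 1)) refl)
          (cong (_⊕ ⟪ + 2 ⟫ ⊗ 1𝔼) (sym (δ-≢ (*-≢0 y≢0 y≢0 ∘ sym)))))
        ... | is-neg y y≢0 refl η≡-1 = 0𝔼 , trans (cong (1𝔼 ⊕_) η≡-1) (trans (solveᴱ 0 (conᴱ (+ 1) :+ᴱ (:-ᴱ conᴱ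
            (+ 1)) :=ᴱ conᴱ (+ 0) :+ᴱ conᴱ (+ 2) :*ᴱ conᴱ (+ 0)) refl)
          (cong (_⊕ ⟪ + 2 ⟫ ⊗ 0𝔼) (sym (δ-≢ (-≢0 (*-≢0 y≢0 y≢0) ∘ sym)))))
        half : Fin q → 𝔼
        half z = proj₁ (halve z)
        1+η : ∀ z → 1𝔼 ⊕ η z ≡ δ 0# z ⊕ ⟪ + 2 ⟫ ⊗ half z
        1+η z = proj₂ (halve z)

      Z≡±Γ : ψ M ≢ 1𝔼 → conj Z ≡ ⊖ Z → Z ≡ Γ M ⊎ Z ≡ ⊖ Γ M
      Z≡±Γ ψM≢1 conj-Z with zeros ψM≢1
      ... | κ , κ≡ , zeros≡ = Sum.map
        (λ eq → trans Z≡ (trans (cong (λ t → ⟪ t ⟫ ⊗ √-3) eq) (sym Γ≡)))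
        (λ eq → trans Z≡ (trans (cong (λ t → ⟪ t ⟫ ⊗ √-3) eq) (trans (cong (_⊗ √-3) (⟪⟫-neg (const (Γ M))))
          (trans (solveᴱ 2 (λ a b → (:-ᴱ a) :*ᴱ b :=ᴱ :-ᴱ (a :*ᴱ b)) refl ⟪ const (Γ M) ⟫ √-3) (cong ⊖_ (sym Γ≡))))))
        (Imaginary.twisted-sum {V = proj₁ E-odd} (const Z) (const (Γ M)) (ψ-root M) ψM≢1 κ≡
          (trans E≡ψ (cong₂ (λ a b → ψ M ⊗ (a ⊕ ψ M ⊗ b)) Z≡ Γ≡))
          (proj₂ E-odd)
          (trans E-norm (trans (cong₂ _⊗_ (sym (Γ-norm M≢0)) zeros≡) (trans (𝔼ᵣ.*-comm (Γ M ⊗ conj (Γ M)) ⟪ κ ⟫) (cong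
              (λ t → ⟪ κ ⟫ ⊗ (t ⊗ conj t)) Γ≡)))))
        where
        Z≡ : Z ≡ ⟪ const Z ⟫ ⊗ √-3
        Z≡ = conj≡-⇒imaginary Z conj-Z
        Γ≡ : Γ M ≡ ⟪ const (Γ M) ⟫ ⊗ √-3
        Γ≡ = conj≡-⇒imaginary (Γ M) (conj-Γ M≢0)
        -- The first term of `E≡` is rewritten by ψ(- M) = ψ(M)², the second by ψ(M) ψ(- M) = 1, to
        -- reach the shape that `twisted-sum` expects with p = ψ(M).
        E≡ψ : E ≡ ψ M ⊗ (Z ⊕ ψ M ⊗ Γ M)
        E≡ψ = begin
          E                                                  ≡⟨ E≡ ⟩
          ψ (- M) ⊗ Γ M ⊕ W
            ≡⟨ cong₂ (λ a b → a ⊗ Γ M ⊕ b) (trans (cube-root-* (ψ-root M)) (sym (ψ-neg M))) (trans (cong (_⊗ W) ψM*ψ-M)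
                (𝔼ᵣ.*-identityˡ W)) ⟨
          ψ M ⊗ ψ M ⊗ Γ M ⊕ ψ M ⊗ ψ (- M) ⊗ W
            ≡⟨ solveᴱ 4 (λ a b g w → a :*ᴱ a :*ᴱ g :+ᴱ a :*ᴱ b :*ᴱ w :=ᴱ a :*ᴱ (b :*ᴱ w :+ᴱ a :*ᴱ g)) refl (ψ M) (ψ (- M))
                (Γ M) W ⟩
          ψ M ⊗ (Z ⊕ ψ M ⊗ Γ M)                              ∎
          where
          ψM*ψ-M : ψ M ⊗ ψ (- M) ≡ 1𝔼
          ψM*ψ-M = trans (cong (ψ M ⊗_) (ψ-neg M)) (cube-root-conj (ψ-root M))

-- Sums over lines and over the plane K × K.

module PlaneSums where

  open EisensteinIntegers
  open FiniteSums
  open TernaryFields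
  open AdditiveCharacters
  open GaussSumsOverK
  open QuarticSums
  open import Data.Fin.Base using (Fin)
  open import Data.Fin.Patterns using (0F; 1F)
  open import Data.Fin.Properties using () renaming (_≟_ to _≟F_)
  open import Data.Integer.Base using (+_)
  open import Data.Nat.Base as ℕ using (ℕ)
  open import Function.Base using (_∘_)
  open import Relation.Binary.PropositionalEquality
  open import Relation.Nullary using (yes; no)
  open ≡-Reasoning

  module Plane {q} (K : Field₃ q) (Ψ : Character K) (h : ℕ)
    (fermat : ∀ x → Field₃._^_ K x (3 ℕ.+ 4 ℕ.* h) ≡ x)
    (cbrt : Fin q → Fin q) (cbrt³ : ∀ x → Field₃._^_ K (cbrt x) 3 ≡ x) (cbrt-³ : ∀ x → cbrt (Field₃._^_ K x 3) ≡ x) where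
    open Field₃ K
    open FieldSums K
    open Character Ψ
    open QuadraticCharacter K h fermat
    open GaussSums K Ψ h fermat
    open QuarticSum K Ψ h fermat cbrt cbrt³ cbrt-³
    open 𝔼-Solverᴱ
    open Solver₃

    q₋₁ : 𝔼
    q₋₁ = ⟪ + q ⟫ ⊕ ⊖ 1𝔼

    ∑-nonzero : ∀ X → ∑ {q} (λ y → (1𝔼 ⊕ ⊖ δ 0# y) ⊗ X) ≡ q₋₁ ⊗ X
    ∑-nonzero X = trans (∑-cong (λ y → solveᴱ 2 (λ d x → (conᴱ (+ 1) :+ᴱ (:-ᴱ d)) :*ᴱ x :=ᴱ x :+ᴱ (:-ᴱ conᴱ (+ 1)) :*ᴱ
        (d :*ᴱ x)) refl (δ 0# y) X))
      (trans (∑-+ (λ _ → X) (λ y → ⊖ 1𝔼 ⊗ (δ 0# y ⊗ X))) (trans (cong₂ _⊕_ (∑-const q X) (trans (∑-*ˡ (⊖ 1𝔼)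
          (λ y → δ 0# y ⊗ X)) (cong (⊖ 1𝔼 ⊗_) (∑-δ 0# (λ _ → X)))))
        (solveᴱ 2 (λ n x → n :*ᴱ x :+ᴱ (:-ᴱ conᴱ (+ 1)) :*ᴱ x :=ᴱ (n :+ᴱ (:-ᴱ conᴱ (+ 1))) :*ᴱ x) refl ⟪ + q ⟫ X)))

    ψ-Φ : Fin q → 𝔼
    ψ-Φ t = ψ t ⊕ ψ (- t)

    -- Passing from A to - A negates both the Gauss sum and B² / A. Hence the difference in the
    -- summand comes out as a sum of two conjugate character values.
    ∑-line : ∀ {A} B → A ≢ 0# →
             ∑ (λ y → (ψ (A * (y * y)) ⊕ ⊖ ψ (- (A * (y * y)))) ⊗ ψ (- (B * y))) ≡ Γ A ⊗ ψ-Φ (B * B * A ⁻¹)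
    ∑-line {A} B A≢0 = begin
      ∑ (λ y → (ψ (A * (y * y)) ⊕ ⊖ ψ (- (A * (y * y)))) ⊗ ψ (- (B * y)))
        ≡⟨ ∑-cong (λ y → trans (solveᴱ 3 (λ a b c → (a :+ᴱ (:-ᴱ b)) :*ᴱ c :=ᴱ a :*ᴱ c :+ᴱ (:-ᴱ conᴱ (+ 1)) :*ᴱ
            (b :*ᴱ c)) refl (ψ (A * (y * y))) (ψ (- (A * (y * y)))) (ψ (- (B * y))))
             (cong₂ (λ s t → s ⊕ ⊖ 1𝔼 ⊗ t) (sym (ψ-+ _ _)) (trans (sym (ψ-+ _ _)) (cong (λ t → ψ (t + - (B * y))) (solve 2
                 (λ A y → :- (A :* y) := (:- A) :* y) refl A (y * y)))))) ⟩
      ∑ (λ y → ψ (A * (y * y) + - (B * y)) ⊕ ⊖ 1𝔼 ⊗ ψ (- A * (y * y) + - (B * y)))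
        ≡⟨ trans (∑-+ (λ y → ψ (A * (y * y) + - (B * y))) (λ y → ⊖ 1𝔼 ⊗ ψ (- A * (y * y) + - (B * y)))) (cong (∑ (λ y → ψ
            (A * (y * y) + - (B * y))) ⊕_) (∑-*ˡ (⊖ 1𝔼) (λ y → ψ (- A * (y * y) + - (B * y))))) ⟩
      ∑ (λ y → ψ (A * (y * y) + - (B * y))) ⊕ ⊖ 1𝔼 ⊗ ∑ (λ y → ψ (- A * (y * y) + - (B * y)))
        ≡⟨ cong₂ (λ s t → s ⊕ ⊖ 1𝔼 ⊗ t) (∑-quadratic B A≢0) (trans (∑-quadratic B (-≢0 A≢0)) (cong₂ _⊗_ (cong ψ eq)
            (Γ-neg A≢0))) ⟩
      ψ (- (B * B * A ⁻¹)) ⊗ Γ A ⊕ ⊖ 1𝔼 ⊗ (ψ (B * B * A ⁻¹) ⊗ ⊖ Γ A)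
        ≡⟨ solveᴱ 3 (λ g s t → t :*ᴱ g :+ᴱ (:-ᴱ conᴱ (+ 1)) :*ᴱ (s :*ᴱ (:-ᴱ g)) :=ᴱ g :*ᴱ (s :+ᴱ t)) refl (Γ A) (ψ
            (B * B * A ⁻¹)) (ψ (- (B * B * A ⁻¹))) ⟩
      Γ A ⊗ ψ-Φ (B * B * A ⁻¹) ∎
      where
      eq : - (B * B * (- A) ⁻¹) ≡ B * B * A ⁻¹
      eq = trans (cong (λ t → - (B * B * t)) (⁻¹-neg A≢0)) (solve 2 (λ b a → :- (b :* (:- a)) := b :* a) refl (B * B) (A ⁻¹))

    -- α² + β² is the norm of α + i β, so this is the sum of ψ(c N(x)) over `F`; it splits into two
    -- equal Gauss sums.
    ∑-plane : ∀ {c} → c ≢ 0# → ∑ (λ α → ∑ (λ β → ψ (c * (α * α + β * β)))) ≡ ⊖ ⟪ + q ⟫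
    ∑-plane {c} c≢0 = begin
      ∑ (λ α → ∑ (λ β → ψ (c * (α * α + β * β))))
        ≡⟨ ∑-cong (λ α → trans (∑-cong (λ β → trans (cong ψ (distribˡ c (α * α) (β * β))) (ψ-+ _ _))) (∑-*ˡ (ψ (c *
            (α * α))) (λ β → ψ (c * (β * β))))) ⟩
      ∑ (λ α → ψ (c * (α * α)) ⊗ Γ c)
        ≡⟨ ∑-*ʳ (Γ c) (λ α → ψ (c * (α * α))) ⟩
      Γ c ⊗ Γ c
        ≡⟨ Γ² c≢0 ⟩
      ⊖ ⟪ + q ⟫ ∎

    module _ {M : Fin q} (M≢0 : M ≢ 0#) where
      -- The contribution of a square x = w² to the sum `Z′` over `F`, in terms of n = N(w) and ν =
      -- T(w)² / N(w).
      quartic : Fin q → Fin q → 𝔼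
      quartic n ν = η n ⊗ ψ (M * (ν * ν - ν - 1#))

      private
        point : Fin q → Fin q → 𝔼
        point α β = quartic (α * α + β * β) (α * α * (α * α + β * β) ⁻¹)

        Y : 𝔼
        Y = ∑ (λ γ → quartic (1# + γ * γ) ((1# + γ * γ) ⁻¹))

      row-0 : ∑ (point 0#) ≡ q₋₁ ⊗ ψ (- M)
      row-0 = trans (∑-cong (λ β → begin
        point 0# β
          ≡⟨ cong₂ (λ n ν → η n ⊗ ψ (M * (ν * ν - ν - 1#))) (solve 1 (λ b → con 0F :* con 0F :+ b :* b := b :* b) refl β)
               (solve 1 (λ i → con 0F :* con 0F :* i := con 0F) refl ((0# * 0# + β * β) ⁻¹)) ⟩
        η (β * β) ⊗ ψ (M * (0# * 0# - 0# - 1#))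
          ≡⟨ cong₂ _⊗_ (η-β² β) (cong ψ (solve 1 (λ M → M :* (con 0F :* con 0F :- con 0F :- con 1F) := :- M) refl M)) ⟩
        (1𝔼 ⊕ ⊖ δ 0# β) ⊗ ψ (- M) ∎)) (∑-nonzero (ψ (- M)))
        where
        η-β² : ∀ β → η (β * β) ≡ 1𝔼 ⊕ ⊖ δ 0# β
        η-β² β with β ≟F 0#
        ... | yes refl = trans (trans (cong η (zeroˡ 0#)) η-0) (sym (trans (cong (λ d → 1𝔼 ⊕ ⊖ d) (δ-≡ refl)) (𝔼ᵣ.-‿inverseʳ 1𝔼)))
        ... | no β≢0   = trans (η-square β≢0) (sym (trans (cong (λ d → 1𝔼 ⊕ ⊖ d) (δ-≢ (β≢0 ∘ sym))) (solveᴱ 0 (conᴱ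
            (+ 1) :+ᴱ (:-ᴱ conᴱ (+ 0)) :=ᴱ conᴱ (+ 1)) refl)))

      -- Along β = α γ the norm is the square α² times 1 + γ², and ν = 1 / (1 + γ²) does not involve
      -- α. Thus all rows with α ≠ 0 have the same sum.
      row : ∀ {α} → α ≢ 0# → ∑ (point α) ≡ Y
      row {α} α≢0 = trans (sym (∑-scale (point α) α≢0)) (∑-cong (λ γ → begin
        quartic (α * α + α * γ * (α * γ)) (α * α * (α * α + α * γ * (α * γ)) ⁻¹)
          ≡⟨ cong (λ t → quartic t (α * α * t ⁻¹)) (solve 2 (λ a g → a :* a :+ a :* g :* (a :* g) := a :* a :*
              (con 1F :+ g :* g)) refl α γ) ⟩
        quartic (α * α * (1# + γ * γ)) (α * α * (α * α * (1# + γ * γ)) ⁻¹)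
          ≡⟨ cong₂ quartic′ (trans (η-* (α * α) (1# + γ * γ)) (trans (cong (_⊗ η (1# + γ * γ)) (η-square α≢0))
              (𝔼ᵣ.*-identityˡ _)))
               (trans (cong (α * α *_) (⁻¹-* (α * α) (1# + γ * γ))) (trans (sym (*-assoc (α * α) ((α * α) ⁻¹) _)) (trans
                   (cong (_* (1# + γ * γ) ⁻¹) (*-inverse (*-≢0 α≢0 α≢0))) (*-identityˡ _)))) ⟩
        quartic (1# + γ * γ) ((1# + γ * γ) ⁻¹) ∎))
        where
        quartic′ : 𝔼 → Fin q → 𝔼
        quartic′ s ν = s ⊗ ψ (M * (ν * ν - ν - 1#))

      -- This is `∑-conic` for the kernel ψ(M (z² - z)), which is invariant under z ↦ 1 - z,
      -- multiplied by ψ(- M). The term ψ(- M) outside `Y` comes from the row α = 0.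
      Y≡ : ψ (- M) ⊕ Y ≡ Z M≢0 ⊕ Z M≢0
      Y≡ = begin
        ψ (- M) ⊕ Y
          ≡⟨ cong₂ _⊕_ (trans (sym (𝔼ᵣ.*-identityʳ (ψ (- M)))) (cong (ψ (- M) ⊗_) (sym kernel-0)))
               (trans (∑-cong (λ γ → trans (cong (η (1# + γ * γ) ⊗_) (trans (cong ψ (split ((1# + γ * γ) ⁻¹))) (ψ-+ _ _)))
                  (solveᴱ 3 (λ a b c → a :*ᴱ (b :*ᴱ c) :=ᴱ b :*ᴱ (a :*ᴱ c)) refl (η (1# + γ * γ)) (ψ (- M)) (kernel M≢0
                      ((1# + γ * γ) ⁻¹)))))
               (∑-*ˡ (ψ (- M)) (λ γ → η (1# + γ * γ) ⊗ kernel M≢0 ((1# + γ * γ) ⁻¹)))) ⟩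
        ψ (- M) ⊗ kernel M≢0 0# ⊕ ψ (- M) ⊗ ∑ (λ γ → η (1# + γ * γ) ⊗ kernel M≢0 ((1# + γ * γ) ⁻¹))
          ≡⟨ 𝔼ᵣ.distribˡ (ψ (- M)) _ _ ⟨
        ψ (- M) ⊗ (kernel M≢0 0# ⊕ ∑ (λ γ → η (1# + γ * γ) ⊗ kernel M≢0 ((1# + γ * γ) ⁻¹)))
          ≡⟨ cong (ψ (- M) ⊗_) (∑-conic (kernel M≢0) (λ z → cong ψ (solve 2 (λ M z → M :* ((con 1F :- z) :*
              (con 1F :- z) :- (con 1F :- z)) := M :* (z :* z :- z)) refl M z))) ⟩
        ψ (- M) ⊗ (W M≢0 ⊕ W M≢0)
          ≡⟨ 𝔼ᵣ.distribˡ (ψ (- M)) _ _ ⟩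
        Z M≢0 ⊕ Z M≢0 ∎
        where
        kernel-0 : kernel M≢0 0# ≡ 1𝔼
        kernel-0 = trans (cong ψ (solve 1 (λ M → M :* (con 0F :* con 0F :- con 0F) := con 0F) refl M)) ψ-0
        split : ∀ ν → M * (ν * ν - ν - 1#) ≡ - M + M * (ν * ν - ν)
        split ν = solve 2 (λ M ν → M :* (ν :* ν :- ν :- con 1F) := (:- M) :+ M :* (ν :* ν :- ν)) refl M ν

      ∑-quartic : ∑ (λ α → ∑ (λ β → quartic (α * α + β * β) (α * α * (α * α + β * β) ⁻¹))) ≡ q₋₁ ⊗ (Z M≢0 ⊕ Z M≢0)
      ∑-quartic = begin
        ∑ (λ α → ∑ (point α))
          ≡⟨ ∑-cong rows ⟩
        ∑ (λ α → δ 0# α ⊗ (q₋₁ ⊗ ψ (- M)) ⊕ (1𝔼 ⊕ ⊖ δ 0# α) ⊗ Y)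
          ≡⟨ trans (∑-+ (λ α → δ 0# α ⊗ (q₋₁ ⊗ ψ (- M))) (λ α → (1𝔼 ⊕ ⊖ δ 0# α) ⊗ Y)) (cong₂ _⊕_ (∑-δ 0# (λ _ → q₋₁ ⊗ ψ
              (- M))) (∑-nonzero Y)) ⟩
        q₋₁ ⊗ ψ (- M) ⊕ q₋₁ ⊗ Y
          ≡⟨ 𝔼ᵣ.distribˡ q₋₁ (ψ (- M)) Y ⟨
        q₋₁ ⊗ (ψ (- M) ⊕ Y)
          ≡⟨ cong (q₋₁ ⊗_) Y≡ ⟩
        q₋₁ ⊗ (Z M≢0 ⊕ Z M≢0) ∎
        where
        rows : ∀ α → ∑ (point α) ≡ δ 0# α ⊗ (q₋₁ ⊗ ψ (- M)) ⊕ (1𝔼 ⊕ ⊖ δ 0# α) ⊗ Y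
        rows α with α ≟F 0#
        ... | yes refl = trans row-0 (trans (solveᴱ 2 (λ r y → r :=ᴱ conᴱ (+ 1) :*ᴱ r :+ᴱ (conᴱ (+ 1) :+ᴱ (:-ᴱ conᴱ
            (+ 1))) :*ᴱ y) refl (q₋₁ ⊗ ψ (- M)) Y)
          (cong (λ d → d ⊗ (q₋₁ ⊗ ψ (- M)) ⊕ (1𝔼 ⊕ ⊖ d) ⊗ Y) (sym (δ-≡ refl))))
        ... | no α≢0 = trans (row α≢0) (trans (solveᴱ 2 (λ r y → y :=ᴱ conᴱ (+ 0) :*ᴱ r :+ᴱ (conᴱ (+ 1) :+ᴱ (:-ᴱ conᴱ
            (+ 0))) :*ᴱ y) refl (q₋₁ ⊗ ψ (- M)) Y)
          (cong (λ d → d ⊗ (q₋₁ ⊗ ψ (- M)) ⊕ (1𝔼 ⊕ ⊖ d) ⊗ Y) (sym (δ-≢ (α≢0 ∘ sym)))))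

-- The quadratic extension F = K (i): trace, norm and quartic residue symbol.

module QuadraticExtensions where

  open TernaryFields
  open import Data.Fin.Base using (Fin)
  open import Data.Fin.Patterns using (1F)
  open import Data.Fin.Base using (combine; remQuot)
  open import Data.Fin.Permutation as Perm using (↔⇒≡)
  open import Data.Fin.Properties using (remQuot-combine; combine-remQuot) renaming ()
  import Data.Nat.Properties as ℕₚ
  open import Relation.Binary.Definitions using (tri<; tri≈; tri>)
  open import Data.Nat.Base as ℕ using (ℕ; zero; suc)
  open import Data.Nat.Solver using (module +-*-Solver)
  open import Data.Product.Base using (∃; _,_; proj₁; proj₂)
  open import Data.Sum.Base as Sum using (inj₁; inj₂)
  open import Function.Base using (_∘_)
  open import Relation.Binary.PropositionalEquality
  open import Relation.Nullary using (contradiction)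
  open ≡-Reasoning

  open +-*-Solver using () renaming (solve to solveℕ; con to conℕ; _:+_ to _:+ℕ_; _:*_ to _:*ℕ_; _:=_ to _:=ℕ_)

  -- F = K (i) with i² = - 1, where K is the fixed field of x ↦ x ^ r and r = √|F| = 8 g + 3
  record QuadraticExtension {N q} (F : Field₃ N) (K : Field₃ q) : Set where
    open Field₃ F
    open Field₃ K using () renaming (_+_ to _+ₖ_; _*_ to _*ₖ_; -_ to -ₖ_; 0# to 0ₖ; 1# to 1ₖ; _^_ to _^ₖ_)

    field
      r         : ℕ
      N≡        : N ≡ r ℕ.* r
      g         : ℕ
      r≡        : r ≡ 3 ℕ.+ 4 ℕ.* (2 ℕ.* g)

    bar : Fin N → Fin N
    bar x = x ^ r

    field
      bar-+     : ∀ x y → bar (x + y) ≡ bar x + bar y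
      bar-bar   : ∀ x → bar (bar x) ≡ x
      j         : Fin q → Fin N
      j-+       : ∀ x y → j (x +ₖ y) ≡ j x + j y
      j-*       : ∀ x y → j (x *ₖ y) ≡ j x * j y
      j-1       : j 1ₖ ≡ 1#
      j-inj     : ∀ {x y} → j x ≡ j y → x ≡ y
      bar-j     : ∀ y → bar (j y) ≡ j y
      restrict  : ∀ x → bar x ≡ x → ∃ λ y → j y ≡ x
      i         : Fin N
      i²        : i * i ≡ - 1#
      bar-i     : bar i ≡ - i

    h : ℕ
    h = 2 ℕ.* g

    opaque
      -- (r² - 1) / 4
      e : ℕ
      e = (2 ℕ.+ 4 ℕ.* h) ℕ.* (1 ℕ.+ h)

      e≡ : e ≡ (2 ℕ.+ 4 ℕ.* h) ℕ.* (1 ℕ.+ h)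
      e≡ = refl

      e-suc : e ≡ suc (h ℕ.+ (1 ℕ.+ 4 ℕ.* h) ℕ.* (1 ℕ.+ h))
      e-suc = refl

      1+4e : 1 ℕ.+ e ℕ.* 4 ≡ r ℕ.* r
      1+4e = trans (solveℕ 1 (λ h → conℕ 1 :+ℕ (conℕ 2 :+ℕ conℕ 4 :*ℕ h) :*ℕ (conℕ 1 :+ℕ h) :*ℕ conℕ 4
        :=ℕ (conℕ 3 :+ℕ conℕ 4 :*ℕ h) :*ℕ (conℕ 3 :+ℕ conℕ 4 :*ℕ h)) refl h) (sym (cong (λ r → r ℕ.* r) r≡))

      e+e : e ℕ.+ e ≡ (1 ℕ.+ r) ℕ.* (1 ℕ.+ 2 ℕ.* h)
      e+e = trans (solveℕ 1 (λ h → (conℕ 2 :+ℕ conℕ 4 :*ℕ h) :*ℕ (conℕ 1 :+ℕ h) :+ℕ (conℕ 2 :+ℕ conℕ 4 :*ℕ h) :*ℕ (conℕ 1 :+ℕ h)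
        :=ℕ (conℕ 1 :+ℕ (conℕ 3 :+ℕ conℕ 4 :*ℕ h)) :*ℕ (conℕ 1 :+ℕ conℕ 2 :*ℕ h)) refl h)
        (sym (cong (λ r → (1 ℕ.+ r) ℕ.* (1 ℕ.+ 2 ℕ.* h)) r≡))

      -- r ≡ 3 mod 8 makes (r - 1) (r + 1) exactly divisible by 8. The odd cofactor is what yields
      -- χ(i) = (- 1)^odd = - 1.
      e-odd : e ≡ 2 ℕ.* (1 ℕ.+ 2 ℕ.* (3 ℕ.* g ℕ.+ 4 ℕ.* (g ℕ.* g)))
      e-odd = solveℕ 1 (λ g → (conℕ 2 :+ℕ conℕ 4 :*ℕ (conℕ 2 :*ℕ g)) :*ℕ (conℕ 1 :+ℕ conℕ 2 :*ℕ g)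
        :=ℕ conℕ 2 :*ℕ (conℕ 1 :+ℕ conℕ 2 :*ℕ (conℕ 3 :*ℕ g :+ℕ conℕ 4 :*ℕ (g :*ℕ g)))) refl g

    -- The quartic residue symbol of `F`, with its values in `F` itself: 0, ± 1 and ± i.
    χ : Fin N → Fin N
    χ x = x ^ e

    open Solver₃

    bar-* : ∀ x y → bar (x * y) ≡ bar x * bar y
    bar-* x y = ^-distrib-* x y r

    bar-neg : ∀ x → bar (- x) ≡ - bar x
    bar-neg x = trans (solve 2 (λ p s → p := p :+ s :- s) refl (bar (- x)) (bar x))
      (trans (cong (_- bar x) (trans (sym (bar-+ (- x) x)) (trans (cong bar (-‿inverseˡ x)) bar-0))) (+-identityˡ (- bar x)))
      where
      bar-0 : bar 0# ≡ 0#
      bar-0 = trans (cong (0# ^_) r≡) (0^suc (2 ℕ.+ 4 ℕ.* (2 ℕ.* g)))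

    j-0 : j 0ₖ ≡ 0#
    j-0 = trans (solve 1 (λ x → x := (x :+ x) :- x) refl (j 0ₖ)) (trans (cong (_- j 0ₖ) (trans (sym (j-+ 0ₖ 0ₖ)) (cong j
        (Field₃.+-identityˡ K 0ₖ)))) (-‿inverseʳ (j 0ₖ)))

    j-neg : ∀ x → j (-ₖ x) ≡ - j x
    j-neg x = trans (solve 2 (λ p s → p := p :+ s :- s) refl (j (-ₖ x)) (j x))
      (trans (cong (_- j x) (trans (sym (j-+ (-ₖ x) x)) (trans (cong j (Field₃.-‿inverseˡ K x)) j-0))) (+-identityˡ (- j x)))

    j-^ : ∀ x n → j (x ^ₖ n) ≡ j x ^ n
    j-^ x zero    = j-1
    j-^ x (suc n) = trans (j-* x (x ^ₖ n)) (cong (j x *_) (j-^ x n))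

    j≢0 : ∀ {x} → x ≢ 0ₖ → j x ≢ 0#
    j≢0 x≢0 eq = x≢0 (j-inj (trans eq (sym j-0)))

    opaque
      T Nm : Fin N → Fin q
      T x = proj₁ (restrict (x + bar x) (trans (bar-+ x (bar x)) (trans (cong (bar x +_) (bar-bar x)) (+-comm (bar x) x))))
      Nm x = proj₁ (restrict (x * bar x) (trans (bar-* x (bar x)) (trans (cong (bar x *_) (bar-bar x)) (*-comm (bar x) x))))

      j-T : ∀ x → j (T x) ≡ x + bar x
      j-T x = proj₂ (restrict (x + bar x) _)

      j-N : ∀ x → j (Nm x) ≡ x * bar x
      j-N x = proj₂ (restrict (x * bar x) _)

    T-neg : ∀ x → T (- x) ≡ -ₖ T x
    T-neg x = j-inj (begin
      j (T (- x))                   ≡⟨ j-T (- x) ⟩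
      - x + bar (- x)               ≡⟨ cong (- x +_) (bar-neg x) ⟩
      - x + - bar x                 ≡⟨ solve 2 (λ x y → (:- x) :+ (:- y) := :- (x :+ y)) refl x (bar x) ⟩
      - (x + bar x)                 ≡⟨ cong -_ (j-T x) ⟨
      - j (T x)                     ≡⟨ j-neg (T x) ⟨
      j (-ₖ T x)                    ∎)

    T-j* : ∀ y x → T (j y * x) ≡ y *ₖ T x
    T-j* y x = j-inj (begin
      j (T (j y * x))               ≡⟨ j-T (j y * x) ⟩
      j y * x + bar (j y * x)       ≡⟨ cong (j y * x +_) (trans (bar-* (j y) x) (cong (_* bar x) (bar-j y))) ⟩
      j y * x + j y * bar x         ≡⟨ distribˡ (j y) x (bar x) ⟨
      j y * (x + bar x)             ≡⟨ cong (j y *_) (j-T x) ⟨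
      j y * j (T x)                 ≡⟨ j-* y (T x) ⟨
      j (y *ₖ T x)                  ∎)

    T-bar : ∀ x → T (bar x) ≡ T x
    T-bar x = j-inj (trans (j-T (bar x)) (trans (cong (bar x +_) (bar-bar x)) (trans (+-comm (bar x) x) (sym (j-T x)))))

    T-0 : T 0# ≡ 0ₖ
    T-0 = trans (cong T (trans (sym (zeroˡ 0#)) (cong (_* 0#) (sym j-0)))) (trans (T-j* 0ₖ 0#) (Field₃.zeroˡ K (T 0#)))

    N-* : ∀ x y → Nm (x * y) ≡ Nm x *ₖ Nm y
    N-* x y = j-inj (begin
      j (Nm (x * y))                ≡⟨ j-N (x * y) ⟩
      x * y * bar (x * y)           ≡⟨ cong (x * y *_) (bar-* x y) ⟩
      x * y * (bar x * bar y)       ≡⟨ solve 4 (λ x y a b → x :* y :* (a :* b) := (x :* a) :* (y :* b)) refl x y (bar x) (bar y) ⟩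
      x * bar x * (y * bar y)       ≡⟨ cong₂ _*_ (j-N x) (j-N y) ⟨
      j (Nm x) * j (Nm y)           ≡⟨ j-* (Nm x) (Nm y) ⟨
      j (Nm x *ₖ Nm y)              ∎)

    N-j : ∀ y → Nm (j y) ≡ y *ₖ y
    N-j y = j-inj (trans (j-N (j y)) (trans (cong (j y *_) (bar-j y)) (sym (j-* y y))))

    N-bar : ∀ x → Nm (bar x) ≡ Nm x
    N-bar x = j-inj (trans (j-N (bar x)) (trans (cong (bar x *_) (bar-bar x)) (trans (*-comm (bar x) x) (sym (j-N x)))))

    N-0 : Nm 0# ≡ 0ₖ
    N-0 = j-inj (trans (j-N 0#) (trans (zeroˡ (bar 0#)) (sym j-0)))

    N-1 : Nm 1# ≡ 1ₖ
    N-1 = trans (cong Nm (sym j-1)) (trans (N-j 1ₖ) (Field₃.*-identityˡ K 1ₖ))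

    N≢0 : ∀ {x} → x ≢ 0# → Nm x ≢ 0ₖ
    N≢0 {x} x≢0 eq = *-≢0 x≢0 (^-≢0 r x≢0) (trans (sym (j-N x)) (trans (cong j eq) j-0))

    N-i* : ∀ x → Nm (i * x) ≡ Nm x
    N-i* x = trans (N-* i x) (trans (cong (_*ₖ Nm x) (j-inj (trans (j-N i) (trans (cong (i *_) bar-i)
      (trans (solve 1 (λ i → i :* (:- i) := :- (i :* i)) refl i) (trans (cong -_ i²) (trans (solve 0 (:-
          (:- con 1F) := con 1F) refl) (sym j-1)))))))) (Field₃.*-identityˡ K (Nm x)))

    j-T-i* : ∀ x → j (T (i * x)) ≡ i * (x - bar x)
    j-T-i* x = trans (j-T (i * x)) (trans (cong (i * x +_) (trans (bar-* i x) (cong (_* bar x) bar-i)))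
      (solve 3 (λ i x y → i :* x :+ (:- i) :* y := i :* (x :- y)) refl i x (bar x)))

    -- (x + x̄)² - (x - x̄)² = 4 x x̄ with 4 = 1, where T(i x) = i (x - x̄). It is the source of θ(i
    -- x) = 1 - θ(x) below.
    T²-i* : ∀ x → T (i * x) *ₖ T (i * x) +ₖ T x *ₖ T x ≡ Nm x
    T²-i* x = j-inj (begin
      j (T (i * x) *ₖ T (i * x) +ₖ T x *ₖ T x)
        ≡⟨ trans (j-+ _ _) (cong₂ _+_ (j-* _ _) (j-* _ _)) ⟩
      j (T (i * x)) * j (T (i * x)) + j (T x) * j (T x)
        ≡⟨ cong₂ (λ a b → a * a + b * b) (j-T-i* x) (j-T x) ⟩
      i * (x - bar x) * (i * (x - bar x)) + (x + bar x) * (x + bar x)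
        ≡⟨ solve 3 (λ i x y → i :* (x :- y) :* (i :* (x :- y)) :+ (x :+ y) :* (x :+ y) := (i :* i) :* ((x :- y) :*
            (x :- y)) :+ (x :+ y) :* (x :+ y)) refl i x (bar x) ⟩
      i * i * ((x - bar x) * (x - bar x)) + (x + bar x) * (x + bar x)
        ≡⟨ cong (λ t → t * ((x - bar x) * (x - bar x)) + (x + bar x) * (x + bar x)) i² ⟩
      - 1# * ((x - bar x) * (x - bar x)) + (x + bar x) * (x + bar x)
        ≡⟨ solve 2 (λ x y → (:- con 1F) :* ((x :- y) :* (x :- y)) :+ (x :+ y) :* (x :+ y) := x :* y) refl x (bar x) ⟩
      x * bar x
        ≡⟨ j-N x ⟨
      j (Nm x) ∎)

    T-square : ∀ x → T (x * x) ≡ T x *ₖ T x +ₖ Nm x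
    T-square x = j-inj (begin
      j (T (x * x))                    ≡⟨ trans (j-T (x * x)) (cong (x * x +_) (bar-* x x)) ⟩
      x * x + bar x * bar x            ≡⟨ solve 2 (λ x y → x :* x :+ y :* y := (x :+ y) :* (x :+ y) :+ x :* y) refl x (bar x) ⟩
      (x + bar x) * (x + bar x) + x * bar x
                                       ≡⟨ cong₂ (λ a b → a * a + b) (j-T x) (j-N x) ⟨
      j (T x) * j (T x) + j (Nm x)     ≡⟨ trans (j-+ _ _) (cong (_+ j (Nm x)) (j-* _ _)) ⟨
      j (T x *ₖ T x +ₖ Nm x)           ∎)

    N-minus : ∀ x t → Nm (x - t) ≡ Nm x +ₖ (-ₖ T (x * bar t)) +ₖ Nm t
    N-minus x t = j-inj (begin
      j (Nm (x - t))
        ≡⟨ trans (j-N (x - t)) (cong ((x - t) *_) (trans (bar-+ x (- t)) (cong (bar x +_) (bar-neg t)))) ⟩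
      (x - t) * (bar x - bar t)
        ≡⟨ solve 4 (λ x t x̄ t̄ → (x :- t) :* (x̄ :- t̄) := x :* x̄ :+ (:- (x :* t̄ :+ x̄ :* t)) :+ t :* t̄) refl x t
            (bar x) (bar t) ⟩
      x * bar x + - (x * bar t + bar x * t) + t * bar t
        ≡⟨ cong (λ s → x * bar x + - (x * bar t + s) + t * bar t) (trans (bar-* x (bar t)) (cong (bar x *_) (bar-bar t))) ⟨
      x * bar x + - (x * bar t + bar (x * bar t)) + t * bar t
        ≡⟨ cong₂ _+_ (cong₂ (λ a b → a + - b) (j-N x) (j-T (x * bar t))) (j-N t) ⟨
      j (Nm x) + - j (T (x * bar t)) + j (Nm t)
        ≡⟨ trans (j-+ _ _) (cong (_+ j (Nm t)) (trans (j-+ _ _) (cong (j (Nm x) +_) (j-neg _)))) ⟨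
      j (Nm x +ₖ (-ₖ T (x * bar t)) +ₖ Nm t) ∎)

    -- Coordinates of `F` over `K`. They are recovered from x = α + i β as α = - T(x), because T(x)
    -- = 2 α, and β = T(i x).
    pair : Fin q → Fin q → Fin N
    pair α β = j α + i * j β

    bar-pair : ∀ α β → bar (pair α β) ≡ j α - i * j β
    bar-pair α β = trans (bar-+ (j α) (i * j β)) (cong₂ _+_ (bar-j α) (trans (bar-* i (j β)) (trans (cong₂ _*_ bar-i (bar-j β))
      (solve 2 (λ i b → (:- i) :* b := :- (i :* b)) refl i (j β)))))

    T-pair : ∀ α β → T (pair α β) ≡ -ₖ α
    T-pair α β = j-inj (trans (j-T (pair α β)) (trans (cong (pair α β +_) (bar-pair α β))
      (trans (solve 3 (λ a i b → a :+ i :* b :+ (a :- i :* b) := :- a) refl (j α) i (j β)) (sym (j-neg α)))))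

    N-pair : ∀ α β → Nm (pair α β) ≡ α *ₖ α +ₖ β *ₖ β
    N-pair α β = j-inj (trans (j-N (pair α β)) (trans (cong (pair α β *_) (bar-pair α β))
      (trans (solve 3 (λ a i b → (a :+ i :* b) :* (a :- i :* b) := a :* a :- (i :* i) :* (b :* b)) refl (j α) i (j β))
      (trans (cong (λ t → j α * j α - t * (j β * j β)) i²)
      (trans (solve 2 (λ a b → a :* a :- (:- con 1F) :* (b :* b) := a :* a :+ b :* b) refl (j α) (j β))
        (sym (trans (j-+ _ _) (cong₂ _+_ (j-* α α) (j-* β β)))))))))

    T-i*pair : ∀ α β → T (i * pair α β) ≡ β
    T-i*pair α β = j-inj (trans (j-T-i* (pair α β)) (trans (cong (λ t → i * (pair α β - t)) (bar-pair α β))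
      (trans (solve 3 (λ a i b → i :* (a :+ i :* b :- (a :- i :* b)) := :- ((i :* i) :* b)) refl (j α) i (j β))
      (trans (cong (λ t → - (t * j β)) i²) (solve 1 (λ b → :- ((:- con 1F) :* b) := b) refl (j β))))))

    pair-surjective : ∀ x → pair (-ₖ T x) (T (i * x)) ≡ x
    pair-surjective x = trans (cong₂ (λ a b → a + i * b) (trans (j-neg (T x)) (cong -_ (j-T x))) (j-T-i* x))
      (trans (solve 3 (λ i x y → (:- (x :+ y)) :+ i :* (i :* (x :- y)) := (:- (x :+ y)) :+ (i :* i) :* (x :- y)) refl i x (bar x))
      (trans (cong (λ t → - (x + bar x) + t * (x - bar x)) i²) (solve 2 (λ x y → (:- (x :+ y)) :+ (:- con 1F) :*
          (x :- y) := x) refl x (bar x))))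

    -- The fixed field comes without a known size. Counting `F` by its coordinates over `K` gives q²
    -- = N = r².
    q≡r : q ≡ r
    q≡r = square-injective (trans (↔⇒≡ (Perm.permutation to from to-from from-to)) N≡)
      where
      to : Fin (q ℕ.* q) → Fin N
      to u = pair (proj₁ (remQuot {q} q u)) (proj₂ (remQuot {q} q u))
      from : Fin N → Fin (q ℕ.* q)
      from x = combine {q} {q} (-ₖ T x) (T (i * x))
      to-from : ∀ x → to (from x) ≡ x
      to-from x = trans (cong (λ (α , β) → pair α β) (remQuot-combine {q} {q} (-ₖ T x) (T (i * x)))) (pair-surjective x)
      from-to : ∀ u → from (to u) ≡ u
      from-to u = trans (cong₂ (combine {q} {q}) (trans (cong -ₖ_ (T-pair _ _)) (-ₖ-involutive _)) (T-i*pair _ _))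
          (combine-remQuot {q} q u)
        where
        -ₖ-involutive : ∀ y → -ₖ (-ₖ y) ≡ y
        -ₖ-involutive y = j-inj (trans (j-neg (-ₖ y)) (trans (cong -_ (j-neg y)) (solve 1 (λ x → :- (:- x) := x) refl (j y))))
      square-injective : ∀ {m n} → m ℕ.* m ≡ n ℕ.* n → m ≡ n
      square-injective {m} {n} eq with ℕₚ.<-cmp m n
      ... | tri< m<n _ _ = contradiction eq (ℕₚ.<⇒≢ (ℕₚ.*-mono-< m<n m<n))
      ... | tri≈ _ m≡n _ = m≡n
      ... | tri> _ _ n<m = contradiction (sym eq) (ℕₚ.<⇒≢ (ℕₚ.*-mono-< n<m n<m))

    q≡ : q ≡ 3 ℕ.+ 4 ℕ.* h
    q≡ = trans q≡r r≡

    fermat : ∀ y → y ^ₖ (3 ℕ.+ 4 ℕ.* h) ≡ y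
    fermat y = trans (cong (y ^ₖ_) (sym r≡)) (j-inj (trans (j-^ y r) (bar-j y)))

    data Unit₄ : Fin N → Set where
      u₁  : Unit₄ 1#
      uᵢ  : Unit₄ i
      u₋₁ : Unit₄ (- 1#)
      u₋ᵢ : Unit₄ (- i)

    χ-* : ∀ x y → χ (x * y) ≡ χ x * χ y
    χ-* x y = ^-distrib-* x y e

    χ-0 : χ 0# ≡ 0#
    χ-0 = trans (cong (0# ^_) e-suc) (0^suc (h ℕ.+ (1 ℕ.+ 4 ℕ.* h) ℕ.* (1 ℕ.+ h)))

    χ-bar : ∀ x → χ (bar x) ≡ bar (χ x)
    χ-bar x = begin
      (x ^ r) ^ e      ≡⟨ ^-assocʳ x r e ⟩
      x ^ (r ℕ.* e)    ≡⟨ cong (x ^_) (ℕₚ.*-comm r e) ⟩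
      x ^ (e ℕ.* r)    ≡⟨ ^-assocʳ x e r ⟨
      (x ^ e) ^ r      ∎

    x^r² : ∀ x → x ^ (r ℕ.* r) ≡ x
    x^r² x = trans (sym (^-assocʳ x r r)) (bar-bar x)

    χ⁴ : ∀ {x} → x ≢ 0# → χ x ^ 4 ≡ 1#
    χ⁴ {x} x≢0 = *-cancelˡ x x≢0 (begin
      x * (x ^ e) ^ 4            ≡⟨ cong (x *_) (^-assocʳ x e 4) ⟩
      x ^ suc (e ℕ.* 4)          ≡⟨ cong (x ^_) 1+4e ⟩
      x ^ (r ℕ.* r)              ≡⟨ x^r² x ⟩
      x                          ≡⟨ *-identityʳ x ⟨
      x * 1#                     ∎)

    χ-unit : ∀ {x} → x ≢ 0# → Unit₄ (χ x)
    χ-unit {x} x≢0 with x²≡y²⇒x≡±y {χ x * χ x} {1#} (trans (solve 1 (λ u → u :* u :* (u :* u) := u :^ 4) refl (χ x))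
        (trans (χ⁴ x≢0) (sym (*-identityˡ 1#))))
    ... | inj₁ eq with x²≡y²⇒x≡±y (trans eq (sym (*-identityˡ 1#)))
    ...   | inj₁ p = subst Unit₄ (sym p) u₁
    ...   | inj₂ p = subst Unit₄ (sym p) u₋₁
    χ-unit {x} x≢0 | inj₂ eq with x²≡y²⇒x≡±y (trans eq (sym i²))
    ...   | inj₁ p = subst Unit₄ (sym p) uᵢ
    ...   | inj₂ p = subst Unit₄ (sym p) u₋ᵢ

    -- 2 e = (r + 1) · (r - 1) / 2: the square of the quartic symbol of x is the Euler power, in
    -- `K`, of the norm of x.
    χ² : ∀ x → χ x * χ x ≡ j (Nm x ^ₖ (1 ℕ.+ 2 ℕ.* h))
    χ² x = begin
      x ^ e * x ^ e                                    ≡⟨ ^-homo-* x e e ⟨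
      x ^ (e ℕ.+ e)                                    ≡⟨ cong (x ^_) e+e ⟩
      x ^ ((1 ℕ.+ r) ℕ.* (1 ℕ.+ 2 ℕ.* h))              ≡⟨ ^-assocʳ x (1 ℕ.+ r) (1 ℕ.+ 2 ℕ.* h) ⟨
      (x * bar x) ^ (1 ℕ.+ 2 ℕ.* h)                    ≡⟨ cong (_^ (1 ℕ.+ 2 ℕ.* h)) (j-N x) ⟨
      j (Nm x) ^ (1 ℕ.+ 2 ℕ.* h)                       ≡⟨ j-^ (Nm x) (1 ℕ.+ 2 ℕ.* h) ⟨
      j (Nm x ^ₖ (1 ℕ.+ 2 ℕ.* h))                      ∎

    -- The exponent e is a multiple of r - 1 = 2 + 4 h. Consequently χ, and every sign built from
    -- it, is constant on K*-lines.
    χ-j : ∀ {y} → y ≢ 0ₖ → χ (j y) ≡ 1#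
    χ-j {y} y≢0 = begin
      j y ^ e                                 ≡⟨ j-^ y e ⟨
      j (y ^ₖ e)                              ≡⟨ cong (λ n → j (y ^ₖ n)) e≡ ⟩
      j (y ^ₖ ((2 ℕ.+ 4 ℕ.* h) ℕ.* (1 ℕ.+ h))) ≡⟨ cong j (Field₃.^-assocʳ K y (2 ℕ.+ 4 ℕ.* h) (1 ℕ.+ h)) ⟨
      j ((y ^ₖ (2 ℕ.+ 4 ℕ.* h)) ^ₖ (1 ℕ.+ h)) ≡⟨ cong (λ t → j (t ^ₖ (1 ℕ.+ h))) (Field₃.*-cancelˡ K y y≢0 (trans
          (fermat y) (sym (Field₃.*-identityʳ K y)))) ⟩
      j (1ₖ ^ₖ (1 ℕ.+ h))                     ≡⟨ cong j (Field₃.1^ K (1 ℕ.+ h)) ⟩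
      j 1ₖ                                    ≡⟨ j-1 ⟩
      1#                                      ∎

    χ-i : χ i ≡ - 1#
    χ-i = begin
      i ^ e                                   ≡⟨ cong (i ^_) e-odd ⟩
      i ^ (2 ℕ.* (1 ℕ.+ 2 ℕ.* m))             ≡⟨ ^-assocʳ i 2 (1 ℕ.+ 2 ℕ.* m) ⟨
      (i ^ 2) ^ (1 ℕ.+ 2 ℕ.* m)               ≡⟨ cong (_^ (1 ℕ.+ 2 ℕ.* m)) (trans (solve 1 (λ i → i :^ 2 := i :* i) refl i) i²) ⟩
      - 1# * (- 1#) ^ (2 ℕ.* m)               ≡⟨ cong (- 1# *_) (^-assocʳ (- 1#) 2 m) ⟨
      - 1# * ((- 1#) ^ 2) ^ m                 ≡⟨ cong (λ t → - 1# * t ^ m) (solve 0 ((:- con 1F) :^ 2 := con 1F) refl) ⟩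
      - 1# * 1# ^ m                           ≡⟨ trans (cong (- 1# *_) (1^ m)) (*-identityʳ (- 1#)) ⟩
      - 1#                                    ∎
      where
      m : ℕ
      m = 3 ℕ.* g ℕ.+ 4 ℕ.* (g ℕ.* g)

    χ-i* : ∀ x → χ (i * x) ≡ - χ x
    χ-i* x = trans (χ-* i x) (trans (cong (_* χ x) χ-i) (solve 1 (λ x → (:- con 1F) :* x := :- x) refl (χ x)))

    i≢0 : i ≢ 0#
    i≢0 eq = -≢0 (0≢1 ∘ sym) (trans (sym i²) (trans (cong (_* i) eq) (zeroˡ i)))

    i≢1 : i ≢ 1#
    i≢1 eq = -1≢1 (trans (sym i²) (trans (cong₂ _*_ eq eq) (*-identityˡ 1#)))

    i≢-1 : i ≢ - 1#
    i≢-1 eq = -1≢1 (trans (sym i²) (trans (cong₂ _*_ eq eq) (solve 0 ((:- con 1F) :* (:- con 1F) := con 1F) refl)))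

-- Signs attached to the quartic residue symbol.

module WalshPreliminaries where

  open EisensteinIntegers
  open FiniteSums
  open TernaryFields
  open AdditiveCharacters
  open GaussSumsOverK
  open QuarticSums
  open PlaneSums
  open QuadraticExtensions
  open import Data.Fin.Base using (Fin)
  open import Data.Fin.Patterns using (1F)
  open import Data.Fin.Properties using () renaming (_≟_ to _≟F_)
  open import Data.Integer.Base as ℤ using (+_)
  open import Data.Nat.Base as ℕ using (ℕ)
  open import Data.Product.Base using (∃₂; _×_; _,_)
  open import Data.Sum.Base as Sum using (_⊎_; inj₁; inj₂)
  open import Function.Base using (_∘_)
  open import Relation.Binary.PropositionalEquality
  open import Relation.Nullary using (yes; no)
  open ≡-Reasoning

  module WalshSums {N q} {F : Field₃ N} {K : Field₃ q} (X : QuadraticExtension F K) (Ψ : Character K)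
    (cbrt : Fin q → Fin q) (cbrt³ : ∀ x → Field₃._^_ K (cbrt x) 3 ≡ x) (cbrt-³ : ∀ x → cbrt (Field₃._^_ K x 3) ≡ x) where
    open Field₃ F
    open Field₃ K using () renaming (-_ to -ₖ_; 1# to 1ₖ; _^_ to _^ₖ_)
    private module Kf = Field₃ K
    open QuadraticExtension X hiding (r)
    open Character Ψ
    open FieldSums F
    open QuadraticCharacter K h fermat
    open GaussSums K Ψ h fermat
    open QuarticSum K Ψ h fermat cbrt cbrt³ cbrt-³
    open Plane K Ψ h fermat cbrt cbrt³ cbrt-³
    open 𝔼-Solverᴱ

    -- Since ℤ[ω] has no square root of - 1, a fourth root of unity u is represented by its "real
    -- part" κ and "imaginary part" μ. The sign of the overview is ε; its product with the quadratic
    -- symbol of the norm is ς.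
    κ μ ε ς : Fin N → 𝔼
    κ u = δ u 1# ⊕ ⊖ δ u (- 1#)
    μ u = δ u i ⊕ ⊖ δ u (- i)
    ε u = κ u ⊕ μ u
    ς u = κ u ⊕ ⊖ μ u

    neg-neg : ∀ x → - - x ≡ x
    neg-neg = solve 1 (λ x → :- (:- x) := x) refl where open Solver₃

    private
      δ-pair : ∀ {a b : Fin N} {s t : 𝔼} u → δ u a ≡ s → δ u b ≡ t → δ u a ⊕ ⊖ δ u b ≡ s ⊕ ⊖ t
      δ-pair u = cong₂ (λ s t → s ⊕ ⊖ t)

      1-0 : 1𝔼 ⊕ ⊖ 0𝔼 ≡ 1𝔼
      1-0 = solveᴱ 0 (conᴱ (+ 1) :+ᴱ (:-ᴱ conᴱ (+ 0)) :=ᴱ conᴱ (+ 1)) refl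
      0-0 : 0𝔼 ⊕ ⊖ 0𝔼 ≡ 0𝔼
      0-0 = 𝔼ᵣ.-‿inverseʳ 0𝔼

      swap-δ : ∀ {u v a b c d : Fin N} → δ u a ≡ δ v d → δ u b ≡ δ v c → δ u a ⊕ ⊖ δ u b ≡ ⊖ (δ v c ⊕ ⊖ δ v d)
      swap-δ {v = v} {c = c} {d} eq₁ eq₂ = trans (cong₂ (λ s t → s ⊕ ⊖ t) eq₁ eq₂) (solveᴱ 2 (λ s t → t :+ᴱ
          (:-ᴱ s) :=ᴱ :-ᴱ (s :+ᴱ (:-ᴱ t))) refl (δ v c) (δ v d))

      neg-⇔ : ∀ u v → δ (- u) v ≡ δ u (- v)
      neg-⇔ u v = δ-⇔ (λ eq → trans (sym (neg-neg u)) (cong -_ eq)) (λ eq → trans (cong -_ eq) (neg-neg v))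

    κ-neg : ∀ u → κ (- u) ≡ ⊖ κ u
    κ-neg u = swap-δ (neg-⇔ u 1#) (trans (neg-⇔ u (- 1#)) (cong (δ u) (neg-neg 1#)))

    μ-neg : ∀ u → μ (- u) ≡ ⊖ μ u
    μ-neg u = swap-δ (neg-⇔ u i) (trans (neg-⇔ u (- i)) (cong (δ u) (neg-neg i)))

    private
      i*-⇔ : ∀ u v → δ (i * u) v ≡ δ u (- (i * v))
      i*-⇔ u v = δ-⇔ (λ eq → trans (l u) (cong (λ t → - (i * t)) eq)) (λ eq → trans (cong (i *_) eq) (r v))
        where
        open Solver₃
        r : ∀ v → i * - (i * v) ≡ v
        r v = trans (solve 2 (λ i v → i :* (:- (i :* v)) := (:- (i :* i)) :* v) refl i v) (trans (cong (λ t → - t * v) i²)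
            (solve 1 (λ v → (:- (:- con 1F)) :* v := v) refl v))
        l : ∀ u → u ≡ - (i * (i * u))
        l u = sym (trans (solve 2 (λ i v → :- (i :* (i :* v)) := i :* (:- (i :* v))) refl i u) (r u))

      -i*1 : - (i * 1#) ≡ - i
      -i*1 = cong -_ (*-identityʳ i)
      -i*-1 : - (i * - 1#) ≡ i
      -i*-1 = solve 1 (λ i → :- (i :* (:- con 1F)) := i) refl i where open Solver₃
      -i*i : - (i * i) ≡ 1#
      -i*i = trans (cong -_ i²) (neg-neg 1#)
      -i*-i : - (i * - i) ≡ - 1#
      -i*-i = trans (solve 1 (λ i → :- (i :* (:- i)) := i :* i) refl i) i² where open Solver₃

    κ-i* : ∀ u → κ (i * u) ≡ ⊖ μ u
    κ-i* u = swap-δ (trans (i*-⇔ u 1#) (cong (δ u) -i*1)) (trans (i*-⇔ u (- 1#)) (cong (δ u) -i*-1))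

    μ-i* : ∀ u → μ (i * u) ≡ κ u
    μ-i* u = δ-pair (i * u) (trans (i*-⇔ u i) (cong (δ u) -i*i)) (trans (i*-⇔ u (- i)) (cong (δ u) -i*-i))

    private
      bar-⇔ : ∀ u v → δ (bar u) v ≡ δ u (bar v)
      bar-⇔ u v = δ-⇔ (λ eq → trans (sym (bar-bar u)) (cong bar eq)) (λ eq → trans (cong bar eq) (bar-bar v))

    μ-bar : ∀ u → μ (bar u) ≡ ⊖ μ u
    μ-bar u = swap-δ (trans (bar-⇔ u i) (cong (δ u) bar-i)) (trans (bar-⇔ u (- i)) (cong (δ u) (trans (bar-neg i) (trans
        (cong -_ bar-i) (neg-neg i)))))

    κ-0 : κ 0# ≡ 0𝔼
    κ-0 = trans (δ-pair 0# (δ-≢ 0≢1) (δ-≢ (-≢0 (0≢1 ∘ sym) ∘ sym))) 0-0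

    μ-0 : μ 0# ≡ 0𝔼
    μ-0 = trans (δ-pair 0# (δ-≢ (i≢0 ∘ sym)) (δ-≢ (-≢0 i≢0 ∘ sym))) 0-0

    κ-1 : κ 1# ≡ 1𝔼
    κ-1 = trans (δ-pair 1# (δ-≡ refl) (δ-≢ (-1≢1 ∘ sym))) 1-0

    μ-1 : μ 1# ≡ 0𝔼
    μ-1 = trans (δ-pair 1# (δ-≢ (i≢1 ∘ sym)) (δ-≢ λ eq → i≢-1 (trans (sym (neg-neg i)) (cong -_ (sym eq))))) 0-0

    private
      ⊖0 : ⊖ 0𝔼 ≡ 0𝔼
      ⊖0 = solveᴱ 0 (:-ᴱ conᴱ (+ 0) :=ᴱ conᴱ (+ 0)) refl

    κ-i : κ i ≡ 0𝔼
    κ-i = trans (cong κ (sym (*-identityʳ i))) (trans (κ-i* 1#) (trans (cong ⊖_ μ-1) ⊖0))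

    μ-i : μ i ≡ 1𝔼
    μ-i = trans (cong μ (sym (*-identityʳ i))) (trans (μ-i* 1#) κ-1)

    κ-neg1 : κ (- 1#) ≡ ⊖ 1𝔼
    κ-neg1 = trans (κ-neg 1#) (cong ⊖_ κ-1)

    -- At χ x, and as functions of the discrete logarithm of x mod 4, ε is (+, +, -, -) and ς is (+, -, -, +).
    ε-values : ∀ {u} → Unit₄ u → (ε u ≡ 1𝔼 × (u ≡ 1# ⊎ u ≡ i)) ⊎ (ε u ≡ ⊖ 1𝔼 × (u ≡ - 1# ⊎ u ≡ - i))
    ε-values u₁  = inj₁ (trans (cong₂ _⊕_ κ-1 μ-1) (𝔼ᵣ.+-identityʳ 1𝔼) , inj₁ refl)
    ε-values uᵢ  = inj₁ (trans (cong₂ _⊕_ κ-i μ-i) (𝔼ᵣ.+-identityˡ 1𝔼) , inj₂ refl)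
    ε-values u₋₁ = inj₂ (trans (cong₂ _⊕_ κ-neg1 (trans (μ-neg 1#) (trans (cong ⊖_ μ-1) ⊖0))) (𝔼ᵣ.+-identityʳ (⊖ 1𝔼)) , inj₁ refl)
    ε-values u₋ᵢ = inj₂ (trans (cong₂ _⊕_ (trans (κ-neg i) (trans (cong ⊖_ κ-i) ⊖0)) (trans (μ-neg i) (cong ⊖_ μ-i)))
        (𝔼ᵣ.+-identityˡ (⊖ 1𝔼)) , inj₂ refl)

    ε-0 : ε 0# ≡ 0𝔼
    ε-0 = trans (cong₂ _⊕_ κ-0 μ-0) (𝔼ᵣ.+-identityˡ 0𝔼)

    ς-0 : ς 0# ≡ 0𝔼
    ς-0 = trans (cong₂ (λ s t → s ⊕ ⊖ t) κ-0 μ-0) 0-0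

    ς-neg : ∀ u → ς (- u) ≡ ⊖ ς u
    ς-neg u = trans (cong₂ (λ s t → s ⊕ ⊖ t) (κ-neg u) (μ-neg u)) (solveᴱ 2 (λ s t → (:-ᴱ s) :+ᴱ (:-ᴱ (:-ᴱ t)) :=ᴱ :-ᴱ
        (s :+ᴱ (:-ᴱ t))) refl (κ u) (μ u))

    ⊖-⊗ˡ : ∀ A B → ⊖ A ⊗ B ≡ ⊖ (A ⊗ B)
    ⊖-⊗ˡ = solveᴱ 2 (λ s t → (:-ᴱ s) :*ᴱ t :=ᴱ :-ᴱ (s :*ᴱ t)) refl

    ε-neg : ∀ u → ε (- u) ≡ ⊖ ε u
    ε-neg u = trans (cong₂ _⊕_ (κ-neg u) (μ-neg u)) (solveᴱ 2 (λ s t → (:-ᴱ s) :+ᴱ (:-ᴱ t) :=ᴱ :-ᴱ (s :+ᴱ t)) refl (κ u) (μ u))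

    private
      neg² : ∀ u → - u * - u ≡ u * u
      neg² = solve 1 (λ u → (:- u) :* (:- u) := u :* u) refl where open Solver₃

    -- κ(u²) is 1 at ± 1 and - 1 at ± i, so multiplying by it keeps the part κ of ε and negates the
    -- part μ.
    ε-κ² : ∀ {u} → Unit₄ u → ε u ⊗ κ (u * u) ≡ ς u
    ε-κ² u₁ = trans (cong (ε 1# ⊗_) (trans (cong κ (*-identityˡ 1#)) κ-1)) (trans (cong (λ t → (κ 1# ⊕ t) ⊗ 1𝔼) μ-1)
      (trans (solveᴱ 1 (λ k → (k :+ᴱ conᴱ (+ 0)) :*ᴱ conᴱ (+ 1) :=ᴱ k :+ᴱ (:-ᴱ conᴱ (+ 0))) refl (κ 1#)) (cong
          (λ t → κ 1# ⊕ ⊖ t) (sym μ-1))))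
    ε-κ² uᵢ = trans (cong (ε i ⊗_) (trans (cong κ i²) κ-neg1)) (trans (cong (λ t → (t ⊕ μ i) ⊗ ⊖ 1𝔼) κ-i)
      (trans (solveᴱ 1 (λ k → (conᴱ (+ 0) :+ᴱ k) :*ᴱ (:-ᴱ conᴱ (+ 1)) :=ᴱ conᴱ (+ 0) :+ᴱ (:-ᴱ k)) refl (μ i)) (cong
          (λ t → t ⊕ ⊖ μ i) (sym κ-i))))
    ε-κ² u₋₁ = trans (cong₂ _⊗_ (ε-neg 1#) (cong κ (neg² 1#))) (trans (⊖-⊗ˡ (ε 1#) (κ (1# * 1#))) (trans (cong ⊖_
        (ε-κ² u₁)) (sym (ς-neg 1#))))
    ε-κ² u₋ᵢ = trans (cong₂ _⊗_ (ε-neg i) (cong κ (neg² i))) (trans (⊖-⊗ˡ (ε i) (κ (i * i))) (trans (cong ⊖_ (ε-κ² uᵢ))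
        (sym (ς-neg i))))

    IsSign : 𝔼 → Set
    IsSign σ = σ ≡ 1𝔼 ⊎ σ ≡ ⊖ 1𝔼

    IsSign-⊗ : ∀ {σ τ} → IsSign σ → IsSign τ → IsSign (σ ⊗ τ)
    IsSign-⊗ {τ = τ} (inj₁ refl) s = subst IsSign (sym (𝔼ᵣ.*-identityˡ τ)) s
    IsSign-⊗ (inj₂ refl) (inj₁ refl) = inj₂ (𝔼ᵣ.*-identityʳ (⊖ 1𝔼))
    IsSign-⊗ (inj₂ refl) (inj₂ refl) = inj₁ (solveᴱ 0 ((:-ᴱ conᴱ (+ 1)) :*ᴱ (:-ᴱ conᴱ (+ 1)) :=ᴱ conᴱ (+ 1)) refl)

    -- Multiplication by v rotates the pair κ, μ up to signs. The sign in front of κ is the one that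
    -- reaches the result, as the μ part sums to 0 by `∑-μ`.
    ς-twist : ∀ {v} → Unit₄ v → ∃₂ λ σ τ → IsSign σ × (∀ u → ς (v * u) ≡ σ ⊗ κ u ⊕ τ ⊗ μ u)
    ς-twist u₁ = 1𝔼 , ⊖ 1𝔼 , inj₁ refl , λ u → trans (cong ς (*-identityˡ u)) (r u)
      where
      r : ∀ u → ς u ≡ 1𝔼 ⊗ κ u ⊕ ⊖ 1𝔼 ⊗ μ u
      r u = solveᴱ 2 (λ k m → k :+ᴱ (:-ᴱ m) :=ᴱ conᴱ (+ 1) :*ᴱ k :+ᴱ (:-ᴱ conᴱ (+ 1)) :*ᴱ m) refl (κ u) (μ u)
    ς-twist u₋₁ = ⊖ 1𝔼 , 1𝔼 , inj₂ refl , λ u → trans (cong ς (solve 1 (λ u → (:- con 1F) :* u := :- u) refl u)) (trans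
        (ς-neg u) (r u))
      where
      open Solver₃
      r : ∀ u → ⊖ ς u ≡ ⊖ 1𝔼 ⊗ κ u ⊕ 1𝔼 ⊗ μ u
      r u = solveᴱ 2 (λ k m → :-ᴱ (k :+ᴱ (:-ᴱ m)) :=ᴱ (:-ᴱ conᴱ (+ 1)) :*ᴱ k :+ᴱ conᴱ (+ 1) :*ᴱ m) refl (κ u) (μ u)
    ς-twist uᵢ = ⊖ 1𝔼 , ⊖ 1𝔼 , inj₂ refl , λ u → trans (cong₂ (λ s t → s ⊕ ⊖ t) (κ-i* u) (μ-i* u)) (r u)
      where
      r : ∀ u → ⊖ μ u ⊕ ⊖ κ u ≡ ⊖ 1𝔼 ⊗ κ u ⊕ ⊖ 1𝔼 ⊗ μ u
      r u = solveᴱ 2 (λ k m → (:-ᴱ m) :+ᴱ (:-ᴱ k) :=ᴱ (:-ᴱ conᴱ (+ 1)) :*ᴱ k :+ᴱ (:-ᴱ conᴱ (+ 1)) :*ᴱ m) refl (κ u) (μ u)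
    ς-twist u₋ᵢ = 1𝔼 , 1𝔼 , inj₁ refl , λ u → trans (cong ς (solve 2 (λ i u → (:- i) :* u := :- (i :* u)) refl i u))
        (trans (ς-neg (i * u))
        (trans (cong₂ (λ s t → ⊖ (s ⊕ ⊖ t)) (κ-i* u) (μ-i* u)) (r u)))
      where
      open Solver₃
      r : ∀ u → ⊖ (⊖ μ u ⊕ ⊖ κ u) ≡ 1𝔼 ⊗ κ u ⊕ 1𝔼 ⊗ μ u
      r u = solveᴱ 2 (λ k m → :-ᴱ ((:-ᴱ m) :+ᴱ (:-ᴱ k)) :=ᴱ conᴱ (+ 1) :*ᴱ k :+ᴱ conᴱ (+ 1) :*ᴱ m) refl (κ u) (μ u)

    η-N : ∀ x → η (Nm x) ≡ κ (χ x * χ x)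
    η-N x = sym (trans (cong κ (χ² x)) (δ-pair (j u) (δ-⇔ (λ eq → j-inj (trans eq (sym j-1))) (λ eq → trans (cong j eq) j-1))
      (δ-⇔ (λ eq → j-inj (trans eq (sym j-neg1))) (λ eq → trans (cong j eq) j-neg1))))
      where
      u : Fin q
      u = Nm x ^ₖ (1 ℕ.+ 2 ℕ.* h)
      j-neg1 : j (-ₖ 1ₖ) ≡ - 1#
      j-neg1 = trans (j-neg 1ₖ) (cong -_ j-1)

    ε-η : ∀ x → ε (χ x) ⊗ η (Nm x) ≡ ς (χ x)
    ε-η x with x ≟F 0#
    ... | yes refl = trans (cong (_⊗ η (Nm 0#)) (trans (cong ε χ-0) ε-0)) (trans (𝔼ᵣ.zeroˡ (η (Nm 0#))) (sym (trans
        (cong ς χ-0) ς-0)))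
    ... | no x≢0 = trans (cong (ε (χ x) ⊗_) (η-N x)) (ε-κ² (χ-unit x≢0))

    q₋₁-cancel : ∀ {A B} → q₋₁ ⊗ A ≡ q₋₁ ⊗ B → A ≡ B
    q₋₁-cancel {A} {B} eq = ⟪⟫-cancelˡ (+ (2 ℕ.+ 4 ℕ.* h)) A B (trans (cong (_⊗ A) (sym q₋₁≡)) (trans eq (cong (_⊗ B) q₋₁≡)))
      where
      q₋₁≡ : q₋₁ ≡ ⟪ + (2 ℕ.+ 4 ℕ.* h) ⟫
      q₋₁≡ = trans (cong (λ q → ⟪ + q ⟫ ⊕ ⊖ 1𝔼) q≡) (trans (cong (_⊕ ⊖ 1𝔼) (⟪⟫-+ (+ 1) (+ (2 ℕ.+ 4 ℕ.* h))))
        (solveᴱ 1 (λ m → conᴱ (+ 1) :+ᴱ m :+ᴱ (:-ᴱ conᴱ (+ 1)) :=ᴱ m) refl ⟪ + (2 ℕ.+ 4 ℕ.* h) ⟫))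

    2-cancel : ∀ {A B} → A ⊕ A ≡ B ⊕ B → A ≡ B
    2-cancel {A} {B} eq = ⟪⟫-cancelˡ (+ 2) A B (trans (2* A) (trans eq (sym (2* B))))
      where
      2* : ∀ A → ⟪ + 2 ⟫ ⊗ A ≡ A ⊕ A
      2* = solveᴱ 1 (λ a → conᴱ (+ 2) :*ᴱ a :=ᴱ a :+ᴱ a) refl

    self-neg : ∀ {A} → A ≡ ⊖ A → A ≡ 0𝔼
    self-neg {A} eq = 2-cancel (trans (cong (A ⊕_) eq) (trans (𝔼ᵣ.-‿inverseʳ A) (sym (𝔼ᵣ.+-identityˡ 0𝔼))))

    ∑-⊖ : ∀ {m} (f : Fin m → 𝔼) → ∑ (λ x → ⊖ f x) ≡ ⊖ ∑ f
    ∑-⊖ f = trans (∑-cong (λ x → ⊖≡ (f x))) (trans (∑-*ˡ (⊖ 1𝔼) f) (sym (⊖≡ (∑ f))))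
      where
      ⊖≡ : ∀ A → ⊖ A ≡ ⊖ 1𝔼 ⊗ A
      ⊖≡ = solveᴱ 1 (λ a → :-ᴱ a :=ᴱ (:-ᴱ conᴱ (+ 1)) :*ᴱ a) refl

    ∑-i* : (f : Fin N → 𝔼) → ∑ (λ x → f (i * x)) ≡ ∑ f
    ∑-i* f = ∑-scale f i≢0

    ∑-bar : (f : Fin N → 𝔼) → ∑ (λ x → f (bar x)) ≡ ∑ f
    ∑-bar f = ∑-reindex f bar bar bar-bar bar-bar

-- Evaluation of the Walsh sums in ℤ[ω].

module WalshCoefficients where

  open EisensteinIntegers
  open FiniteSums
  open TernaryFields
  open AdditiveCharacters
  open GaussSumsOverK
  open QuarticSums
  open PlaneSums
  open QuadraticExtensions
  open WalshPreliminaries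
  open import Data.Fin.Base using (Fin)
  open import Data.Fin.Patterns using (0F; 1F)
  open import Data.Fin.Properties using () renaming (_≟_ to _≟F_)
  open import Data.Integer.Base as ℤ using (+_)
  open import Data.Product.Base using (∃; ∃₂; _×_; _,_; proj₁; proj₂)
  open import Data.Sum.Base as Sum using (_⊎_; inj₁; inj₂)
  open import Function.Base using (_∘_)
  open import Relation.Binary.PropositionalEquality
  open import Relation.Nullary using (yes; no; contradiction)
  open ≡-Reasoning

  module WalshValues {N q} {F : Field₃ N} {K : Field₃ q} (X : QuadraticExtension F K) (Ψ : Character K)
    (cbrt : Fin q → Fin q) (cbrt³ : ∀ x → Field₃._^_ K (cbrt x) 3 ≡ x) (cbrt-³ : ∀ x → cbrt (Field₃._^_ K x 3) ≡ x)
    (sqrt : ∀ x → Field₃._*_ F (QuadraticExtension.χ X x) (QuadraticExtension.χ X x) ≡ Field₃.1# F → ∃ λ w → x ≡ Field₃._*_ F w w)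
    (a : Fin N) (a≢0 : a ≢ Field₃.0# F) (bar-a : QuadraticExtension.bar X a ≡ Field₃._*_ F (QuadraticExtension.i X) a) where
    open Field₃ F
    open Field₃ K using () renaming (_+_ to _+ₖ_; _*_ to _*ₖ_; -_ to -ₖ_; 0# to 0ₖ; 1# to 1ₖ; _⁻¹ to _⁻¹ₖ)
    private
      module Kf = Field₃ K
      module SK = Field₃.Solver₃ K
    open QuadraticExtension X
    open Character Ψ
    open FieldSums F
    open QuadraticCharacter K h fermat
    open GaussSums K Ψ h fermat
    open QuarticSum K Ψ h fermat cbrt cbrt³ cbrt-³
    open Plane K Ψ h fermat cbrt cbrt³ cbrt-³
    open WalshSums X Ψ cbrt cbrt³ cbrt-³
    open 𝔼-Solverᴱ
    open SK using () renaming (solve to solveᴷ; con to conᴷ; _:=_ to _:=ᴷ_; _:*_ to _:*ᴷ_; _:+_ to _:+ᴷ_; :-_ to :-ᴷ_; _:-_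
        to _:-ᴷ_)

    c : Fin q
    c = T a

    private
      j-c : j c ≡ a + i * a
      j-c = trans (j-T a) (cong (λ s → a + s) bar-a)

    c≢0 : c ≢ 0ₖ
    c≢0 eq = *-≢0 a≢0 1+i≢0 (trans (solve 2 (λ a i → a :* (con 1F :+ i) := a :+ i :* a) refl a i) (trans (sym j-c) (trans
        (cong j eq) j-0)))
      where
      open Solver₃
      1+i≢0 : 1# + i ≢ 0#
      1+i≢0 eq = i≢-1 (trans (solve 1 (λ i → i := (con 1F :+ i) :- con 1F) refl i) (trans (cong (_- 1#) eq) (+-identityˡ (- 1#))))

    -- The purpose of the choice of a: conjugation sends a to i a and i a back to a, so both have
    -- the same trace. On fourth roots of unity u, T(a u) thus takes only the values c and - c.
    T-ai : T (a * i) ≡ c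
    T-ai = j-inj (begin
      j (T (a * i))                  ≡⟨ trans (j-T (a * i)) (cong (λ s → a * i + s) (trans (bar-* a i) (cong₂ _*_ bar-a bar-i))) ⟩
      a * i + i * a * - i            ≡⟨ solve 2 (λ a i → a :* i :+ i :* a :* (:- i) := (:- (i :* i)) :* a :+ i :* a) refl a i ⟩
      - (i * i) * a + i * a          ≡⟨ cong (λ t → - t * a + i * a) i² ⟩
      - - 1# * a + i * a             ≡⟨ solve 2 (λ a i → (:- (:- con 1F)) :* a :+ i :* a := a :+ i :* a) refl a i ⟩
      a + i * a                      ≡⟨ j-c ⟨
      j c                            ∎)
      where open Solver₃

    T-a-neg : ∀ u → T (a * - u) ≡ -ₖ T (a * u)
    T-a-neg u = trans (cong T (solve 2 (λ a u → a :* (:- u) := :- (a :* u)) refl a u)) (T-neg (a * u))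
      where open Solver₃

    bracket : Fin q → 𝔼
    bracket n = ψ n ⊕ ⊖ ψ (-ₖ n)

    bracket-0 : ∀ {n} → n ≡ 0ₖ → bracket n ≡ 0𝔼
    bracket-0 refl = trans (cong (λ t → ψ 0ₖ ⊕ ⊖ ψ t) (solveᴷ 0 (:-ᴷ conᴷ 0F :=ᴷ conᴷ 0F) refl)) (𝔼ᵣ.-‿inverseʳ (ψ 0ₖ))

    -- T (a u) = ± c with the sign ε u, and 2 ψ (± s) = ψ s + ψ (- s) ± (ψ s - ψ (- s))
    split : ∀ u n → u ≡ 0# × n ≡ 0ₖ ⊎ Unit₄ u → ψ (T (a * u) *ₖ n) ⊕ ψ (T (a * u) *ₖ n) ≡ ψ (c *ₖ n) ⊕ ψ (-ₖ
        (c *ₖ n)) ⊕ ε u ⊗ bracket (c *ₖ n)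
    split u n (inj₁ (refl , refl)) = trans (cong (λ t → ψ t ⊕ ψ t) (Kf.zeroʳ _)) (sym (trans
      (cong₂ (λ s t → ψ s ⊕ ψ t ⊕ ε 0# ⊗ bracket s) (Kf.zeroʳ c) (trans (cong -ₖ_ (Kf.zeroʳ c)) (solveᴷ 0
          (:-ᴷ conᴷ 0F :=ᴷ conᴷ 0F) refl)))
      (trans (cong (λ t → ψ 0ₖ ⊕ ψ 0ₖ ⊕ t ⊗ bracket 0ₖ) ε-0) (solveᴱ 2 (λ s t → s :+ᴱ s :+ᴱ conᴱ
          (+ 0) :*ᴱ t :=ᴱ s :+ᴱ s) refl (ψ 0ₖ) (bracket 0ₖ)))))
    split u n (inj₂ unit) with ε-values unit
    ... | inj₁ (ε≡1 , u≡) = trans (cong (λ t → ψ (t *ₖ n) ⊕ ψ (t *ₖ n)) (T≡ u≡))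
      (trans (solveᴱ 2 (λ s t → s :+ᴱ s :=ᴱ s :+ᴱ t :+ᴱ conᴱ (+ 1) :*ᴱ (s :+ᴱ (:-ᴱ t))) refl (ψ (c *ₖ n)) (ψ (-ₖ (c *ₖ n))))
        (cong (λ t → ψ (c *ₖ n) ⊕ ψ (-ₖ (c *ₖ n)) ⊕ t ⊗ bracket (c *ₖ n)) (sym ε≡1)))
      where
      T≡ : ∀ {u} → u ≡ 1# ⊎ u ≡ i → T (a * u) ≡ c
      T≡ (inj₁ refl) = cong T (*-identityʳ a)
      T≡ (inj₂ refl) = T-ai
    ... | inj₂ (ε≡-1 , u≡) = trans (cong (λ t → ψ t ⊕ ψ t) (trans (cong (_*ₖ n) (T≡ u≡)) (solveᴷ 2 (λ c n →
        (:-ᴷ c) :*ᴷ n :=ᴷ :-ᴷ (c :*ᴷ n)) refl c n)))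
      (trans (solveᴱ 2 (λ s t → t :+ᴱ t :=ᴱ s :+ᴱ t :+ᴱ (:-ᴱ conᴱ (+ 1)) :*ᴱ (s :+ᴱ (:-ᴱ t))) refl (ψ (c *ₖ n)) (ψ (-ₖ (c *ₖ n))))
        (cong (λ t → ψ (c *ₖ n) ⊕ ψ (-ₖ (c *ₖ n)) ⊕ t ⊗ bracket (c *ₖ n)) (sym ε≡-1)))
      where
      T≡ : ∀ {u} → u ≡ - 1# ⊎ u ≡ - i → T (a * u) ≡ -ₖ c
      T≡ (inj₁ refl) = trans (T-a-neg 1#) (cong (λ t → -ₖ T t) (*-identityʳ a))
      T≡ (inj₂ refl) = trans (T-a-neg i) (cong -ₖ_ T-ai)

    χ-cases : ∀ x → χ x ≡ 0# × Nm x ≡ 0ₖ ⊎ Unit₄ (χ x)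
    χ-cases x with x ≟F 0#
    ... | yes refl = inj₁ (χ-0 , N-0)
    ... | no x≢0   = inj₂ (χ-unit x≢0)

    S P : Fin N → 𝔼
    S b = ∑ (λ x → ψ (T (a * χ x) *ₖ Nm x) ⊗ ψ (-ₖ T (b * x)))
    P b = ∑ (λ x → ε (χ x) ⊗ bracket (c *ₖ Nm x) ⊗ ψ (-ₖ T (b * x)))

    Q : Fin q → Fin N → 𝔼
    Q c b = ∑ (λ x → ψ (c *ₖ Nm x) ⊗ ψ (-ₖ T (b * x)))

    2S : ∀ b → S b ⊕ S b ≡ Q c b ⊕ Q (-ₖ c) b ⊕ P b
    2S b = begin
      S b ⊕ S b
        ≡⟨ ∑-+ _ _ ⟨
      ∑ (λ x → ψ (T (a * χ x) *ₖ Nm x) ⊗ ψ (-ₖ T (b * x)) ⊕ ψ (T (a * χ x) *ₖ Nm x) ⊗ ψ (-ₖ T (b * x)))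
        ≡⟨ ∑-cong (λ x → trans (sym (𝔼ᵣ.distribʳ (ψ (-ₖ T (b * x))) _ _)) (trans (cong (_⊗ ψ (-ₖ T (b * x))) (trans (split
            (χ x) (Nm x) (χ-cases x))
             (cong (λ t → ψ (c *ₖ Nm x) ⊕ ψ t ⊕ ε (χ x) ⊗ bracket (c *ₖ Nm x)) (solveᴷ 2 (λ c n → :-ᴷ (c :*ᴷ n) :=ᴷ
                 (:-ᴷ c) :*ᴷ n) refl c (Nm x)))))
             (trans (𝔼ᵣ.distribʳ (ψ (-ₖ T (b * x))) _ _) (cong (_⊕ ε (χ x) ⊗ bracket (c *ₖ Nm x) ⊗ ψ (-ₖ T (b * x)))
                 (𝔼ᵣ.distribʳ (ψ (-ₖ T (b * x))) _ _))))) ⟩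
      ∑ (λ x → ψ (c *ₖ Nm x) ⊗ ψ (-ₖ T (b * x)) ⊕ ψ ((-ₖ c) *ₖ Nm x) ⊗ ψ (-ₖ T (b * x)) ⊕ ε (χ x) ⊗ bracket
          (c *ₖ Nm x) ⊗ ψ (-ₖ T (b * x)))
        ≡⟨ trans (∑-+ (λ x → ψ (c *ₖ Nm x) ⊗ ψ (-ₖ T (b * x)) ⊕ ψ ((-ₖ c) *ₖ Nm x) ⊗ ψ (-ₖ T (b * x))) _) (cong (_⊕ P b)
            (∑-+ (λ x → ψ (c *ₖ Nm x) ⊗ ψ (-ₖ T (b * x))) _)) ⟩
      Q c b ⊕ Q (-ₖ c) b ⊕ P b ∎

    Q-value : ∀ {c} b → c ≢ 0ₖ → Q c b ≡ ⊖ (⟪ + q ⟫ ⊗ ψ (-ₖ (Nm b *ₖ c ⁻¹ₖ)))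
    Q-value {c} b c≢0 = begin
      Q c b
        ≡⟨ ∑-cong (λ x → trans (sym (ψ-+ _ _)) (trans (cong ψ (complete x)) (ψ-+ _ _))) ⟩
      ∑ (λ x → ψ (-ₖ (Nm b *ₖ c ⁻¹ₖ)) ⊗ ψ (c *ₖ Nm (x - t)))
        ≡⟨ ∑-*ˡ (ψ (-ₖ (Nm b *ₖ c ⁻¹ₖ))) (λ x → ψ (c *ₖ Nm (x - t))) ⟩
      ψ (-ₖ (Nm b *ₖ c ⁻¹ₖ)) ⊗ ∑ (λ x → ψ (c *ₖ Nm (x - t)))
        ≡⟨ cong (ψ (-ₖ (Nm b *ₖ c ⁻¹ₖ)) ⊗_) (trans (∑-shift (- t) (λ x → ψ (c *ₖ Nm x))) (trans (∑-reindex₂ (λ x → ψ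
            (c *ₖ Nm x)) pair (λ x → -ₖ T x) (λ x → T (i * x)) pair-surjective
             (λ α β → trans (cong -ₖ_ (T-pair α β)) (solveᴷ 1 (λ a → :-ᴷ (:-ᴷ a) :=ᴷ a) refl α)) T-i*pair)
             (trans (∑-cong (λ α → ∑-cong (λ β → cong (λ n → ψ (c *ₖ n)) (N-pair α β)))) (∑-plane c≢0)))) ⟩
      ψ (-ₖ (Nm b *ₖ c ⁻¹ₖ)) ⊗ ⊖ ⟪ + q ⟫
        ≡⟨ solveᴱ 2 (λ s t → s :*ᴱ (:-ᴱ t) :=ᴱ :-ᴱ (t :*ᴱ s)) refl (ψ (-ₖ (Nm b *ₖ c ⁻¹ₖ))) ⟪ + q ⟫ ⟩
      ⊖ (⟪ + q ⟫ ⊗ ψ (-ₖ (Nm b *ₖ c ⁻¹ₖ))) ∎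
      where
      -- The centre t = b̄ / c completes the square in the norm form: c N(x - t) = c N(x) - T(b x) +
      -- N(b) / c.
      t : Fin N
      t = bar b * j (c ⁻¹ₖ)
      T-t : ∀ x → T (x * bar t) ≡ c ⁻¹ₖ *ₖ T (b * x)
      T-t x = trans (cong T (trans (cong (x *_) (trans (bar-* (bar b) (j (c ⁻¹ₖ))) (cong₂ _*_ (bar-bar b) (bar-j (c ⁻¹ₖ)))))
        (solve 3 (λ x b d → x :* (b :* d) := d :* (b :* x)) refl x b (j (c ⁻¹ₖ))))) (T-j* (c ⁻¹ₖ) (b * x))
        where open Solver₃
      N-t : Nm t ≡ Nm b *ₖ (c ⁻¹ₖ *ₖ c ⁻¹ₖ)
      N-t = trans (N-* (bar b) (j (c ⁻¹ₖ))) (cong₂ _*ₖ_ (N-bar b) (N-j (c ⁻¹ₖ)))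
      complete : ∀ x → c *ₖ Nm x +ₖ (-ₖ T (b * x)) ≡ (-ₖ (Nm b *ₖ c ⁻¹ₖ)) +ₖ c *ₖ Nm (x - t)
      complete x = sym (begin
        (-ₖ (Nm b *ₖ c ⁻¹ₖ)) +ₖ c *ₖ Nm (x - t)
          ≡⟨ cong (λ s → (-ₖ (Nm b *ₖ c ⁻¹ₖ)) +ₖ c *ₖ s) (trans (N-minus x t) (cong₂ (λ u v → Nm x +ₖ (-ₖ u) +ₖ v) (T-t x) N-t)) ⟩
        (-ₖ (Nm b *ₖ c ⁻¹ₖ)) +ₖ c *ₖ (Nm x +ₖ (-ₖ (c ⁻¹ₖ *ₖ T (b * x))) +ₖ Nm b *ₖ (c ⁻¹ₖ *ₖ c ⁻¹ₖ))
          ≡⟨ solveᴷ 5 (λ c d n u m → (:-ᴷ (m :*ᴷ d)) :+ᴷ c :*ᴷ (n :+ᴷ (:-ᴷ (d :*ᴷ u)) :+ᴷ m :*ᴷ (d :*ᴷ d)) :=ᴷ (:-ᴷ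
              (m :*ᴷ d)) :+ᴷ (c :*ᴷ n :+ᴷ (:-ᴷ ((c :*ᴷ d) :*ᴷ u)) :+ᴷ m :*ᴷ ((c :*ᴷ d) :*ᴷ d)))
               refl c (c ⁻¹ₖ) (Nm x) (T (b * x)) (Nm b) ⟩
        (-ₖ (Nm b *ₖ c ⁻¹ₖ)) +ₖ (c *ₖ Nm x +ₖ (-ₖ (c *ₖ c ⁻¹ₖ *ₖ T (b * x))) +ₖ Nm b *ₖ (c *ₖ c ⁻¹ₖ *ₖ c ⁻¹ₖ))
          ≡⟨ cong (λ s → (-ₖ (Nm b *ₖ c ⁻¹ₖ)) +ₖ (c *ₖ Nm x +ₖ (-ₖ (s *ₖ T (b * x))) +ₖ Nm b *ₖ (s *ₖ c ⁻¹ₖ)))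
              (Kf.*-inverse c≢0) ⟩
        (-ₖ (Nm b *ₖ c ⁻¹ₖ)) +ₖ (c *ₖ Nm x +ₖ (-ₖ (1ₖ *ₖ T (b * x))) +ₖ Nm b *ₖ (1ₖ *ₖ c ⁻¹ₖ))
          ≡⟨ solveᴷ 5 (λ c d n u m → (:-ᴷ (m :*ᴷ d)) :+ᴷ (c :*ᴷ n :+ᴷ (:-ᴷ (conᴷ 1F :*ᴷ u)) :+ᴷ m :*ᴷ
              (conᴷ 1F :*ᴷ d)) :=ᴷ c :*ᴷ n :+ᴷ (:-ᴷ u)) refl c (c ⁻¹ₖ) (Nm x) (T (b * x)) (Nm b) ⟩
        c *ₖ Nm x +ₖ (-ₖ T (b * x)) ∎)

    private
      p : Fin N → Fin N → 𝔼
      p b x = ε (χ x) ⊗ bracket (c *ₖ Nm x) ⊗ ψ (-ₖ T (b * x))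

      line : Fin N → Fin N → Fin q → 𝔼
      line b x y = bracket (c *ₖ Nm x *ₖ (y *ₖ y)) ⊗ ψ (-ₖ (T (b * x) *ₖ y))

    p-scale : ∀ b x y → p b (j y * x) ≡ ε (χ x) ⊗ line b x y
    p-scale b x y with y ≟F 0ₖ
    ... | yes refl = trans (cong (λ s → ε (χ (j 0ₖ * x)) ⊗ s ⊗ ψ (-ₖ T (b * (j 0ₖ * x)))) (bracket-0 (trans (cong (c *ₖ_)
        (trans (N-* (j 0ₖ) x) (trans (cong (_*ₖ Nm x) (trans (cong Nm j-0) N-0)) (Kf.zeroˡ (Nm x))))) (Kf.zeroʳ c))))
      (trans (solveᴱ 2 (λ s t → s :*ᴱ conᴱ (+ 0) :*ᴱ t :=ᴱ conᴱ (+ 0)) refl (ε (χ (j 0ₖ * x))) (ψ (-ₖ T (b * (j 0ₖ * x)))))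
      (sym (trans (cong (λ s → ε (χ x) ⊗ (s ⊗ ψ (-ₖ (T (b * x) *ₖ 0ₖ)))) (bracket-0 (solveᴷ 1 (λ s → s :*ᴷ
          (conᴷ 0F :*ᴷ conᴷ 0F) :=ᴷ conᴷ 0F) refl (c *ₖ Nm x))))
        (solveᴱ 2 (λ s t → s :*ᴱ (conᴱ (+ 0) :*ᴱ t) :=ᴱ conᴱ (+ 0)) refl (ε (χ x)) (ψ (-ₖ (T (b * x) *ₖ 0ₖ)))))))
    ... | no y≢0 = trans (cong₂ _⊗_ (cong₂ (λ s t → ε s ⊗ bracket t) (trans (χ-* (j y) x) (trans (cong (_* χ x) (χ-j y≢0))
        (*-identityˡ (χ x))))
        (trans (cong (c *ₖ_) (trans (N-* (j y) x) (cong (_*ₖ Nm x) (N-j y)))) (solveᴷ 3 (λ c y n → c :*ᴷ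
            (y :*ᴷ y :*ᴷ n) :=ᴷ c :*ᴷ n :*ᴷ (y :*ᴷ y)) refl c y (Nm x))))
        (cong (λ s → ψ (-ₖ s)) (trans (cong T (solve 3 (λ b y x → b :* (y :* x) := y :* (b :* x)) refl b (j y) x)) (trans
            (T-j* y (b * x)) (Kf.*-comm y (T (b * x)))))))
      (𝔼ᵣ.*-assoc (ε (χ x)) _ _)
      where open Solver₃

    τ : Fin N → Fin N → Fin q
    τ b x = T (b * x) *ₖ T (b * x) *ₖ (c *ₖ Nm x) ⁻¹ₖ

    -- Sum over all dilations x ↦ y x with y in `K`: each y ≠ 0 reproduces P, and y = 0 contributes
    -- 0. Exchanging the sums leaves `∑-line` with A = c N(x) and B = T(b x); its Gauss sum is
    -- η(N(x)) Γ(c), and η(N(x)) turns ε into ς.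
    P-formula : ∀ b → q₋₁ ⊗ P b ≡ Γ c ⊗ ∑ (λ x → ς (χ x) ⊗ ψ-Φ (τ b x))
    P-formula b = begin
      q₋₁ ⊗ P b
        ≡⟨ ∑-nonzero (P b) ⟨
      ∑ (λ y → (1𝔼 ⊕ ⊖ δ 0ₖ y) ⊗ P b)
        ≡⟨ ∑-cong columns ⟨
      ∑ (λ y → ∑ (λ x → p b (j y * x)))
        ≡⟨ trans (∑-cong (λ y → ∑-cong (λ x → p-scale b x y))) (∑-swap (λ y x → ε (χ x) ⊗ line b x y)) ⟩
      ∑ (λ x → ∑ (λ y → ε (χ x) ⊗ line b x y))
        ≡⟨ ∑-cong (λ x → trans (∑-*ˡ (ε (χ x)) (line b x)) (rows x)) ⟩
      ∑ (λ x → Γ c ⊗ (ς (χ x) ⊗ ψ-Φ (τ b x)))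
        ≡⟨ ∑-*ˡ (Γ c) (λ x → ς (χ x) ⊗ ψ-Φ (τ b x)) ⟩
      Γ c ⊗ ∑ (λ x → ς (χ x) ⊗ ψ-Φ (τ b x)) ∎
      where
      columns : ∀ y → ∑ (λ x → p b (j y * x)) ≡ (1𝔼 ⊕ ⊖ δ 0ₖ y) ⊗ P b
      columns y with y ≟F 0ₖ
      ... | yes refl = trans (∑-0 (λ x → trans (p-scale b x 0ₖ) (trans (cong (λ s → ε (χ x) ⊗ (s ⊗ ψ (-ₖ (T
          (b * x) *ₖ 0ₖ)))) (bracket-0 (solveᴷ 1 (λ s → s :*ᴷ (conᴷ 0F :*ᴷ conᴷ 0F) :=ᴷ conᴷ 0F) refl (c *ₖ Nm x))))
          (solveᴱ 2 (λ s t → s :*ᴱ (conᴱ (+ 0) :*ᴱ t) :=ᴱ conᴱ (+ 0)) refl (ε (χ x)) (ψ (-ₖ (T (b * x) *ₖ 0ₖ)))))))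
        (sym (trans (cong (λ d → (1𝔼 ⊕ ⊖ d) ⊗ P b) (δ-≡ refl)) (solveᴱ 1 (λ s → (conᴱ (+ 1) :+ᴱ (:-ᴱ conᴱ
            (+ 1))) :*ᴱ s :=ᴱ conᴱ (+ 0)) refl (P b))))
      ... | no y≢0 = trans (∑-scale (p b) (j≢0 y≢0)) (sym (trans (cong (λ d → (1𝔼 ⊕ ⊖ d) ⊗ P b) (δ-≢ (y≢0 ∘ sym)))
          (solveᴱ 1 (λ s → (conᴱ (+ 1) :+ᴱ (:-ᴱ conᴱ (+ 0))) :*ᴱ s :=ᴱ s) refl (P b))))
      rows : ∀ x → ε (χ x) ⊗ ∑ (line b x) ≡ Γ c ⊗ (ς (χ x) ⊗ ψ-Φ (τ b x))
      rows x with x ≟F 0#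
      ... | yes refl = trans (cong (_⊗ ∑ (line b 0#)) (trans (cong ε χ-0) ε-0)) (trans (𝔼ᵣ.zeroˡ (∑ (line b 0#)))
        (sym (trans (cong (λ s → Γ c ⊗ (s ⊗ ψ-Φ (τ b 0#))) (trans (cong ς χ-0) ς-0)) (solveᴱ 2 (λ s t → s :*ᴱ (conᴱ
            (+ 0) :*ᴱ t) :=ᴱ conᴱ (+ 0)) refl (Γ c) (ψ-Φ (τ b 0#))))))
      ... | no x≢0 = begin
        ε (χ x) ⊗ ∑ (line b x)
          ≡⟨ cong (ε (χ x) ⊗_) (∑-line (T (b * x)) (Kf.*-≢0 c≢0 (N≢0 x≢0))) ⟩
        ε (χ x) ⊗ (Γ (c *ₖ Nm x) ⊗ ψ-Φ (τ b x))
          ≡⟨ cong (λ s → ε (χ x) ⊗ (s ⊗ ψ-Φ (τ b x))) (trans (cong Γ (Kf.*-comm c (Nm x))) (Γ-scale (N≢0 x≢0) c≢0)) ⟩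
        ε (χ x) ⊗ (η (Nm x) ⊗ Γ c ⊗ ψ-Φ (τ b x))
          ≡⟨ solveᴱ 4 (λ e n g f → e :*ᴱ (n :*ᴱ g :*ᴱ f) :=ᴱ g :*ᴱ ((e :*ᴱ n) :*ᴱ f)) refl (ε (χ x)) (η (Nm x)) (Γ c) (ψ-Φ
              (τ b x)) ⟩
        Γ c ⊗ (ε (χ x) ⊗ η (Nm x) ⊗ ψ-Φ (τ b x))
          ≡⟨ cong (λ s → Γ c ⊗ (s ⊗ ψ-Φ (τ b x))) (ε-η x) ⟩
        Γ c ⊗ (ς (χ x) ⊗ ψ-Φ (τ b x)) ∎

    -- For b = 0 the argument τ vanishes identically, while x ↦ i x negates ς. So the sum in
    -- `P-formula` equals its own negative.
    P-0 : P 0# ≡ 0𝔼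
    P-0 = q₋₁-cancel (trans (P-formula 0#) (trans (cong (Γ c ⊗_) (self-neg (begin
        ∑ f                       ≡⟨ ∑-i* f ⟨
        ∑ (λ x → f (i * x))       ≡⟨ ∑-cong (λ x → trans (cong₂ (λ s t → s ⊗ ψ-Φ t) (trans (cong ς (χ-i* x)) (ς-neg
            (χ x))) (trans (τ-0 (i * x)) (sym (τ-0 x)))) (⊖-⊗ˡ (ς (χ x)) (ψ-Φ (τ 0# x)))) ⟩
        ∑ (λ x → ⊖ f x)           ≡⟨ ∑-⊖ f ⟩
        ⊖ ∑ f                     ∎)))
      (trans (𝔼ᵣ.zeroʳ (Γ c)) (sym (𝔼ᵣ.zeroʳ q₋₁)))))
      where
      f : Fin N → 𝔼
      f x = ς (χ x) ⊗ ψ-Φ (τ 0# x)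
      τ-0 : ∀ x → τ 0# x ≡ 0ₖ
      τ-0 x = trans (cong (λ t → t *ₖ t *ₖ (c *ₖ Nm x) ⁻¹ₖ) (trans (cong T (zeroˡ x)) T-0)) (solveᴷ 1
          (λ s → conᴷ 0F :*ᴷ conᴷ 0F :*ᴷ s :=ᴷ conᴷ 0F) refl ((c *ₖ Nm x) ⁻¹ₖ))

    θ : Fin N → Fin q
    θ x = T x *ₖ T x *ₖ Nm x ⁻¹ₖ

    θ-bar : ∀ x → θ (bar x) ≡ θ x
    θ-bar x = cong₂ (λ t n → t *ₖ t *ₖ n ⁻¹ₖ) (T-bar x) (N-bar x)

    θ-i* : ∀ {x} → x ≢ 0# → θ (i * x) ≡ 1ₖ +ₖ (-ₖ θ x)
    θ-i* {x} x≢0 = begin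
      T (i * x) *ₖ T (i * x) *ₖ Nm (i * x) ⁻¹ₖ
        ≡⟨ cong (λ n → T (i * x) *ₖ T (i * x) *ₖ n ⁻¹ₖ) (N-i* x) ⟩
      T (i * x) *ₖ T (i * x) *ₖ Nm x ⁻¹ₖ
        ≡⟨ solveᴷ 3 (λ s t d → s :*ᴷ s :*ᴷ d :=ᴷ (s :*ᴷ s :+ᴷ t :*ᴷ t) :*ᴷ d :+ᴷ (:-ᴷ (t :*ᴷ t :*ᴷ d))) refl (T (i * x))
            (T x) (Nm x ⁻¹ₖ) ⟩
      (T (i * x) *ₖ T (i * x) +ₖ T x *ₖ T x) *ₖ Nm x ⁻¹ₖ +ₖ (-ₖ θ x)
        ≡⟨ cong (_+ₖ (-ₖ θ x)) (trans (cong (_*ₖ Nm x ⁻¹ₖ) (T²-i* x)) (Kf.*-inverse (N≢0 x≢0))) ⟩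
      1ₖ +ₖ (-ₖ θ x) ∎

    -- θ is centred at the fixed point 1 / 2 = - 1 of the involution θ ↦ 1 - θ, so that L is odd
    -- under x ↦ i x.
    L : Fin N → Fin q
    L x = θ x +ₖ 1ₖ

    L-i* : ∀ {x} → x ≢ 0# → L (i * x) ≡ -ₖ L x
    L-i* {x} x≢0 = trans (cong (_+ₖ 1ₖ) (θ-i* x≢0)) (solveᴷ 1 (λ t → conᴷ 1F :+ᴷ (:-ᴷ t) :+ᴷ conᴷ 1F :=ᴷ :-ᴷ
        (t :+ᴷ conᴷ 1F)) refl (θ x))

    module _ {M : Fin q} (M≢0 : M ≢ 0ₖ) where
      -- A lift of Z to `F`, equal to (q - 1) Z by `Z′≡`. Over `F` the symmetry x ↦ i x shows that
      -- the sum is purely imaginary, and `conj-Z` carries this down to Z.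
      Z′ : 𝔼
      Z′ = ∑ (λ x → κ (χ x) ⊗ ψ (M *ₖ L x))

      private
        κ-twist : (f : Fin q → 𝔼) → ∑ (λ x → κ (χ x) ⊗ f (L x)) ≡ ⊖ ∑ (λ x → κ (χ x) ⊗ f (-ₖ L x))
        -- x ↦ i x negates both κ(χ(x)) and L(x). At x = 0, where L keeps its value, the weight κ is
        -- 0.
        κ-twist f = begin
          ∑ (λ x → κ (χ x) ⊗ f (L x))             ≡⟨ ∑-i* (λ x → κ (χ x) ⊗ f (L x)) ⟨
          ∑ (λ x → κ (χ (i * x)) ⊗ f (L (i * x))) ≡⟨ ∑-cong pointwise ⟩
          ∑ (λ x → ⊖ (κ (χ x) ⊗ f (-ₖ L x)))      ≡⟨ ∑-⊖ (λ x → κ (χ x) ⊗ f (-ₖ L x)) ⟩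
          ⊖ ∑ (λ x → κ (χ x) ⊗ f (-ₖ L x))        ∎
          where
          pointwise : ∀ x → κ (χ (i * x)) ⊗ f (L (i * x)) ≡ ⊖ (κ (χ x) ⊗ f (-ₖ L x))
          pointwise x with x ≟F 0#
          ... | yes refl = trans (cong (_⊗ f (L (i * 0#))) (trans (cong (κ ∘ χ) (zeroʳ i)) (trans (cong κ χ-0) κ-0)))
            (trans (solveᴱ 2 (λ s t → conᴱ (+ 0) :*ᴱ s :=ᴱ :-ᴱ (conᴱ (+ 0) :*ᴱ t)) refl (f (L (i * 0#))) (f (-ₖ L 0#)))
                (cong (λ s → ⊖ (s ⊗ f (-ₖ L 0#))) (sym (trans (cong κ χ-0) κ-0))))
          ... | no x≢0 = trans (cong₂ _⊗_ (trans (cong κ (χ-i* x)) (κ-neg (χ x))) (cong f (L-i* x≢0))) (⊖-⊗ˡ (κ (χ x)) (f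
              (-ₖ L x)))

      conj-Z′ : conj Z′ ≡ ⊖ Z′
      conj-Z′ = begin
        conj Z′                                     ≡⟨ conj-∑ (λ x → κ (χ x) ⊗ ψ (M *ₖ L x)) ⟩
        ∑ (λ x → conj (κ (χ x) ⊗ ψ (M *ₖ L x)))     ≡⟨ ∑-cong (λ x → trans (conj-* (κ (χ x)) (ψ (M *ₖ L x))) (cong₂ _⊗_
            (conj-κ (χ x)) (trans (sym (ψ-neg (M *ₖ L x)))
                                                         (cong ψ (solveᴷ 2 (λ m l → :-ᴷ (m :*ᴷ l) :=ᴷ m :*ᴷ
                                                             (:-ᴷ l)) refl M (L x)))))) ⟩
        ∑ (λ x → κ (χ x) ⊗ ψ (M *ₖ (-ₖ L x)))       ≡⟨ solveᴱ 1 (λ s → s :=ᴱ :-ᴱ (:-ᴱ s)) refl _ ⟩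
        ⊖ ⊖ ∑ (λ x → κ (χ x) ⊗ ψ (M *ₖ (-ₖ L x)))   ≡⟨ cong ⊖_ (κ-twist (λ l → ψ (M *ₖ l))) ⟨
        ⊖ Z′                                        ∎
        where
        conj-δ : ∀ (u v : Fin N) → conj (δ u v) ≡ δ u v
        conj-δ u v with u ≟F v
        ... | yes p = trans (cong conj (δ-≡ p)) (trans (conj-⟪⟫ (+ 1)) (sym (δ-≡ p)))
        ... | no ¬p = trans (cong conj (δ-≢ ¬p)) (trans (conj-⟪⟫ (+ 0)) (sym (δ-≢ ¬p)))
        conj-κ : ∀ u → conj (κ u) ≡ κ u
        conj-κ u = trans (conj-+ (δ u 1#) (⊖ δ u (- 1#))) (cong₂ _⊕_ (conj-δ u 1#) (trans (conj-neg (δ u (- 1#))) (cong ⊖_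
            (conj-δ u (- 1#)))))

      -- From M θ = - M + M L, the sum of ψ(± M θ) becomes ψ(- M) ψ(M L) + ψ(M) ψ(- M L). The
      -- oddness in `κ-twist` folds the second half onto the first with a minus sign.
      ∑-κ : ∑ (λ x → κ (χ x) ⊗ ψ-Φ (M *ₖ θ x)) ≡ (ψ (-ₖ M) ⊕ ⊖ ψ M) ⊗ Z′
      ∑-κ = begin
        ∑ (λ x → κ (χ x) ⊗ ψ-Φ (M *ₖ θ x))
          ≡⟨ trans (∑-cong (λ x → trans (𝔼ᵣ.distribˡ (κ (χ x)) _ _) (cong₂ (λ s t → κ (χ x) ⊗ s ⊕ κ (χ x) ⊗ t)
                (trans (cong ψ (solveᴷ 2 (λ m t → m :*ᴷ t :=ᴷ (:-ᴷ m) :+ᴷ m :*ᴷ (t :+ᴷ conᴷ 1F)) refl M (θ x))) (ψ-+ _ _))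
                (trans (cong ψ (solveᴷ 2 (λ m t → :-ᴷ (m :*ᴷ t) :=ᴷ m :+ᴷ m :*ᴷ (:-ᴷ (t :+ᴷ conᴷ 1F))) refl M (θ x)))
                    (ψ-+ _ _)))))
             (∑-+ (λ x → κ (χ x) ⊗ (ψ (-ₖ M) ⊗ ψ (M *ₖ L x))) (λ x → κ (χ x) ⊗ (ψ M ⊗ ψ (M *ₖ (-ₖ L x))))) ⟩
        ∑ (λ x → κ (χ x) ⊗ (ψ (-ₖ M) ⊗ ψ (M *ₖ L x))) ⊕ ∑ (λ x → κ (χ x) ⊗ (ψ M ⊗ ψ (M *ₖ (-ₖ L x))))
          ≡⟨ cong₂ _⊕_ (trans (∑-cong (λ x → comm (κ (χ x)) (ψ (-ₖ M)) _)) (∑-*ˡ (ψ (-ₖ M)) (λ x → κ (χ x) ⊗ ψ (M *ₖ L x))))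
               (trans (∑-cong (λ x → comm (κ (χ x)) (ψ M) _)) (∑-*ˡ (ψ M) (λ x → κ (χ x) ⊗ ψ (M *ₖ (-ₖ L x))))) ⟩
        ψ (-ₖ M) ⊗ Z′ ⊕ ψ M ⊗ ∑ (λ x → κ (χ x) ⊗ ψ (M *ₖ (-ₖ L x)))
          ≡⟨ solveᴱ 4 (λ s t z y → s :*ᴱ z :+ᴱ t :*ᴱ y :=ᴱ s :*ᴱ z :+ᴱ (:-ᴱ t) :*ᴱ (:-ᴱ y)) refl (ψ (-ₖ M)) (ψ M) Z′ _ ⟩
        ψ (-ₖ M) ⊗ Z′ ⊕ ⊖ ψ M ⊗ ⊖ ∑ (λ x → κ (χ x) ⊗ ψ (M *ₖ (-ₖ L x)))
          ≡⟨ cong (λ s → ψ (-ₖ M) ⊗ Z′ ⊕ ⊖ ψ M ⊗ s) (κ-twist (λ l → ψ (M *ₖ l))) ⟨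
        ψ (-ₖ M) ⊗ Z′ ⊕ ⊖ ψ M ⊗ Z′
          ≡⟨ 𝔼ᵣ.distribʳ Z′ (ψ (-ₖ M)) (⊖ ψ M) ⟨
        (ψ (-ₖ M) ⊕ ⊖ ψ M) ⊗ Z′ ∎
        where
        comm : ∀ a b c → a ⊗ (b ⊗ c) ≡ b ⊗ (a ⊗ c)
        comm = solveᴱ 3 (λ a b c → a :*ᴱ (b :*ᴱ c) :=ᴱ b :*ᴱ (a :*ᴱ c)) refl

      -- Conjugation of `F` over `K` fixes θ, but it exchanges i and - i and so negates μ(χ(x)).
      ∑-μ : ∑ (λ x → μ (χ x) ⊗ ψ-Φ (M *ₖ θ x)) ≡ 0𝔼
      ∑-μ = self-neg (begin
        ∑ f                        ≡⟨ ∑-bar f ⟨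
        ∑ (λ x → f (bar x))        ≡⟨ ∑-cong (λ x → trans (cong₂ (λ s t → s ⊗ ψ-Φ (M *ₖ t)) (trans (cong μ (χ-bar x))
            (μ-bar (χ x))) (θ-bar x)) (⊖-⊗ˡ (μ (χ x)) _)) ⟩
        ∑ (λ x → ⊖ f x)            ≡⟨ ∑-⊖ f ⟩
        ⊖ ∑ f                      ∎)
        where
        f : Fin N → 𝔼
        f x = μ (χ x) ⊗ ψ-Φ (M *ₖ θ x)

      -- Only squares x = w² contribute to Z′, each of them twice.
      Z′-squares : Z′ ⊕ Z′ ≡ ∑ (λ w → quartic M≢0 (Nm w) (θ w))
      Z′-squares = sym (begin
        ∑ (λ w → quartic M≢0 (Nm w) (θ w))
          ≡⟨ ∑-cong square ⟨
        ∑ (λ w → f (w * w))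
          ≡⟨ ∑-fibre (λ w → w * w) f ⟩
        ∑ (λ x → ∑ (λ w → δ (w * w) x) ⊗ f x)
          ≡⟨ ∑-cong doubled ⟩
        ∑ (λ x → f x ⊕ f x)
          ≡⟨ ∑-+ f f ⟩
        Z′ ⊕ Z′ ∎)
        where
        f : Fin N → 𝔼
        f x = κ (χ x) ⊗ ψ (M *ₖ L x)

        vanishes : ∀ {x} S → κ (χ x) ≡ 0𝔼 → S ⊗ f x ≡ f x ⊕ f x
        vanishes {x} S κ≡0 = trans (cong (λ s → S ⊗ (s ⊗ ψ (M *ₖ L x))) κ≡0) (trans (solveᴱ 2 (λ s t → s :*ᴱ (conᴱ
            (+ 0) :*ᴱ t) :=ᴱ conᴱ (+ 0) :*ᴱ t :+ᴱ conᴱ (+ 0) :*ᴱ t) refl S (ψ (M *ₖ L x)))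
          (cong (λ s → s ⊗ ψ (M *ₖ L x) ⊕ s ⊗ ψ (M *ₖ L x)) (sym κ≡0)))

        twice : ∀ {x} → x ≢ 0# → χ x * χ x ≡ 1# → ∑ (λ w → δ (w * w) x) ⊗ f x ≡ f x ⊕ f x
        twice {x} x≢0 χ²≡1 with sqrt x χ²≡1
        ... | w , refl = trans (cong (_⊗ f (w * w)) (∑-square-roots (λ w≡0 → x≢0 (trans (cong (_* w) w≡0) (zeroˡ w)))))
          (solveᴱ 1 (λ s → (conᴱ (+ 1) :+ᴱ conᴱ (+ 1)) :*ᴱ s :=ᴱ s :+ᴱ s) refl (f (w * w)))

        doubled : ∀ x → ∑ (λ w → δ (w * w) x) ⊗ f x ≡ f x ⊕ f x
        doubled x with x ≟F 0#
        ... | yes refl = vanishes _ (trans (cong κ χ-0) κ-0)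
        ... | no x≢0   = by-unit refl (χ-unit x≢0)
          where
          open Solver₃
          by-unit : ∀ {u} → χ x ≡ u → Unit₄ u → ∑ (λ w → δ (w * w) x) ⊗ f x ≡ f x ⊕ f x
          by-unit eq u₁  = twice x≢0 (trans (cong₂ _*_ eq eq) (*-identityˡ 1#))
          by-unit eq u₋₁ = twice x≢0 (trans (cong₂ _*_ eq eq) (solve 0 ((:- con 1F) :* (:- con 1F) := con 1F) refl))
          by-unit eq uᵢ  = vanishes _ (trans (cong κ eq) κ-i)
          by-unit eq u₋ᵢ = vanishes _ (trans (cong κ eq) (trans (κ-neg i) (trans (cong ⊖_ κ-i) (solveᴱ 0 (:-ᴱ conᴱ
              (+ 0) :=ᴱ conᴱ (+ 0)) refl))))

        κ-square : ∀ w → κ (χ (w * w)) ≡ η (Nm w)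
        κ-square w = trans (cong κ (χ-* w w)) (sym (η-N w))

        -- T(w²) = T(w)² + N(w) gives θ(w²) = (θ(w) + 1)², whence L(w²) = (θ + 1)² + 1 = θ² - θ - 1
        -- with θ = θ(w). At w = 0 both sides carry the factor η(0) = 0.
        square : ∀ w → f (w * w) ≡ quartic M≢0 (Nm w) (θ w)
        square w with w ≟F 0#
        ... | yes refl = trans (cong (_⊗ ψ (M *ₖ L (0# * 0#))) zero-η) (trans (𝔼ᵣ.zeroˡ (ψ (M *ₖ L (0# * 0#)))) (sym
            (trans (cong (_⊗ ψ (M *ₖ (θ 0# *ₖ θ 0# +ₖ (-ₖ θ 0#) +ₖ (-ₖ 1ₖ)))) (trans (cong η N-0) η-0)) (𝔼ᵣ.zeroˡ _))))
          where
          zero-η : κ (χ (0# * 0#)) ≡ 0𝔼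
          zero-η = trans (κ-square 0#) (trans (cong η N-0) η-0)
        ... | no w≢0 = cong₂ _⊗_ (κ-square w) (cong (λ l → ψ (M *ₖ l)) (begin
          T (w * w) *ₖ T (w * w) *ₖ Nm (w * w) ⁻¹ₖ +ₖ 1ₖ
            ≡⟨ cong₂ (λ t d → t *ₖ t *ₖ d +ₖ 1ₖ) (T-square w) (trans (cong _⁻¹ₖ (N-* w w)) (Kf.⁻¹-* (Nm w) (Nm w))) ⟩
          (T w *ₖ T w +ₖ Nm w) *ₖ (T w *ₖ T w +ₖ Nm w) *ₖ (Nm w ⁻¹ₖ *ₖ Nm w ⁻¹ₖ) +ₖ 1ₖ
            ≡⟨ solveᴷ 3 (λ t n d → (t :*ᴷ t :+ᴷ n) :*ᴷ (t :*ᴷ t :+ᴷ n) :*ᴷ (d :*ᴷ d) :+ᴷ conᴷ 1F :=ᴷ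
                (t :*ᴷ t :*ᴷ d :+ᴷ n :*ᴷ d) :*ᴷ (t :*ᴷ t :*ᴷ d :+ᴷ n :*ᴷ d) :+ᴷ conᴷ 1F) refl (T w) (Nm w) (Nm w ⁻¹ₖ) ⟩
          (θ w +ₖ Nm w *ₖ Nm w ⁻¹ₖ) *ₖ (θ w +ₖ Nm w *ₖ Nm w ⁻¹ₖ) +ₖ 1ₖ
            ≡⟨ cong (λ s → (θ w +ₖ s) *ₖ (θ w +ₖ s) +ₖ 1ₖ) (Kf.*-inverse (N≢0 w≢0)) ⟩
          (θ w +ₖ 1ₖ) *ₖ (θ w +ₖ 1ₖ) +ₖ 1ₖ
            ≡⟨ solveᴷ 1 (λ t → (t :+ᴷ conᴷ 1F) :*ᴷ (t :+ᴷ conᴷ 1F) :+ᴷ conᴷ 1F :=ᴷ t :*ᴷ t :+ᴷ (:-ᴷ t) :+ᴷ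
                (:-ᴷ conᴷ 1F)) refl (θ w) ⟩
          θ w *ₖ θ w +ₖ (-ₖ θ w) +ₖ (-ₖ 1ₖ) ∎))

      Z′≡ : Z′ ≡ q₋₁ ⊗ Z M≢0
      Z′≡ = 2-cancel (begin
        Z′ ⊕ Z′
          ≡⟨ Z′-squares ⟩
        ∑ (λ w → quartic M≢0 (Nm w) (θ w))
          ≡⟨ ∑-reindex₂ (λ w → quartic M≢0 (Nm w) (θ w)) pair (λ x → -ₖ T x) (λ x → T (i * x)) pair-surjective
               (λ α β → trans (cong -ₖ_ (T-pair α β)) (solveᴷ 1 (λ a → :-ᴷ (:-ᴷ a) :=ᴷ a) refl α)) T-i*pair ⟩
        ∑ (λ α → ∑ (λ β → quartic M≢0 (Nm (pair α β)) (θ (pair α β))))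
          ≡⟨ ∑-cong (λ α → ∑-cong (λ β → trans (cong₂ (λ t n → quartic M≢0 n (t *ₖ t *ₖ n ⁻¹ₖ)) (T-pair α β) (N-pair α β))
               (cong (λ s → quartic M≢0 (α *ₖ α +ₖ β *ₖ β) (s *ₖ (α *ₖ α +ₖ β *ₖ β) ⁻¹ₖ)) (solveᴷ 1 (λ a → (:-ᴷ a) :*ᴷ
                   (:-ᴷ a) :=ᴷ a :*ᴷ a) refl α)))) ⟩
        ∑ (λ α → ∑ (λ β → quartic M≢0 (α *ₖ α +ₖ β *ₖ β) (α *ₖ α *ₖ (α *ₖ α +ₖ β *ₖ β) ⁻¹ₖ)))
          ≡⟨ ∑-quartic M≢0 ⟩
        q₋₁ ⊗ (Z M≢0 ⊕ Z M≢0)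
          ≡⟨ 𝔼ᵣ.distribˡ q₋₁ (Z M≢0) (Z M≢0) ⟩
        q₋₁ ⊗ Z M≢0 ⊕ q₋₁ ⊗ Z M≢0 ∎)

      conj-Z : conj (Z M≢0) ≡ ⊖ Z M≢0
      conj-Z = q₋₁-cancel (begin
        q₋₁ ⊗ conj (Z M≢0)          ≡⟨ cong (_⊗ conj (Z M≢0)) (trans (conj-+ ⟪ + q ⟫ (⊖ 1𝔼)) (cong₂ _⊕_ (conj-⟪⟫ (+ q))
            (trans (conj-neg 1𝔼) (cong ⊖_ (conj-⟪⟫ (+ 1)))))) ⟨
        conj q₋₁ ⊗ conj (Z M≢0)     ≡⟨ conj-* q₋₁ (Z M≢0) ⟨
        conj (q₋₁ ⊗ Z M≢0)          ≡⟨ cong conj Z′≡ ⟨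
        conj Z′                     ≡⟨ trans conj-Z′ (cong ⊖_ Z′≡) ⟩
        ⊖ (q₋₁ ⊗ Z M≢0)             ≡⟨ solveᴱ 2 (λ s t → :-ᴱ (s :*ᴱ t) :=ᴱ s :*ᴱ (:-ᴱ t)) refl q₋₁ (Z M≢0) ⟩
        q₋₁ ⊗ ⊖ Z M≢0               ∎)

    module _ {b : Fin N} (b≢0 : b ≢ 0#) where
      M : Fin q
      M = Nm b *ₖ c ⁻¹ₖ

      M≢0 : M ≢ 0ₖ
      M≢0 = Kf.*-≢0 (N≢0 b≢0) (Kf.⁻¹-≢0 c≢0)

      -- Substituting b⁻¹ x for x normalises the linear form to T(x). The dependence on b is then
      -- confined to M = N(b) / c and to a rotation of ς by χ(b⁻¹).
      τ-scale : ∀ x → τ b (b ⁻¹ * x) ≡ M *ₖ θ x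
      τ-scale x = begin
        T (b * (b ⁻¹ * x)) *ₖ T (b * (b ⁻¹ * x)) *ₖ (c *ₖ Nm (b ⁻¹ * x)) ⁻¹ₖ
          ≡⟨ cong₂ (λ s t → T s *ₖ T s *ₖ t) (trans (sym (*-assoc b (b ⁻¹) x)) (trans (cong (_* x) (*-inverse b≢0))
              (*-identityˡ x)))
               (trans (Kf.⁻¹-* c (Nm (b ⁻¹ * x))) (cong (c ⁻¹ₖ *ₖ_) (trans (cong _⁻¹ₖ (N-* (b ⁻¹) x)) (trans (Kf.⁻¹-* (Nm
                   (b ⁻¹)) (Nm x)) (cong (_*ₖ Nm x ⁻¹ₖ) N-b⁻¹))))) ⟩
        T x *ₖ T x *ₖ (c ⁻¹ₖ *ₖ (Nm b *ₖ Nm x ⁻¹ₖ))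
          ≡⟨ solveᴷ 4 (λ t d n e → t :*ᴷ t :*ᴷ (d :*ᴷ (n :*ᴷ e)) :=ᴷ n :*ᴷ d :*ᴷ (t :*ᴷ t :*ᴷ e)) refl (T x) (c ⁻¹ₖ)
              (Nm b) (Nm x ⁻¹ₖ) ⟩
        M *ₖ θ x ∎
        where
        N-b⁻¹ : Nm (b ⁻¹) ⁻¹ₖ ≡ Nm b
        N-b⁻¹ = Kf.⁻¹-unique (trans (sym (N-* (b ⁻¹) b)) (trans (cong Nm (trans (*-comm (b ⁻¹) b) (*-inverse b≢0))) N-1))

      P-value : ∃ λ σ → IsSign σ × P b ≡ σ ⊗ (Γ c ⊗ ((ψ (-ₖ M) ⊕ ⊖ ψ M) ⊗ Z M≢0))
      P-value = untwist (ς-twist (χ-unit (⁻¹-≢0 b≢0)))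
        where
        untwist : ∃₂ (λ σ ρ → IsSign σ × (∀ u → ς (χ (b ⁻¹) * u) ≡ σ ⊗ κ u ⊕ ρ ⊗ μ u)) →
                  ∃ λ σ → IsSign σ × P b ≡ σ ⊗ (Γ c ⊗ ((ψ (-ₖ M) ⊕ ⊖ ψ M) ⊗ Z M≢0))
        untwist (σ , ρ , σ-sign , twist) = σ , σ-sign , q₋₁-cancel (begin
            q₋₁ ⊗ P b
              ≡⟨ P-formula b ⟩
            Γ c ⊗ ∑ (λ x → ς (χ x) ⊗ ψ-Φ (τ b x))
              ≡⟨ cong (Γ c ⊗_) (∑-scale (λ x → ς (χ x) ⊗ ψ-Φ (τ b x)) (⁻¹-≢0 b≢0)) ⟨
            Γ c ⊗ ∑ (λ x → ς (χ (b ⁻¹ * x)) ⊗ ψ-Φ (τ b (b ⁻¹ * x)))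
              ≡⟨ cong (Γ c ⊗_) (∑-cong (λ x → trans (cong₂ (λ s t → s ⊗ ψ-Φ t) (trans (cong ς (χ-* (b ⁻¹) x)) (twist
                  (χ x))) (τ-scale x))
                   (solveᴱ 5 (λ s k r m f → (s :*ᴱ k :+ᴱ r :*ᴱ m) :*ᴱ f :=ᴱ s :*ᴱ (k :*ᴱ f) :+ᴱ r :*ᴱ (m :*ᴱ f)) refl σ (κ
                       (χ x)) ρ (μ (χ x)) (ψ-Φ (M *ₖ θ x))))) ⟩
            Γ c ⊗ ∑ (λ x → σ ⊗ (κ (χ x) ⊗ ψ-Φ (M *ₖ θ x)) ⊕ ρ ⊗ (μ (χ x) ⊗ ψ-Φ (M *ₖ θ x)))
              ≡⟨ cong (Γ c ⊗_) (trans (∑-+ (λ x → σ ⊗ (κ (χ x) ⊗ ψ-Φ (M *ₖ θ x))) (λ x → ρ ⊗ (μ (χ x) ⊗ ψ-Φ (M *ₖ θ x))))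
                   (cong₂ _⊕_ (trans (∑-*ˡ σ (λ x → κ (χ x) ⊗ ψ-Φ (M *ₖ θ x))) (cong (σ ⊗_) (trans (∑-κ M≢0) (cong ((ψ
                       (-ₖ M) ⊕ ⊖ ψ M) ⊗_) (Z′≡ M≢0)))))
                              (trans (∑-*ˡ ρ (λ x → μ (χ x) ⊗ ψ-Φ (M *ₖ θ x))) (cong (ρ ⊗_) (∑-μ M≢0))))) ⟩
            Γ c ⊗ (σ ⊗ ((ψ (-ₖ M) ⊕ ⊖ ψ M) ⊗ (q₋₁ ⊗ Z M≢0)) ⊕ ρ ⊗ 0𝔼)
              ≡⟨ solveᴱ 6 (λ g s d n z r → g :*ᴱ (s :*ᴱ (d :*ᴱ (n :*ᴱ z)) :+ᴱ r :*ᴱ conᴱ (+ 0)) :=ᴱ n :*ᴱ (s :*ᴱ (g :*ᴱ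
                  (d :*ᴱ z)))) refl (Γ c) σ (ψ (-ₖ M) ⊕ ⊖ ψ M) q₋₁ (Z M≢0) ρ ⟩
            q₋₁ ⊗ (σ ⊗ (Γ c ⊗ ((ψ (-ₖ M) ⊕ ⊖ ψ M) ⊗ Z M≢0))) ∎)

      Γ-M : ∃ λ σ → IsSign σ × Γ M ≡ σ ⊗ Γ c
      Γ-M = η n , sign-view (squareView n) , trans (cong Γ M≡) (Γ-scale n≢0 c≢0)
        where
        n : Fin q
        n = M *ₖ c ⁻¹ₖ
        n≢0 : n ≢ 0ₖ
        n≢0 = Kf.*-≢0 M≢0 (Kf.⁻¹-≢0 c≢0)
        M≡ : M ≡ n *ₖ c
        M≡ = sym (trans (Kf.*-assoc M (c ⁻¹ₖ) c) (trans (cong (M *ₖ_) (trans (Kf.*-comm (c ⁻¹ₖ) c) (Kf.*-inverse c≢0)))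
            (Kf.*-identityʳ M)))
        sign-view : SquareView n → IsSign (η n)
        sign-view (is-zero n≡0)       = contradiction n≡0 n≢0
        sign-view (is-square _ _ _ p) = inj₁ p
        sign-view (is-neg _ _ _ p)    = inj₂ p

      -- If ψ(M) = 1, both sides vanish and any sign will do. Otherwise Z = ± Γ(M) = ± Γ(c), and
      -- Γ(c)² = - q supplies the factor q.
      P-sign : ∃ λ σ → IsSign σ × P b ≡ σ ⊗ (⟪ + q ⟫ ⊗ (ψ M ⊕ ⊖ ψ (-ₖ M)))
      P-sign = cases P-value (cube-root-1? (ψ-root M))
        where
        combine : ∀ {σ} → IsSign σ → P b ≡ σ ⊗ (Γ c ⊗ ((ψ (-ₖ M) ⊕ ⊖ ψ M) ⊗ Z M≢0)) →
                  (∃ λ ρ → IsSign ρ × Γ M ≡ ρ ⊗ Γ c) → Z M≢0 ≡ Γ M ⊎ Z M≢0 ≡ ⊖ Γ M → ∃ λ σ → IsSign σ × P b ≡ σ ⊗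
                      (⟪ + q ⟫ ⊗ (ψ M ⊕ ⊖ ψ (-ₖ M)))
        combine {σ} σ-sign P≡ (ρ , ρ-sign , Γ≡) Z≡ = σ ⊗ (ω ⊗ ρ) , IsSign-⊗ σ-sign (IsSign-⊗ ω-sign ρ-sign) , (begin
          P b
            ≡⟨ trans P≡ (cong (λ z → σ ⊗ (Γ c ⊗ ((ψ (-ₖ M) ⊕ ⊖ ψ M) ⊗ z))) (trans Z≡ωΓ (cong (ω ⊗_) Γ≡))) ⟩
          σ ⊗ (Γ c ⊗ ((ψ (-ₖ M) ⊕ ⊖ ψ M) ⊗ (ω ⊗ (ρ ⊗ Γ c))))
            ≡⟨ solveᴱ 6 (λ s g t u w r → s :*ᴱ (g :*ᴱ ((t :+ᴱ (:-ᴱ u)) :*ᴱ (w :*ᴱ (r :*ᴱ g)))) :=ᴱ s :*ᴱ (w :*ᴱ r) :*ᴱ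
                ((:-ᴱ (g :*ᴱ g)) :*ᴱ (u :+ᴱ (:-ᴱ t)))) refl σ (Γ c) (ψ (-ₖ M)) (ψ M) ω ρ ⟩
          σ ⊗ (ω ⊗ ρ) ⊗ (⊖ (Γ c ⊗ Γ c) ⊗ (ψ M ⊕ ⊖ ψ (-ₖ M)))
            ≡⟨ cong (λ s → σ ⊗ (ω ⊗ ρ) ⊗ (s ⊗ (ψ M ⊕ ⊖ ψ (-ₖ M)))) (trans (cong ⊖_ (Γ² c≢0)) (solveᴱ 1 (λ n → :-ᴱ
                (:-ᴱ n) :=ᴱ n) refl ⟪ + q ⟫)) ⟩
          σ ⊗ (ω ⊗ ρ) ⊗ (⟪ + q ⟫ ⊗ (ψ M ⊕ ⊖ ψ (-ₖ M))) ∎)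
          where
          signed : Z M≢0 ≡ Γ M ⊎ Z M≢0 ≡ ⊖ Γ M → ∃ λ ω → IsSign ω × Z M≢0 ≡ ω ⊗ Γ M
          signed (inj₁ eq) = 1𝔼 , inj₁ refl , trans eq (sym (𝔼ᵣ.*-identityˡ (Γ M)))
          signed (inj₂ eq) = ⊖ 1𝔼 , inj₂ refl , trans eq (solveᴱ 1 (λ g → :-ᴱ g :=ᴱ (:-ᴱ conᴱ (+ 1)) :*ᴱ g) refl (Γ M))
          ω : 𝔼
          ω = proj₁ (signed Z≡)
          ω-sign : IsSign ω
          ω-sign = proj₁ (proj₂ (signed Z≡))
          Z≡ωΓ : Z M≢0 ≡ ω ⊗ Γ M
          Z≡ωΓ = proj₂ (proj₂ (signed Z≡))

        cases : (∃ λ σ → IsSign σ × P b ≡ σ ⊗ (Γ c ⊗ ((ψ (-ₖ M) ⊕ ⊖ ψ M) ⊗ Z M≢0))) → ψ M ≡ 1𝔼 ⊎ ψ M ≢ 1𝔼 →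
                ∃ λ σ → IsSign σ × P b ≡ σ ⊗ (⟪ + q ⟫ ⊗ (ψ M ⊕ ⊖ ψ (-ₖ M)))
        cases (σ , σ-sign , P≡) (inj₁ ψM≡1) = σ , σ-sign , trans P≡ (cong (σ ⊗_) (trans (cong₂ (λ s t → Γ c ⊗
            ((s ⊕ ⊖ t) ⊗ Z M≢0)) ψ-M≡1 ψM≡1)
            (trans (solveᴱ 3 (λ g z n → g :*ᴱ ((conᴱ (+ 1) :+ᴱ (:-ᴱ conᴱ (+ 1))) :*ᴱ z) :=ᴱ n :*ᴱ (conᴱ (+ 1) :+ᴱ
                (:-ᴱ conᴱ (+ 1)))) refl (Γ c) (Z M≢0) ⟪ + q ⟫)
              (cong₂ (λ s t → ⟪ + q ⟫ ⊗ (s ⊕ ⊖ t)) (sym ψM≡1) (sym ψ-M≡1)))))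
          where
          ψ-M≡1 : ψ (-ₖ M) ≡ 1𝔼
          ψ-M≡1 = trans (ψ-neg M) (trans (cong conj ψM≡1) (conj-⟪⟫ (+ 1)))
        cases (σ , σ-sign , P≡) (inj₂ ψM≢1) = combine σ-sign P≡ Γ-M (Z≡±Γ M≢0 ψM≢1 (conj-Z M≢0))

    2S′ : ∀ b → S b ⊕ S b ≡ ⊖ (⟪ + q ⟫ ⊗ ψ (-ₖ (Nm b *ₖ c ⁻¹ₖ))) ⊕ ⊖ (⟪ + q ⟫ ⊗ ψ (Nm b *ₖ c ⁻¹ₖ)) ⊕ P b
    2S′ b = trans (2S b) (cong₂ (λ s t → s ⊕ t ⊕ P b) (Q-value b c≢0) (trans (Q-value b (Kf.-≢0 c≢0)) (cong (λ s → ⊖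
        (⟪ + q ⟫ ⊗ ψ s))
      (trans (cong (λ s → -ₖ (Nm b *ₖ s)) (Kf.⁻¹-neg c≢0)) (solveᴷ 2 (λ n d → :-ᴷ (n :*ᴷ (:-ᴷ d)) :=ᴷ n :*ᴷ d) refl (Nm b)
          (c ⁻¹ₖ))))))

    S-0 : ∃ λ p → IsCubeRoot p × S 0# ≡ ⊖ (⟪ + q ⟫ ⊗ p)
    S-0 = 1𝔼 , is1 , 2-cancel (trans (2S′ 0#) (trans (cong₂ (λ s t → ⊖ (⟪ + q ⟫ ⊗ s) ⊕ ⊖ (⟪ + q ⟫ ⊗ t) ⊕ P 0#)
          (trans (cong ψ (trans (cong -ₖ_ N0/c) (solveᴷ 0 (:-ᴷ conᴷ 0F :=ᴷ conᴷ 0F) refl))) ψ-0) (trans (cong ψ N0/c) ψ-0))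
        (trans (cong (λ s → ⊖ (⟪ + q ⟫ ⊗ 1𝔼) ⊕ ⊖ (⟪ + q ⟫ ⊗ 1𝔼) ⊕ s) P-0) (𝔼ᵣ.+-identityʳ _))))
      where
      N0/c : Nm 0# *ₖ c ⁻¹ₖ ≡ 0ₖ
      N0/c = trans (cong (_*ₖ c ⁻¹ₖ) N-0) (Kf.zeroˡ (c ⁻¹ₖ))

    S-≢0 : ∀ {b} (b≢0 : b ≢ 0#) → (∃ λ σ → IsSign σ × P b ≡ σ ⊗ (⟪ + q ⟫ ⊗ (ψ (M b≢0) ⊕ ⊖ ψ (-ₖ M b≢0)))) →
           ∃ λ p → IsCubeRoot p × S b ≡ ⊖ (⟪ + q ⟫ ⊗ p)
    S-≢0 {b} b≢0 (_ , inj₁ refl , P≡) = ψ (-ₖ M b≢0) , ψ-root _ , 2-cancel (trans (2S′ b) (trans (cong (λ s → ⊖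
        (⟪ + q ⟫ ⊗ ψ (-ₖ M b≢0)) ⊕ ⊖ (⟪ + q ⟫ ⊗ ψ (M b≢0)) ⊕ s) P≡)
      (solveᴱ 3 (λ n s t → (:-ᴱ (n :*ᴱ t)) :+ᴱ (:-ᴱ (n :*ᴱ s)) :+ᴱ conᴱ (+ 1) :*ᴱ (n :*ᴱ (s :+ᴱ (:-ᴱ t))) :=ᴱ (:-ᴱ
          (n :*ᴱ t)) :+ᴱ (:-ᴱ (n :*ᴱ t))) refl ⟪ + q ⟫ (ψ (M b≢0)) (ψ (-ₖ M b≢0)))))
    S-≢0 {b} b≢0 (_ , inj₂ refl , P≡) = ψ (M b≢0) , ψ-root _ , 2-cancel (trans (2S′ b) (trans (cong (λ s → ⊖ (⟪ + q ⟫ ⊗ ψ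
        (-ₖ M b≢0)) ⊕ ⊖ (⟪ + q ⟫ ⊗ ψ (M b≢0)) ⊕ s) P≡)
      (solveᴱ 3 (λ n s t → (:-ᴱ (n :*ᴱ t)) :+ᴱ (:-ᴱ (n :*ᴱ s)) :+ᴱ (:-ᴱ conᴱ (+ 1)) :*ᴱ (n :*ᴱ (s :+ᴱ (:-ᴱ t))) :=ᴱ (:-ᴱ
          (n :*ᴱ s)) :+ᴱ (:-ᴱ (n :*ᴱ s))) refl ⟪ + q ⟫ (ψ (M b≢0)) (ψ (-ₖ M b≢0)))))

    S-value : ∀ b → ∃ λ p → IsCubeRoot p × S b ≡ ⊖ (⟪ + q ⟫ ⊗ p)
    S-value b with b ≟F 0#
    ... | yes refl = S-0
    ... | no b≢0   = S-≢0 b≢0 (P-sign b≢0)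

-- Transport of finite fields to index sets.

module Transport where

  open import Defs using (FiniteField)
  open TernaryFields
  open import Algebra.Structures using (IsCommutativeRing)
  open import Data.Fin.Base using (Fin; zero; suc)
  open import Data.Nat.Base as ℕ using (ℕ; zero; suc)
  open import Data.Product.Base using (∃; _,_; proj₁; proj₂)
  open import Function.Base using (_∘_)
  open import Relation.Binary.PropositionalEquality as ≡ using (_≡_)
  open import Relation.Nullary using (yes; no; ¬_; contradiction)
  open import Relation.Unary using (Decidable; Pred)

  -- The ring operations on a subset P are pulled back along an enumeration e, which turns setoid
  -- equality into equality of indices. It is used for `F`, with P always true, and for `K`, with P
  -- the fixed points of x ↦ x^r.
  module Subfield {c ℓ} {N m : ℕ} (F : FiniteField N c ℓ)
    (e : Fin m → FiniteField.Carrier F) (e-inj : ∀ {x y} → FiniteField._≈_ F (e x) (e y) → x ≡ y)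
    (P : FiniteField.Carrier F → Set ℓ) (e-surj : ∀ x → P x → ∃ λ i → FiniteField._≈_ F (e i) x) (e-P : ∀ i → P (e i)) where
    open FiniteField F

    module Build
      (P-+ : ∀ {x y} → P x → P y → P (x + y)) (P-* : ∀ {x y} → P x → P y → P (x * y)) (P-neg : ∀ {x} → P x → P (- x))
      (P-0 : P 0#) (P-1 : P 1#) (P-inv : ∀ {x y} → P x → x * y ≈ 1# → P y) (1+1+1 : 1# + (1# + 1#) ≈ 0#) where

      private
        _⊞_ _⊠_ : Fin m → Fin m → Fin m
        x ⊞ y = proj₁ (e-surj (e x + e y) (P-+ (e-P x) (e-P y)))
        x ⊠ y = proj₁ (e-surj (e x * e y) (P-* (e-P x) (e-P y)))
        ⊟_ : Fin m → Fin m
        ⊟ x = proj₁ (e-surj (- e x) (P-neg (e-P x)))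
        𝟘 𝟙 : Fin m
        𝟘 = proj₁ (e-surj 0# P-0)
        𝟙 = proj₁ (e-surj 1# P-1)

        e-+′ : ∀ x y → e (x ⊞ y) ≈ e x + e y
        e-+′ x y = proj₂ (e-surj (e x + e y) _)
        e-*′ : ∀ x y → e (x ⊠ y) ≈ e x * e y
        e-*′ x y = proj₂ (e-surj (e x * e y) _)
        e-neg′ : ∀ x → e (⊟ x) ≈ - e x
        e-neg′ x = proj₂ (e-surj (- e x) _)
        e-0′ : e 𝟘 ≈ 0#
        e-0′ = proj₂ (e-surj 0# P-0)
        e-1′ : e 𝟙 ≈ 1#
        e-1′ = proj₂ (e-surj 1# P-1)

        isCommutativeRing′ : IsCommutativeRing _≡_ _⊞_ _⊠_ ⊟_ 𝟘 𝟙
        isCommutativeRing′ = record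
          { isRing = record
            { +-isAbelianGroup = record
              { isGroup = record
                { isMonoid = record
                  { isSemigroup = record
                    { isMagma = record { isEquivalence = ≡.isEquivalence ; ∙-cong = ≡.cong₂ _⊞_ }
                    ; assoc = λ x y z → e-inj (trans (e-+′ _ z) (trans (+-congʳ (e-+′ x y)) (trans (+-assoc (e x) (e y)
                        (e z)) (sym (trans (e-+′ x _) (+-congˡ (e-+′ y z)))))))
                    }
                  ; identity = (λ x → e-inj (trans (e-+′ 𝟘 x) (trans (+-congʳ e-0′) (+-identityˡ (e x)))))
                             , (λ x → e-inj (trans (e-+′ x 𝟘) (trans (+-congˡ e-0′) (+-identityʳ (e x)))))
                  }
                ; inverse = (λ x → e-inj (trans (e-+′ _ x) (trans (+-congʳ (e-neg′ x)) (trans (-‿inverseˡ (e x)) (sym e-0′)))))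
                          , (λ x → e-inj (trans (e-+′ x _) (trans (+-congˡ (e-neg′ x)) (trans (-‿inverseʳ (e x)) (sym e-0′)))))
                ; ⁻¹-cong = ≡.cong ⊟_
                }
              ; comm = λ x y → e-inj (trans (e-+′ x y) (trans (+-comm (e x) (e y)) (sym (e-+′ y x))))
              }
            ; *-cong = ≡.cong₂ _⊠_
            ; *-assoc = λ x y z → e-inj (trans (e-*′ _ z) (trans (*-congʳ (e-*′ x y)) (trans (*-assoc (e x) (e y) (e z))
                (sym (trans (e-*′ x _) (*-congˡ (e-*′ y z)))))))
            ; *-identity = (λ x → e-inj (trans (e-*′ 𝟙 x) (trans (*-congʳ e-1′) (*-identityˡ (e x)))))
                         , (λ x → e-inj (trans (e-*′ x 𝟙) (trans (*-congˡ e-1′) (*-identityʳ (e x)))))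
            ; distrib = (λ x y z → e-inj (trans (e-*′ x _) (trans (*-congˡ (e-+′ y z)) (trans (distribˡ (e x) (e y) (e z))
                (sym (trans (e-+′ _ _) (+-cong (e-*′ x y) (e-*′ x z))))))))
                      , (λ x y z → e-inj (trans (e-*′ _ x) (trans (*-congʳ (e-+′ y z)) (trans (distribʳ (e x) (e y) (e z))
                          (sym (trans (e-+′ _ _) (+-cong (e-*′ y x) (e-*′ z x))))))))
            }
          ; *-comm = λ x y → e-inj (trans (e-*′ x y) (trans (*-comm (e x) (e y)) (sym (e-*′ y x))))
          }

      opaque
        subfield : Field₃ m
        subfield = record
          { _+_ = _⊞_ ; _*_ = _⊠_ ; -_ = ⊟_ ; 0# = 𝟘 ; 1# = 𝟙
          ; isCommutativeRing = isCommutativeRing′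
          ; 0≢1 = λ eq → 0≉1 (trans (sym e-0′) (trans (reflexive (≡.cong e eq)) e-1′))
          ; inverse = λ x x≢0 → inv x (λ ex≈0 → x≢0 (e-inj (trans ex≈0 (sym e-0′))))
          ; 1+1+1 = e-inj (trans (e-+′ 𝟙 _) (trans (+-cong e-1′ (trans (e-+′ 𝟙 𝟙) (+-cong e-1′ e-1′))) (trans 1+1+1 (sym e-0′))))
          }
          where
          inv : ∀ x → ¬ (e x ≈ 0#) → ∃ λ y → x ⊠ y ≡ 𝟙
          inv x ex≉0 with inverse (e x) ex≉0
          ... | y , xy≈1 with e-surj y (P-inv (e-P x) xy≈1)
          ...   | y′ , ey′≈y = y′ , e-inj (trans (e-*′ x y′) (trans (*-congˡ ey′≈y) (trans xy≈1 (sym e-1′))))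

        private module S = Field₃ subfield

        e-+ : ∀ x y → e (x S.+ y) ≈ e x + e y
        e-+ = e-+′

        e-* : ∀ x y → e (x S.* y) ≈ e x * e y
        e-* = e-*′

        e-0 : e S.0# ≈ 0#
        e-0 = e-0′

        e-1 : e S.1# ≈ 1#
        e-1 = e-1′

      e-^ : ∀ x n → e (x S.^ n) ≈ e x ^ n
      e-^ x zero    = e-1
      e-^ x (suc n) = trans (e-* x (x S.^ n)) (*-congˡ (e-^ x n))

  record Enumeration {ℓ} {N} (P : Pred (Fin N) ℓ) : Set ℓ where
    field
      size     : ℕ
      elem     : Fin size → Fin N
      sound    : ∀ i → P (elem i)
      index    : ∀ x → P x → ∃ λ i → elem i ≡ x
      elem-inj : ∀ {i j} → elem i ≡ elem j → i ≡ j

  enumerate : ∀ {ℓ N} {P : Pred (Fin N) ℓ} → Decidable P → Enumeration P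
  enumerate {N = zero} P? = record { size = 0 ; elem = λ () ; sound = λ () ; index = λ () ; elem-inj = λ {} }
  enumerate {N = suc N} {P} P? with P? zero | enumerate (P? ∘ suc)
  ... | no ¬P0 | E = record
    { size = size ; elem = suc ∘ elem ; sound = sound
    ; index = λ { zero P0 → contradiction P0 ¬P0 ; (suc x) Px → proj₁ (index x Px) , ≡.cong suc (proj₂ (index x Px)) }
    ; elem-inj = λ eq → elem-inj (suc-injective eq)
    }
    where
    open Enumeration E
    open import Data.Fin.Properties using (suc-injective)
  ... | yes P0 | E = record
    { size = suc size
    ; elem = λ { zero → zero ; (suc i) → suc (elem i) }
    ; sound = λ { zero → P0 ; (suc i) → sound i }
    ; index = λ { zero P0 → zero , ≡.refl ; (suc x) Px → suc (proj₁ (index x Px)) , ≡.cong suc (proj₂ (index x Px)) }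
    ; elem-inj = λ { {zero} {zero} eq → ≡.refl ; {suc i} {suc j} eq → ≡.cong suc (elem-inj (suc-injective eq)) }
    }
    where
    open Enumeration E
    open import Data.Fin.Properties using (suc-injective)

-- The order of a primitive element and the independence of Frobenius powers.

module PrimitiveElements where

  open TernaryFields
  open import Data.Fin.Base as Fin using (Fin; zero; suc; fromℕ<)
  open import Data.Fin.Patterns using (0F; 1F)
  open import Data.Fin.Properties using (injective⇒≤; fromℕ<-injective; suc-injective) renaming (_≟_ to _≟F_)
  open import Data.Nat.Base as ℕ using (ℕ; zero; suc; _≤_; _<_)
  open import Data.Nat.DivMod using (_%_; _/_; m≡m%n+[m/n]*n; m%n<n)
  import Data.Nat.Properties as ℕₚ
  open import Data.Product.Base using (∃; proj₁; proj₂)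
  open import Data.Sum.Base using (_⊎_; inj₁; inj₂)
  open import Relation.Binary.PropositionalEquality
  open import Relation.Nullary using (yes; no; contradiction)
  open ≡-Reasoning

  module PrimitiveElement {N} (F : Field₃ N) (ξ : Fin N) (ξ≢0 : ξ ≢ Field₃.0# F)
    (log : ∀ y → y ≢ Field₃.0# F → ∃ λ m → Field₃._^_ F ξ m ≡ y) where
    open Field₃ F
    open Solver₃

    -- If ξ^(m + 1) = 1, an element is determined by its logarithm modulo m + 1, with one further
    -- code for 0; so there are at most m + 2 elements.
    order-bound : ∀ m → ξ ^ suc m ≡ 1# → N ≤ suc (suc m)
    order-bound m ξ^m≡1 = injective⇒≤ {f = code} code-injective
      where
      residue : ∀ j → ξ ^ (j % suc m) ≡ ξ ^ j
      residue j = sym (begin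
        ξ ^ j                                        ≡⟨ cong (ξ ^_) (m≡m%n+[m/n]*n j (suc m)) ⟩
        ξ ^ (j % suc m ℕ.+ j / suc m ℕ.* suc m)      ≡⟨ ^-homo-* ξ (j % suc m) (j / suc m ℕ.* suc m) ⟩
        ξ ^ (j % suc m) * ξ ^ (j / suc m ℕ.* suc m)  ≡⟨ cong (λ t → ξ ^ (j % suc m) * ξ ^ t) (ℕₚ.*-comm (j / suc m) (suc m)) ⟩
        ξ ^ (j % suc m) * ξ ^ (suc m ℕ.* (j / suc m)) ≡⟨ cong (ξ ^ (j % suc m) *_) (trans (sym (^-assocʳ ξ (suc m)
            (j / suc m))) (trans (cong (_^ (j / suc m)) ξ^m≡1) (1^ (j / suc m)))) ⟩
        ξ ^ (j % suc m) * 1#                         ≡⟨ *-identityʳ _ ⟩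
        ξ ^ (j % suc m)                              ∎)
      code : Fin N → Fin (suc (suc m))
      code y with y ≟F 0#
      ... | yes _  = zero
      ... | no y≢0 = suc (fromℕ< (m%n<n (proj₁ (log y y≢0)) (suc m)))
      code-injective : ∀ {x y} → code x ≡ code y → x ≡ y
      code-injective {x} {y} eq with x ≟F 0# | y ≟F 0#
      ... | yes x≡0 | yes y≡0 = trans x≡0 (sym y≡0)
      ... | yes _   | no _    = contradiction eq λ ()
      ... | no _    | yes _   = contradiction eq λ ()
      ... | no x≢0  | no y≢0  = begin
        x                                   ≡⟨ trans (residue (proj₁ (log x x≢0))) (proj₂ (log x x≢0)) ⟨
        ξ ^ (proj₁ (log x x≢0) % suc m)     ≡⟨ cong (ξ ^_) (fromℕ<-injective _ _ _ _ (suc-injective eq)) ⟩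
        ξ ^ (proj₁ (log y y≢0) % suc m)     ≡⟨ trans (residue (proj₁ (log y y≢0))) (proj₂ (log y y≢0)) ⟩
        y                                   ∎

    -- ∑_{j < m} c j x^{3^j}
    Λ : ℕ → (ℕ → Fin N) → Fin N → Fin N
    Λ zero    c x = 0#
    Λ (suc m) c x = Λ m c x + c m * x ^ (3 ℕ.^ m)

    -- Replacing x by ξ x multiplies the term of index j by ξ^(3^j). Subtracting s times the
    -- original scales c j by ξ^(3^j) - s, which is 0 at the top index for a suitable s.
    Λ-twist : ∀ m c s x → Λ m (λ j → c j * (ξ ^ (3 ℕ.^ j) - s)) x ≡ Λ m c (ξ * x) - s * Λ m c x
    Λ-twist zero    c s x = solve 1 (λ s → con 0F := con 0F :- s :* con 0F) refl s
    Λ-twist (suc m) c s x = begin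
      Λ m (λ j → c j * (ξ ^ (3 ℕ.^ j) - s)) x + c m * (ξ ^ (3 ℕ.^ m) - s) * x ^ (3 ℕ.^ m)
        ≡⟨ cong (_+ c m * (ξ ^ (3 ℕ.^ m) - s) * x ^ (3 ℕ.^ m)) (Λ-twist m c s x) ⟩
      Λ m c (ξ * x) - s * Λ m c x + c m * (ξ ^ (3 ℕ.^ m) - s) * x ^ (3 ℕ.^ m)
        ≡⟨ solve 6 (λ l₁ s l₂ c u v → l₁ :- s :* l₂ :+ c :* (u :- s) :* v := l₁ :+ c :* (u :* v) :- s :* (l₂ :+ c :* v))
             refl (Λ m c (ξ * x)) s (Λ m c x) (c m) (ξ ^ (3 ℕ.^ m)) (x ^ (3 ℕ.^ m)) ⟩
      Λ m c (ξ * x) + c m * (ξ ^ (3 ℕ.^ m) * x ^ (3 ℕ.^ m)) - s * (Λ m c x + c m * x ^ (3 ℕ.^ m))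
        ≡⟨ cong (λ t → Λ m c (ξ * x) + c m * t - s * (Λ m c x + c m * x ^ (3 ℕ.^ m))) (^-distrib-* ξ x (3 ℕ.^ m)) ⟨
      Λ m c (ξ * x) + c m * (ξ * x) ^ (3 ℕ.^ m) - s * (Λ m c x + c m * x ^ (3 ℕ.^ m)) ∎

    twist : (ℕ → Fin N) → Fin N → ℕ → Fin N
    twist c s j = c j * (ξ ^ (3 ℕ.^ j) - s)

    Λ-eliminate : ∀ m c s → s ≡ ξ ^ (3 ℕ.^ m) → (∀ x → Λ (suc m) c x ≡ 0#) → ∀ x → Λ m (twist c s) x ≡ 0#
    Λ-eliminate m c s s≡ vanish x = begin
      Λ m (twist c s) x
        ≡⟨ solve 4 (λ l c s v → l := l :+ c :* (s :- s) :* v) refl (Λ m (twist c s) x) (c m) s (x ^ (3 ℕ.^ m)) ⟩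
      Λ m (twist c s) x + c m * (s - s) * x ^ (3 ℕ.^ m)
        ≡⟨ cong (λ t → Λ m (twist c s) x + c m * (t - s) * x ^ (3 ℕ.^ m)) s≡ ⟩
      Λ (suc m) (twist c s) x
        ≡⟨ Λ-twist (suc m) c s x ⟩
      Λ (suc m) c (ξ * x) - s * Λ (suc m) c x
        ≡⟨ cong₂ (λ u v → u - s * v) (vanish (ξ * x)) (vanish x) ⟩
      0# - s * 0#
        ≡⟨ solve 1 (λ s → con 0F :- s :* con 0F := con 0F) refl s ⟩
      0# ∎

    ξ≢ξ^ : ∀ l → 2 ≤ l → l < N → ξ ^ 1 ≢ ξ ^ l
    ξ≢ξ^ (suc (suc l)) _ l<N eq = contradiction (order-bound l (*-cancelˡ ξ ξ≢0 (sym eq))) (ℕₚ.<⇒≱ l<N)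
    ξ≢ξ^ (suc zero) (ℕ.s≤s ())

    -- Linear independence of the powers of Frobenius; the last term is eliminated by comparing x and ξ x.
    independence : ∀ m c → 3 ℕ.^ m < N → (∀ x → Λ (suc m) c x ≡ 0#) → c 0 ≡ 0#
    independence zero c _ vanish = trans (solve 1 (λ c → c := con 0F :+ c :* (con 1F :* con 1F)) refl (c 0)) (vanish 1#)
    -- Only the coefficient of index 0 is followed: the elimination multiplies it by ξ - s, which is
    -- nonzero because the order of ξ is too large for ξ = ξ^(3^(m + 1)).
    independence (suc m) c 3^m<N vanish = first-or (no-zero-divisors (c 0) (ξ ^ 1 - s)
        (independence m (twist c s) (ℕₚ.<-trans (ℕₚ.^-monoʳ-< 3 (ℕ.s≤s (ℕ.s≤s ℕ.z≤n)) (ℕₚ.n<1+n m)) 3^m<N) (Λ-eliminate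
            (suc m) c s refl vanish)))
      where
      s : Fin N
      s = ξ ^ (3 ℕ.^ suc m)
      first-or : c 0 ≡ 0# ⊎ ξ ^ 1 - s ≡ 0# → c 0 ≡ 0#
      first-or (inj₁ c₀≡0) = c₀≡0
      first-or (inj₂ ξ≡s)  = contradiction (x-y≡0⇒x≡y ξ≡s)
        (ξ≢ξ^ (3 ℕ.^ suc m) (ℕₚ.≤-trans (ℕ.s≤s (ℕ.s≤s ℕ.z≤n)) (ℕₚ.^-monoʳ-≤ 3 {1} {suc m} (ℕ.s≤s ℕ.z≤n))) 3^m<N)

-- The trace character and the given function.

module TraceCharacters where

  open import Defs using (FiniteField; module FiniteField; 𝔽₃; _-₃_; module Trace)
  open EisensteinIntegers
  open FiniteSums
  open TernaryFields
  open AdditiveCharacters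
  open QuadraticExtensions
  open WalshCoefficients
  open Transport
  open PrimitiveElements
  open import Level using (Level)
  import Algebra.Properties.CommutativeMonoid.Sum as Sum
  import Algebra.Properties.CommutativeSemiring.Exp as Exp
  import Algebra.Properties.Semiring.Mult as Mult
  import Algebra.Properties.Group as GroupProperties
  open import Data.Fin.Base as Fin using (Fin; toℕ)
  open import Data.Fin.Patterns using (0F; 1F; 2F)
  open import Data.Fin.Properties using (any?; toℕ-inject₁; toℕ-fromℕ) renaming (_≟_ to _≟F_)
  open import Data.Integer.Base using (+_)
  open import Data.Nat.Base as ℕ using (ℕ; zero; suc)
  open import Data.Nat.DivMod using (_/_; m*n/n≡m)
  import Data.Nat.Properties as ℕₚ
  open import Data.Nat.Solver using (module +-*-Solver)
  open import Data.Product.Base using (∃; _,_; proj₁; proj₂)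
  open import Data.Sum.Base as Sum′ using (_⊎_; inj₁; inj₂)
  open import Data.Unit.Polymorphic.Base using (⊤)
  open import Function.Base using (_∘_)
  open import Function.Bundles using (Inverse)
  open import Relation.Binary.PropositionalEquality as ≡ using (_≡_; _≢_; cong; cong₂)
  open import Relation.Nullary.Decidable using (decidable-stable)
  open import Relation.Nullary using (Dec; yes; no; ¬_; ¬?; contradiction)

  parity : ∀ m → ∃ λ l → m ≡ l ℕ.+ l ⊎ m ≡ suc (l ℕ.+ l)
  parity zero    = 0 , inj₁ ≡.refl
  parity (suc m) with parity m
  ... | l , inj₁ eq = l , inj₂ (cong suc eq)
  ... | l , inj₂ eq = suc l , inj₁ (≡.trans (cong suc eq) (cong suc (≡.sym (ℕₚ.+-suc l l))))

  ζ^ : 𝔽₃ → 𝔼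
  ζ^ 0F = 1𝔼
  ζ^ 1F = ζ
  ζ^ 2F = ζ²

  ζ^-root : ∀ s → IsCubeRoot (ζ^ s)
  ζ^-root 0F = is1
  ζ^-root 1F = isζ
  ζ^-root 2F = isζ²

  ζ^-surjective : ∀ {p} → IsCubeRoot p → ∃ λ s → ζ^ s ≡ p
  ζ^-surjective is1  = 0F , ≡.refl
  ζ^-surjective isζ  = 1F , ≡.refl
  ζ^-surjective isζ² = 2F , ≡.refl

  _+₃_ : 𝔽₃ → 𝔽₃ → 𝔽₃
  0F +₃ t = t
  s  +₃ 0F = s
  1F +₃ 1F = 2F
  1F +₃ 2F = 0F
  2F +₃ 1F = 0F
  2F +₃ 2F = 1F

  ζ^-+ : ∀ s t → ζ^ (s +₃ t) ≡ ζ^ s ⊗ ζ^ t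
  ζ^-+ 0F t  = ≡.sym (𝔼ᵣ.*-identityˡ (ζ^ t))
  ζ^-+ 1F 0F = ≡.sym (𝔼ᵣ.*-identityʳ ζ)
  ζ^-+ 1F 1F = ≡.sym ζ*ζ
  ζ^-+ 1F 2F = ≡.sym ζ*ζ²
  ζ^-+ 2F 0F = ≡.sym (𝔼ᵣ.*-identityʳ ζ²)
  ζ^-+ 2F 1F = ≡.sym (≡.trans (𝔼ᵣ.*-comm ζ² ζ) ζ*ζ²)
  ζ^-+ 2F 2F = ≡.sym ζ²*ζ²

  ζ^-- : ∀ s t → ζ^ (s -₃ t) ≡ ζ^ s ⊗ conj (ζ^ t)
  ζ^-- s 0F = ≡.trans (l s) (≡.sym (≡.trans (cong (ζ^ s ⊗_) (conj-⟪⟫ (+ 1))) (𝔼ᵣ.*-identityʳ (ζ^ s))))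
    where
    l : ∀ s → ζ^ (s -₃ 0F) ≡ ζ^ s
    l 0F = ≡.refl
    l 1F = ≡.refl
    l 2F = ≡.refl
  ζ^-- s 1F = ≡.trans (≡.trans (l s) (ζ^-+ s 2F)) (cong (ζ^ s ⊗_) (≡.sym conj-ζ))
    where
    l : ∀ s → ζ^ (s -₃ 1F) ≡ ζ^ (s +₃ 2F)
    l 0F = ≡.refl
    l 1F = ≡.refl
    l 2F = ≡.refl
  ζ^-- s 2F = ≡.trans (≡.trans (l s) (ζ^-+ s 1F)) (cong (ζ^ s ⊗_) (≡.sym conj-ζ²))
    where
    l : ∀ s → ζ^ (s -₃ 2F) ≡ ζ^ (s +₃ 1F)
    l 0F = ≡.refl
    l 1F = ≡.refl
    l 2F = ≡.refl

  module Main {c ℓ : Level} (k′ g n : ℕ) (n≡ : n ≡ 2 ℕ.* suc k′) (r≡ : 3 ℕ.^ suc k′ ≡ 3 ℕ.+ 4 ℕ.* (2 ℕ.* g))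
    (F₀ : FiniteField (3 ℕ.^ n) c ℓ) (ξ₀ : FiniteField.Carrier F₀) (generates : FiniteField.IsPrimitive F₀ ξ₀) where

    private
      N r h e₀ : ℕ
      N = 3 ℕ.^ n
      r = 3 ℕ.^ suc k′
      h = 2 ℕ.* g
      e₀ = (2 ℕ.+ 4 ℕ.* h) ℕ.* (1 ℕ.+ h)
      module F₀ = FiniteField F₀
      module E = Inverse F₀.enumeration
      module Tr = Trace n F₀
      module Ex₀ = Exp F₀.commutativeSemiring
      module G₀ = GroupProperties F₀.+-group
      open F₀ using (_≈_) renaming (_+_ to _+₀_; _*_ to _*₀_; -_ to -₀_; 0# to 0₀; 1# to 1₀; _^_ to _^₀_; refl to ≈-refl;
          sym to ≈-sym; trans to ≈-trans)

      N≡ : N ≡ r ℕ.* r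
      N≡ = ≡.trans (cong (3 ℕ.^_) (≡.trans n≡ (cong (suc k′ ℕ.+_) (ℕₚ.+-identityʳ (suc k′))))) (ℕₚ.^-distribˡ-+-* 3
          (suc k′) (suc k′))

      e : Fin N → F₀.Carrier
      e = E.to

      e-inj : ∀ {x y} → e x ≈ e y → x ≡ y
      e-inj {x} {y} eq = ≡.trans (≡.sym (Tr.from-to x)) (≡.trans (E.from-cong eq) (Tr.from-to y))

      1+1+1₀ : 1₀ +₀ (1₀ +₀ 1₀) ≈ 0₀
      1+1+1₀ = ≈-trans (F₀.+-congˡ (F₀.+-congˡ (≈-sym (F₀.+-identityʳ 1₀)))) Tr.characteristic-3

      frobenius₀ : ∀ m x y → (x +₀ y) ^₀ (3 ℕ.^ m) ≈ x ^₀ (3 ℕ.^ m) +₀ y ^₀ (3 ℕ.^ m)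
      frobenius₀ zero    x y = ≈-trans (F₀.*-identityʳ _) (F₀.+-cong (≈-sym (F₀.*-identityʳ x)) (≈-sym (F₀.*-identityʳ y)))
      frobenius₀ (suc m) x y = ≈-trans (step (x +₀ y)) (≈-trans (Ex₀.^-congˡ 3 (frobenius₀ m x y))
        (≈-trans (Tr.frobenius-+ _ _) (≈-sym (F₀.+-cong (step x) (step y)))))
        where
        step : ∀ x → x ^₀ (3 ℕ.^ suc m) ≈ (x ^₀ (3 ℕ.^ m)) ^₀ 3
        step x = ≈-trans (Ex₀.^-congʳ x (ℕₚ.*-comm 3 (3 ℕ.^ m))) (≈-sym (Ex₀.^-assocʳ x (3 ℕ.^ m) 3))

      0^₀ : ∀ m → .{{ℕ.NonZero m}} → 0₀ ^₀ m ≈ 0₀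
      0^₀ (suc m) = F₀.zeroˡ _

      1^₀ : ∀ m → 1₀ ^₀ m ≈ 1₀
      1^₀ zero    = ≈-refl
      1^₀ (suc m) = ≈-trans (F₀.*-identityˡ _) (1^₀ m)

      Fixed : F₀.Carrier → Set ℓ
      Fixed x = x ^₀ r ≈ x

      opaque
        index : Enumeration (λ i → Fixed (e i))
        index = enumerate (λ i → (e i ^₀ r) Tr.≟ e i)

    open Enumeration index public using () renaming (size to q; elem to j)

    private
      module I = Enumeration index
      fixed-index : ∀ x → Fixed x → ∃ λ l → e (j l) ≈ x
      fixed-index x fx = proj₁ found , ≈-trans (F₀.reflexive (cong e (proj₂ found))) (Tr.to-from x)
        where
        found : ∃ λ l → j l ≡ E.from x
        found = I.index (E.from x) (≈-trans (Ex₀.^-congˡ r (Tr.to-from x)) (≈-trans fx (≈-sym (Tr.to-from x))))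
      module FB = Subfield F₀ e e-inj (λ _ → ⊤) (λ x _ → E.from x , Tr.to-from x) (λ _ → _)
      module FS = FB.Build (λ _ _ → _) (λ _ _ → _) (λ _ → _) _ _ (λ _ _ → _) 1+1+1₀
      module KB = Subfield F₀ (e ∘ j) (I.elem-inj ∘ e-inj) Fixed fixed-index I.sound
      fixed-neg : ∀ {x} → Fixed x → Fixed (-₀ x)
      fixed-neg {x} fx = G₀.∙-cancelˡ x _ _ (≈-trans (F₀.+-congʳ (≈-sym fx)) (≈-trans (≈-sym (frobenius₀ (suc k′) x (-₀ x)))
        (≈-trans (Ex₀.^-congˡ r (F₀.-‿inverseʳ x)) (≈-trans (0^₀ r {{ℕₚ.m^n≢0 3 (suc k′)}}) (≈-sym (F₀.-‿inverseʳ x))))))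
      fixed-inv : ∀ {x y} → Fixed x → x *₀ y ≈ 1₀ → Fixed y
      fixed-inv {x} {y} fx xy≈1 = Tr.*-cancelˡ x (λ x≈0 → F₀.0≉1 (≈-trans (≈-sym (≈-trans (F₀.*-congʳ x≈0) (F₀.zeroˡ y))) xy≈1))
        (≈-trans (F₀.*-congʳ (≈-sym fx)) (≈-trans (≈-sym (Ex₀.^-distrib-* x y r)) (≈-trans (Ex₀.^-congˡ r xy≈1) (≈-trans
            (1^₀ r) (≈-sym xy≈1)))))
      module KS = KB.Build
        (λ {x} {y} fx fy → ≈-trans (frobenius₀ (suc k′) x y) (F₀.+-cong fx fy))
        (λ {x} {y} fx fy → ≈-trans (Ex₀.^-distrib-* x y r) (F₀.*-cong fx fy))
        fixed-neg (0^₀ r {{ℕₚ.m^n≢0 3 (suc k′)}}) (1^₀ r) fixed-inv 1+1+1₀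

    F : Field₃ N
    F = FS.subfield

    K : Field₃ q
    K = KS.subfield

    open Field₃ F
    open Field₃ K using () renaming (_*_ to _*ₖ_; -_ to -ₖ_; _^_ to _^ₖ_)
    open Solver₃
    open ≡ using (refl; sym; trans)
    open ≡.≡-Reasoning

    ξ : Fin N
    ξ = E.from ξ₀

    ξ≢0 : ξ ≢ 0#
    ξ≢0 eq = proj₁ generates (≈-trans (≈-sym (Tr.to-from ξ₀)) (≈-trans (F₀.reflexive (cong e eq)) FS.e-0))

    log : ∀ y → y ≢ 0# → ∃ λ m → ξ ^ m ≡ y
    log y y≢0 with proj₂ generates (e y) (λ ey≈0 → y≢0 (e-inj (≈-trans ey≈0 (≈-sym FS.e-0))))
    ... | m , ξ^m≈y = m , e-inj (≈-trans (FS.e-^ ξ m) (≈-trans (Ex₀.^-congˡ m (Tr.to-from ξ₀)) ξ^m≈y))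

    open PrimitiveElement F ξ ξ≢0 log

    private
      x^N≡x : ∀ x → x ^ N ≡ x
      x^N≡x x = e-inj (≈-trans (FS.e-^ x N) (Tr.x^q≈x (e x)))

      opaque
        e₁ : ℕ
        e₁ = e₀

        e₁≡ : e₁ ≡ e₀
        e₁≡ = refl

        1+4e₁ : suc (e₁ ℕ.* 4) ≡ N
        1+4e₁ = trans (solveℕ 1 (λ h → conℕ 1 :+ℕ (conℕ 2 :+ℕ conℕ 4 :*ℕ h) :*ℕ (conℕ 1 :+ℕ h) :*ℕ conℕ 4
          :=ℕ (conℕ 3 :+ℕ conℕ 4 :*ℕ h) :*ℕ (conℕ 3 :+ℕ conℕ 4 :*ℕ h)) refl h) (sym (trans N≡ (cong (λ r → r ℕ.* r) r≡)))
          where open +-*-Solver using () renaming (solve to solveℕ; con to conℕ; _:+_ to _:+ℕ_; _:*_ to _:*ℕ_; _:=_ to _:=ℕ_)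

        e₁-suc : ∃ λ m → e₁ ≡ suc m
        e₁-suc = _ , refl

        e₁+1+h : e₁ ℕ.+ (1 ℕ.+ h) ≡ (1 ℕ.+ h) ℕ.* r
        e₁+1+h = trans (solveℕ 1 (λ h → (conℕ 2 :+ℕ conℕ 4 :*ℕ h) :*ℕ (conℕ 1 :+ℕ h) :+ℕ (conℕ 1 :+ℕ h)
          :=ℕ (conℕ 1 :+ℕ h) :*ℕ (conℕ 3 :+ℕ conℕ 4 :*ℕ h)) refl h) (cong ((1 ℕ.+ h) ℕ.*_) (sym r≡))
          where open +-*-Solver using () renaming (solve to solveℕ; con to conℕ; _:+_ to _:+ℕ_; _:*_ to _:*ℕ_; _:=_ to _:=ℕ_)

    i : Fin N
    i = ξ ^ e₁

    i⁴ : i ^ 4 ≡ 1#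
    i⁴ = *-cancelˡ ξ ξ≢0 (trans (cong (ξ *_) (^-assocʳ ξ e₁ 4)) (trans (cong (ξ ^_) 1+4e₁) (trans (x^N≡x ξ) (sym
        (*-identityʳ ξ)))))

    -- i⁴ = 1 leaves i² = ± 1. The value 1 would give ξ^(2 e₁) = 1, hence at most 2 e₁ + 1 elements,
    -- whereas N = 4 e₁ + 1.
    i² : i * i ≡ - 1#
    i² = minus (x²≡y²⇒x≡±y {i * i} {1#} (trans (solve 1 (λ i → i :* i :* (i :* i) := i :^ 4) refl i) (trans i⁴ (sym
        (*-identityˡ 1#)))))
      where
      minus : i * i ≡ 1# ⊎ i * i ≡ - 1# → i * i ≡ - 1#
      minus (inj₂ eq) = eq
      minus (inj₁ eq) = too-small e₁-suc
        where
        too-small : (∃ λ m → e₁ ≡ suc m) → i * i ≡ - 1#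
        too-small (m , e₁≡sm) = contradiction (order-bound (m ℕ.+ suc m) (trans (^-homo-* ξ (suc m) (suc m)) (trans
            (cong₂ _*_ (cong (ξ ^_) (sym e₁≡sm)) (cong (ξ ^_) (sym e₁≡sm))) eq)))
          (ℕₚ.<⇒≱ (≡.subst (suc (suc (m ℕ.+ suc m)) ℕ.<_) (trans (cong (λ t → suc (t ℕ.* 4)) (sym e₁≡sm)) 1+4e₁) small))
          where
          open +-*-Solver using () renaming (solve to solveℕ; con to conℕ; _:+_ to _:+ℕ_; _:*_ to _:*ℕ_; _:=_ to _:=ℕ_)
          small : suc (suc (m ℕ.+ suc m)) ℕ.< suc (suc m ℕ.* 4)
          small = ≡.subst (suc (suc (m ℕ.+ suc m)) ℕ.<_) (solveℕ 1 (λ m → (conℕ 2 :+ℕ (m :+ℕ (conℕ 1 :+ℕ m))) :+ℕ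
              (conℕ 2 :+ℕ (m :+ℕ m)) :=ℕ conℕ 1 :+ℕ (conℕ 1 :+ℕ m) :*ℕ conℕ 4) refl m)
            (ℕₚ.m<m+n (suc (suc (m ℕ.+ suc m))) (ℕ.s≤s ℕ.z≤n))

    bar-i : i ^ r ≡ - i
    bar-i = begin
      i ^ r                    ≡⟨ cong (i ^_) r≡ ⟩
      i ^ (3 ℕ.+ 4 ℕ.* h)      ≡⟨ ^-homo-* i 3 (4 ℕ.* h) ⟩
      i ^ 3 * i ^ (4 ℕ.* h)    ≡⟨ cong (i ^ 3 *_) (^-assocʳ i 4 h) ⟨
      i ^ 3 * (i ^ 4) ^ h      ≡⟨ cong (λ t → i ^ 3 * t ^ h) i⁴ ⟩
      i ^ 3 * 1# ^ h           ≡⟨ cong (i ^ 3 *_) (1^ h) ⟩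
      i ^ 3 * 1#               ≡⟨ solve 1 (λ i → i :^ 3 :* con 1F := (i :* i) :* i) refl i ⟩
      i * i * i                ≡⟨ cong (_* i) i² ⟩
      - 1# * i                 ≡⟨ solve 1 (λ i → (:- con 1F) :* i := :- i) refl i ⟩
      - i                      ∎

    X : QuadraticExtension F K
    X = record
      { r = r ; N≡ = N≡ ; g = g ; r≡ = r≡
      ; bar-+ = frobenius-+ (suc k′)
      ; bar-bar = λ x → trans (^-assocʳ x r r) (trans (cong (x ^_) (sym N≡)) (x^N≡x x))
      ; j = j
      ; j-+ = λ x y → e-inj (≈-trans (KS.e-+ x y) (≈-sym (FS.e-+ (j x) (j y))))
      ; j-* = λ x y → e-inj (≈-trans (KS.e-* x y) (≈-sym (FS.e-* (j x) (j y))))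
      ; j-1 = e-inj (≈-trans KS.e-1 (≈-sym FS.e-1))
      ; j-inj = I.elem-inj
      ; bar-j = λ y → e-inj (≈-trans (FS.e-^ (j y) r) (I.sound y))
      ; restrict = λ x fix → I.index x (≈-trans (≈-sym (FS.e-^ x r)) (F₀.reflexive (cong e fix)))
      ; i = i ; i² = i² ; bar-i = bar-i
      }

    open QuadraticExtension X using (bar; χ; T; T-j*; Nm; j-T; j-N; j-inj; χ-0; q≡r; j-^; bar-j) renaming (e to e₂; e≡ to e₂≡)

    e₂≡e₁ : e₂ ≡ e₁
    e₂≡e₁ = trans e₂≡ (sym e₁≡)

    -- χ(ξ^m) = i^m has the square (- 1)^m, so the hypothesis makes the logarithm of x even.
    sqrt : ∀ x → χ x * χ x ≡ 1# → ∃ λ w → x ≡ w * w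
    sqrt x χ²≡1 = by-parity (proj₁ (log x x≢0)) (proj₂ (log x x≢0)) (parity (proj₁ (log x x≢0)))
      where
      x≢0 : x ≢ 0#
      x≢0 refl = 0≢1 (trans (sym (trans (cong₂ _*_ χ-0 χ-0) (zeroˡ 0#))) χ²≡1)
      by-parity : ∀ m → ξ ^ m ≡ x → (∃ λ l → m ≡ l ℕ.+ l ⊎ m ≡ suc (l ℕ.+ l)) → ∃ λ w → x ≡ w * w
      by-parity m ξ^m≡x (l , inj₁ refl) = ξ ^ l , trans (sym ξ^m≡x) (^-homo-* ξ l l)
      by-parity m ξ^m≡x (l , inj₂ refl) = contradiction (begin
        - 1#                                  ≡⟨ solve 0 (:- con 1F := (:- con 1F) :* con 1F) refl ⟩
        - 1# * 1#                             ≡⟨ cong (- 1# *_) (1^ l) ⟨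
        - 1# * 1# ^ l                         ≡⟨ cong (λ t → - 1# * t ^ l) (solve 0 ((:- con 1F) :* (:- con 1F) := con 1F) refl) ⟨
        - 1# * (- 1# * - 1#) ^ l              ≡⟨ cong (- 1# *_) (trans (^-distrib-* (- 1#) (- 1#) l) (sym (^-homo-*
            (- 1#) l l))) ⟩
        (- 1#) ^ suc (l ℕ.+ l)                ≡⟨ cong (_^ suc (l ℕ.+ l)) i² ⟨
        (i * i) ^ suc (l ℕ.+ l)               ≡⟨ ^-distrib-* i i (suc (l ℕ.+ l)) ⟩
        i ^ suc (l ℕ.+ l) * i ^ suc (l ℕ.+ l) ≡⟨ cong (λ t → t * t) χx ⟨
        χ x * χ x                             ≡⟨ χ²≡1 ⟩
        1#                                    ∎) -1≢1
        where
        χx : χ x ≡ i ^ suc (l ℕ.+ l)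
        χx = begin
          x ^ e₂                              ≡⟨ cong₂ _^_ (sym ξ^m≡x) e₂≡e₁ ⟩
          (ξ ^ suc (l ℕ.+ l)) ^ e₁            ≡⟨ ^-assocʳ ξ (suc (l ℕ.+ l)) e₁ ⟩
          ξ ^ (suc (l ℕ.+ l) ℕ.* e₁)          ≡⟨ cong (ξ ^_) (ℕₚ.*-comm (suc (l ℕ.+ l)) e₁) ⟩
          ξ ^ (e₁ ℕ.* suc (l ℕ.+ l))          ≡⟨ ^-assocʳ ξ e₁ (suc (l ℕ.+ l)) ⟨
          i ^ suc (l ℕ.+ l)                   ∎

    -- The exponent is 3^(k - 1); cubing inverts it on `K` because y^(3^k) = y there.
    cbrt : Fin q → Fin q
    cbrt y = y ^ₖ (3 ℕ.^ k′)

    private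
      y^r≡y : ∀ y → y ^ₖ r ≡ y
      y^r≡y y = j-inj (trans (j-^ y r) (bar-j y))

    cbrt³ : ∀ y → cbrt y ^ₖ 3 ≡ y
    cbrt³ y = trans (Field₃.^-assocʳ K y (3 ℕ.^ k′) 3) (trans (cong (y ^ₖ_) (ℕₚ.*-comm (3 ℕ.^ k′) 3)) (y^r≡y y))

    cbrt-³ : ∀ y → cbrt (y ^ₖ 3) ≡ y
    cbrt-³ y = trans (Field₃.^-assocʳ K y 3 (3 ℕ.^ k′)) (y^r≡y y)

    opaque
      tr : Fin N → 𝔽₃
      tr x = Tr.Tr (e x)

      tr≡ : ∀ x → tr x ≡ Tr.Tr (e x)
      tr≡ x = refl

      ι-tr : ∀ x → Tr.ι (tr x) ≈ Tr.conjugateSum (e x)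
      ι-tr x = Tr.ι-Tr (e x)

    private
      module Add = Sum F₀.+-commutativeMonoid
      module ×₀ = Mult F₀.semiring

      ι-+ : ∀ s t → Tr.ι (s +₃ t) ≈ Tr.ι s +₀ Tr.ι t
      ι-+ 0F t  = ≈-sym (F₀.+-identityˡ (Tr.ι t))
      ι-+ 1F 0F = ≈-sym (F₀.+-identityʳ _)
      ι-+ 1F 1F = ×₀.×-homo-+ 1₀ 1 1
      ι-+ 1F 2F = ≈-trans (≈-sym Tr.characteristic-3) (×₀.×-homo-+ 1₀ 1 2)
      ι-+ 2F 0F = ≈-sym (F₀.+-identityʳ _)
      ι-+ 2F 1F = ≈-trans (≈-sym Tr.characteristic-3) (×₀.×-homo-+ 1₀ 2 1)
      ι-+ 2F 2F = ≈-trans (≈-sym (≈-trans (F₀.+-congˡ Tr.characteristic-3) (F₀.+-congˡ ≈-refl))) (×₀.×-homo-+ 1₀ 2 2)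

      conjugateSum-+ : ∀ x y → Tr.conjugateSum (x +₀ y) ≈ Tr.conjugateSum x +₀ Tr.conjugateSum y
      conjugateSum-+ x y = ≈-trans (Add.sum-cong-≋ {n} (λ l → frobenius₀ (toℕ l) x y)) (Add.∑-distrib-+ {n} (λ l → x ^₀
          (3 ℕ.^ toℕ l)) (λ l → y ^₀ (3 ℕ.^ toℕ l)))

      conjugateSum-^3 : ∀ x → Tr.conjugateSum (x ^₀ 3) ≈ Tr.conjugateSum x
      conjugateSum-^3 x = ≈-trans (Add.sum-cong-≋ {n} (λ l → ≈-trans (Ex₀.^-assocʳ x 3 (3 ℕ.^ toℕ l)) (≈-trans
          (Ex₀.^-congʳ x (ℕₚ.*-comm 3 (3 ℕ.^ toℕ l))) (≈-sym (Ex₀.^-assocʳ x (3 ℕ.^ toℕ l) 3)))))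
        (≈-trans (≈-sym (Tr.frobenius-sum {n} (λ l → x ^₀ (3 ℕ.^ toℕ l)))) (Tr.conjugateSum³ x))

    tr-+ : ∀ x y → tr (x + y) ≡ tr x +₃ tr y
    tr-+ x y = Tr.ι-injective {tr (x + y)} {tr x +₃ tr y} (≈-trans (ι-tr (x + y)) (≈-trans (Tr.conjugateSum-cong
        (FS.e-+ x y)) (≈-trans (conjugateSum-+ (e x) (e y))
      (≈-sym (≈-trans (ι-+ (tr x) (tr y)) (F₀.+-cong (ι-tr x) (ι-tr y)))))))

    tr-^3 : ∀ x → tr (x ^ 3) ≡ tr x
    tr-^3 x = Tr.ι-injective {tr (x ^ 3)} {tr x} (≈-trans (ι-tr (x ^ 3)) (≈-trans (Tr.conjugateSum-cong (FS.e-^ x 3))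
        (≈-trans (conjugateSum-^3 (e x)) (≈-sym (ι-tr x)))))

    private
      Λ-sum : ∀ m x → e (Λ m (λ _ → 1#) x) ≈ F₀.sum {m} (λ l → e x ^₀ (3 ℕ.^ toℕ l))
      Λ-sum zero    x = FS.e-0
      Λ-sum (suc m) x = ≈-trans (FS.e-+ _ _) (≈-trans (F₀.+-cong
          (≈-trans (Λ-sum m x) (Add.sum-cong-≋ {m} (λ l → Ex₀.^-congʳ (e x) (cong (3 ℕ.^_) (sym (toℕ-inject₁ l))))))
          (≈-trans (FS.e-* _ _) (≈-trans (F₀.*-congʳ FS.e-1) (≈-trans (F₀.*-identityˡ _) (≈-trans (FS.e-^ x (3 ℕ.^ m))
              (Ex₀.^-congʳ (e x) (cong (3 ℕ.^_) (sym (toℕ-fromℕ m)))))))))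
        (≈-sym (Add.sum-init-last {m} (λ l → e x ^₀ (3 ℕ.^ toℕ l)))))

    -- A trace vanishing everywhere would be a linear relation with all coefficients 1 between the
    -- Frobenius powers. The witness is found by search through the finite field.
    tr-nontrivial : ∃ λ x → tr x ≢ 0F
    tr-nontrivial = from-dec (any? (λ x → ¬? (tr x ≟F 0F)))
      where
      tr≡0 : ¬ (∃ λ x → tr x ≢ 0F) → ∀ x → tr x ≡ 0F
      tr≡0 none x = decidable-stable (tr x ≟F 0F) (λ trx≢0 → none (x , trx≢0))
      vanish : ¬ (∃ λ x → tr x ≢ 0F) → ∀ x → Λ n (λ _ → 1#) x ≡ 0#
      vanish none x = e-inj {Λ n (λ _ → 1#) x} {0#} (≈-trans (Λ-sum n x) (≈-trans (≈-sym (ι-tr x)) (≈-trans (F₀.reflexive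
          (cong Tr.ι (tr≡0 none x))) (≈-sym FS.e-0))))
      1≡0 : ∀ m → n ≡ suc m → ¬ (∃ λ x → tr x ≢ 0F) → 1# ≡ 0#
      1≡0 m n≡ none = independence m (λ _ → 1#) (ℕₚ.<-≤-trans (ℕₚ.^-monoʳ-< 3 (ℕ.s≤s (ℕ.s≤s ℕ.z≤n)) (ℕₚ.n<1+n m))
          (ℕₚ.≤-reflexive (cong (3 ℕ.^_) (sym n≡))))
        (λ x → trans (cong (λ n → Λ n (λ _ → 1#) x) (sym n≡)) (vanish none x))
      from-dec : Dec (∃ λ x → tr x ≢ 0F) → ∃ λ x → tr x ≢ 0F
      from-dec (yes found) = found
      -- The number supplied here is n - 1, in the form to which 2 (k′ + 1) reduces.
      from-dec (no none)   = contradiction (sym (1≡0 (k′ ℕ.+ 1 ℕ.* suc k′) n≡ none)) 0≢1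

    φ : Fin N → 𝔼
    φ x = ζ^ (tr x)

    φ-+ : ∀ x y → φ (x + y) ≡ φ x ⊗ φ y
    φ-+ x y = trans (cong ζ^ (tr-+ x y)) (ζ^-+ (tr x) (tr y))

    φ-root : ∀ x → IsCubeRoot (φ x)
    φ-root x = ζ^-root (tr x)

    φ-^3^ : ∀ m x → φ (x ^ (3 ℕ.^ m)) ≡ φ x
    φ-^3^ zero    x = cong φ (*-identityʳ x)
    φ-^3^ (suc m) x = trans (cong φ (trans (cong (x ^_) (ℕₚ.*-comm 3 (3 ℕ.^ m))) (sym (^-assocʳ x (3 ℕ.^ m) 3)))) (trans
        (cong ζ^ (tr-^3 _)) (φ-^3^ m x))

    -- The trace of K is that of F restricted to K, up to the factor [F : K] = - 1.
    φ-T : ∀ x → φ (- j (T x)) ≡ φ x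
    φ-T x = begin
      φ (- j (T x))                       ≡⟨ cong φ (trans (cong (-_) (j-T x)) (solve 2 (λ x y → :- (x :+ y) :=
          (x :+ y) :+ (x :+ y)) refl x (bar x))) ⟩
      φ (x + bar x + (x + bar x))         ≡⟨ trans (φ-+ _ _) (cong (λ t → t ⊗ t) (trans (φ-+ x (bar x)) (cong (φ x ⊗_)
          (φ-^3^ (suc k′) x)))) ⟩
      φ x ⊗ φ x ⊗ (φ x ⊗ φ x)             ≡⟨ trans (𝔼ᵣ.*-assoc (φ x) (φ x) _) (cong (λ t → φ x ⊗ (φ x ⊗ t)) (cube-root-*
          (φ-root x))) ⟩
      φ x ⊗ (φ x ⊗ conj (φ x))            ≡⟨ trans (cong (φ x ⊗_) (cube-root-conj (φ-root x))) (𝔼ᵣ.*-identityʳ (φ x)) ⟩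
      φ x                                 ∎

    -- The character of `K` is read off from that of `F` through `φ-T`; it is nontrivial at T(x) as
    -- soon as φ is nontrivial at x.
    Ψ : Character K
    Ψ = record
      { ψ      = λ y → φ (- j y)
      ; ψ-+    = λ x y → trans (cong φ (trans (cong (-_) (QuadraticExtension.j-+ X x y)) (solve 2 (λ x y → :- (x :+ y) :=
          (:- x) :+ (:- y)) refl (j x) (j y)))) (φ-+ (- j x) (- j y))
      ; ψ-root = λ y → φ-root (- j y)
      ; ψ-^3   = λ y → trans (cong φ (trans (cong (-_) (j-^ y 3)) (solve 1 (λ x → :- (x :^ 3) := (:- x) :^ 3) refl
          (j y)))) (cong ζ^ (tr-^3 (- j y)))
      ; t₀     = T (proj₁ tr-nontrivial)
      ; ψt₀≢1  = λ eq → nontrivial (proj₂ tr-nontrivial) (trans (sym (φ-T (proj₁ tr-nontrivial))) eq)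
      }
      where
      nontrivial : ∀ {s} → s ≢ 0F → ζ^ s ≢ 1𝔼
      nontrivial {0F} s≢0 _ = s≢0 refl
      nontrivial {1F} _ ()
      nontrivial {2F} _ ()

    a : Fin N
    a = ξ ^ (1 ℕ.+ h)

    -- a = ξ^((r + 1) / 4) is chosen so that a^(r - 1) = ξ^((r² - 1) / 4) = i.
    bar-a : bar a ≡ i * a
    bar-a = trans (^-assocʳ ξ (1 ℕ.+ h) r) (trans (cong (ξ ^_) (sym e₁+1+h)) (^-homo-* ξ e₁ (1 ℕ.+ h)))

    open WalshValues X Ψ cbrt cbrt³ cbrt-³ sqrt a (^-≢0 (1 ℕ.+ h) ξ≢0) bar-a using (S; S-value)

    -- At each b this is Tr(N(b) / c), the trace being that of `K`, up to a sign depending on b; it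
    -- is taken as the exponent of the cube root in `S-value`.
    dual : F₀.Carrier → 𝔽₃
    dual b₀ = proj₁ (ζ^-surjective (proj₁ (proj₂ (S-value (E.from b₀)))))

    dual-cong : ∀ {b₀ b₁} → b₀ ≈ b₁ → dual b₀ ≡ dual b₁
    dual-cong b₀≈b₁ = cong (λ b → proj₁ (ζ^-surjective (proj₁ (proj₂ (S-value b))))) (E.from-cong b₀≈b₁)

    walsh-value : ∀ b₀ → let a₀ = ξ₀ ^₀ ((r ℕ.+ 1) / 4) ; d = (N ℕ.∸ 1) / 4 ℕ.+ r ℕ.+ 1 in
      ∑ (λ x → ζ^ (Tr.Tr (a₀ *₀ E.to x ^₀ d) -₃ Tr.Tr (b₀ *₀ E.to x))) ≡ ⊖ (⟪ + r ⟫ ⊗ ζ^ (dual b₀))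
    walsh-value b₀ = trans (∑-cong term) (trans (proj₂ (proj₂ (S-value b)))
        (cong₂ (λ t p → ⊖ (⟪ + t ⟫ ⊗ p)) q≡r (sym (proj₂ (ζ^-surjective (proj₁ (proj₂ (S-value b))))))))
      where
      b : Fin N
      b = E.from b₀
      a₀ : F₀.Carrier
      a₀ = ξ₀ ^₀ ((r ℕ.+ 1) / 4)
      d d′ : ℕ
      d  = (N ℕ.∸ 1) / 4 ℕ.+ r ℕ.+ 1
      d′ = e₂ ℕ.+ r ℕ.+ 1
      [r+1]/4 : (r ℕ.+ 1) / 4 ≡ 1 ℕ.+ h
      [r+1]/4 = trans (cong (_/ 4) (trans (cong (ℕ._+ 1) r≡) (solveℕ 1 (λ h → conℕ 3 :+ℕ conℕ 4 :*ℕ h :+ℕ conℕ 1 :=ℕ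
          (conℕ 1 :+ℕ h) :*ℕ conℕ 4) refl h))) (m*n/n≡m (1 ℕ.+ h) 4)
        where open +-*-Solver using () renaming (solve to solveℕ; con to conℕ; _:+_ to _:+ℕ_; _:*_ to _:*ℕ_; _:=_ to _:=ℕ_)
      d≡d′ : d ≡ d′
      d≡d′ = cong (λ t → t ℕ.+ r ℕ.+ 1) (trans (trans (cong (λ t → (t ℕ.∸ 1) / 4) (sym 1+4e₁)) (m*n/n≡m e₁ 4)) (sym e₂≡e₁))
      a≈a₀ : e a ≈ a₀
      a≈a₀ = ≈-trans (FS.e-^ ξ (1 ℕ.+ h)) (≈-trans (Ex₀.^-congˡ (1 ℕ.+ h) (Tr.to-from ξ₀)) (Ex₀.^-congʳ ξ₀ (sym [r+1]/4)))
      tr-f : ∀ x → Tr.Tr (a₀ *₀ e x ^₀ d) ≡ tr (a * x ^ d′)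
      tr-f x = trans (Tr.Tr-cong (≈-sym (≈-trans (FS.e-* a (x ^ d′)) (F₀.*-cong a≈a₀ (≈-trans (FS.e-^ x d′) (Ex₀.^-congʳ
          (e x) (sym d≡d′))))))) (sym (tr≡ (a * x ^ d′)))
      tr-b : ∀ x → Tr.Tr (b₀ *₀ e x) ≡ tr (b * x)
      tr-b x = trans (Tr.Tr-cong (≈-sym (≈-trans (FS.e-* b x) (F₀.*-congʳ (Tr.to-from b₀))))) (sym (tr≡ (b * x)))
      open Character Ψ using (ψ; ψ-neg)
      -- x^d′ is χ(x) · x̄ · x, so a x^d′ = N(x) (a χ(x)). Taking the trace to `K` lets the factor
      -- N(x) out.
      φ-f : ∀ x → φ (a * x ^ d′) ≡ ψ (T (a * χ x) *ₖ Nm x)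
      φ-f x = begin
        φ (a * x ^ d′)                    ≡⟨ cong (λ t → φ (a * t)) (trans (^-homo-* x (e₂ ℕ.+ r) 1) (cong (_* x ^ 1)
            (^-homo-* x e₂ r))) ⟩
        φ (a * (χ x * bar x * x ^ 1))     ≡⟨ cong φ (solve 4 (λ a c y x → a :* (c :* y :* x :^ 1) := x :* y :*
            (a :* c)) refl a (χ x) (bar x) x) ⟩
        φ (x * bar x * (a * χ x))         ≡⟨ cong (λ t → φ (t * (a * χ x))) (j-N x) ⟨
        φ (j (Nm x) * (a * χ x))          ≡⟨ φ-T _ ⟨
        φ (- j (T (j (Nm x) * (a * χ x)))) ≡⟨ cong ψ (trans (T-j* (Nm x) (a * χ x)) (Field₃.*-comm K (Nm x) (T (a * χ x)))) ⟩
        ψ (T (a * χ x) *ₖ Nm x)           ∎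
      term : ∀ x → ζ^ (Tr.Tr (a₀ *₀ e x ^₀ d) -₃ Tr.Tr (b₀ *₀ e x)) ≡ ψ (T (a * χ x) *ₖ Nm x) ⊗ ψ (-ₖ T (b * x))
      term x = begin
        ζ^ (Tr.Tr (a₀ *₀ e x ^₀ d) -₃ Tr.Tr (b₀ *₀ e x)) ≡⟨ cong₂ (λ s t → ζ^ (s -₃ t)) (tr-f x) (tr-b x) ⟩
        ζ^ (tr (a * x ^ d′) -₃ tr (b * x))               ≡⟨ ζ^-- (tr (a * x ^ d′)) (tr (b * x)) ⟩
        φ (a * x ^ d′) ⊗ conj (φ (b * x))                ≡⟨ cong₂ (λ s t → s ⊗ conj t) (φ-f x) (sym (φ-T (b * x))) ⟩
        ψ (T (a * χ x) *ₖ Nm x) ⊗ conj (ψ (T (b * x)))   ≡⟨ cong (ψ (T (a * χ x) *ₖ Nm x) ⊗_) (ψ-neg (T (b * x))) ⟨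
        ψ (T (a * χ x) *ₖ Nm x) ⊗ ψ (-ₖ T (b * x))       ∎

-- Passage from ℤ[ω] to the complex numbers.

module ComplexSums where

  open import Defs
  open EisensteinIntegers
  open FiniteSums
  open TraceCharacters using (ζ^)
  open import Data.Fin.Base using (Fin; zero; suc; toℕ)
  open import Data.Fin.Patterns using (0F; 1F; 2F)
  open import Data.Integer.Base as ℤ using (ℤ; +_)
  import Data.Integer.Properties as ℤₚ
  open import Data.Nat.Base as ℕ using (ℕ; zero; suc)
  import Data.Nat.Properties as ℕₚ
  open import Data.Product.Base using (∃; _×_; _,_; proj₁; proj₂)
  open import Data.Rational.Base as ℚ using (ℚ; 0ℚ; 1ℚ; ½; -½; ∣_∣)
  import Data.Rational.Properties as ℚₚ
  open import Data.Rational.Solver using (module +-*-Solver)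
  import Data.Rational.Unnormalised.Base as ℚᵘ
  import Data.Rational.Unnormalised.Properties as ℚᵘₚ
  open import Data.Integer.Tactic.RingSolver using (solve-∀)
  open import Relation.Binary.PropositionalEquality
  open import Relation.Nullary using (contradiction)

  open Reals using (approx; cauchy; IsCauchy; P/Q; half; halves; sub-+; eventually-bounded; *-modulus; *-bound; √3*√3≈3)
  open +-*-Solver using () renaming (solve to solveℚ; _:=_ to _:=ℚ_; _:+_ to _:+ℚ_; _:*_ to _:*ℚ_; :-_ to :-ℚ_; _:-_ to
      _:-ℚ_; con to conℚ)

  infix 4 _∼_

  -- x ≈ℝ y unfolds to approx x ∼ approx y. Working with the sequences alone keeps the Cauchy moduli out of the terms.
  record _∼_ (x y : ℕ → ℚ) : Set where
    constructor mk∼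
    field
      get∼ : ∀ ε → 0ℚ ℚ.< ε → ∃ λ N → ∀ n → N ℕ.≤ n → ∣ x n ℚ.- y n ∣ ℚ.≤ ε

  open _∼_

  pointwise : ∀ {x y} → (∀ n → x n ≡ y n) → x ∼ y
  pointwise {x} {y} eq = mk∼ λ ε 0<ε → 0 , λ n _ → subst (ℚ._≤ ε)
    (sym (cong ∣_∣ (trans (cong (ℚ._- y n) (eq n)) (ℚₚ.+-inverseʳ (y n))))) (ℚₚ.<⇒≤ 0<ε)

  ∼-sym : ∀ {x y} → x ∼ y → y ∼ x
  ∼-sym {x} {y} (mk∼ x∼y) = mk∼ λ ε 0<ε → let N , close = x∼y ε 0<ε in N , λ n N≤n →
    subst (ℚ._≤ ε) (trans (sym (ℚₚ.∣-p∣≡∣p∣ (x n ℚ.- y n))) (cong ∣_∣ (flip (x n) (y n)))) (close n N≤n)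
    where
    flip : ∀ a b → ℚ.- (a ℚ.- b) ≡ b ℚ.- a
    flip = solveℚ 2 (λ a b → :-ℚ (a :-ℚ b) :=ℚ b :-ℚ a) refl

  private
    close-+ : ∀ {ε} a b → ∣ a ∣ ℚ.≤ ½ ℚ.* ε → ∣ b ∣ ℚ.≤ ½ ℚ.* ε → ∣ a ℚ.+ b ∣ ℚ.≤ ε
    close-+ {ε} a b a≤ b≤ = ℚₚ.≤-trans (ℚₚ.∣p+q∣≤∣p∣+∣q∣ a b) (ℚₚ.≤-trans (ℚₚ.+-mono-≤ a≤ b≤) (ℚₚ.≤-reflexive (halves ε)))

  ∼-trans : ∀ {x y z} → x ∼ y → y ∼ z → x ∼ z
  ∼-trans {x} {y} {z} (mk∼ x∼y) (mk∼ y∼z) = mk∼ λ ε 0<ε →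
    let M , px = x∼y (½ ℚ.* ε) (half 0<ε)
        N , py = y∼z (½ ℚ.* ε) (half 0<ε)
    in M ℕ.⊔ N , λ n n≥ → subst (λ t → ∣ t ∣ ℚ.≤ ε) (telescope (x n) (y n) (z n))
      (close-+ (x n ℚ.- y n) (y n ℚ.- z n) (px n (ℕₚ.m⊔n≤o⇒m≤o M N n≥)) (py n (ℕₚ.m⊔n≤o⇒n≤o M N n≥)))
    where
    telescope : ∀ a b c → (a ℚ.- b) ℚ.+ (b ℚ.- c) ≡ a ℚ.- c
    telescope = solveℚ 3 (λ a b c → (a :-ℚ b) :+ℚ (b :-ℚ c) :=ℚ a :-ℚ c) refl

  ∼-+ : ∀ {x y u v} → x ∼ y → u ∼ v → (λ n → x n ℚ.+ u n) ∼ (λ n → y n ℚ.+ v n)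
  ∼-+ {x} {y} {u} {v} (mk∼ x∼y) (mk∼ u∼v) = mk∼ λ ε 0<ε →
    let M , px = x∼y (½ ℚ.* ε) (half 0<ε)
        N , pu = u∼v (½ ℚ.* ε) (half 0<ε)
    in M ℕ.⊔ N , λ n n≥ → subst (λ t → ∣ t ∣ ℚ.≤ ε) (sym (sub-+ (x n) (u n) (y n) (v n)))
      (close-+ (x n ℚ.- y n) (u n ℚ.- v n) (px n (ℕₚ.m⊔n≤o⇒m≤o M N n≥)) (pu n (ℕₚ.m⊔n≤o⇒n≤o M N n≥)))

  -- The difference is split as (x - y) u + y (u - v), so bounds are wanted for u and y; their
  -- Cauchy property provides them.
  ∼-* : ∀ {x y u v} → IsCauchy y → IsCauchy u → x ∼ y → u ∼ v → (λ n → x n ℚ.* u n) ∼ (λ n → y n ℚ.* v n)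
  ∼-* {x} {y} {u} {v} cy cu (mk∼ x∼y) (mk∼ u∼v) = mk∼ λ ε 0<ε →
    let K , A , 0<A , by = eventually-bounded {y} cy
        L , B , 0<B , bu = eventually-bounded {u} cu
        δ , 0<δ , eq     = *-modulus {ε} {A} {B} 0<ε 0<A 0<B
        M , px           = x∼y δ 0<δ
        N , pu           = u∼v δ 0<δ
    in M ℕ.⊔ N ℕ.⊔ (K ℕ.⊔ L) , λ n n≥ →
    let n≥MN = ℕₚ.m⊔n≤o⇒m≤o (M ℕ.⊔ N) (K ℕ.⊔ L) n≥
        n≥KL = ℕₚ.m⊔n≤o⇒n≤o (M ℕ.⊔ N) (K ℕ.⊔ L) n≥
    in subst (∣ x n ℚ.* u n ℚ.- y n ℚ.* v n ∣ ℚ.≤_) eq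
      (*-bound {δ} {A} {B} (x n) (u n) (y n) (v n) 0<δ 0<B
        (px n (ℕₚ.m⊔n≤o⇒m≤o M N n≥MN)) (pu n (ℕₚ.m⊔n≤o⇒n≤o M N n≥MN))
        (by n (ℕₚ.m⊔n≤o⇒m≤o K L n≥KL)) (bu n (ℕₚ.m⊔n≤o⇒n≤o K L n≥KL)))

  ∼-refl : ∀ {x} → x ∼ x
  ∼-refl = pointwise (λ _ → refl)

  const-cauchy : ∀ p → IsCauchy (λ _ → p)
  const-cauchy p = cauchy (fromℚ p)

  ∼-scale : ∀ p {x y} → IsCauchy x → x ∼ y → (λ n → p ℚ.* x n) ∼ (λ n → p ℚ.* y n)
  ∼-scale p {x} {y} cx x∼y = ∼-* {λ _ → p} {λ _ → p} {x} {y} (const-cauchy p) cx ∼-refl x∼y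

  P/Q²∼3 : (λ n → P/Q n ℚ.* P/Q n) ∼ (λ _ → + 3 ℚ./ 1)
  P/Q²∼3 = mk∼ √3*√3≈3

  P/Q²-cauchy : IsCauchy (λ n → P/Q n ℚ.* P/Q n)
  P/Q²-cauchy = cauchy (√3 ℝR.* √3)

  opaque
    intℚ : ℤ → ℚ
    intℚ m = m ℚ./ 1

    intℚ≡ : ∀ m → intℚ m ≡ m ℚ./ 1
    intℚ≡ m = refl

    toℚᵘ-int : ∀ m → ℚ.toℚᵘ (intℚ m) ℚᵘ.≃ ℚᵘ.mkℚᵘ m 0
    toℚᵘ-int m = ℚₚ.toℚᵘ-fromℚᵘ (ℚᵘ.mkℚᵘ m 0)

    intℚ-+ : ∀ m n → intℚ (m ℤ.+ n) ≡ intℚ m ℚ.+ intℚ n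
    intℚ-+ m n = ℚₚ.toℚᵘ-injective (ℚᵘₚ.≃-trans (toℚᵘ-int (m ℤ.+ n)) (ℚᵘₚ.≃-sym (ℚᵘₚ.≃-trans (ℚₚ.toℚᵘ-homo-+ (intℚ m) (intℚ n))
      (ℚᵘₚ.≃-trans (ℚᵘₚ.+-cong (toℚᵘ-int m) (toℚᵘ-int n)) (ℚᵘ.*≡* (l m n))))))
      where
      l : ∀ m n → (m ℤ.* + 1 ℤ.+ n ℤ.* + 1) ℤ.* + 1 ≡ (m ℤ.+ n) ℤ.* + 1
      l = solve-∀

    intℚ-* : ∀ m n → intℚ (m ℤ.* n) ≡ intℚ m ℚ.* intℚ n
    intℚ-* m n = ℚₚ.toℚᵘ-injective (ℚᵘₚ.≃-trans (toℚᵘ-int (m ℤ.* n)) (ℚᵘₚ.≃-sym (ℚᵘₚ.≃-trans (ℚₚ.toℚᵘ-homo-* (intℚ m) (intℚ n))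
      (ℚᵘₚ.≃-trans (ℚᵘₚ.*-cong (toℚᵘ-int m) (toℚᵘ-int n)) (ℚᵘ.*≡* refl)))))

    intℚ-neg : ∀ m → intℚ (ℤ.- m) ≡ ℚ.- intℚ m
    intℚ-neg m = trans (cong intℚ (sym (ℤₚ.-1*i≡-i m))) (trans (intℚ-* (ℤ.- + 1) m) (solveℚ 1 (λ x → conℚ
        (ℚ.- 1ℚ) :*ℚ x :=ℚ :-ℚ x) refl (intℚ m)))

  -- real part and imaginary part / √3
  reᴱ imᴱ : 𝔼 → ℚ
  reᴱ z = intℚ (const z) ℚ.- ½ ℚ.* intℚ (coω z)
  imᴱ z = ½ ℚ.* intℚ (coω z)

  reᴱ-⊕ : ∀ x y → reᴱ (x ⊕ y) ≡ reᴱ x ℚ.+ reᴱ y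
  reᴱ-⊕ x y = trans (cong₂ (λ a b → a ℚ.- ½ ℚ.* b) (trans (cong intℚ (const-⊕ x y)) (intℚ-+ (const x) (const y))) (trans
      (cong intℚ (coω-⊕ x y)) (intℚ-+ (coω x) (coω y))))
    (solveℚ 4 (λ a b c d → a :+ℚ b :-ℚ conℚ ½ :*ℚ (c :+ℚ d) :=ℚ (a :-ℚ conℚ ½ :*ℚ c) :+ℚ (b :-ℚ conℚ ½ :*ℚ d)) refl (intℚ
        (const x)) (intℚ (const y)) (intℚ (coω x)) (intℚ (coω y)))

  imᴱ-⊕ : ∀ x y → imᴱ (x ⊕ y) ≡ imᴱ x ℚ.+ imᴱ y
  imᴱ-⊕ x y = trans (cong (½ ℚ.*_) (trans (cong intℚ (coω-⊕ x y)) (intℚ-+ (coω x) (coω y)))) (ℚₚ.*-distribˡ-+ ½ (intℚ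
      (coω x)) (intℚ (coω y)))

  reᴱ-scale : ∀ m z → reᴱ (⊖ (⟪ m ⟫ ⊗ z)) ≡ ℚ.- (intℚ m ℚ.* reᴱ z)
  reᴱ-scale m z = trans (cong reᴱ (trans (cong ⊖_ (⟪⟫-*𝔼 m z)) (⊖-components ((m ℤ.* const z) +ω (m ℤ.* coω z))))) (trans
    (cong₂ (λ a b → a ℚ.- ½ ℚ.* b) (trans (intℚ-neg (m ℤ.* const z)) (cong ℚ.-_ (intℚ-* m (const z)))) (trans (intℚ-neg
        (m ℤ.* coω z)) (cong ℚ.-_ (intℚ-* m (coω z)))))
    (solveℚ 3 (λ m a b → (:-ℚ (m :*ℚ a)) :-ℚ conℚ ½ :*ℚ (:-ℚ (m :*ℚ b)) :=ℚ :-ℚ (m :*ℚ (a :-ℚ conℚ ½ :*ℚ b))) refl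
        (intℚ m) (intℚ (const z)) (intℚ (coω z))))

  imᴱ-scale : ∀ m z → imᴱ (⊖ (⟪ m ⟫ ⊗ z)) ≡ ℚ.- (intℚ m ℚ.* imᴱ z)
  imᴱ-scale m z = trans (cong imᴱ (trans (cong ⊖_ (⟪⟫-*𝔼 m z)) (⊖-components ((m ℤ.* const z) +ω (m ℤ.* coω z))))) (trans
    (cong (½ ℚ.*_) (trans (intℚ-neg (m ℤ.* coω z)) (cong ℚ.-_ (intℚ-* m (coω z)))))
    (solveℚ 2 (λ m b → conℚ ½ :*ℚ (:-ℚ (m :*ℚ b)) :=ℚ :-ℚ (m :*ℚ (conℚ ½ :*ℚ b))) refl (intℚ m) (intℚ (coω z))))

  cosᴿ sinᴿ : 𝔽₃ → ℚ
  cosᴿ 0F = 1ℚ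
  cosᴿ 1F = -½
  cosᴿ 2F = -½
  sinᴿ 0F = 0ℚ
  sinᴿ 1F = ½
  sinᴿ 2F = -½

  opaque
    unfolding intℚ

    reᴱ-ζ^ : ∀ s → reᴱ (ζ^ s) ≡ cosᴿ s
    reᴱ-ζ^ 0F = refl
    reᴱ-ζ^ 1F = refl
    reᴱ-ζ^ 2F = refl

    imᴱ-ζ^ : ∀ s → imᴱ (ζ^ s) ≡ sinᴿ s
    imᴱ-ζ^ 0F = refl
    imᴱ-ζ^ 1F = refl
    imᴱ-ζ^ 2F = refl

    intℚ-3 : intℚ (+ 3) ≡ + 3 ℚ./ 1
    intℚ-3 = refl

    intℚ-0 : 0ℚ ≡ intℚ (+ 0) ℚ.- ½ ℚ.* intℚ (+ 0)
    intℚ-0 = refl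

    intℚ-0′ : 0ℚ ≡ intℚ (+ 0)
    intℚ-0′ = refl

    intℚ-1 : intℚ (+ 1) ≡ 1ℚ
    intℚ-1 = refl

  -- States z = a + b √-3 with rational a and b. `P/Q` approximates √3, so the imaginary part is
  -- compared with b times that sequence.
  Near : ℂ → ℚ → ℚ → Set
  Near z a b = approx (re z) ∼ (λ _ → a) × approx (im z) ∼ (λ n → b ℚ.* P/Q n)

  ω^-value : ∀ t → Near (ω ℂR.^ toℕ t) (cosᴿ t) (sinᴿ t)
  ω^-value 0F = pointwise (λ _ → refl) , pointwise (λ n → solveℚ 1 (λ s → conℚ 0ℚ :=ℚ conℚ 0ℚ :*ℚ s) refl (P/Q n))
  ω^-value 1F =
      pointwise (λ n → solveℚ 1 (λ s → conℚ -½ :*ℚ conℚ 1ℚ :+ℚ (:-ℚ ((conℚ ½ :*ℚ s) :*ℚ conℚ 0ℚ)) :=ℚ conℚ -½) refl (P/Q n))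
    , pointwise (λ n → solveℚ 1 (λ s → conℚ -½ :*ℚ conℚ 0ℚ :+ℚ (conℚ ½ :*ℚ s) :*ℚ conℚ 1ℚ :=ℚ conℚ ½ :*ℚ s) refl (P/Q n))
  ω^-value 2F =
      -- The real part of ω² is 1 / 4 - s² / 4 with s approximating √3. Here alone s² occurs, and s²
      -- → 3 gives - 1 / 2.
      ∼-trans (pointwise (λ n → solveℚ 1 (λ s → conℚ -½ :*ℚ (conℚ -½ :*ℚ conℚ 1ℚ :+ℚ (:-ℚ
          ((conℚ ½ :*ℚ s) :*ℚ conℚ 0ℚ))) :+ℚ (:-ℚ ((conℚ ½ :*ℚ s) :*ℚ (conℚ -½ :*ℚ conℚ 0ℚ :+ℚ (conℚ ½ :*ℚ s) :*ℚ conℚ 1ℚ)))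
          :=ℚ conℚ (½ ℚ.* ½) :+ℚ conℚ (½ ℚ.* -½) :*ℚ (s :*ℚ s)) refl (P/Q n)))
        (∼-trans (∼-+ {λ _ → ½ ℚ.* ½} {λ _ → ½ ℚ.* ½} {λ n → ½ ℚ.* -½ ℚ.* (P/Q n ℚ.* P/Q n)} {λ _ → ½ ℚ.* -½ ℚ.* (+ 3 ℚ./ 1)}
          ∼-refl (∼-scale (½ ℚ.* -½) {λ n → P/Q n ℚ.* P/Q n} {λ _ → + 3 ℚ./ 1} P/Q²-cauchy P/Q²∼3)) (pointwise (λ _ → refl)))
    , pointwise (λ n → solveℚ 1 (λ s → conℚ -½ :*ℚ (conℚ -½ :*ℚ conℚ 0ℚ :+ℚ (conℚ ½ :*ℚ s) :*ℚ conℚ 1ℚ) :+ℚ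
        (conℚ ½ :*ℚ s) :*ℚ (conℚ -½ :*ℚ conℚ 1ℚ :+ℚ (:-ℚ ((conℚ ½ :*ℚ s) :*ℚ conℚ 0ℚ)))
          :=ℚ conℚ -½ :*ℚ s) refl (P/Q n))

  sum-value : ∀ {m} (t : Fin m → 𝔽₃) → Near (ℂR.sum (λ i → ω ℂR.^ toℕ (t i))) (reᴱ (∑ (λ i → ζ^ (t i)))) (imᴱ (∑ (λ i → ζ^
      (t i))))
  sum-value {zero} t =
      pointwise (λ _ → trans intℚ-0 (cong reᴱ (sym (∑-zero (λ i → ζ^ (t i))))))
    , pointwise (λ n → trans (solveℚ 1 (λ x → conℚ 0ℚ :=ℚ conℚ ½ :*ℚ conℚ 0ℚ :*ℚ x) refl (P/Q n))
        (cong (ℚ._* P/Q n) (trans (cong (½ ℚ.*_) intℚ-0′) (cong imᴱ (sym (∑-zero (λ i → ζ^ (t i))))))))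
  sum-value {suc m} t =
      ∼-trans (∼-+ {approx (re z)} {λ _ → cosᴿ (t zero)} {approx (re w)} {λ _ → reᴱ W} (proj₁ (ω^-value (t zero))) (proj₁
          (sum-value (λ i → t (suc i))))) (pointwise (λ _ →
        trans (cong (ℚ._+ reᴱ W) (sym (reᴱ-ζ^ (t zero)))) (trans (sym (reᴱ-⊕ (ζ^ (t zero)) W)) (cong reᴱ (sym (∑-suc
            (λ i → ζ^ (t i))))))))
    , ∼-trans (∼-+ {approx (im z)} {λ n → sinᴿ (t zero) ℚ.* P/Q n} {approx (im w)} {λ n → imᴱ W ℚ.* P/Q n} (proj₂
        (ω^-value (t zero))) (proj₂ (sum-value (λ i → t (suc i))))) (pointwise (λ n →
        trans (sym (ℚₚ.*-distribʳ-+ (P/Q n) (sinᴿ (t zero)) (imᴱ W))) (cong (ℚ._* P/Q n)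
          (trans (cong (ℚ._+ imᴱ W) (sym (imᴱ-ζ^ (t zero)))) (trans (sym (imᴱ-⊕ (ζ^ (t zero)) W)) (cong imᴱ (sym (∑-suc
              (λ i → ζ^ (t i))))))))))
    where
    z w : ℂ
    z = ω ℂR.^ toℕ (t zero)
    w = ℂR.sum (λ i → ω ℂR.^ toℕ (t (suc i)))
    W : 𝔼
    W = ∑ (λ i → ζ^ (t (suc i)))

  cos²+3sin² : ∀ t → cosᴿ t ℚ.* cosᴿ t ℚ.+ sinᴿ t ℚ.* sinᴿ t ℚ.* (+ 3 ℚ./ 1) ≡ 1ℚ
  cos²+3sin² 0F = refl
  cos²+3sin² 1F = refl
  cos²+3sin² 2F = refl

  module _ (x : ℝ) (x² : (λ n → approx x n ℚ.* approx x n) ∼ (λ _ → + 1 ℚ./ 3)) where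
    private
      step : ∀ m R n → approx (x ℝR.^ suc (suc m)) n ℚ.* ((+ 3 ℚ./ 1) ℚ.* R) ≡ (approx x n ℚ.* approx x n ℚ.*
          (+ 3 ℚ./ 1)) ℚ.* (approx (x ℝR.^ m) n ℚ.* R)
      step m R n = solveℚ 3 (λ x p t → x :*ℚ (x :*ℚ p) :*ℚ (conℚ (+ 3 ℚ./ 1) :*ℚ t) :=ℚ (x :*ℚ x :*ℚ conℚ (+ 3 ℚ./ 1)) :*ℚ
          (p :*ℚ t)) refl
        (approx x n) (approx (x ℝR.^ m) n) R

      3x²∼1 : (λ n → approx x n ℚ.* approx x n ℚ.* (+ 3 ℚ./ 1)) ∼ (λ _ → 1ℚ)
      3x²∼1 = ∼-* {λ n → approx x n ℚ.* approx x n} {λ _ → + 1 ℚ./ 3} {λ _ → + 3 ℚ./ 1} {λ _ → + 3 ℚ./ 1}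
        (const-cauchy (+ 1 ℚ./ 3)) (const-cauchy (+ 3 ℚ./ 1)) x² ∼-refl

    -- Each factor 3 is absorbed by two factors x, as 3 x² = 1. With m = 2 k this says that 3^(-m/2)
    -- is inverse to 3^k.
    even-power : ∀ k m → m ≡ k ℕ.+ k → (λ n → approx (x ℝR.^ m) n ℚ.* intℚ (+ (3 ℕ.^ k))) ∼ (λ _ → 1ℚ)
    even-power zero    zero _ = pointwise (λ _ → trans (ℚₚ.*-identityˡ (intℚ (+ 1))) intℚ-1)
    even-power (suc k) zero ()
    even-power (suc k) (suc zero) eq = contradiction (trans eq (cong suc (ℕₚ.+-suc k k))) λ ()
    even-power (suc k) (suc (suc m)) eq = ∼-trans {λ n → approx (x ℝR.^ suc (suc m)) n ℚ.* intℚ (+ (3 ℕ.^ suc k))}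
      {λ n → (approx x n ℚ.* approx x n ℚ.* (+ 3 ℚ./ 1)) ℚ.* (approx (x ℝR.^ m) n ℚ.* R)} {λ _ → 1ℚ}
      (pointwise (λ n → trans (cong (λ R → approx (x ℝR.^ suc (suc m)) n ℚ.* R) R≡) (step m R n)))
      (∼-* {λ n → approx x n ℚ.* approx x n ℚ.* (+ 3 ℚ./ 1)} {λ _ → 1ℚ} {λ n → approx (x ℝR.^ m) n ℚ.* R} {λ _ → 1ℚ}
        (const-cauchy 1ℚ) (cauchy ((x ℝR.^ m) ℝR.* fromℚ R)) 3x²∼1
        (even-power k m (ℕₚ.suc-injective (ℕₚ.suc-injective (trans eq (cong suc (ℕₚ.+-suc k k)))))))
      where
      R : ℚ
      R = intℚ (+ (3 ℕ.^ k))
      R≡ : intℚ (+ (3 ℕ.^ suc k)) ≡ (+ 3 ℚ./ 1) ℚ.* R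
      R≡ = trans (cong intℚ (ℤₚ.pos-* 3 (3 ℕ.^ k))) (trans (intℚ-* (+ 3) (+ (3 ℕ.^ k))) (cong (λ t → t ℚ.* R) intℚ-3))

  1/√3^2k : ∀ k m → m ≡ k ℕ.+ k → (λ n → approx (3^- m /2) n ℚ.* intℚ (+ (3 ℕ.^ k))) ∼ (λ _ → 1ℚ)
  1/√3^2k = even-power (fromℚ (+ 1 ℚ./ 3) ℝR.* √3) (∼-trans
    {λ n → ((+ 1 ℚ./ 3) ℚ.* P/Q n) ℚ.* ((+ 1 ℚ./ 3) ℚ.* P/Q n)} {λ n → (+ 1 ℚ./ 9) ℚ.* (P/Q n ℚ.* P/Q n)} {λ _ → + 1 ℚ./ 3}
    (pointwise (λ n → solveℚ 1 (λ s → (conℚ (+ 1 ℚ./ 3) :*ℚ s) :*ℚ (conℚ (+ 1 ℚ./ 3) :*ℚ s) :=ℚ conℚ (+ 1 ℚ./ 9) :*ℚ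
        (s :*ℚ s)) refl (P/Q n)))
    (∼-scale (+ 1 ℚ./ 9) {λ n → P/Q n ℚ.* P/Q n} {λ _ → + 3 ℚ./ 1} P/Q²-cauchy P/Q²∼3))

  module _ {w : ℂ} {R : ℚ} (t : 𝔽₃) (near : Near w (ℚ.- (R ℚ.* cosᴿ t)) (ℚ.- (R ℚ.* sinᴿ t))) where
    private
      a b : ℚ
      a = ℚ.- (R ℚ.* cosᴿ t)
      b = ℚ.- (R ℚ.* sinᴿ t)

    norm-value : ∣ w ∣² ≈ℝ fromℚ (R ℚ.* R)
    norm-value = get∼ (∼-trans
      {λ n → approx (re w) n ℚ.* approx (re w) n ℚ.+ approx (im w) n ℚ.* approx (im w) n}
      {λ n → a ℚ.* a ℚ.+ (b ℚ.* P/Q n) ℚ.* (b ℚ.* P/Q n)} {λ _ → R ℚ.* R}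
      (∼-+ {λ n → approx (re w) n ℚ.* approx (re w) n} {λ _ → a ℚ.* a} {λ n → approx (im w) n ℚ.* approx (im w) n} {λ n →
          (b ℚ.* P/Q n) ℚ.* (b ℚ.* P/Q n)}
        (∼-* {approx (re w)} {λ _ → a} {approx (re w)} {λ _ → a} (const-cauchy a) (cauchy (re w)) (proj₁ near) (proj₁ near))
        (∼-* {approx (im w)} {λ n → b ℚ.* P/Q n} {approx (im w)} {λ n → b ℚ.* P/Q n} (cauchy (fromℚ b ℝR.* √3)) (cauchy
            (im w)) (proj₂ near) (proj₂ near)))
      (∼-trans {λ n → a ℚ.* a ℚ.+ (b ℚ.* P/Q n) ℚ.* (b ℚ.* P/Q n)} {λ n → a ℚ.* a ℚ.+ (b ℚ.* b) ℚ.*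
          (P/Q n ℚ.* P/Q n)} {λ _ → R ℚ.* R}
        (pointwise (λ n → solveℚ 3 (λ a b s → a :+ℚ (b :*ℚ s) :*ℚ (b :*ℚ s) :=ℚ a :+ℚ (b :*ℚ b) :*ℚ (s :*ℚ s)) refl
            (a ℚ.* a) b (P/Q n)))
        (∼-trans {λ n → a ℚ.* a ℚ.+ (b ℚ.* b) ℚ.* (P/Q n ℚ.* P/Q n)} {λ _ → a ℚ.* a ℚ.+ (b ℚ.* b) ℚ.* (+ 3 ℚ./ 1)} {λ _ → R ℚ.* R}
          (∼-+ {λ _ → a ℚ.* a} {λ _ → a ℚ.* a} {λ n → (b ℚ.* b) ℚ.* (P/Q n ℚ.* P/Q n)} {λ _ → (b ℚ.* b) ℚ.* (+ 3 ℚ./ 1)} ∼-refl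
            (∼-scale (b ℚ.* b) {λ n → P/Q n ℚ.* P/Q n} {λ _ → + 3 ℚ./ 1} P/Q²-cauchy P/Q²∼3))
          (pointwise (λ _ → trans (factor R (cosᴿ t) (sinᴿ t) (+ 3 ℚ./ 1)) (trans (cong (R ℚ.* R ℚ.*_) (cos²+3sin² t))
              (ℚₚ.*-identityʳ (R ℚ.* R))))))))
      where
      factor : ∀ R c s v → (ℚ.- (R ℚ.* c)) ℚ.* (ℚ.- (R ℚ.* c)) ℚ.+ (ℚ.- (R ℚ.* s)) ℚ.* (ℚ.- (R ℚ.* s)) ℚ.* v ≡ R ℚ.* R ℚ.*
          (c ℚ.* c ℚ.+ s ℚ.* s ℚ.* v)
      factor = solveℚ 4 (λ R c s v → (:-ℚ (R :*ℚ c)) :*ℚ (:-ℚ (R :*ℚ c)) :+ℚ (:-ℚ (R :*ℚ s)) :*ℚ (:-ℚ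
          (R :*ℚ s)) :*ℚ v :=ℚ R :*ℚ R :*ℚ (c :*ℚ c :+ℚ s :*ℚ s :*ℚ v)) refl

    module _ {ρ : ℝ} (ρR∼1 : (λ n → approx ρ n ℚ.* R) ∼ (λ _ → 1ℚ)) where
      private
        scaled : (x : ℝ) (c : ℝ) → approx x ∼ (λ n → ℚ.- (R ℚ.* approx c n)) → (λ n → ℚ.- (approx ρ n ℚ.* approx x n)) ∼ approx c
        scaled x c x∼ = ∼-trans {λ n → ℚ.- (approx ρ n ℚ.* approx x n)} {λ n → ℚ.- 1ℚ ℚ.* (approx ρ n ℚ.* approx x n)} {approx c}
          (pointwise (λ n → solveℚ 1 (λ s → :-ℚ s :=ℚ conℚ (ℚ.- 1ℚ) :*ℚ s) refl (approx ρ n ℚ.* approx x n)))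
          (∼-trans {λ n → ℚ.- 1ℚ ℚ.* (approx ρ n ℚ.* approx x n)} {λ n → ℚ.- 1ℚ ℚ.* (approx ρ n ℚ.* (ℚ.-
              (R ℚ.* approx c n)))} {approx c}
            (∼-scale (ℚ.- 1ℚ) {λ n → approx ρ n ℚ.* approx x n} {λ n → approx ρ n ℚ.* (ℚ.- (R ℚ.* approx c n))} (cauchy
                (ρ ℝR.* x))
              (∼-* {approx ρ} {approx ρ} {approx x} {λ n → ℚ.- (R ℚ.* approx c n)} (cauchy ρ) (cauchy x) ∼-refl x∼))
            (∼-trans {λ n → ℚ.- 1ℚ ℚ.* (approx ρ n ℚ.* (ℚ.- (R ℚ.* approx c n)))} {λ n →
                (approx ρ n ℚ.* R) ℚ.* approx c n} {approx c}
              (pointwise (λ n → solveℚ 3 (λ p r c → conℚ (ℚ.- 1ℚ) :*ℚ (p :*ℚ (:-ℚ (r :*ℚ c))) :=ℚ (p :*ℚ r) :*ℚ c) refl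
                  (approx ρ n) R (approx c n)))
              (∼-trans {λ n → (approx ρ n ℚ.* R) ℚ.* approx c n} {λ n → 1ℚ ℚ.* approx c n} {approx c}
                (∼-* {λ n → approx ρ n ℚ.* R} {λ _ → 1ℚ} {approx c} {approx c} (const-cauchy 1ℚ) (cauchy c) ρR∼1 ∼-refl)
                (pointwise (λ n → ℚₚ.*-identityˡ (approx c n))))))

        u : ℂ
        u = ℂR.- ℂR.1#

      -- w is - R ω^t and ρ is the inverse of R, so u = - 1 cancels the sign and leaves a power of
      -- ω.
      normalised : u ℂR.* fromℝ ρ ℂR.* w ℂR.≈ ω ℂR.^ toℕ t
      normalised = get∼ re∼ , get∼ im∼
        where
        expand-re : ∀ p x y → ((ℚ.- 1ℚ) ℚ.* p ℚ.+ ℚ.- ((ℚ.- 0ℚ) ℚ.* 0ℚ)) ℚ.* x ℚ.+ ℚ.- (((ℚ.- 1ℚ) ℚ.* 0ℚ ℚ.+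
            (ℚ.- 0ℚ) ℚ.* p) ℚ.* y) ≡ ℚ.- (p ℚ.* x)
        expand-re = solveℚ 3 (λ p x y → ((:-ℚ conℚ 1ℚ) :*ℚ p :+ℚ (:-ℚ ((:-ℚ conℚ 0ℚ) :*ℚ conℚ 0ℚ))) :*ℚ x :+ℚ (:-ℚ
            (((:-ℚ conℚ 1ℚ) :*ℚ conℚ 0ℚ :+ℚ (:-ℚ conℚ 0ℚ) :*ℚ p) :*ℚ y)) :=ℚ :-ℚ (p :*ℚ x)) refl
        expand-im : ∀ p x y → ((ℚ.- 1ℚ) ℚ.* p ℚ.+ ℚ.- ((ℚ.- 0ℚ) ℚ.* 0ℚ)) ℚ.* y ℚ.+ ((ℚ.- 1ℚ) ℚ.* 0ℚ ℚ.+
            (ℚ.- 0ℚ) ℚ.* p) ℚ.* x ≡ ℚ.- (p ℚ.* y)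
        expand-im = solveℚ 3 (λ p x y → ((:-ℚ conℚ 1ℚ) :*ℚ p :+ℚ (:-ℚ ((:-ℚ conℚ 0ℚ) :*ℚ conℚ 0ℚ))) :*ℚ y :+ℚ
            ((:-ℚ conℚ 1ℚ) :*ℚ conℚ 0ℚ :+ℚ (:-ℚ conℚ 0ℚ) :*ℚ p) :*ℚ x :=ℚ :-ℚ (p :*ℚ y)) refl
        re∼ : approx (re (u ℂR.* fromℝ ρ ℂR.* w)) ∼ approx (re (ω ℂR.^ toℕ t))
        re∼ = ∼-trans {approx (re (u ℂR.* fromℝ ρ ℂR.* w))} {λ n → ℚ.- (approx ρ n ℚ.* approx (re w) n)} {approx (re
            (ω ℂR.^ toℕ t))}
          (pointwise (λ n → expand-re (approx ρ n) (approx (re w) n) (approx (im w) n)))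
          (∼-trans {y = λ _ → cosᴿ t} (scaled (re w) (fromℚ (cosᴿ t)) (proj₁ near)) (∼-sym (proj₁ (ω^-value t))))
        im∼ : approx (im (u ℂR.* fromℝ ρ ℂR.* w)) ∼ approx (im (ω ℂR.^ toℕ t))
        im∼ = ∼-trans {approx (im (u ℂR.* fromℝ ρ ℂR.* w))} {λ n → ℚ.- (approx ρ n ℚ.* approx (im w) n)} {approx (im
            (ω ℂR.^ toℕ t))}
          (pointwise (λ n → expand-im (approx ρ n) (approx (re w) n) (approx (im w) n)))
          (∼-trans {y = λ n → sinᴿ t ℚ.* P/Q n} (scaled (im w) (fromℚ (sinᴿ t) ℝR.* √3)
            (∼-trans {approx (im w)} {λ n → b ℚ.* P/Q n} {λ n → ℚ.- (R ℚ.* (sinᴿ t ℚ.* P/Q n))} (proj₂ near)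
              (pointwise (λ n → solveℚ 3 (λ r c s → (:-ℚ (r :*ℚ c)) :*ℚ s :=ℚ :-ℚ (r :*ℚ (c :*ℚ s))) refl R (sinᴿ t)
                  (P/Q n))))) (∼-sym (proj₂ (ω^-value t))))

  ∣-1∣² : ∣ ℂR.- ℂR.1# ∣² ≈ℝ ℝR.1#
  ∣-1∣² = get∼ {λ n → approx ∣ ℂR.- ℂR.1# ∣² n} {λ _ → 1ℚ} (pointwise (λ _ → refl))

-- Odd k and the final statement.

open import Defs
open import Level using (Level)
open import Data.Nat.Base using (ℕ; _+_; _*_; _∸_; _^_)
open import Data.Nat.Divisibility using (_∤_)
open import Data.Nat.DivMod using (_/_)
open import Relation.Binary.PropositionalEquality using (_≡_)
open EisensteinIntegers
open TraceCharacters using (ζ^; parity; module Main)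
open ComplexSums
open import Data.Fin.Base using (toℕ)
open import Data.Integer.Base using (+_)
import Data.Integer.Properties as ℤₚ
open import Data.Nat.Base using (suc)
open import Data.Nat.Divisibility using (divides)
import Data.Nat.Properties as ℕₚ
open import Data.Nat.Solver using (module +-*-Solver)
open import Data.Product.Base using (∃; _,_; proj₁; proj₂)
open import Data.Rational.Base as ℚ using (ℚ)
open import Data.Sum.Base using (_⊎_; inj₁; inj₂)
open import Function.Bundles using (Inverse)
open import Relation.Binary.PropositionalEquality using (refl; sym; trans; cong; subst; subst₂)
open import Relation.Nullary using (contradiction)

9^ : ∀ l → ∃ λ g → 9 ^ l ≡ 1 + 8 * g
9^ 0 = 0 , refl
9^ (suc l) with 9^ l
... | g , 9^l≡ = 1 + 9 * g , trans (cong (9 *_) 9^l≡) (solve 1 (λ g → con 9 :* (con 1 :+ con 8 :* g) := con 1 :+ con 8 :*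
    (con 1 :+ con 9 :* g)) refl g)
  where open +-*-Solver

-- 9 ≡ 1 mod 8, so odd powers of 3 are 3 mod 8. This is how the oddness of k enters.
3^odd : ∀ l → ∃ λ g → 3 ^ suc (l + l) ≡ 3 + 4 * (2 * g)
3^odd l with 9^ l
... | g , 9^l≡ = 3 * g , trans (cong (3 *_) (trans (cong (λ m → 3 ^ (l + m)) (sym (ℕₚ.+-identityʳ l))) (trans (sym
    (ℕₚ.^-*-assoc 3 2 l)) 9^l≡)))
  (solve 1 (λ g → con 3 :* (con 1 :+ con 8 :* g) := con 3 :+ con 4 :* (con 2 :* (con 3 :* g))) refl g)
  where open +-*-Solver

module OddExponent {c ℓ : Level} (l g n : ℕ) (n≡ : n ≡ 2 * suc (l + l)) (r≡ : 3 ^ suc (l + l) ≡ 3 + 4 * (2 * g))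
  (F : FiniteField (3 ^ n) c ℓ) (ξ : Carrier F) (generates : IsPrimitive F ξ) where
  open Main (l + l) g n n≡ r≡ F ξ generates using (dual; dual-cong; walsh-value)

  private
    k r : ℕ
    k = suc (l + l)
    r = 3 ^ k
    R : ℚ
    R = intℚ (+ r)
    f : Trace.TernaryFunction n F
    f = traceMonomial n F (power F ξ ((3 ^ k + 1) / 4)) ((3 ^ n ∸ 1) / 4 + 3 ^ k + 1)

  walsh-near : ∀ b → Near (Trace.walsh n F f b) (ℚ.- (R ℚ.* cosᴿ (dual b))) (ℚ.- (R ℚ.* sinᴿ (dual b)))
  walsh-near b = subst₂ (Near (Trace.walsh n F f b))
    (trans (cong reᴱ (walsh-value b)) (trans (reᴱ-scale (+ r) (ζ^ (dual b))) (cong (λ t → ℚ.- (R ℚ.* t)) (reᴱ-ζ^ (dual b)))))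
    (trans (cong imᴱ (walsh-value b)) (trans (imᴱ-scale (+ r) (ζ^ (dual b))) (cong (λ t → ℚ.- (R ℚ.* t)) (imᴱ-ζ^ (dual b)))))
    (sum-value (λ i → let x = Inverse.to (FiniteField.enumeration F) i in Func.to f x -₃ Trace.Tr n F (FiniteField._*_ F b x)))
    where open import Function.Bundles using (module Func)

  R² : R ℚ.* R ≡ + (3 ^ n) ℚ./ 1
  R² = trans (sym (intℚ-* (+ r) (+ r))) (trans (cong intℚ (trans (sym (ℤₚ.pos-* r r)) (cong +_ (trans (sym
      (ℕₚ.^-distribˡ-+-* 3 k k))
    (cong (3 ^_) (sym k+k)))))) (intℚ≡ (+ (3 ^ n))))
    where
    k+k : n ≡ k + k
    k+k = trans n≡ (cong (λ m → k + m) (ℕₚ.+-identityʳ k))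

  bent : Trace.IsBent n F f
  bent b = subst (λ Q → ∣ Trace.walsh n F f b ∣² ≈ℝ fromℚ Q) R² (norm-value {Trace.walsh n F f b} {R} (dual b) (walsh-near b))

  dualFunction : Trace.TernaryFunction n F
  dualFunction = record { to = dual ; cong = dual-cong }

  3^-n/2 : (λ m → Reals.approx (3^- n /2) m ℚ.* R) ∼ (λ _ → ℚ.1ℚ)
  3^-n/2 = 1/√3^2k k n (trans n≡ (cong (λ m → k + m) (ℕₚ.+-identityʳ k)))

  weaklyRegular : ∀ b → (ℂR.- ℂR.1#) ℂR.* fromℝ (3^- n /2) ℂR.* Trace.walsh n F f b ℂR.≈ ω ℂR.^ toℕ (dual b)
  weaklyRegular b = normalised {Trace.walsh n F f b} {R} (dual b) (walsh-near b) {3^- n /2} 3^-n/2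

  weaklyRegularBent : IsWeaklyRegularBent n F f
  weaklyRegularBent = bent , ℂR.- ℂR.1# , ∣-1∣² , dualFunction , weaklyRegular

theorem1p4 : ∀ {c ℓ : Level} (k n : ℕ) → 2 ∤ k → n ≡ 2 * k →
    (F : FiniteField (3 ^ n) c ℓ) (ξ : Carrier F) → IsPrimitive F ξ →
    let a = power F ξ ((3 ^ k + 1) / 4) in
    IsWeaklyRegularBent n F (traceMonomial n F a ((3 ^ n ∸ 1) / 4 + 3 ^ k + 1))
theorem1p4 k n 2∤k n≡2k F ξ generates = by-parity k (parity k) 2∤k n≡2k
  where
  by-parity : ∀ k → (∃ λ l → k ≡ l + l ⊎ k ≡ suc (l + l)) → 2 ∤ k → n ≡ 2 * k →
              IsWeaklyRegularBent n F (traceMonomial n F (power F ξ ((3 ^ k + 1) / 4)) ((3 ^ n ∸ 1) / 4 + 3 ^ k + 1))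
  by-parity _ (l , inj₁ refl) 2∤k _ = contradiction (divides l (trans (cong (λ m → l + m) (sym (ℕₚ.+-identityʳ l)))
      (ℕₚ.*-comm 2 l))) 2∤k
  by-parity _ (l , inj₂ refl) _ n≡2k = OddExponent.weaklyRegularBent l (proj₁ (3^odd l)) n n≡2k (proj₂ (3^odd l)) F ξ generates
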